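{- Let $n$ and $r$ be integers with $2\leq n\leq 5$ and $r\geq n$. Then the Vietoris--Rips complex $\mathrm{VR}(\mathbb{Z}^n;r)$ is contractible.
   Context: $\mathbb{Z}^n$ is equipped with the Manhattan (word) metric $d(x,y)=\sum_{i=1}^n |x_i-y_i|$. For a metric space $X$ and $r\geq 0$, $\mathrm{VR}(X;r)$ is the simplicial complex with vertex set $X$ whose simplices are the finite subsets of $X$ of diameter at most $r$. -}

module Defs where

import Algebra.Properties.CommutativeSemigroup
open import Data.Nat using (ℕ; _⊔_)
import Data.Nat as ℕ
import Data.Nat.Properties as ℕₚ
open import Data.Integer using (ℤ)
import Data.Integer as ℤ
import Data.Integer.Properties as ℤₚ
open import Data.Integer.Tactic.RingSolver using (solve-∀)
open import Data.Rational using (ℚ; 0ℚ; 1ℚ; ½)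
import Data.Rational as ℚ
import Data.Rational.Properties as ℚₚ
import Data.Rational.Solver as ℚSolver
open import Data.List using (List; []; _∷_; [_]; map; foldr)
open import Data.List.Membership.Propositional using (_∈_; _∉_)
open import Data.List.Relation.Binary.Subset.Propositional using (_⊆_)
open import Data.List.Relation.Unary.Any using (here)
open import Data.List.Relation.Unary.Unique.Propositional using (Unique)
open import Data.Vec using (Vec; []; _∷_; zipWith; sum)
open import Data.Product using (Σ; ∃; _×_; _,_; proj₁; proj₂)
open import Function using (id; const)
open import Function.Metric.Nat using (IsMetric)
open import Relation.Nullary using (¬_)
open import Relation.Binary.PropositionalEquality using (_≡_; _≢_; refl; sym; cong; cong₂; subst; isEquivalence)

-- Cauchy reals, taken as a setoid under _≈_.
record ℝ : Set where
  field
    seq    : ℕ → ℚ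
    cauchy : ∀ ε → 0ℚ ℚ.< ε →
             ∃ λ N → ∀ m n → N ℕ.≤ m → N ℕ.≤ n → ℚ.∣ seq m ℚ.- seq n ∣ ℚ.< ε

open ℝ public

infix 4 _≈_ _<_ _≤_
infixl 6 _+_

_≈_ : ℝ → ℝ → Set
x ≈ y = ∀ ε → 0ℚ ℚ.< ε →
        ∃ λ N → ∀ n → N ℕ.≤ n → ℚ.∣ seq x n ℚ.- seq y n ∣ ℚ.< ε

_<_ : ℝ → ℝ → Set
x < y = Σ ℚ λ ε → 0ℚ ℚ.< ε ×
        (∃ λ N → ∀ n → N ℕ.≤ n → seq x n ℚ.+ ε ℚ.≤ seq y n)

_≤_ : ℝ → ℝ → Set
x ≤ y = ¬ (y < x)

fromℚ : ℚ → ℝ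
fromℚ q .seq    _       = q
fromℚ q .cauchy ε 0<ε = 0 , λ _ _ _ _ →
  subst (λ z → ℚ.∣ z ∣ ℚ.< ε) (sym (ℚₚ.+-inverseʳ q)) 0<ε

0ℝ 1ℝ : ℝ
0ℝ = fromℚ 0ℚ
1ℝ = fromℚ 1ℚ

private
  0<½*_ : ∀ {ε} → 0ℚ ℚ.< ε → 0ℚ ℚ.< ½ ℚ.* ε
  0<½*_ {ε} 0<ε = subst (ℚ._< ½ ℚ.* ε) (ℚₚ.*-zeroʳ ½) (ℚₚ.*-monoʳ-<-pos ½ 0<ε)

  half+half : ∀ ε → ½ ℚ.* ε ℚ.+ ½ ℚ.* ε ≡ ε
  half+half = solve 1 (λ e → con ½ :* e :+ con ½ :* e := e) refl
    where open ℚSolver.+-*-Solver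

  interchange : ∀ a b c d → (a ℚ.+ b) ℚ.- (c ℚ.+ d) ≡ (a ℚ.- c) ℚ.+ (b ℚ.- d)
  interchange = solve 4 (λ a b c d → (a :+ b) :- (c :+ d) := (a :- c) :+ (b :- d)) refl
    where open ℚSolver.+-*-Solver

_+_ : ℝ → ℝ → ℝ
(x + y) .seq n = seq x n ℚ.+ seq y n
(x + y) .cauchy ε 0<ε with cauchy x (½ ℚ.* ε) (0<½* 0<ε) | cauchy y (½ ℚ.* ε) (0<½* 0<ε)
... | M , p | N , q = M ⊔ N , λ m n M⊔N≤m M⊔N≤n → begin-strict
  ℚ.∣ (seq x m ℚ.+ seq y m) ℚ.- (seq x n ℚ.+ seq y n) ∣
    ≡⟨ cong ℚ.∣_∣ (interchange (seq x m) (seq y m) (seq x n) (seq y n)) ⟩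
  ℚ.∣ (seq x m ℚ.- seq x n) ℚ.+ (seq y m ℚ.- seq y n) ∣
    ≤⟨ ℚₚ.∣p+q∣≤∣p∣+∣q∣ (seq x m ℚ.- seq x n) (seq y m ℚ.- seq y n) ⟩
  ℚ.∣ seq x m ℚ.- seq x n ∣ ℚ.+ ℚ.∣ seq y m ℚ.- seq y n ∣
    <⟨ ℚₚ.+-mono-<
         (p m n (ℕₚ.≤-trans (ℕₚ.m≤m⊔n M N) M⊔N≤m) (ℕₚ.≤-trans (ℕₚ.m≤m⊔n M N) M⊔N≤n))
         (q m n (ℕₚ.≤-trans (ℕₚ.m≤n⊔m M N) M⊔N≤m) (ℕₚ.≤-trans (ℕₚ.m≤n⊔m M N) M⊔N≤n)) ⟩
  ½ ℚ.* ε ℚ.+ ½ ℚ.* ε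
    ≡⟨ half+half ε ⟩
  ε ∎
  where open ℚₚ.≤-Reasoning

sumℝ : List ℝ → ℝ
sumℝ = foldr _+_ 0ℝ

infix 4 ∣_-_∣<_

∣_-_∣<_ : ℝ → ℝ → ℚ → Set
∣ x - y ∣< ε = x < y + fromℚ ε × y < x + fromℚ ε

record I : Set where
  field
    val : ℝ
    0≤  : 0ℝ ≤ val
    ≤1  : val ≤ 1ℝ

open I public using (val)

private
  1+q≰0 : ∀ {q} → 0ℚ ℚ.< q → ¬ (1ℚ ℚ.+ q ℚ.≤ 0ℚ)
  1+q≰0 0<q 1+q≤0 = ℚₚ.<-irrefl refl (ℚₚ.<-≤-trans (ℚₚ.+-mono-< (ℚₚ.positive⁻¹ 1ℚ) 0<q) 1+q≤0)

  p+q≰p : ∀ {p q} → 0ℚ ℚ.< q → ¬ (p ℚ.+ q ℚ.≤ p)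
  p+q≰p {p} {q} 0<q p+q≤p =
    ℚₚ.<-irrefl (ℚₚ.+-identityʳ p) (ℚₚ.<-≤-trans (ℚₚ.+-monoʳ-< p 0<q) p+q≤p)

0I 1I : I
0I = record
  { val = 0ℝ
  ; 0≤  = λ (_ , 0<ε , N , p) → p+q≰p 0<ε (p N ℕₚ.≤-refl)
  ; ≤1  = λ (_ , 0<ε , N , p) → 1+q≰0 0<ε (p N ℕₚ.≤-refl)
  }
1I = record
  { val = 1ℝ
  ; 0≤  = λ (_ , 0<ε , N , p) → 1+q≰0 0<ε (p N ℕₚ.≤-refl)
  ; ≤1  = λ (_ , 0<ε , N , p) → p+q≰p 0<ε (p N ℕₚ.≤-refl)
  }

-- A list stands for the finite set of its entries: `face` makes IsSimplex
-- insensitive to order and repetition.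
record SimplicialComplex (V : Set) : Set₁ where
  field
    IsSimplex : List V → Set
    nonempty  : ∀ {σ} → IsSimplex σ → σ ≢ []
    vertex    : ∀ v → IsSimplex [ v ]
    face      : ∀ {σ τ} → IsSimplex σ → τ ≢ [] → τ ⊆ σ → IsSimplex τ

module Realisation {V : Set} (K : SimplicialComplex V) where
  open SimplicialComplex K

  -- A point is given by its barycentric coordinates together with some
  -- simplex containing their support; the choice of that simplex is
  -- forgotten by _≋_.
  record Point : Set where
    field
      coord     : V → ℝ
      carrier   : List V
      unique    : Unique carrier
      isSimplex : IsSimplex carrier
      coord≥0   : ∀ v → 0ℝ ≤ coord v
      support   : ∀ v → v ∉ carrier → coord v ≈ 0ℝ
      total     : sumℝ (map coord carrier) ≈ 1ℝ

  open Point public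

  infix 4 _≋_ _∈∣_∣

  _≋_ : Point → Point → Set
  x ≋ y = ∀ v → coord x v ≈ coord y v

  -- The closed simplex spanned by σ.
  _∈∣_∣ : Point → List V → Set
  x ∈∣ σ ∣ = ∀ v → v ∉ σ → coord x v ≈ 0ℝ

  Near : ℚ → Point → Point → Set
  Near ε x y = ∀ v → ∣ coord x v - coord y v ∣< ε

  -- The weak (coherent) topology: U is open iff it meets every closed simplex
  -- in a relatively open set.  Such a U automatically respects _≋_.
  Open : (Point → Set) → Set
  Open U = ∀ σ → IsSimplex σ → ∀ x → x ∈∣ σ ∣ → U x →
           Σ ℚ λ ε → 0ℚ ℚ.< ε ×
           (∀ y → y ∈∣ σ ∣ → Near ε x y → U y)

  -- The topology of the product of the realisation with I: W is open iff it
  -- meets |σ| × I in an open set for every simplex σ.  Since I is compact,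
  -- this is the product topology.
  Open×I : (Point → I → Set) → Set
  Open×I W = ∀ σ → IsSimplex σ → ∀ x → x ∈∣ σ ∣ → ∀ t → W x t →
             Σ ℚ λ ε → 0ℚ ℚ.< ε ×
             (∀ y → y ∈∣ σ ∣ → Near ε x y →
              ∀ s → ∣ val t - val s ∣< ε → W y s)

  record Homotopy (f g : Point → Point) : Set₁ where
    field
      H          : Point → I → Point
      H-cong     : ∀ {x y s t} → x ≋ y → val s ≈ val t → H x s ≋ H y t
      continuous : ∀ (U : Point → Set) → Open U → Open×I (λ x t → U (H x t))
      at-0       : ∀ x → H x 0I ≋ f x
      at-1       : ∀ x → H x 1I ≋ g x

Contractible : {V : Set} → SimplicialComplex V → Set₁
Contractible K = Σ Point λ p → Homotopy id (const p)
  where open Realisation K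

-- Simplices are by convention nonempty.
VR : {X : Set} {d : X → X → ℕ} → IsMetric _≡_ d → ℕ → SimplicialComplex X
VR {X} {d} isMetric r = record
  { IsSimplex = λ σ → σ ≢ [] × (∀ {x y} → x ∈ σ → y ∈ σ → d x y ℕ.≤ r)
  ; nonempty  = proj₁
  ; vertex    = λ v → (λ ()) , λ where
      (here refl) (here refl) → subst (ℕ._≤ r) (sym (IsMetric.≈⇒0 isMetric refl)) ℕ.z≤n
  ; face      = λ (_ , diam≤r) τ≢[] τ⊆σ → τ≢[] , λ x∈τ y∈τ → diam≤r (τ⊆σ x∈τ) (τ⊆σ y∈τ)
  }

manhattan : ∀ {n} → Vec ℤ n → Vec ℤ n → ℕ
manhattan x y = sum (zipWith (λ a b → ℤ.∣ a ℤ.- b ∣) x y)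

private
  module CS = Algebra.Properties.CommutativeSemigroup ℕₚ.+-commutativeSemigroup

  self : ∀ {n} (x : Vec ℤ n) → manhattan x x ≡ 0
  self []      = refl
  self (a ∷ x) = cong₂ ℕ._+_ (cong ℤ.∣_∣ (ℤₚ.+-inverseʳ a)) (self x)

  definite : ∀ {n} (x : Vec ℤ n) {y : Vec ℤ n} → x ≡ y → manhattan x y ≡ 0
  definite x refl = self x

  indiscernible : ∀ {n} (x y : Vec ℤ n) → manhattan x y ≡ 0 → x ≡ y
  indiscernible []      []      _  = refl
  indiscernible (a ∷ x) (b ∷ y) eq = cong₂ _∷_
    (ℤₚ.i-j≡0⇒i≡j a b (ℤₚ.∣i∣≡0⇒i≡0 (ℕₚ.m+n≡0⇒m≡0 _ eq)))
    (indiscernible x y (ℕₚ.m+n≡0⇒n≡0 ℤ.∣ a ℤ.- b ∣ eq))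

  symmetric : ∀ {n} (x y : Vec ℤ n) → manhattan x y ≡ manhattan y x
  symmetric []      []      = refl
  symmetric (a ∷ x) (b ∷ y) = cong₂ ℕ._+_ (ℤₚ.∣i-j∣≡∣j-i∣ a b) (symmetric x y)

  telescope : ∀ a b c → a ℤ.- c ≡ (a ℤ.- b) ℤ.+ (b ℤ.- c)
  telescope = solve-∀

  triangle : ∀ {n} (x y z : Vec ℤ n) → manhattan x z ℕ.≤ manhattan x y ℕ.+ manhattan y z
  triangle []      []      []      = ℕ.z≤n
  triangle (a ∷ x) (b ∷ y) (c ∷ z) = begin
    ℤ.∣ a ℤ.- c ∣ ℕ.+ manhattan x z
      ≡⟨ cong (λ i → ℤ.∣ i ∣ ℕ.+ manhattan x z) (telescope a b c) ⟩
    ℤ.∣ (a ℤ.- b) ℤ.+ (b ℤ.- c) ∣ ℕ.+ manhattan x z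
      ≤⟨ ℕₚ.+-mono-≤ (ℤₚ.∣i+j∣≤∣i∣+∣j∣ (a ℤ.- b) (b ℤ.- c)) (triangle x y z) ⟩
    (ab ℕ.+ bc) ℕ.+ (manhattan x y ℕ.+ manhattan y z)
      ≡⟨ CS.interchange ab bc (manhattan x y) (manhattan y z) ⟩
    (ab ℕ.+ manhattan x y) ℕ.+ (bc ℕ.+ manhattan y z) ∎
    where
    open ℕₚ.≤-Reasoning
    ab = ℤ.∣ a ℤ.- b ∣
    bc = ℤ.∣ b ℤ.- c ∣

manhattan-isMetric : ∀ n → IsMetric _≡_ (manhattan {n})
manhattan-isMetric n = record
  { isSemiMetric = record
    { isQuasiSemiMetric = record
      { isPreMetric = record
        { isProtoMetric = record
          { isPartialOrder  = ℕₚ.≤-isPartialOrder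
          ; ≈-isEquivalence = isEquivalence
          ; cong            = cong₂ manhattan
          ; nonNegative     = ℕ.z≤n
          }
        ; ≈⇒0 = λ {x} x≡y → definite x x≡y
        }
      ; 0⇒≈ = λ {x} {y} → indiscernible x y
      }
    ; sym = symmetric
    }
  ; triangle = triangle
  }

{-# OPTIONS --safe #-}
module Submission where

-- Build ℤⁿ from the origin by boxes that grow by one facet at a time.  A finite set A of diameter at most r
-- in a facet has a centre: a point w′ of the facet at distance less than r from each point of A such that
-- every point p has some a in A with d(w′, p) ≤ d(a, p) + 1.  Let w be w′ moved one step inwards.  Then
-- every point u of the smaller box within r of A satisfies d(w, u) ≤ r, so within the part of the complex
-- already present the link of A is a cone with apex w, and A can be pushed off: subtract from the
-- barycentric coordinates on A their minimum and give the mass to w.  Doing this for all nonempty A,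
-- supersets first and outer facets first, on time intervals that shrink geometrically towards t = 0, yields
-- the contraction; near a point only finitely many of the pushes move anything.
--
-- For centres in dimension 4, write the Manhattan norm as the maximum of the sixteen functionals ±x±y±z±h.
-- They all have the same parity at a lattice point, so for either parity π and for a suitable height, w′ is
-- sought as a point of parity π on which each functional is bounded just below its range on A; solvability
-- reduces to inequalities between pairs and quadruples of the functionals, and it is shown that it cannot fail
-- for both parities.

-- Two obstacles shape the construction. The order of the reals is not decidable: one cannot tell
-- whether the minimum on A is positive, hence whether the pushed point needs the vertex w, and
-- adding w to the old simplex may make its diameter exceed r. So w is given only the part of the
-- removed mass that exceeds ½, and the rest is restored by rescaling. While the removed mass is at
-- most ½ the old simplex still carries the image; as soon as it is positive, w together with the
-- part of the simplex in its star does. These cases overlap, an approximate comparison chooses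
-- between them, and its choice remains valid nearby, which is what continuity in the weak topology
-- asks for. The other obstacle is parity. The bound on a functional loses a unit when it has the
-- wrong parity, and keeping the distance below r costs another one; the losses of several
-- functionals together have to be covered by their ranges on A. For a single parity the argument
-- can leave a gap, in dimension 4 for r = 6.

-- Linear inequalities proved by reflection

module LinearArithmetic where
  open import Algebra.Structures using (IsCommutativeRing)
  open import Data.Nat using (ℕ; zero; suc; z≤n)
  open import Data.Bool using (Bool; true; false; T; _∧_)
  open import Data.Integer using (ℤ; +≤+)
  import Data.Integer as ℤ
  import Data.Integer.Properties as ℤₚ
  open import Data.List using (List; []; _∷_)
  open import Data.List.Relation.Unary.All using (All; []; _∷_)
  open import Data.Rational using (ℚ; mkℚ)
  import Data.Rational as ℚ
  import Data.Rational.Properties as ℚₚ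
  open import Relation.Binary.PropositionalEquality

  infixl 6 _⊞_ _⊟_
  infixr 7 _⊠_
  infix 5.6 _⊑_
  infix 5.3 _⊗_

  data Expr (R : Set) : Set where
    var     : ℕ → Expr R
    con     : R → Expr R
    _⊞_ _⊟_ : Expr R → Expr R → Expr R
    ⊝_      : Expr R → Expr R
    _⊠_     : R → Expr R → Expr R

  data Ineq (R : Set) : Set where
    _⊑_ : Expr R → Expr R → Ineq R

  -- The number is the multiplier that the hypothesis receives in a certificate.
  data Weighted (R : Set) : Set where
    _⊗_ : ℕ → Ineq R → Weighted R

  v₀ v₁ v₂ v₃ v₄ v₅ v₆ v₇ v₈ v₉ v₁₀ v₁₁ : ∀ {R} → Expr R
  v₀ = var 0
  v₁ = var 1
  v₂ = var 2
  v₃ = var 3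
  v₄ = var 4
  v₅ = var 5
  v₆ = var 6
  v₇ = var 7
  v₈ = var 8
  v₉ = var 9
  v₁₀ = var 10
  v₁₁ = var 11

  -- Farkas certificates for linear inequalities over an ordered commutative ring.
  module Linear {R : Set} {_+_ _*_ : R → R → R} { -_ : R → R} {0# 1# : R}
    (isCommutativeRing : IsCommutativeRing _≡_ _+_ _*_ -_ 0# 1#)
    (_≤_ : R → R → Set) (≤-refl : ∀ {a} → a ≤ a) (+-mono-≤ : ∀ {a b c d} → a ≤ b → c ≤ d → (a + c) ≤ (b + d))
    (fromℕ : ℕ → R) (scale-nonNeg : ∀ n {a} → 0# ≤ a → 0# ≤ (fromℕ n * a))
    (isZero isNonNeg : R → Bool) (isZero-sound : ∀ a → T (isZero a) → a ≡ 0#) (isNonNeg-sound : ∀ a → T (isNonNeg a) → 0# ≤ a)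
    where

    open IsCommutativeRing isCommutativeRing
      using (+-assoc; +-comm; +-identityˡ; +-identityʳ; zeroˡ; zeroʳ; *-assoc; *-identityˡ; *-identityʳ; -‿inverseˡ; -‿inverseʳ; distribˡ; distribʳ)

    private
      Env : Set
      Env = List R

    at : Env → ℕ → R
    at []      _       = 0#
    at (x ∷ _) zero    = x
    at (_ ∷ ρ) (suc i) = at ρ i

    ⟦_⟧ : Expr R → Env → R
    ⟦ var i ⟧ ρ = at ρ i
    ⟦ con c ⟧ ρ = c
    ⟦ a ⊞ b ⟧ ρ = ⟦ a ⟧ ρ + ⟦ b ⟧ ρ
    ⟦ a ⊟ b ⟧ ρ = ⟦ a ⟧ ρ + (- ⟦ b ⟧ ρ)
    ⟦ ⊝ a ⟧ ρ   = - ⟦ a ⟧ ρ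
    ⟦ c ⊠ a ⟧ ρ = c * ⟦ a ⟧ ρ

    ⟪_⟫ : Ineq R → Env → Set
    ⟪ a ⊑ b ⟫ ρ = ⟦ a ⟧ ρ ≤ ⟦ b ⟧ ρ

    Holds : Env → Weighted R → Set
    Holds ρ (_ ⊗ h) = ⟪ h ⟫ ρ

    dot : List R → Env → R
    dot []       _       = 0#
    dot (_ ∷ _)  []      = 0#
    dot (c ∷ cs) (x ∷ ρ) = (c * x) + dot cs ρ

    add : List R → List R → List R
    add []       bs       = bs
    add as       []       = as
    add (a ∷ as) (b ∷ bs) = a + b ∷ add as bs

    scale : R → List R → List R
    scale c []       = []
    scale c (a ∷ as) = c * a ∷ scale c as

    unit : ℕ → List R
    unit zero    = 1# ∷ []
    unit (suc i) = 0# ∷ unit i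

    -- The coefficient of the constant term comes first.
    norm : Expr R → List R
    norm (var i) = unit (suc i)
    norm (con c) = c ∷ []
    norm (a ⊞ b) = add (norm a) (norm b)
    norm (a ⊟ b) = add (norm a) (scale (- 1#) (norm b))
    norm (⊝ a)   = scale (- 1#) (norm a)
    norm (c ⊠ a) = scale c (norm a)

    private
      interchange : ∀ a b c d → (a + b) + (c + d) ≡ (a + c) + (b + d)
      interchange a b c d = trans (+-assoc a b (c + d)) (trans (cong (a +_)
        (trans (sym (+-assoc b c d)) (trans (cong (_+ d) (+-comm b c)) (+-assoc c b d)))) (sym (+-assoc a c (b + d))))

      zero+ : ∀ x u → ((0# * x) + u) ≡ u
      zero+ x u = trans (cong (_+ u) (zeroˡ x)) (+-identityˡ u)

      times-one : ∀ c → ((c * 1#) + 0#) ≡ c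
      times-one c = trans (+-identityʳ _) (*-identityʳ c)

      neg-unique : ∀ {a b} → (a + b) ≡ 0# → b ≡ - a
      neg-unique {a} {b} e = trans (sym (+-identityˡ b)) (trans (cong (_+ b) (sym (-‿inverseˡ a)))
        (trans (+-assoc (- a) a b) (trans (cong ((- a) +_) e) (+-identityʳ (- a)))))

      neg-one : ∀ a → ((- 1#) * a) ≡ - a
      neg-one a = neg-unique (trans (cong (_+ ((- 1#) * a)) (sym (*-identityˡ a)))
        (trans (sym (distribʳ a 1# (- 1#))) (trans (cong (_* a) (-‿inverseʳ 1#)) (zeroˡ a))))

    dot-add : ∀ as bs ρ → dot (add as bs) ρ ≡ (dot as ρ + dot bs ρ)
    dot-add []       bs       ρ       = sym (+-identityˡ _)
    dot-add (a ∷ as) []       ρ       = sym (+-identityʳ _)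
    dot-add (a ∷ as) (b ∷ bs) []      = sym (+-identityˡ 0#)
    dot-add (a ∷ as) (b ∷ bs) (x ∷ ρ) =
      trans (cong₂ _+_ (distribʳ x a b) (dot-add as bs ρ)) (interchange (a * x) (b * x) (dot as ρ) (dot bs ρ))

    dot-scale : ∀ c as ρ → dot (scale c as) ρ ≡ (c * dot as ρ)
    dot-scale c []       ρ       = sym (zeroʳ c)
    dot-scale c (a ∷ as) []      = sym (zeroʳ c)
    dot-scale c (a ∷ as) (x ∷ ρ) =
      trans (cong₂ _+_ (*-assoc c a x) (dot-scale c as ρ)) (sym (distribˡ c (a * x) (dot as ρ)))

    dot-unit : ∀ i ρ → dot (unit i) ρ ≡ at ρ i
    dot-unit zero    []      = refl
    dot-unit (suc i) []      = refl
    dot-unit zero    (x ∷ ρ) = trans (+-identityʳ _) (*-identityˡ x)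
    dot-unit (suc i) (x ∷ ρ) = trans (zero+ x _) (dot-unit i ρ)

    private
      negated : ∀ e {ρ} → dot (norm e) (1# ∷ ρ) ≡ ⟦ e ⟧ ρ → dot (scale (- 1#) (norm e)) (1# ∷ ρ) ≡ - ⟦ e ⟧ ρ
      negated e {ρ} eq = trans (dot-scale (- 1#) (norm e) (1# ∷ ρ)) (trans (cong ((- 1#) *_) eq) (neg-one (⟦ e ⟧ ρ)))

    norm-sound : ∀ e ρ → dot (norm e) (1# ∷ ρ) ≡ ⟦ e ⟧ ρ
    norm-sound (var i) ρ = dot-unit (suc i) (1# ∷ ρ)
    norm-sound (con c) ρ = times-one c
    norm-sound (a ⊞ b) ρ = trans (dot-add (norm a) (norm b) (1# ∷ ρ)) (cong₂ _+_ (norm-sound a ρ) (norm-sound b ρ))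
    norm-sound (a ⊟ b) ρ = trans (dot-add (norm a) (scale (- 1#) (norm b)) (1# ∷ ρ))
      (cong₂ _+_ (norm-sound a ρ) (negated b (norm-sound b ρ)))
    norm-sound (⊝ a)   ρ =
      negated a (norm-sound a ρ)
    norm-sound (c ⊠ a) ρ = trans (dot-scale c (norm a) (1# ∷ ρ)) (cong (c *_) (norm-sound a ρ))

    combination : List (Weighted R) → Expr R
    combination []               = con 0#
    combination (k ⊗ a ⊑ b ∷ hs) = fromℕ k ⊠ (b ⊟ a) ⊞ combination hs

    allZero : List R → Bool
    allZero []       = true
    allZero (a ∷ as) = isZero a ∧ allZero as

    nonNegConst : List R → Bool
    nonNegConst []       = true
    nonNegConst (a ∷ as) = isNonNeg a ∧ allZero as

    certifies : List (Weighted R) → Ineq R → Bool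
    certifies hs (a ⊑ b) = nonNegConst (norm ((b ⊟ a) ⊟ combination hs))

    private
      ∧-split : ∀ {a b} → T (a ∧ b) → T a
      ∧-split {true} _ = _

      ∧-split′ : ∀ {a b} → T (a ∧ b) → T b
      ∧-split′ {true} t = t

      transfer : ∀ {a b} → a ≡ b → 0# ≤ a → 0# ≤ b
      transfer refl p = p

    allZero-sound : ∀ as ρ → T (allZero as) → dot as ρ ≡ 0#
    allZero-sound []       ρ       _ = refl
    allZero-sound (a ∷ as) []      _ = refl
    allZero-sound (a ∷ as) (x ∷ ρ) t =
      trans (cong₂ (λ u v → (u * x) + v) (isZero-sound a (∧-split t)) (allZero-sound as ρ (∧-split′ {isZero a} t))) (zero+ x 0#)

    nonNegConst-sound : ∀ as ρ → T (nonNegConst as) → 0# ≤ dot as (1# ∷ ρ)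
    nonNegConst-sound []       ρ _ = ≤-refl
    nonNegConst-sound (a ∷ as) ρ t =
      transfer (sym (trans (cong ((a * 1#) +_) (allZero-sound as ρ (∧-split′ {isNonNeg a} t))) (times-one a))) (isNonNeg-sound a (∧-split t))

    difference : ∀ {a b} → a ≤ b → 0# ≤ (b + (- a))
    difference {a} {b} p with +-mono-≤ p (≤-refl { - a})
    ... | q rewrite -‿inverseʳ a = q

    from-difference : ∀ {a b} → 0# ≤ (b + (- a)) → a ≤ b
    from-difference {a} {b} p with +-mono-≤ p (≤-refl {a})
    ... | q rewrite +-identityˡ a | +-assoc b (- a) a | -‿inverseˡ a | +-identityʳ b = q

    nonNeg-+ : ∀ {a b} → 0# ≤ a → 0# ≤ b → 0# ≤ (a + b)
    nonNeg-+ p q with +-mono-≤ p q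
    ... | s rewrite +-identityˡ 0# = s

    combination-nonNeg : ∀ hs ρ → All (Holds ρ) hs → 0# ≤ ⟦ combination hs ⟧ ρ
    combination-nonNeg []               ρ []       = ≤-refl
    combination-nonNeg (k ⊗ a ⊑ b ∷ hs) ρ (p ∷ ps) = nonNeg-+ (scale-nonNeg k (difference p)) (combination-nonNeg hs ρ ps)

    -- What the weighted hypotheses leave of the goal has to be a nonnegative constant. This is
    -- decided on coefficient lists, so at each use the implicit argument is filled in by
    -- evaluation.
    linear : ∀ ρ hs goal → {T (certifies hs goal)} → All (Holds ρ) hs → ⟪ goal ⟫ ρ
    linear ρ hs (a ⊑ b) {t} ps = from-difference (transfer cancel
      (nonNeg-+ (transfer (norm-sound ((b ⊟ a) ⊟ combination hs) ρ) (nonNegConst-sound (norm ((b ⊟ a) ⊟ combination hs)) ρ t))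
                (combination-nonNeg hs ρ ps)))
      where
      u = ⟦ b ⟧ ρ + (- ⟦ a ⟧ ρ)
      v = ⟦ combination hs ⟧ ρ
      cancel : ((u + (- v)) + v) ≡ u
      cancel = trans (+-assoc u (- v) v) (trans (cong (u +_) (-‿inverseˡ v)) (+-identityʳ u))

  private
    ℤ-isZero ℤ-isNonNeg : ℤ → Bool
    ℤ-isZero (ℤ.+ zero) = true
    ℤ-isZero _        = false
    ℤ-isNonNeg (ℤ.+ _)  = true
    ℤ-isNonNeg _      = false

    ℤ-isZero-sound : ∀ a → T (ℤ-isZero a) → a ≡ ℤ.+ 0
    ℤ-isZero-sound (ℤ.+ zero) _ = refl

    ℤ-isNonNeg-sound : ∀ a → T (ℤ-isNonNeg a) → ℤ.+ 0 ℤ.≤ a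
    ℤ-isNonNeg-sound (ℤ.+ _) _ = +≤+ z≤n

    ℤ-scale : ∀ n {a} → ℤ.+ 0 ℤ.≤ a → ℤ.+ 0 ℤ.≤ ℤ.+ n ℤ.* a
    ℤ-scale n {a} p = subst (ℤ._≤ ℤ.+ n ℤ.* a) (ℤₚ.*-zeroʳ (ℤ.+ n)) (ℤₚ.*-monoˡ-≤-nonNeg (ℤ.+ n) p)

  module ℤ-Linear = Linear ℤₚ.+-*-isCommutativeRing ℤ._≤_ ℤₚ.≤-refl ℤₚ.+-mono-≤ ℤ.+_ ℤ-scale
    ℤ-isZero ℤ-isNonNeg ℤ-isZero-sound ℤ-isNonNeg-sound

  fromℕ : ℕ → ℚ
  fromℕ n = ℤ.+ n ℚ./ 1

  0≤fromℕ : ∀ n → ℚ.0ℚ ℚ.≤ fromℕ n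
  0≤fromℕ n = ℚₚ.nonNegative⁻¹ (fromℕ n) {{ℚₚ.normalize-nonNeg n 1}}

  private
    ℚ-isZero ℚ-isNonNeg : ℚ → Bool
    ℚ-isZero   q = ℤ-isZero (ℚ.↥ q)
    ℚ-isNonNeg q = ℤ-isNonNeg (ℚ.↥ q)

    ℚ-isZero-sound : ∀ q → T (ℚ-isZero q) → q ≡ ℚ.0ℚ
    ℚ-isZero-sound q t = ℚₚ.↥p≡0⇒p≡0 q (ℤ-isZero-sound (ℚ.↥ q) t)

    ℚ-isNonNeg-sound : ∀ q → T (ℚ-isNonNeg q) → ℚ.0ℚ ℚ.≤ q
    ℚ-isNonNeg-sound (mkℚ (ℤ.+ n) _ _) _ = ℚₚ.nonNegative⁻¹ _

    ℚ-scale : ∀ n {a} → ℚ.0ℚ ℚ.≤ a → ℚ.0ℚ ℚ.≤ fromℕ n ℚ.* a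
    ℚ-scale n {a} p = subst (ℚ._≤ fromℕ n ℚ.* a) (ℚₚ.*-zeroʳ (fromℕ n))
      (ℚₚ.*-monoˡ-≤-nonNeg (fromℕ n) {{ℚ.nonNegative (0≤fromℕ n)}} p)

  module ℚ-Linear = Linear ℚₚ.+-*-isCommutativeRing ℚ._≤_ ℚₚ.≤-refl ℚₚ.+-mono-≤ fromℕ ℚ-scale
    ℚ-isZero ℚ-isNonNeg ℚ-isZero-sound ℚ-isNonNeg-sound

-- The sixteen functionals of the Manhattan norm in dimension 4

module Centres where
  open import Defs using (manhattan)
  open LinearArithmetic
  open ℤ-Linear using (linear)
  open import Data.Nat using (ℕ; zero; suc; z≤n; s≤s; _≤′_; ≤′-refl; ≤′-step)
  import Data.Nat as ℕ
  import Data.Nat.Properties as ℕₚ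
  open import Data.Integer using (ℤ; +_; -[1+_]; 0ℤ; 1ℤ; _+_; _*_; -_; _-_; _≤_; _<_; ∣_∣; +≤+)
  import Data.Integer.Properties as ℤₚ
  open import Data.Integer.Tactic.RingSolver using (solve-∀)
  open import Data.List using (List; []; _∷_; map)
  open import Data.List.Membership.Propositional using (_∈_)
  open import Data.List.Relation.Unary.All using ([]; _∷_)
  open import Data.List.Relation.Unary.Any using (here; there)
  open import Data.Product using (∃; ∃₂; _×_; _,_; proj₁; proj₂)
  open import Data.Sum using (_⊎_; inj₁; inj₂; [_,_]′)
  open import Data.Vec using (Vec; []; _∷_; head)
  open import Relation.Nullary using (¬_; yes; no; Dec)
  open import Relation.Binary.PropositionalEquality
  open import Function using (id)
  open import Data.Empty using (⊥; ⊥-elim)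
  open import Data.Nat.Tactic.RingSolver using () renaming (solve-∀ to ℕsolve-∀)
  open import Data.List.Membership.Propositional.Properties using (∈-map⁺; ∈-map⁻)

  data Sgn : Set where
    ⊕ ⊖ : Sgn

  opp : Sgn → Sgn
  opp ⊕ = ⊖
  opp ⊖ = ⊕

  sg : Sgn → ℤ → ℤ
  sg ⊕ i = i
  sg ⊖ i = - i

  data Ix : Set where
    k₀ k₁ k₂ k₃ : Ix

  P : Set
  P = Vec ℤ 4

  ht : P → ℤ
  ht (h ∷ _) = h

  -- The sign vectors of {±1}³: the four vectors of either sign σ sum to zero.
  signs : Sgn → Ix → Sgn × Sgn × Sgn
  signs ⊕ k₀ = ⊕ , ⊕ , ⊕
  signs ⊕ k₁ = ⊕ , ⊖ , ⊖
  signs ⊕ k₂ = ⊖ , ⊕ , ⊖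
  signs ⊕ k₃ = ⊖ , ⊖ , ⊕
  signs ⊖ k₀ = ⊖ , ⊖ , ⊖
  signs ⊖ k₁ = ⊖ , ⊕ , ⊕
  signs ⊖ k₂ = ⊕ , ⊖ , ⊕
  signs ⊖ k₃ = ⊕ , ⊕ , ⊖

  index : ∀ a b c → ∃₂ λ σ k → signs σ k ≡ (a , b , c)
  index ⊕ ⊕ ⊕ = ⊕ , k₀ , refl
  index ⊕ ⊖ ⊖ = ⊕ , k₁ , refl
  index ⊖ ⊕ ⊖ = ⊕ , k₂ , refl
  index ⊖ ⊖ ⊕ = ⊕ , k₃ , refl
  index ⊖ ⊖ ⊖ = ⊖ , k₀ , refl
  index ⊖ ⊕ ⊕ = ⊖ , k₁ , refl
  index ⊕ ⊖ ⊕ = ⊖ , k₂ , refl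
  index ⊕ ⊕ ⊖ = ⊖ , k₃ , refl

  f′ : Sgn × Sgn × Sgn → P → ℤ
  f′ (a , b , c) (_ ∷ x ∷ y ∷ z ∷ []) = sg a x + sg b y + sg c z

  f : Sgn → Ix → P → ℤ
  f σ k = f′ (signs σ k)

  -- The signs of x, y, z are encoded by a class `σ` and a place `k` because the relations that
  -- matter are then uniform: `f-opp` between the classes and `f-sum` within each.
  φ : Sgn → Ix → Sgn → P → ℤ
  φ σ k s p = f σ k p + sg s (ht p)

  abs≥ : ∀ i → i ≤ + ∣ i ∣
  abs≥ (+ n)    = ℤₚ.≤-refl
  abs≥ -[1+ n ] = Data.Integer.-≤+

  abs≥- : ∀ i → - i ≤ + ∣ i ∣
  abs≥- i = subst (λ n → - i ≤ + n) (ℤₚ.∣-i∣≡∣i∣ i) (abs≥ (- i))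

  absSgn : ∀ i → ∃ λ s → sg s i ≡ + ∣ i ∣
  absSgn (+ n)    = ⊕ , refl
  absSgn -[1+ n ] = ⊖ , refl

  sg≤abs : ∀ s i → sg s i ≤ + ∣ i ∣
  sg≤abs ⊕ = abs≥
  sg≤abs ⊖ = abs≥-

  sg-minus : ∀ s i j → sg s i - sg s j ≡ sg s (i - j)
  sg-minus ⊕ i j = refl
  sg-minus ⊖ = lem
    where
    lem : ∀ i j → (- i) - (- j) ≡ - (i - j)
    lem = solve-∀

  infix 4 _≡₂_

  _≡₂_ : ℤ → ℤ → Set
  i ≡₂ j = ∃ λ q → i ≡ j + + 2 * q

  private
    φ-expand′ : ∀ a b c s {h x y z h′ x′ y′ z′} →
      (f′ (a , b , c) (h ∷ x ∷ y ∷ z ∷ []) + sg s h) - (f′ (a , b , c) (h′ ∷ x′ ∷ y′ ∷ z′ ∷ []) + sg s h′) ≡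
      sg s (h - h′) + (sg a (x - x′) + (sg b (y - y′) + (sg c (z - z′) + 0ℤ)))
    φ-expand′ a b c s {h} {x} {y} {z} {h′} {x′} {y′} {z′}
      rewrite sym (sg-minus s h h′) | sym (sg-minus a x x′) | sym (sg-minus b y y′) | sym (sg-minus c z z′)
      = lem (sg s h) (sg a x) (sg b y) (sg c z) (sg s h′) (sg a x′) (sg b y′) (sg c z′)
      where
      lem : ∀ h x y z h′ x′ y′ z′ → (x + y + z + h) - (x′ + y′ + z′ + h′) ≡ (h - h′) + ((x - x′) + ((y - y′) + ((z - z′) + 0ℤ)))
      lem = solve-∀

  dist : P → P → ℤ
  dist p q = + manhattan p q

  φ-lipschitz : ∀ σ k s p q → φ σ k s p - φ σ k s q ≤ dist p q
  φ-lipschitz σ k s (h ∷ x ∷ y ∷ z ∷ []) (h′ ∷ x′ ∷ y′ ∷ z′ ∷ []) with signs σ k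
  ... | a , b , c = subst (_≤ _) (sym (φ-expand′ a b c s {h} {x} {y} {z} {h′} {x′} {y′} {z′}))
    (ℤₚ.+-mono-≤ (sg≤abs s (h - h′)) (ℤₚ.+-mono-≤ (sg≤abs a (x - x′))
      (ℤₚ.+-mono-≤ (sg≤abs b (y - y′)) (ℤₚ.+-mono-≤ (sg≤abs c (z - z′)) (ℤₚ.≤-refl {0ℤ})))))

  -- The signs are chosen coordinate by coordinate so that each difference becomes nonnegative.
  -- Together with `φ-lipschitz` this makes the distance the maximum of the sixteen differences.
  φ-norming : ∀ p q → ∃ λ σ → ∃₂ λ k s → dist p q ≡ φ σ k s p - φ σ k s q
  φ-norming (h ∷ x ∷ y ∷ z ∷ []) (h′ ∷ x′ ∷ y′ ∷ z′ ∷ [])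
    with absSgn (h - h′) | absSgn (x - x′) | absSgn (y - y′) | absSgn (z - z′)
  ... | s , eh | a , ex | b , ey | c , ez with index a b c
  ... | σ , k , eq = σ , k , s , sym (trans
    (subst (λ abc → (f′ abc (h ∷ x ∷ y ∷ z ∷ []) + sg s h) - (f′ abc (h′ ∷ x′ ∷ y′ ∷ z′ ∷ []) + sg s h′) ≡
                    sg s (h - h′) + (sg a (x - x′) + (sg b (y - y′) + (sg c (z - z′) + 0ℤ))))
           (sym eq) (φ-expand′ a b c s {h} {x} {y} {z} {h′} {x′} {y′} {z′}))
    (cong₂ _+_ eh (cong₂ _+_ ex (cong₂ _+_ ey (cong (_+ 0ℤ) ez)))))

  f-opp⊕ : ∀ k p → f ⊖ k p ≡ - f ⊕ k p
  f-opp⊕ k₀ (_ ∷ x ∷ y ∷ z ∷ []) = lem x y z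
    where
    lem : ∀ x y z → - x + - y + - z ≡ - (x + y + z)
    lem = solve-∀
  f-opp⊕ k₁ (_ ∷ x ∷ y ∷ z ∷ []) = lem x y z
    where
    lem : ∀ x y z → - x + y + z ≡ - (x + - y + - z)
    lem = solve-∀
  f-opp⊕ k₂ (_ ∷ x ∷ y ∷ z ∷ []) = lem x y z
    where
    lem : ∀ x y z → x + - y + z ≡ - (- x + y + - z)
    lem = solve-∀
  f-opp⊕ k₃ (_ ∷ x ∷ y ∷ z ∷ []) = lem x y z
    where
    lem : ∀ x y z → x + y + - z ≡ - (- x + - y + z)
    lem = solve-∀
  f-opp : ∀ σ k p → f (opp σ) k p ≡ - f σ k p
  f-opp ⊕ k p = f-opp⊕ k p
  f-opp ⊖ k p = trans (sym (ℤₚ.neg-involutive (f ⊕ k p))) (cong -_ (sym (f-opp⊕ k p)))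

  f-sum : ∀ σ p → f σ k₀ p + f σ k₁ p + f σ k₂ p + f σ k₃ p ≡ 0ℤ
  f-sum ⊕ (_ ∷ x ∷ y ∷ z ∷ []) = lem x y z
    where
    lem : ∀ x y z → (x + y + z) + (x + - y + - z) + (- x + y + - z) + (- x + - y + z) ≡ 0ℤ
    lem = solve-∀
  f-sum ⊖ (_ ∷ x ∷ y ∷ z ∷ []) = lem x y z
    where
    lem : ∀ x y z → (- x + - y + - z) + (- x + y + z) + (x + - y + z) + (x + y + - z) ≡ 0ℤ
    lem = solve-∀

  sg-parity : ∀ s i → sg s i ≡₂ i
  sg-parity ⊕ i = 0ℤ , sym (ℤₚ.+-identityʳ i)
  sg-parity ⊖ i = - i , lem i
    where
    lem : ∀ i → - i ≡ i + + 2 * (- i)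
    lem = solve-∀

  parity : P → ℤ
  parity (h ∷ x ∷ y ∷ z ∷ []) = x + y + z + h

  φ-parity : ∀ σ k s p → φ σ k s p ≡₂ parity p
  φ-parity σ k s (h ∷ x ∷ y ∷ z ∷ []) with signs σ k
  ... | a , b , c with sg-parity a x | sg-parity b y | sg-parity c z | sg-parity s h
  ... | qx , ex | qy , ey | qz , ez | qh , eh = qx + qy + qz + qh ,
    trans (cong₂ _+_ (cong₂ _+_ (cong₂ _+_ ex ey) ez) eh) (lem x y z h qx qy qz qh)
    where
    lem : ∀ x y z h a b c d → (x + + 2 * a) + (y + + 2 * b) + (z + + 2 * c) + (h + + 2 * d) ≡ (x + y + z + h) + + 2 * (a + b + c + d)
    lem = solve-∀

  -- Rounding by parity: many inequalities below are obtained only up to -1, but for even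
  -- quantities, where that is enough.
  sum≤ : ∀ (i : ℤ) → -[1+ 0 ] ≤ + 2 * i → 0ℤ ≤ i
  sum≤ (+ n)          _ = +≤+ z≤n
  sum≤ (-[1+ zero ])  (Data.Integer.-≤- ())
  sum≤ (-[1+ suc n ]) (Data.Integer.-≤- ())

  parity-dec : ∀ i j → i ≡₂ j ⊎ i ≡₂ j + 1ℤ
  parity-dec i j with even-or-odd (i - j)
    where
    half : ∀ n → ∃ λ q → + n ≡ + 2 * q ⊎ + n ≡ 1ℤ + + 2 * q
    half zero = 0ℤ , inj₁ refl
    half (suc n) with half n
    ... | q , inj₁ e = q , inj₂ (cong (λ v → 1ℤ + v) e)
    ... | q , inj₂ e = 1ℤ + q , inj₁ (trans (cong (λ v → 1ℤ + v) e) (lem q))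
      where
      lem : ∀ q → 1ℤ + (1ℤ + + 2 * q) ≡ + 2 * (1ℤ + q)
      lem = solve-∀
    even-or-odd : ∀ i → ∃ λ q → i ≡ + 2 * q ⊎ i ≡ 1ℤ + + 2 * q
    even-or-odd (+ n) = half n
    even-or-odd -[1+ n ] with half (suc n)
    ... | q , inj₁ e = - q , inj₁ (trans (cong -_ e) (lem q))
      where
      lem : ∀ q → - (+ 2 * q) ≡ + 2 * (- q)
      lem = solve-∀
    ... | q , inj₂ e = - q - 1ℤ , inj₂ (trans (cong -_ e) (lem q))
      where
      lem : ∀ q → - (1ℤ + + 2 * q) ≡ 1ℤ + + 2 * (- q - 1ℤ)
      lem = solve-∀
  ... | q , inj₁ e = inj₁ (q , trans (lem i j) (cong (λ v → j + v) e))
    where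
    lem : ∀ i j → i ≡ j + (i - j)
    lem = solve-∀
  ... | q , inj₂ e = inj₂ (q , trans (lem i j) (trans (cong (λ v → j + v) e) (lem′ j q)))
    where
    lem : ∀ i j → i ≡ j + (i - j)
    lem = solve-∀
    lem′ : ∀ j q → j + (1ℤ + + 2 * q) ≡ j + 1ℤ + + 2 * q
    lem′ = solve-∀

  argmax : {X : Set} (g : X → ℤ) {x₀ : X} (xs : List X) → x₀ ∈ xs → ∃ λ a → a ∈ xs × (∀ {b} → b ∈ xs → g b ≤ g a)
  argmax g (x ∷ [])     _ = x , here refl , λ { (here refl) → ℤₚ.≤-refl }
  argmax g (x ∷ y ∷ xs) _ with argmax g (y ∷ xs) (here refl)
  ... | a , a∈ , mx with ℤₚ.≤-total (g x) (g a)
  ... | inj₁ gx≤ = a , there a∈ , λ { (here refl) → gx≤ ; (there b∈) → mx b∈ }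
  ... | inj₂ ga≤ = x , here refl , λ { (here refl) → ℤₚ.≤-refl ; (there b∈) → ℤₚ.≤-trans (mx b∈) ga≤ }

  sumIx : (Ix → ℤ) → ℤ
  sumIx g = g k₀ + g k₁ + g k₂ + g k₃

  -- The slopes of four functionals of one class: two against two, three against one, or all equal.
  -- In the balanced case `j` shares its sign with `k₀`; in the tilted case `j` is the exception and
  -- `d` the majority.
  data Pattern (s : Ix → Sgn) : Set where
    balanced : (∀ x → sumIx (λ k → sg (s k) x) ≡ 0ℤ) →
               ∀ j → (∀ i → i ≡ k₀ ⊎ i ≡ j ⊎ s i ≡ opp (s k₀)) → Pattern s
    tilted   : ∀ d j → s j ≡ opp d → (∀ x → sumIx (λ k → sg (s k) x) ≡ + 2 * sg d x) → Pattern s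
    constant : ∀ d → (∀ x → sumIx (λ k → sg (s k) x) ≡ + 4 * sg d x) → Pattern s

  private
    at-signs : ∀ (s : Ix → Sgn) x {a b c d} → s k₀ ≡ a → s k₁ ≡ b → s k₂ ≡ c → s k₃ ≡ d →
               sumIx (λ k → sg (s k) x) ≡ sg a x + sg b x + sg c x + sg d x
    at-signs s x refl refl refl refl = refl

  classify : ∀ s → Pattern s
  classify s with s k₀ in e₀ | s k₁ in e₁ | s k₂ in e₂ | s k₃ in e₃
  ... | ⊕ | ⊕ | ⊕ | ⊕ = constant ⊕ λ x → trans (at-signs s x e₀ e₁ e₂ e₃) (lem x)
    where
    lem : ∀ x → x + x + x + x ≡ + 4 * x
    lem = solve-∀
  ... | ⊕ | ⊕ | ⊕ | ⊖ = tilted ⊕ k₃ e₃ λ x → trans (at-signs s x e₀ e₁ e₂ e₃) (lem x)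
    where
    lem : ∀ x → x + x + x + - x ≡ + 2 * x
    lem = solve-∀
  ... | ⊕ | ⊕ | ⊖ | ⊕ = tilted ⊕ k₂ e₂ λ x → trans (at-signs s x e₀ e₁ e₂ e₃) (lem x)
    where
    lem : ∀ x → x + x + - x + x ≡ + 2 * x
    lem = solve-∀
  ... | ⊕ | ⊕ | ⊖ | ⊖ = balanced (λ x → trans (at-signs s x e₀ e₁ e₂ e₃) (lem x)) k₁ λ { k₀ → inj₁ refl ; k₁ → inj₂ (inj₁ refl) ; k₂ → inj₂ (inj₂ (trans e₂ (sym (cong opp e₀)))) ; k₃ → inj₂ (inj₂ (trans e₃ (sym (cong opp e₀)))) }
    where
    lem : ∀ x → x + x + - x + - x ≡ 0ℤ
    lem = solve-∀
  ... | ⊕ | ⊖ | ⊕ | ⊕ = tilted ⊕ k₁ e₁ λ x → trans (at-signs s x e₀ e₁ e₂ e₃) (lem x)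
    where
    lem : ∀ x → x + - x + x + x ≡ + 2 * x
    lem = solve-∀
  ... | ⊕ | ⊖ | ⊕ | ⊖ = balanced (λ x → trans (at-signs s x e₀ e₁ e₂ e₃) (lem x)) k₂ λ { k₀ → inj₁ refl ; k₁ → inj₂ (inj₂ (trans e₁ (sym (cong opp e₀)))) ; k₂ → inj₂ (inj₁ refl) ; k₃ → inj₂ (inj₂ (trans e₃ (sym (cong opp e₀)))) }
    where
    lem : ∀ x → x + - x + x + - x ≡ 0ℤ
    lem = solve-∀
  ... | ⊕ | ⊖ | ⊖ | ⊕ = balanced (λ x → trans (at-signs s x e₀ e₁ e₂ e₃) (lem x)) k₃ λ { k₀ → inj₁ refl ; k₁ → inj₂ (inj₂ (trans e₁ (sym (cong opp e₀)))) ; k₂ → inj₂ (inj₂ (trans e₂ (sym (cong opp e₀)))) ; k₃ → inj₂ (inj₁ refl) }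
    where
    lem : ∀ x → x + - x + - x + x ≡ 0ℤ
    lem = solve-∀
  ... | ⊕ | ⊖ | ⊖ | ⊖ = tilted ⊖ k₀ e₀ λ x → trans (at-signs s x e₀ e₁ e₂ e₃) (lem x)
    where
    lem : ∀ x → x + - x + - x + - x ≡ + 2 * (- x)
    lem = solve-∀
  ... | ⊖ | ⊕ | ⊕ | ⊕ = tilted ⊕ k₀ e₀ λ x → trans (at-signs s x e₀ e₁ e₂ e₃) (lem x)
    where
    lem : ∀ x → - x + x + x + x ≡ + 2 * x
    lem = solve-∀
  ... | ⊖ | ⊕ | ⊕ | ⊖ = balanced (λ x → trans (at-signs s x e₀ e₁ e₂ e₃) (lem x)) k₃ λ { k₀ → inj₁ refl ; k₁ → inj₂ (inj₂ (trans e₁ (sym (cong opp e₀)))) ; k₂ → inj₂ (inj₂ (trans e₂ (sym (cong opp e₀)))) ; k₃ → inj₂ (inj₁ refl) }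
    where
    lem : ∀ x → - x + x + x + - x ≡ 0ℤ
    lem = solve-∀
  ... | ⊖ | ⊕ | ⊖ | ⊕ = balanced (λ x → trans (at-signs s x e₀ e₁ e₂ e₃) (lem x)) k₂ λ { k₀ → inj₁ refl ; k₁ → inj₂ (inj₂ (trans e₁ (sym (cong opp e₀)))) ; k₂ → inj₂ (inj₁ refl) ; k₃ → inj₂ (inj₂ (trans e₃ (sym (cong opp e₀)))) }
    where
    lem : ∀ x → - x + x + - x + x ≡ 0ℤ
    lem = solve-∀
  ... | ⊖ | ⊕ | ⊖ | ⊖ = tilted ⊖ k₁ e₁ λ x → trans (at-signs s x e₀ e₁ e₂ e₃) (lem x)
    where
    lem : ∀ x → - x + x + - x + - x ≡ + 2 * (- x)
    lem = solve-∀
  ... | ⊖ | ⊖ | ⊕ | ⊕ = balanced (λ x → trans (at-signs s x e₀ e₁ e₂ e₃) (lem x)) k₁ λ { k₀ → inj₁ refl ; k₁ → inj₂ (inj₁ refl) ; k₂ → inj₂ (inj₂ (trans e₂ (sym (cong opp e₀)))) ; k₃ → inj₂ (inj₂ (trans e₃ (sym (cong opp e₀)))) }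
    where
    lem : ∀ x → - x + - x + x + x ≡ 0ℤ
    lem = solve-∀
  ... | ⊖ | ⊖ | ⊕ | ⊖ = tilted ⊖ k₂ e₂ λ x → trans (at-signs s x e₀ e₁ e₂ e₃) (lem x)
    where
    lem : ∀ x → - x + - x + x + - x ≡ + 2 * (- x)
    lem = solve-∀
  ... | ⊖ | ⊖ | ⊖ | ⊕ = tilted ⊖ k₃ e₃ λ x → trans (at-signs s x e₀ e₁ e₂ e₃) (lem x)
    where
    lem : ∀ x → - x + - x + - x + x ≡ + 2 * (- x)
    lem = solve-∀
  ... | ⊖ | ⊖ | ⊖ | ⊖ = constant ⊖ λ x → trans (at-signs s x e₀ e₁ e₂ e₃) (lem x)
    where
    lem : ∀ x → - x + - x + - x + - x ≡ + 4 * (- x)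
    lem = solve-∀

  -- Bounds on the functionals at given parity and height

  module Slice (A : List P) (r π t : ℤ) where

    -- How much the bound loses against the maximum. It loses 2 only if the range of `g` on `A` is
    -- `r` and the maximum has parity `π`, and 1 only if the range is at least r - 1 and the parity
    -- is the other one; the point `p` witnesses the range.
    data Kind (g : P → ℤ) (H C : ℤ) : Set where
      two  : H ≡ C + + 2 → ∀ p → p ∈ A → g p ≡ H - r → Kind g H C
      one  : H ≡ C + 1ℤ → ∀ p → p ∈ A → g p ≤ H - (r - 1ℤ) → Kind g H C
      zero : H ≤ C → Kind g H C

    -- C is the largest value of the parity π that g may take at the centre.
    record Bound (g : P → ℤ) : Set where
      field
        H     : ℤ
        top   : P
        top∈  : top ∈ A
        g-top : g top ≡ H
        max   : ∀ {a} → a ∈ A → g a ≤ H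
        half  : ℤ
      C : ℤ
      C = π + + 2 * half
      field
        C≤top : C ≤ H + 1ℤ
        C≤all : ∀ {a} → a ∈ A → C ≤ g a + (r - 1ℤ)
        kind  : Kind g H C

    -- According to the parity of the maximum H, and to whether the range reaches `r` or r - 1
    -- respectively, the bound is H - 2, H, H - 1 or H + 1.
    bound : ∀ g {a₀} → a₀ ∈ A → (∀ {a b} → a ∈ A → b ∈ A → g a - g b ≤ r) → Bound g
    bound g a₀∈ diam with argmax g A a₀∈ | argmax (λ a → - g a) A a₀∈
    ... | a , a∈ , a-max | b , b∈ , b-max with parity-dec (g a) π
    ... | inj₁ (q , e) with r ℤₚ.≤? g a - g b
    ...   | yes r≤W = record
      { H = g a ; top = a ; top∈ = a∈ ; g-top = refl ; max = a-max ; half = q - 1ℤ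
      ; C≤top = linear (g a ∷ π ∷ q ∷ []) (1 ⊗ v₁ ⊞ + 2 ⊠ v₂ ⊑ v₀ ∷ []) (v₁ ⊞ + 2 ⊠ (v₂ ⊟ con 1ℤ) ⊑ v₀ ⊞ con 1ℤ)
                  (ℤₚ.≤-reflexive (sym e) ∷ [])
      ; C≤all = λ {c} c∈ → linear (g a ∷ π ∷ q ∷ g c ∷ r ∷ [])
                  (1 ⊗ v₁ ⊞ + 2 ⊠ v₂ ⊑ v₀ ∷ 1 ⊗ v₀ ⊟ v₃ ⊑ v₄ ∷ []) (v₁ ⊞ + 2 ⊠ (v₂ ⊟ con 1ℤ) ⊑ v₃ ⊞ (v₄ ⊟ con 1ℤ))
                  (ℤₚ.≤-reflexive (sym e) ∷ diam a∈ c∈ ∷ [])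
      ; kind = two (trans e (lem π q)) b b∈ (ℤₚ.≤-antisym
                  (linear (g a ∷ g b ∷ r ∷ []) (1 ⊗ v₂ ⊑ v₀ ⊟ v₁ ∷ []) (v₁ ⊑ v₀ ⊟ v₂) (r≤W ∷ []))
                  (linear (g a ∷ g b ∷ r ∷ []) (1 ⊗ v₀ ⊟ v₁ ⊑ v₂ ∷ []) (v₀ ⊟ v₂ ⊑ v₁) (diam a∈ b∈ ∷ [])))
      }
      where
      lem : ∀ π q → π + + 2 * q ≡ π + + 2 * (q - 1ℤ) + + 2
      lem = solve-∀
    ...   | no r≰W = record
      { H = g a ; top = a ; top∈ = a∈ ; g-top = refl ; max = a-max ; half = q
      ; C≤top = linear (g a ∷ π ∷ q ∷ []) (1 ⊗ v₁ ⊞ + 2 ⊠ v₂ ⊑ v₀ ∷ []) (v₁ ⊞ + 2 ⊠ v₂ ⊑ v₀ ⊞ con 1ℤ)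
                  (ℤₚ.≤-reflexive (sym e) ∷ [])
      ; C≤all = λ {c} c∈ → linear (g a ∷ π ∷ q ∷ g c ∷ r ∷ g b ∷ [])
                  (1 ⊗ v₁ ⊞ + 2 ⊠ v₂ ⊑ v₀ ∷ 1 ⊗ con 1ℤ ⊞ (v₀ ⊟ v₅) ⊑ v₄ ∷ 1 ⊗ ⊝ v₃ ⊑ ⊝ v₅ ∷ [])
                  (v₁ ⊞ + 2 ⊠ v₂ ⊑ v₃ ⊞ (v₄ ⊟ con 1ℤ))
                  (ℤₚ.≤-reflexive (sym e) ∷ ℤₚ.i<j⇒suc[i]≤j (ℤₚ.≰⇒> r≰W) ∷ b-max c∈ ∷ [])
      ; kind = zero (ℤₚ.≤-reflexive e)
      }
    bound g a₀∈ diam | a , a∈ , a-max | b , b∈ , b-max | inj₂ (q , e) with r - 1ℤ ℤₚ.≤? g a - g b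
    ...   | yes r-1≤W = record
      { H = g a ; top = a ; top∈ = a∈ ; g-top = refl ; max = a-max ; half = q
      ; C≤top = linear (g a ∷ π ∷ q ∷ []) (1 ⊗ v₁ ⊞ con 1ℤ ⊞ + 2 ⊠ v₂ ⊑ v₀ ∷ []) (v₁ ⊞ + 2 ⊠ v₂ ⊑ v₀ ⊞ con 1ℤ)
                  (ℤₚ.≤-reflexive (sym e) ∷ [])
      ; C≤all = λ {c} c∈ → linear (g a ∷ π ∷ q ∷ g c ∷ r ∷ [])
                  (1 ⊗ v₁ ⊞ con 1ℤ ⊞ + 2 ⊠ v₂ ⊑ v₀ ∷ 1 ⊗ v₀ ⊟ v₃ ⊑ v₄ ∷ []) (v₁ ⊞ + 2 ⊠ v₂ ⊑ v₃ ⊞ (v₄ ⊟ con 1ℤ))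
                  (ℤₚ.≤-reflexive (sym e) ∷ diam a∈ c∈ ∷ [])
      ; kind = one (trans e (lem π q)) b b∈
                  (linear (g a ∷ g b ∷ r ∷ []) (1 ⊗ v₂ ⊟ con 1ℤ ⊑ v₀ ⊟ v₁ ∷ []) (v₁ ⊑ v₀ ⊟ (v₂ ⊟ con 1ℤ)) (r-1≤W ∷ []))
      }
      where
      lem : ∀ π q → π + 1ℤ + + 2 * q ≡ π + + 2 * q + 1ℤ
      lem = solve-∀
    ...   | no r-1≰W = record
      { H = g a ; top = a ; top∈ = a∈ ; g-top = refl ; max = a-max ; half = q + 1ℤ
      ; C≤top = linear (g a ∷ π ∷ q ∷ []) (1 ⊗ v₁ ⊞ con 1ℤ ⊞ + 2 ⊠ v₂ ⊑ v₀ ∷ []) (v₁ ⊞ + 2 ⊠ (v₂ ⊞ con 1ℤ) ⊑ v₀ ⊞ con 1ℤ)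
                  (ℤₚ.≤-reflexive (sym e) ∷ [])
      ; C≤all = λ {c} c∈ → linear (g a ∷ π ∷ q ∷ g c ∷ r ∷ g b ∷ [])
                  (1 ⊗ v₁ ⊞ con 1ℤ ⊞ + 2 ⊠ v₂ ⊑ v₀ ∷ 1 ⊗ con 1ℤ ⊞ (v₀ ⊟ v₅) ⊑ v₄ ⊟ con 1ℤ ∷ 1 ⊗ ⊝ v₃ ⊑ ⊝ v₅ ∷ [])
                  (v₁ ⊞ + 2 ⊠ (v₂ ⊞ con 1ℤ) ⊑ v₃ ⊞ (v₄ ⊟ con 1ℤ))
                  (ℤₚ.≤-reflexive (sym e) ∷ ℤₚ.i<j⇒suc[i]≤j (ℤₚ.≰⇒> r-1≰W) ∷ b-max c∈ ∷ [])
      ; kind = zero (linear (g a ∷ π ∷ q ∷ []) (1 ⊗ v₀ ⊑ v₁ ⊞ con 1ℤ ⊞ + 2 ⊠ v₂ ∷ []) (v₀ ⊑ v₁ ⊞ + 2 ⊠ (v₂ ⊞ con 1ℤ))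
                  (ℤₚ.≤-reflexive e ∷ []))
      }

    open Bound

    module Solve (B : ∀ σ k s → Bound (φ σ k s)) where

      -- The bound that f σ k has to satisfy once the height of the centre is t.
      D : Sgn → Ix → Sgn → ℤ
      D σ k s = C (B σ k s) - sg s t

      -- At height `t` the four values `f ⊕ k` of a point are bounded above by `D ⊕` and below by
      -- minus `D ⊖`, have a fixed parity and sum 0, and are otherwise free. So the four intervals
      -- must be nonempty (`α`) and 0 must lie between the sums of their ends (`β`). The sums are
      -- even, so -1 does the work of 0.
      record Solvable : Set where
        field
          α : ∀ σ k s s′ → -[1+ 0 ] ≤ D σ k s + D (opp σ) k s′
          β : ∀ σ (s : Ix → Sgn) → -[1+ 0 ] ≤ D σ k₀ (s k₀) + D σ k₁ (s k₁) + D σ k₂ (s k₂) + D σ k₃ (s k₃)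

      private
        e : ℤ
        e = π - t

        shift : Sgn → ℤ
        shift ⊕ = 0ℤ
        shift ⊖ = t

        hi lo : Ix → Sgn → ℤ
        hi k s = half (B ⊕ k s) + shift s
        lo k s = - half (B ⊖ k s) - shift s - e

        hi-D : ∀ k s → D ⊕ k s ≡ e + + 2 * hi k s
        hi-D k ⊕ = lem π t (half (B ⊕ k ⊕))
          where
          lem : ∀ π t u → π + + 2 * u - t ≡ π - t + + 2 * (u + 0ℤ)
          lem = solve-∀
        hi-D k ⊖ = lem π t (half (B ⊕ k ⊖))
          where
          lem : ∀ π t u → π + + 2 * u - (- t) ≡ π - t + + 2 * (u + t)
          lem = solve-∀

        lo-D : ∀ k s → D ⊖ k s ≡ - (e + + 2 * lo k s)
        lo-D k ⊕ = lem π t (half (B ⊖ k ⊕))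
          where
          lem : ∀ π t u → π + + 2 * u - t ≡ - (π - t + + 2 * (- u - 0ℤ - (π - t)))
          lem = solve-∀
        lo-D k ⊖ = lem π t (half (B ⊖ k ⊖))
          where
          lem : ∀ π t u → π + + 2 * u - (- t) ≡ - (π - t + + 2 * (- u - t - (π - t)))
          lem = solve-∀

        least : (g : Sgn → ℤ) → ∃ λ s → ∀ s′ → g s ≤ g s′
        least g with ℤₚ.≤-total (g ⊕) (g ⊖)
        ... | inj₁ le = ⊕ , λ { ⊕ → ℤₚ.≤-refl ; ⊖ → le }
        ... | inj₂ ge = ⊖ , λ { ⊕ → ge ; ⊖ → ℤₚ.≤-refl }

        -- Integers in given intervals attain every sum between the sums of the ends. This takes off
        -- one summand and leaves a target that is still within reach of the others.
        split : ∀ {L U L′ U′} T → L ≤ U → L′ ≤ U′ → L + L′ ≤ T → T ≤ U + U′ →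
                ∃ λ g → L ≤ g × g ≤ U × L′ ≤ T - g × T - g ≤ U′
        split {L} {U} {L′} {U′} T p q lo≤ ≤hi with ℤₚ.≤-total L (T - U′)
        ... | inj₁ le = T - U′ , le ,
              linear (T ∷ U ∷ U′ ∷ []) (1 ⊗ v₀ ⊑ v₁ ⊞ v₂ ∷ []) (v₀ ⊟ v₂ ⊑ v₁) (≤hi ∷ []) ,
              linear (T ∷ L′ ∷ U′ ∷ []) (1 ⊗ v₁ ⊑ v₂ ∷ []) (v₁ ⊑ v₀ ⊟ (v₀ ⊟ v₂)) (q ∷ []) ,
              linear (T ∷ U′ ∷ []) [] (v₀ ⊟ (v₀ ⊟ v₁) ⊑ v₁) []
        ... | inj₂ ge = L , ℤₚ.≤-refl , p ,
              linear (T ∷ L ∷ L′ ∷ []) (1 ⊗ v₁ ⊞ v₂ ⊑ v₀ ∷ []) (v₂ ⊑ v₀ ⊟ v₁) (lo≤ ∷ []) ,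
              linear (T ∷ L ∷ U′ ∷ []) (1 ⊗ v₀ ⊟ v₂ ⊑ v₁ ∷ []) (v₀ ⊟ v₁ ⊑ v₂) (ge ∷ [])

      solve : Solvable → ∃ λ w → ∀ σ k s → φ σ k s w ≤ C (B σ k s)
      solve record { α = α ; β = β } = w , below
        where
        hi-least : ∀ k → ∃ λ s → ∀ s′ → hi k s ≤ hi k s′
        hi-least k = least (hi k)
        lo-greatest : ∀ k → ∃ λ s → ∀ s′ → - lo k s ≤ - lo k s′
        lo-greatest k = least (λ s → - lo k s)
        U L : Ix → ℤ
        U k = hi k (proj₁ (hi-least k))
        L k = lo k (proj₁ (lo-greatest k))
        L≤U : ∀ k → L k ≤ U k
        L≤U k = ℤₚ.0≤i-j⇒j≤i (sum≤ _ (linear (D ⊕ k (proj₁ (hi-least k)) ∷ D ⊖ k (proj₁ (lo-greatest k)) ∷ e ∷ U k ∷ L k ∷ [])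
          (1 ⊗ con -[1+ 0 ] ⊑ v₀ ⊞ v₁ ∷ 1 ⊗ v₀ ⊑ v₂ ⊞ + 2 ⊠ v₃ ∷ 1 ⊗ v₁ ⊑ ⊝ (v₂ ⊞ + 2 ⊠ v₄) ∷ []) (con -[1+ 0 ] ⊑ + 2 ⊠ (v₃ ⊟ v₄))
          (α ⊕ k _ _ ∷ ℤₚ.≤-reflexive (hi-D k _) ∷ ℤₚ.≤-reflexive (lo-D k _) ∷ [])))
        sumU : - (+ 2 * e) ≤ U k₀ + (U k₁ + (U k₂ + U k₃))
        sumU = linear (e ∷ U k₀ ∷ U k₁ ∷ U k₂ ∷ U k₃ ∷ []) (1 ⊗ con 0ℤ ⊑ v₁ ⊞ v₂ ⊞ v₃ ⊞ v₄ ⊞ + 2 ⊠ v₀ ∷ []) (⊝ (+ 2 ⊠ v₀) ⊑ v₁ ⊞ (v₂ ⊞ (v₃ ⊞ v₄)))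
          (sum≤ (U k₀ + U k₁ + U k₂ + U k₃ + + 2 * e) (linear (D ⊕ k₀ _ ∷ D ⊕ k₁ _ ∷ D ⊕ k₂ _ ∷ D ⊕ k₃ _ ∷ e ∷ U k₀ ∷ U k₁ ∷ U k₂ ∷ U k₃ ∷ [])
            (1 ⊗ con -[1+ 0 ] ⊑ v₀ ⊞ v₁ ⊞ v₂ ⊞ v₃ ∷ 1 ⊗ v₀ ⊑ v₄ ⊞ + 2 ⊠ v₅ ∷ 1 ⊗ v₁ ⊑ v₄ ⊞ + 2 ⊠ v₆ ∷ 1 ⊗ v₂ ⊑ v₄ ⊞ + 2 ⊠ v₇ ∷ 1 ⊗ v₃ ⊑ v₄ ⊞ + 2 ⊠ v₈ ∷ [])
            (con -[1+ 0 ] ⊑ + 2 ⊠ (v₅ ⊞ v₆ ⊞ v₇ ⊞ v₈ ⊞ + 2 ⊠ v₄))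
            (β ⊕ (λ k → proj₁ (hi-least k)) ∷ ℤₚ.≤-reflexive (hi-D k₀ _) ∷ ℤₚ.≤-reflexive (hi-D k₁ _) ∷ ℤₚ.≤-reflexive (hi-D k₂ _) ∷ ℤₚ.≤-reflexive (hi-D k₃ _) ∷ [])) ∷ [])
        sumL : L k₀ + (L k₁ + (L k₂ + L k₃)) ≤ - (+ 2 * e)
        sumL = linear (e ∷ L k₀ ∷ L k₁ ∷ L k₂ ∷ L k₃ ∷ []) (1 ⊗ con 0ℤ ⊑ ⊝ (v₁ ⊞ v₂ ⊞ v₃ ⊞ v₄ ⊞ + 2 ⊠ v₀) ∷ []) (v₁ ⊞ (v₂ ⊞ (v₃ ⊞ v₄)) ⊑ ⊝ (+ 2 ⊠ v₀))
          (sum≤ (- (L k₀ + L k₁ + L k₂ + L k₃ + + 2 * e)) (linear (D ⊖ k₀ _ ∷ D ⊖ k₁ _ ∷ D ⊖ k₂ _ ∷ D ⊖ k₃ _ ∷ e ∷ L k₀ ∷ L k₁ ∷ L k₂ ∷ L k₃ ∷ [])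
            (1 ⊗ con -[1+ 0 ] ⊑ v₀ ⊞ v₁ ⊞ v₂ ⊞ v₃ ∷ 1 ⊗ v₀ ⊑ ⊝ (v₄ ⊞ + 2 ⊠ v₅) ∷ 1 ⊗ v₁ ⊑ ⊝ (v₄ ⊞ + 2 ⊠ v₆) ∷ 1 ⊗ v₂ ⊑ ⊝ (v₄ ⊞ + 2 ⊠ v₇) ∷ 1 ⊗ v₃ ⊑ ⊝ (v₄ ⊞ + 2 ⊠ v₈) ∷ [])
            (con -[1+ 0 ] ⊑ + 2 ⊠ (⊝ (v₅ ⊞ v₆ ⊞ v₇ ⊞ v₈ ⊞ + 2 ⊠ v₄)))
            (β ⊖ (λ k → proj₁ (lo-greatest k)) ∷ ℤₚ.≤-reflexive (lo-D k₀ _) ∷ ℤₚ.≤-reflexive (lo-D k₁ _) ∷ ℤₚ.≤-reflexive (lo-D k₂ _) ∷ ℤₚ.≤-reflexive (lo-D k₃ _) ∷ [])) ∷ [])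
        -- The values of the functionals will be `e` + 2γ, and since these add up to 0 the γ must
        -- add up to -2`e`.
        s₁ = split (- (+ 2 * e)) (L≤U k₀) (ℤₚ.+-mono-≤ (L≤U k₁) (ℤₚ.+-mono-≤ (L≤U k₂) (L≤U k₃))) sumL sumU
        γ₀ = proj₁ s₁
        s₂ = split (- (+ 2 * e) - γ₀) (L≤U k₁) (ℤₚ.+-mono-≤ (L≤U k₂) (L≤U k₃)) (proj₁ (proj₂ (proj₂ (proj₂ s₁)))) (proj₂ (proj₂ (proj₂ (proj₂ s₁))))
        γ₁ = proj₁ s₂
        s₃ = split (- (+ 2 * e) - γ₀ - γ₁) (L≤U k₂) (L≤U k₃) (proj₁ (proj₂ (proj₂ (proj₂ s₂)))) (proj₂ (proj₂ (proj₂ (proj₂ s₂))))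
        γ₂ = proj₁ s₃
        γ : Ix → ℤ
        γ k₀ = γ₀
        γ k₁ = γ₁
        γ k₂ = γ₂
        γ k₃ = - (+ 2 * e) - γ₀ - γ₁ - γ₂
        L≤γ : ∀ k → L k ≤ γ k
        L≤γ k₀ = proj₁ (proj₂ s₁)
        L≤γ k₁ = proj₁ (proj₂ s₂)
        L≤γ k₂ = proj₁ (proj₂ s₃)
        L≤γ k₃ = proj₁ (proj₂ (proj₂ (proj₂ s₃)))
        γ≤U : ∀ k → γ k ≤ U k
        γ≤U k₀ = proj₁ (proj₂ (proj₂ s₁))
        γ≤U k₁ = proj₁ (proj₂ (proj₂ s₂))
        γ≤U k₂ = proj₁ (proj₂ (proj₂ s₃))
        γ≤U k₃ = proj₂ (proj₂ (proj₂ (proj₂ s₃)))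
        w : P
        -- Each of the last three coordinates is half the sum of `f ⊕ k₀` and one other functional.
        w = t ∷ γ₀ + γ₁ + e ∷ γ₀ + γ₂ + e ∷ γ₀ + γ k₃ + e ∷ []
        f-w : ∀ k → f ⊕ k w ≡ e + + 2 * γ k
        f-w k₀ = lem γ₀ γ₁ γ₂ e
          where
          lem : ∀ a b c e → (a + b + e) + (a + c + e) + (a + (- (+ 2 * e) - a - b - c) + e) ≡ e + + 2 * a
          lem = solve-∀
        f-w k₁ = lem γ₀ γ₁ γ₂ e
          where
          lem : ∀ a b c e → (a + b + e) + - (a + c + e) + - (a + (- (+ 2 * e) - a - b - c) + e) ≡ e + + 2 * b
          lem = solve-∀
        f-w k₂ = lem γ₀ γ₁ γ₂ e
          where
          lem : ∀ a b c e → - (a + b + e) + (a + c + e) + - (a + (- (+ 2 * e) - a - b - c) + e) ≡ e + + 2 * c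
          lem = solve-∀
        f-w k₃ = lem γ₀ γ₁ γ₂ e
          where
          lem : ∀ a b c e → - (a + b + e) + - (a + c + e) + (a + (- (+ 2 * e) - a - b - c) + e) ≡ e + + 2 * (- (+ 2 * e) - a - b - c)
          lem = solve-∀
        below : ∀ σ k s → φ σ k s w ≤ C (B σ k s)
        below ⊕ k s = linear (f ⊕ k w ∷ γ k ∷ U k ∷ hi k s ∷ C (B ⊕ k s) ∷ sg s t ∷ e ∷ [])
          (1 ⊗ v₀ ⊑ v₆ ⊞ + 2 ⊠ v₁ ∷ 2 ⊗ v₁ ⊑ v₂ ∷ 2 ⊗ v₂ ⊑ v₃ ∷ 1 ⊗ v₆ ⊞ + 2 ⊠ v₃ ⊑ v₄ ⊟ v₅ ∷ []) (v₀ ⊞ v₅ ⊑ v₄)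
          (ℤₚ.≤-reflexive (f-w k) ∷ γ≤U k ∷ proj₂ (hi-least k) s ∷ ℤₚ.≤-reflexive (sym (hi-D k s)) ∷ [])
        below ⊖ k s = linear (f ⊖ k w ∷ γ k ∷ L k ∷ lo k s ∷ C (B ⊖ k s) ∷ sg s t ∷ e ∷ f ⊕ k w ∷ [])
          (1 ⊗ v₀ ⊑ ⊝ v₇ ∷ 1 ⊗ v₆ ⊞ + 2 ⊠ v₁ ⊑ v₇ ∷ 2 ⊗ v₂ ⊑ v₁ ∷ 2 ⊗ ⊝ v₂ ⊑ ⊝ v₃ ∷ 1 ⊗ ⊝ (v₆ ⊞ + 2 ⊠ v₃) ⊑ v₄ ⊟ v₅ ∷ []) (v₀ ⊞ v₅ ⊑ v₄)
          (ℤₚ.≤-reflexive (f-opp⊕ k w) ∷ ℤₚ.≤-reflexive (sym (f-w k)) ∷ L≤γ k ∷ proj₂ (lo-greatest k) s ∷ ℤₚ.≤-reflexive (sym (lo-D k s)) ∷ [])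

      module Quad (σ : Sgn) (s : Ix → Sgn) where

        b : ∀ k → Bound (φ σ k (s k))
        b k = B σ k (s k)

        gap : Ix → P → ℤ
        gap k a = H (b k) - φ σ k (s k) a

        0≤gap : ∀ k {a} → a ∈ A → 0ℤ ≤ gap k a
        0≤gap k a∈ = ℤₚ.i≤j⇒0≤j-i (max (b k) a∈)

        Λ : ℤ
        Λ = sumIx (λ k → H (b k)) - sumIx (λ k → sg (s k) t)

        -- Λ does not depend on a, because the four functionals f σ k sum to zero.
        Λ-at : ∀ a → Λ ≡ sumIx (λ k → gap k a) + (sumIx (λ k → sg (s k) (ht a)) - sumIx (λ k → sg (s k) t))
        Λ-at a = trans (lem (H (b k₀)) (H (b k₁)) (H (b k₂)) (H (b k₃)) (f σ k₀ a) (f σ k₁ a) (f σ k₂ a) (f σ k₃ a)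
                            (sg (s k₀) (ht a)) (sg (s k₁) (ht a)) (sg (s k₂) (ht a)) (sg (s k₃) (ht a)) (sumIx (λ k → sg (s k) t)))
                       (trans (cong (λ v → rest + v) (f-sum σ a)) (ℤₚ.+-identityʳ rest))
          where
          rest = sumIx (λ k → gap k a) + (sumIx (λ k → sg (s k) (ht a)) - sumIx (λ k → sg (s k) t))
          lem : ∀ H₀ H₁ H₂ H₃ f₀ f₁ f₂ f₃ a₀ a₁ a₂ a₃ T →
                (H₀ + H₁ + H₂ + H₃) - T ≡
                ((H₀ - (f₀ + a₀)) + (H₁ - (f₁ + a₁)) + (H₂ - (f₂ + a₂)) + (H₃ - (f₃ + a₃)) + ((a₀ + a₁ + a₂ + a₃) - T)) + (f₀ + f₁ + f₂ + f₃)
          lem = solve-∀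

        -- The sum of the `D` is `Λ` minus the total of the losses `H` - `C`, so losses up to `Λ` +
        -- 1 are affordable.
        goal : ∀ d₀ d₁ d₂ d₃ →
               H (b k₀) ≤ C (b k₀) + d₀ → H (b k₁) ≤ C (b k₁) + d₁ → H (b k₂) ≤ C (b k₂) + d₂ → H (b k₃) ≤ C (b k₃) + d₃ →
               d₀ + d₁ + d₂ + d₃ ≤ Λ + 1ℤ → -[1+ 0 ] ≤ sumIx (λ k → D σ k (s k))
        goal d₀ d₁ d₂ d₃ p₀ p₁ p₂ p₃ q = subst (-[1+ 0 ] ≤_) (lem (C (b k₀)) (C (b k₁)) (C (b k₂)) (C (b k₃)) (sg (s k₀) t) (sg (s k₁) t) (sg (s k₂) t) (sg (s k₃) t))
          (linear (H (b k₀) ∷ H (b k₁) ∷ H (b k₂) ∷ H (b k₃) ∷ C (b k₀) ∷ C (b k₁) ∷ C (b k₂) ∷ C (b k₃) ∷ d₀ ∷ d₁ ∷ d₂ ∷ d₃ ∷ sumIx (λ k → sg (s k) t) ∷ [])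
            (1 ⊗ v₀ ⊑ v₄ ⊞ v₈ ∷ 1 ⊗ v₁ ⊑ v₅ ⊞ v₉ ∷ 1 ⊗ v₂ ⊑ v₆ ⊞ v₁₀ ∷ 1 ⊗ v₃ ⊑ v₇ ⊞ v₁₁ ∷
             1 ⊗ v₈ ⊞ v₉ ⊞ v₁₀ ⊞ v₁₁ ⊑ (v₀ ⊞ v₁ ⊞ v₂ ⊞ v₃) ⊟ var 12 ⊞ con 1ℤ ∷ [])
            (con -[1+ 0 ] ⊑ (v₄ ⊞ v₅ ⊞ v₆ ⊞ v₇) ⊟ var 12)
            (p₀ ∷ p₁ ∷ p₂ ∷ p₃ ∷ q ∷ []))
          where
          lem : ∀ a b c d x y z w → (a + b + c + d) - (x + y + z + w) ≡ (a - x) + (b - y) + (c - z) + (d - w)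
          lem = solve-∀

        IsTwo : Ix → Set
        IsTwo k = H (b k) ≡ C (b k) + + 2 × ∃ λ p → p ∈ A × φ σ k (s k) p ≡ H (b k) - r

        twoOr : ∀ k → IsTwo k ⊎ H (b k) ≤ C (b k) + 1ℤ
        twoOr k with kind (b k)
        ... | two e p p∈ ep = inj₁ (e , p , p∈ , ep)
        ... | one e p p∈ ep = inj₂ (ℤₚ.≤-reflexive e)
        ... | zero H≤C      = inj₂ (ℤₚ.≤-trans H≤C (ℤₚ.i≤i+j (C (b k)) 1ℤ))

        ≤two : ∀ k → H (b k) ≤ C (b k) + + 2
        ≤two k with twoOr k
        ... | inj₁ (e , _) = ℤₚ.≤-reflexive e
        ... | inj₂ le      = ℤₚ.≤-trans le (ℤₚ.+-monoʳ-≤ (C (b k)) (+≤+ (s≤s z≤n)))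

        from7 : + 7 ≤ Λ → -[1+ 0 ] ≤ sumIx (λ k → D σ k (s k))
        from7 Λ≥ = goal (+ 2) (+ 2) (+ 2) (+ 2) (≤two k₀) (≤two k₁) (≤two k₂) (≤two k₃)
          (linear (Λ ∷ []) (1 ⊗ con (+ 7) ⊑ v₀ ∷ []) (con (+ 8) ⊑ v₀ ⊞ con 1ℤ) (Λ≥ ∷ []))

        -- Losses are at most 2 each, and `Λ` ≥ 6 affords 7. Only four losses of 2 are too much.
        from6 : + 6 ≤ Λ → (∀ k → IsTwo k) ⊎ -[1+ 0 ] ≤ sumIx (λ k → D σ k (s k))
        from6 Λ≥ with twoOr k₀ | twoOr k₁ | twoOr k₂ | twoOr k₃
        ... | inj₁ t₀ | inj₁ t₁ | inj₁ t₂ | inj₁ t₃ = inj₁ λ { k₀ → t₀ ; k₁ → t₁ ; k₂ → t₂ ; k₃ → t₃ }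
        ... | inj₂ l  | _ | _ | _ = inj₂ (goal 1ℤ (+ 2) (+ 2) (+ 2) l (≤two k₁) (≤two k₂) (≤two k₃) (linear (Λ ∷ []) (1 ⊗ con (+ 6) ⊑ v₀ ∷ []) (con (+ 7) ⊑ v₀ ⊞ con 1ℤ) (Λ≥ ∷ [])))
        ... | inj₁ _ | inj₂ l | _ | _ = inj₂ (goal (+ 2) 1ℤ (+ 2) (+ 2) (≤two k₀) l (≤two k₂) (≤two k₃) (linear (Λ ∷ []) (1 ⊗ con (+ 6) ⊑ v₀ ∷ []) (con (+ 7) ⊑ v₀ ⊞ con 1ℤ) (Λ≥ ∷ [])))
        ... | inj₁ _ | inj₁ _ | inj₂ l | _ = inj₂ (goal (+ 2) (+ 2) 1ℤ (+ 2) (≤two k₀) (≤two k₁) l (≤two k₃) (linear (Λ ∷ []) (1 ⊗ con (+ 6) ⊑ v₀ ∷ []) (con (+ 7) ⊑ v₀ ⊞ con 1ℤ) (Λ≥ ∷ [])))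
        ... | inj₁ _ | inj₁ _ | inj₁ _ | inj₂ l = inj₂ (goal (+ 2) (+ 2) (+ 2) 1ℤ (≤two k₀) (≤two k₁) (≤two k₂) l (linear (Λ ∷ []) (1 ⊗ con (+ 6) ⊑ v₀ ∷ []) (con (+ 7) ⊑ v₀ ⊞ con 1ℤ) (Λ≥ ∷ [])))

        someTwo : (∃ IsTwo) ⊎ (∀ k → H (b k) ≤ C (b k) + 1ℤ)
        someTwo with twoOr k₀ | twoOr k₁ | twoOr k₂ | twoOr k₃
        ... | inj₁ t₀ | _ | _ | _ = inj₁ (k₀ , t₀)
        ... | inj₂ _ | inj₁ t₁ | _ | _ = inj₁ (k₁ , t₁)
        ... | inj₂ _ | inj₂ _ | inj₁ t₂ | _ = inj₁ (k₂ , t₂)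
        ... | inj₂ _ | inj₂ _ | inj₂ _ | inj₁ t₃ = inj₁ (k₃ , t₃)
        ... | inj₂ l₀ | inj₂ l₁ | inj₂ l₂ | inj₂ l₃ = inj₂ λ { k₀ → l₀ ; k₁ → l₁ ; k₂ → l₂ ; k₃ → l₃ }

        from3 : + 3 ≤ Λ → (∀ k → H (b k) ≤ C (b k) + 1ℤ) → -[1+ 0 ] ≤ sumIx (λ k → D σ k (s k))
        from3 Λ≥ l = goal 1ℤ 1ℤ 1ℤ 1ℤ (l k₀) (l k₁) (l k₂) (l k₃)
          (linear (Λ ∷ []) (1 ⊗ con (+ 3) ⊑ v₀ ∷ []) (con (+ 4) ⊑ v₀ ⊞ con 1ℤ) (Λ≥ ∷ []))

        one≤sum : ∀ k {a} → a ∈ A → gap k a ≤ sumIx (λ k → gap k a)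
        one≤sum k₀ {a} a∈ = linear (gap k₀ a ∷ gap k₁ a ∷ gap k₂ a ∷ gap k₃ a ∷ []) (1 ⊗ con 0ℤ ⊑ v₁ ∷ 1 ⊗ con 0ℤ ⊑ v₂ ∷ 1 ⊗ con 0ℤ ⊑ v₃ ∷ []) (v₀ ⊑ v₀ ⊞ v₁ ⊞ v₂ ⊞ v₃) (0≤gap k₁ a∈ ∷ 0≤gap k₂ a∈ ∷ 0≤gap k₃ a∈ ∷ [])
        one≤sum k₁ {a} a∈ = linear (gap k₀ a ∷ gap k₁ a ∷ gap k₂ a ∷ gap k₃ a ∷ []) (1 ⊗ con 0ℤ ⊑ v₀ ∷ 1 ⊗ con 0ℤ ⊑ v₂ ∷ 1 ⊗ con 0ℤ ⊑ v₃ ∷ []) (v₁ ⊑ v₀ ⊞ v₁ ⊞ v₂ ⊞ v₃) (0≤gap k₀ a∈ ∷ 0≤gap k₂ a∈ ∷ 0≤gap k₃ a∈ ∷ [])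
        one≤sum k₂ {a} a∈ = linear (gap k₀ a ∷ gap k₁ a ∷ gap k₂ a ∷ gap k₃ a ∷ []) (1 ⊗ con 0ℤ ⊑ v₀ ∷ 1 ⊗ con 0ℤ ⊑ v₁ ∷ 1 ⊗ con 0ℤ ⊑ v₃ ∷ []) (v₂ ⊑ v₀ ⊞ v₁ ⊞ v₂ ⊞ v₃) (0≤gap k₀ a∈ ∷ 0≤gap k₁ a∈ ∷ 0≤gap k₃ a∈ ∷ [])
        one≤sum k₃ {a} a∈ = linear (gap k₀ a ∷ gap k₁ a ∷ gap k₂ a ∷ gap k₃ a ∷ []) (1 ⊗ con 0ℤ ⊑ v₀ ∷ 1 ⊗ con 0ℤ ⊑ v₁ ∷ 1 ⊗ con 0ℤ ⊑ v₂ ∷ []) (v₃ ⊑ v₀ ⊞ v₁ ⊞ v₂ ⊞ v₃) (0≤gap k₀ a∈ ∷ 0≤gap k₁ a∈ ∷ 0≤gap k₂ a∈ ∷ [])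

        gap-two : ∀ {k} ((_ , p , _) : IsTwo k) → gap k p ≡ r
        gap-two {k} (_ , p , _ , e) = trans (cong (λ v → H (b k) - v) e) (lem (H (b k)) r)
          where
          lem : ∀ H r → H - (H - r) ≡ r
          lem = solve-∀

  module QuadGaps (A : List P) (r π t : ℤ) (B : ∀ σ k s → Slice.Bound A r π t (φ σ k s)) (σ : Sgn) (s : Ix → Sgn) where
    open Slice A r π t
    open Solve B
    open Bound
    open Quad σ s

    two≤sum : ∀ k j {a} → a ∈ A → k ≡ j ⊎ gap k a + gap j a ≤ sumIx (λ k → gap k a)
    two≤sum k₀ k₀ a∈ = inj₁ refl
    two≤sum k₀ k₁ {a} a∈ = inj₂ (linear (gap k₀ a ∷ gap k₁ a ∷ gap k₂ a ∷ gap k₃ a ∷ []) (1 ⊗ con 0ℤ ⊑ v₂ ∷ 1 ⊗ con 0ℤ ⊑ v₃ ∷ []) (v₀ ⊞ v₁ ⊑ v₀ ⊞ v₁ ⊞ v₂ ⊞ v₃) (0≤gap k₂ a∈ ∷ 0≤gap k₃ a∈ ∷ []))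
    two≤sum k₀ k₂ {a} a∈ = inj₂ (linear (gap k₀ a ∷ gap k₁ a ∷ gap k₂ a ∷ gap k₃ a ∷ []) (1 ⊗ con 0ℤ ⊑ v₁ ∷ 1 ⊗ con 0ℤ ⊑ v₃ ∷ []) (v₀ ⊞ v₂ ⊑ v₀ ⊞ v₁ ⊞ v₂ ⊞ v₃) (0≤gap k₁ a∈ ∷ 0≤gap k₃ a∈ ∷ []))
    two≤sum k₀ k₃ {a} a∈ = inj₂ (linear (gap k₀ a ∷ gap k₁ a ∷ gap k₂ a ∷ gap k₃ a ∷ []) (1 ⊗ con 0ℤ ⊑ v₁ ∷ 1 ⊗ con 0ℤ ⊑ v₂ ∷ []) (v₀ ⊞ v₃ ⊑ v₀ ⊞ v₁ ⊞ v₂ ⊞ v₃) (0≤gap k₁ a∈ ∷ 0≤gap k₂ a∈ ∷ []))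
    two≤sum k₁ k₀ {a} a∈ = inj₂ (linear (gap k₀ a ∷ gap k₁ a ∷ gap k₂ a ∷ gap k₃ a ∷ []) (1 ⊗ con 0ℤ ⊑ v₂ ∷ 1 ⊗ con 0ℤ ⊑ v₃ ∷ []) (v₁ ⊞ v₀ ⊑ v₀ ⊞ v₁ ⊞ v₂ ⊞ v₃) (0≤gap k₂ a∈ ∷ 0≤gap k₃ a∈ ∷ []))
    two≤sum k₁ k₁ a∈ = inj₁ refl
    two≤sum k₁ k₂ {a} a∈ = inj₂ (linear (gap k₀ a ∷ gap k₁ a ∷ gap k₂ a ∷ gap k₃ a ∷ []) (1 ⊗ con 0ℤ ⊑ v₀ ∷ 1 ⊗ con 0ℤ ⊑ v₃ ∷ []) (v₁ ⊞ v₂ ⊑ v₀ ⊞ v₁ ⊞ v₂ ⊞ v₃) (0≤gap k₀ a∈ ∷ 0≤gap k₃ a∈ ∷ []))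
    two≤sum k₁ k₃ {a} a∈ = inj₂ (linear (gap k₀ a ∷ gap k₁ a ∷ gap k₂ a ∷ gap k₃ a ∷ []) (1 ⊗ con 0ℤ ⊑ v₀ ∷ 1 ⊗ con 0ℤ ⊑ v₂ ∷ []) (v₁ ⊞ v₃ ⊑ v₀ ⊞ v₁ ⊞ v₂ ⊞ v₃) (0≤gap k₀ a∈ ∷ 0≤gap k₂ a∈ ∷ []))
    two≤sum k₂ k₀ {a} a∈ = inj₂ (linear (gap k₀ a ∷ gap k₁ a ∷ gap k₂ a ∷ gap k₃ a ∷ []) (1 ⊗ con 0ℤ ⊑ v₁ ∷ 1 ⊗ con 0ℤ ⊑ v₃ ∷ []) (v₂ ⊞ v₀ ⊑ v₀ ⊞ v₁ ⊞ v₂ ⊞ v₃) (0≤gap k₁ a∈ ∷ 0≤gap k₃ a∈ ∷ []))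
    two≤sum k₂ k₁ {a} a∈ = inj₂ (linear (gap k₀ a ∷ gap k₁ a ∷ gap k₂ a ∷ gap k₃ a ∷ []) (1 ⊗ con 0ℤ ⊑ v₀ ∷ 1 ⊗ con 0ℤ ⊑ v₃ ∷ []) (v₂ ⊞ v₁ ⊑ v₀ ⊞ v₁ ⊞ v₂ ⊞ v₃) (0≤gap k₀ a∈ ∷ 0≤gap k₃ a∈ ∷ []))
    two≤sum k₂ k₂ a∈ = inj₁ refl
    two≤sum k₂ k₃ {a} a∈ = inj₂ (linear (gap k₀ a ∷ gap k₁ a ∷ gap k₂ a ∷ gap k₃ a ∷ []) (1 ⊗ con 0ℤ ⊑ v₀ ∷ 1 ⊗ con 0ℤ ⊑ v₁ ∷ []) (v₂ ⊞ v₃ ⊑ v₀ ⊞ v₁ ⊞ v₂ ⊞ v₃) (0≤gap k₀ a∈ ∷ 0≤gap k₁ a∈ ∷ []))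
    two≤sum k₃ k₀ {a} a∈ = inj₂ (linear (gap k₀ a ∷ gap k₁ a ∷ gap k₂ a ∷ gap k₃ a ∷ []) (1 ⊗ con 0ℤ ⊑ v₁ ∷ 1 ⊗ con 0ℤ ⊑ v₂ ∷ []) (v₃ ⊞ v₀ ⊑ v₀ ⊞ v₁ ⊞ v₂ ⊞ v₃) (0≤gap k₁ a∈ ∷ 0≤gap k₂ a∈ ∷ []))
    two≤sum k₃ k₁ {a} a∈ = inj₂ (linear (gap k₀ a ∷ gap k₁ a ∷ gap k₂ a ∷ gap k₃ a ∷ []) (1 ⊗ con 0ℤ ⊑ v₀ ∷ 1 ⊗ con 0ℤ ⊑ v₂ ∷ []) (v₃ ⊞ v₁ ⊑ v₀ ⊞ v₁ ⊞ v₂ ⊞ v₃) (0≤gap k₀ a∈ ∷ 0≤gap k₂ a∈ ∷ []))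
    two≤sum k₃ k₂ {a} a∈ = inj₂ (linear (gap k₀ a ∷ gap k₁ a ∷ gap k₂ a ∷ gap k₃ a ∷ []) (1 ⊗ con 0ℤ ⊑ v₀ ∷ 1 ⊗ con 0ℤ ⊑ v₁ ∷ []) (v₃ ⊞ v₂ ⊑ v₀ ⊞ v₁ ⊞ v₂ ⊞ v₃) (0≤gap k₀ a∈ ∷ 0≤gap k₁ a∈ ∷ []))
    two≤sum k₃ k₃ a∈ = inj₁ refl

    -- When r is odd, the point p realising the width of a functional has the wrong
    -- parity for the maxima of the other tight functionals, so their gaps at p are odd.
    odd-goal : r ≡ + 5 → ∀ k ((_ , p , _) : IsTwo k) → sumIx (λ k → gap k p) ≤ Λ → -[1+ 0 ] ≤ sumIx (λ k → D σ k (s k))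
    odd-goal r≡5 k two-k@(eₖ , p , p∈ , ep) sum≤Λ = go k two-k (ℤₚ.≤-reflexive (sym (trans (gap-two two-k) r≡5))) near
      where
      odd≥1 : ∀ m → 0ℤ ≤ + 5 + + 2 * m → 1ℤ ≤ + 5 + + 2 * m
      odd≥1 m le = linear (m ∷ []) (2 ⊗ con 0ℤ ⊑ v₀ ⊞ con (+ 2) ∷ []) (con 1ℤ ⊑ con (+ 5) ⊞ + 2 ⊠ v₀)
        (sum≤ (m + + 2) (linear (m ∷ []) (1 ⊗ con 0ℤ ⊑ con (+ 5) ⊞ + 2 ⊠ v₀ ∷ []) (con -[1+ 0 ] ⊑ + 2 ⊠ (v₀ ⊞ con (+ 2))) (le ∷ [])) ∷ [])
      near : ∀ j → H (b j) ≤ C (b j) + (1ℤ + gap j p)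
      near j with twoOr j
      ... | inj₂ l = linear (H (b j) ∷ C (b j) ∷ gap j p ∷ []) (1 ⊗ v₀ ⊑ v₁ ⊞ con 1ℤ ∷ 1 ⊗ con 0ℤ ⊑ v₂ ∷ []) (v₀ ⊑ v₁ ⊞ (con 1ℤ ⊞ v₂)) (l ∷ 0≤gap j p∈ ∷ [])
      ... | inj₁ (eⱼ , _) = linear (H (b j) ∷ C (b j) ∷ gap j p ∷ []) (1 ⊗ v₀ ⊑ v₁ ⊞ con (+ 2) ∷ 1 ⊗ con 1ℤ ⊑ v₂ ∷ []) (v₀ ⊑ v₁ ⊞ (con 1ℤ ⊞ v₂))
          (ℤₚ.≤-reflexive eⱼ ∷ subst (1ℤ ≤_) (sym gap-odd) (odd≥1 (half (b j) - half (b k) - proj₁ qⱼ + proj₁ qₖ) (subst (0ℤ ≤_) gap-odd (0≤gap j p∈))) ∷ [])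
        where
        qⱼ = φ-parity σ j (s j) p
        qₖ = φ-parity σ k (s k) p
        gap-odd : gap j p ≡ + 5 + + 2 * (half (b j) - half (b k) - proj₁ qⱼ + proj₁ qₖ)
        gap-odd = ℤₚ.≤-antisym
          (linear (H (b j) ∷ φ σ j (s j) p ∷ H (b k) ∷ φ σ k (s k) p ∷ π ∷ half (b j) ∷ half (b k) ∷ proj₁ qⱼ ∷ proj₁ qₖ ∷ parity p ∷ r ∷ [])
            (1 ⊗ v₀ ⊑ v₄ ⊞ + 2 ⊠ v₅ ⊞ con (+ 2) ∷ 1 ⊗ v₉ ⊞ + 2 ⊠ v₇ ⊑ v₁ ∷ 1 ⊗ v₄ ⊞ + 2 ⊠ v₆ ⊞ con (+ 2) ⊑ v₂ ∷ 1 ⊗ v₃ ⊑ v₉ ⊞ + 2 ⊠ v₈ ∷ 1 ⊗ v₂ ⊟ v₁₀ ⊑ v₃ ∷ 1 ⊗ v₁₀ ⊑ con (+ 5) ∷ [])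
            (v₀ ⊟ v₁ ⊑ con (+ 5) ⊞ + 2 ⊠ (v₅ ⊟ v₆ ⊟ v₇ ⊞ v₈))
            (ℤₚ.≤-reflexive eⱼ ∷ ℤₚ.≤-reflexive (sym (proj₂ qⱼ)) ∷ ℤₚ.≤-reflexive (sym eₖ) ∷ ℤₚ.≤-reflexive (proj₂ qₖ) ∷ ℤₚ.≤-reflexive (sym ep) ∷ ℤₚ.≤-reflexive r≡5 ∷ []))
          (linear (H (b j) ∷ φ σ j (s j) p ∷ H (b k) ∷ φ σ k (s k) p ∷ π ∷ half (b j) ∷ half (b k) ∷ proj₁ qⱼ ∷ proj₁ qₖ ∷ parity p ∷ r ∷ [])
            (1 ⊗ v₄ ⊞ + 2 ⊠ v₅ ⊞ con (+ 2) ⊑ v₀ ∷ 1 ⊗ v₁ ⊑ v₉ ⊞ + 2 ⊠ v₇ ∷ 1 ⊗ v₂ ⊑ v₄ ⊞ + 2 ⊠ v₆ ⊞ con (+ 2) ∷ 1 ⊗ v₉ ⊞ + 2 ⊠ v₈ ⊑ v₃ ∷ 1 ⊗ v₃ ⊑ v₂ ⊟ v₁₀ ∷ 1 ⊗ con (+ 5) ⊑ v₁₀ ∷ [])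
            (con (+ 5) ⊞ + 2 ⊠ (v₅ ⊟ v₆ ⊟ v₇ ⊞ v₈) ⊑ v₀ ⊟ v₁)
            (ℤₚ.≤-reflexive (sym eⱼ) ∷ ℤₚ.≤-reflexive (proj₂ qⱼ) ∷ ℤₚ.≤-reflexive eₖ ∷ ℤₚ.≤-reflexive (sym (proj₂ qₖ)) ∷ ℤₚ.≤-reflexive ep ∷ ℤₚ.≤-reflexive (sym r≡5) ∷ []))
      go : ∀ k → IsTwo k → + 5 ≤ gap k p → (∀ j → H (b j) ≤ C (b j) + (1ℤ + gap j p)) → -[1+ 0 ] ≤ sumIx (λ k → D σ k (s k))
      -- The losses 2 and three times 1 + gap add up to 5 plus three gaps. As the gap of the
      -- functional `k₀` itself is 5, this is the sum of all four gaps, at most `Λ`.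
      go k₀ (e , _) g5 near = goal (+ 2) (1ℤ + gap k₁ p) (1ℤ + gap k₂ p) (1ℤ + gap k₃ p) (ℤₚ.≤-reflexive e) (near k₁) (near k₂) (near k₃)
        (linear (gap k₀ p ∷ gap k₁ p ∷ gap k₂ p ∷ gap k₃ p ∷ Λ ∷ [])
          (1 ⊗ con (+ 5) ⊑ v₀ ∷ 1 ⊗ v₀ ⊞ v₁ ⊞ v₂ ⊞ v₃ ⊑ v₄ ∷ []) (con (+ 2) ⊞ (con 1ℤ ⊞ v₁) ⊞ (con 1ℤ ⊞ v₂) ⊞ (con 1ℤ ⊞ v₃) ⊑ v₄ ⊞ con 1ℤ) (g5 ∷ sum≤Λ ∷ []))
      go k₁ (e , _) g5 near = goal (1ℤ + gap k₀ p) (+ 2) (1ℤ + gap k₂ p) (1ℤ + gap k₃ p) (near k₀) (ℤₚ.≤-reflexive e) (near k₂) (near k₃)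
        (linear (gap k₀ p ∷ gap k₁ p ∷ gap k₂ p ∷ gap k₃ p ∷ Λ ∷ [])
          (1 ⊗ con (+ 5) ⊑ v₁ ∷ 1 ⊗ v₀ ⊞ v₁ ⊞ v₂ ⊞ v₃ ⊑ v₄ ∷ []) ((con 1ℤ ⊞ v₀) ⊞ con (+ 2) ⊞ (con 1ℤ ⊞ v₂) ⊞ (con 1ℤ ⊞ v₃) ⊑ v₄ ⊞ con 1ℤ) (g5 ∷ sum≤Λ ∷ []))
      go k₂ (e , _) g5 near = goal (1ℤ + gap k₀ p) (1ℤ + gap k₁ p) (+ 2) (1ℤ + gap k₃ p) (near k₀) (near k₁) (ℤₚ.≤-reflexive e) (near k₃)
        (linear (gap k₀ p ∷ gap k₁ p ∷ gap k₂ p ∷ gap k₃ p ∷ Λ ∷ [])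
          (1 ⊗ con (+ 5) ⊑ v₂ ∷ 1 ⊗ v₀ ⊞ v₁ ⊞ v₂ ⊞ v₃ ⊑ v₄ ∷ []) ((con 1ℤ ⊞ v₀) ⊞ (con 1ℤ ⊞ v₁) ⊞ con (+ 2) ⊞ (con 1ℤ ⊞ v₃) ⊑ v₄ ⊞ con 1ℤ) (g5 ∷ sum≤Λ ∷ []))
      go k₃ (e , _) g5 near = goal (1ℤ + gap k₀ p) (1ℤ + gap k₁ p) (1ℤ + gap k₂ p) (+ 2) (near k₀) (near k₁) (near k₂) (ℤₚ.≤-reflexive e)
        (linear (gap k₀ p ∷ gap k₁ p ∷ gap k₂ p ∷ gap k₃ p ∷ Λ ∷ [])
          (1 ⊗ con (+ 5) ⊑ v₃ ∷ 1 ⊗ v₀ ⊞ v₁ ⊞ v₂ ⊞ v₃ ⊑ v₄ ∷ []) ((con 1ℤ ⊞ v₀) ⊞ (con 1ℤ ⊞ v₁) ⊞ (con 1ℤ ⊞ v₂) ⊞ con (+ 2) ⊑ v₄ ⊞ con 1ℤ) (g5 ∷ sum≤Λ ∷ []))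

  -- Sums of four bounds

  module FacetBounds (A : List P) (r π t : ℤ) (B : ∀ σ k s → Slice.Bound A r π t (φ σ k s)) where
    open Slice A r π t
    open Solve B
    open Bound

    -- The points of `A` that are extreme in direction `d`, at least one step beyond `t`. The field
    -- `pair` says that they are spread out horizontally; where this is not so, `inward` gives a
    -- centre directly.
    record Facet (d : Sgn) : Set where
      field
        M    : ℤ
        t<M  : 1ℤ ≤ M - sg d t
        pair : ∀ σ → ∃ λ k → ∃₂ λ c c′ → c ∈ A × c′ ∈ A × sg d (ht c) ≡ M × sg d (ht c′) ≡ M × r - 1ℤ ≤ f σ k c - f σ k c′

    module Beta (diam : ∀ {a b} → a ∈ A → b ∈ A → dist a b ≤ r) (5≤r : + 5 ≤ r) (facet : ∀ d → Facet d) where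

      open Facet

      -- All that can go wrong with `β`: balanced slopes, r = 6, and four losses of 2 against a `Λ`
      -- that affords only 7.
      record Fail (σ : Sgn) (s : Ix → Sgn) : Set where
        open Quad σ s
        open QuadGaps A r π t B σ s
        field
          r≡6   : r ≡ + 6
          bal   : ∀ x → sumIx (λ k → sg (s k) x) ≡ 0ℤ
          same  : Ix
          flip  : ∀ i → i ≡ k₀ ⊎ i ≡ same ⊎ s i ≡ opp (s k₀)
          twos  : ∀ k → IsTwo k
          Λ≤6   : Λ ≤ + 6

      module _ (σ : Sgn) (s : Ix → Sgn) where
        open Quad σ s
        open QuadGaps A r π t B σ s

        same-height : ∀ d {i j} → sg d i ≡ sg d j → ∀ e → sg e i ≡ sg e j
        same-height ⊕ refl e = refl
        same-height ⊖ eq   e = cong (sg e) (ℤₚ.neg-injective eq)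

        pair-gap : ∀ d → let (k , c , c′ , _) = pair (facet d) σ in gap k c + (r - 1ℤ) ≤ gap k c′
        pair-gap d = let (k , c , c′ , _ , _ , e , e′ , sep) = pair (facet d) σ in
          linear (H (b k) ∷ f σ k c ∷ f σ k c′ ∷ sg (s k) (ht c) ∷ sg (s k) (ht c′) ∷ r ∷ [])
            (1 ⊗ v₅ ⊟ con 1ℤ ⊑ v₁ ⊟ v₂ ∷ 1 ⊗ v₄ ⊑ v₃ ∷ [])
            (v₀ ⊟ (v₁ ⊞ v₃) ⊞ (v₅ ⊟ con 1ℤ) ⊑ v₀ ⊟ (v₂ ⊞ v₄))
            (sep ∷ ℤₚ.≤-reflexive (same-height d (trans e′ (sym e)) (s k)) ∷ [])

        -- At the second point of the pair the gap of the separating functional alone is already r -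
        -- 1, since both points have the same height.
        facet-sum : ∀ d → ∃ λ c → c ∈ A × sg d (ht c) ≡ M (facet d) × r - 1ℤ ≤ sumIx (λ k → gap k c)
        facet-sum d = let (k , c , c′ , c∈ , c′∈ , _ , e′ , _) = pair (facet d) σ in
          c′ , c′∈ , e′ , linear (gap k c ∷ gap k c′ ∷ sumIx (λ k → gap k c′) ∷ r ∷ [])
            (1 ⊗ v₀ ⊞ (v₃ ⊟ con 1ℤ) ⊑ v₁ ∷ 1 ⊗ con 0ℤ ⊑ v₀ ∷ 1 ⊗ v₁ ⊑ v₂ ∷ []) (v₃ ⊟ con 1ℤ ⊑ v₂)
            (pair-gap d ∷ 0≤gap k c∈ ∷ one≤sum k c′∈ ∷ [])

        Λ-facet : ∀ (n : ℤ) d → (∀ x → sumIx (λ k → sg (s k) x) ≡ n * sg d x) → ∀ {c} → sg d (ht c) ≡ M (facet d) →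
                  Λ ≡ sumIx (λ k → gap k c) + n * (M (facet d) - sg d t)
        Λ-facet n d eq {c} e = trans (Λ-at c) (cong (λ v → sumIx (λ k → gap k c) + v)
          (trans (cong₂ _-_ (trans (eq (ht c)) (cong (λ v → n * v) e)) (eq t)) (lem n (M (facet d)) (sg d t))))
          where
          lem : ∀ n a b → n * a - n * b ≡ n * (a - b)
          lem = solve-∀

        Λ-lower : ∀ (n : ℤ) d → (∀ x → sumIx (λ k → sg (s k) x) ≡ n * sg d x) →
                  ∃ λ g → r - 1ℤ ≤ g × Λ ≡ g + n * (M (facet d) - sg d t)
        Λ-lower n d eq = go (facet-sum d)
          where
          go : (∃ λ c → c ∈ A × sg d (ht c) ≡ M (facet d) × r - 1ℤ ≤ sumIx (λ k → gap k c)) →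
               ∃ λ g → r - 1ℤ ≤ g × Λ ≡ g + n * (M (facet d) - sg d t)
          go (c , _ , e , le) = sumIx (λ k → gap k c) , le , Λ-facet n d eq {c} e

        neg-at : ∀ d {a} → a ≡ opp d → ∀ i → sg a i ≡ - sg d i
        neg-at ⊕ refl i = refl
        neg-at ⊖ refl i = sym (ℤₚ.neg-involutive i)

        -- A functional with slope -1 along d that drops by r at a point p below t
        -- has a large gap on the facet, because d(c , p) ≤ r already bounds the
        -- functional with slope +1.
        gap-low : ∀ d j → s j ≡ opp d → ∀ {p} → p ∈ A → φ σ j (s j) p ≡ H (b j) - r → 1ℤ + sg d (ht p) ≤ sg d t →
                  ∀ {c} → c ∈ A → sg d (ht c) ≡ M (facet d) → + 4 ≤ gap j c
        gap-low d j sj {p} p∈ ep p<t {c} c∈ e =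
          linear (H (b j) ∷ f σ j c ∷ f σ j p ∷ sg (s j) (ht c) ∷ sg (s j) (ht p) ∷ sg d (ht c) ∷ sg d (ht p) ∷ r ∷ M (facet d) ∷ sg d t ∷ [])
            (1 ⊗ (v₁ ⊞ v₅) ⊟ (v₂ ⊞ v₆) ⊑ v₇ ∷ 1 ⊗ v₂ ⊞ v₄ ⊑ v₀ ⊟ v₇ ∷ 1 ⊗ v₃ ⊑ ⊝ v₅ ∷ 1 ⊗ ⊝ v₆ ⊑ v₄ ∷ 2 ⊗ v₈ ⊑ v₅ ∷ 2 ⊗ con 1ℤ ⊑ v₈ ⊟ v₉ ∷ 2 ⊗ con 1ℤ ⊞ v₆ ⊑ v₉ ∷ [])
            (con (+ 4) ⊑ v₀ ⊟ (v₁ ⊞ v₃))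
            (ℤₚ.≤-trans (φ-lipschitz σ j d c p) (diam c∈ p∈) ∷ ℤₚ.≤-reflexive ep ∷ ℤₚ.≤-reflexive (neg-at d sj (ht c)) ∷ ℤₚ.≤-reflexive (sym (neg-at d sj (ht p))) ∷
             ℤₚ.≤-reflexive (sym e) ∷ t<M (facet d) ∷ p<t ∷ [])

        -- If `k` is `j`, its gap at `c′` is at least 4 + (r - 1); otherwise the gaps r - 1 and 4 of
        -- two different functionals add up.
        sum≥8 : ∀ k j {c c′} → c ∈ A → c′ ∈ A → gap k c + (r - 1ℤ) ≤ gap k c′ → + 4 ≤ gap j c → + 4 ≤ gap j c′ →
                + 8 ≤ sumIx (λ k → gap k c′)
        sum≥8 k j {c} {c′} c∈ c′∈ le g g′ with two≤sum k j c′∈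
        ... | inj₁ refl = linear (gap k c ∷ gap k c′ ∷ sumIx (λ k → gap k c′) ∷ r ∷ []) (1 ⊗ v₀ ⊞ (v₃ ⊟ con 1ℤ) ⊑ v₁ ∷ 1 ⊗ con (+ 4) ⊑ v₀ ∷ 1 ⊗ v₁ ⊑ v₂ ∷ 1 ⊗ con (+ 5) ⊑ v₃ ∷ [])
              (con (+ 8) ⊑ v₂) (le ∷ g ∷ one≤sum k c′∈ ∷ 5≤r ∷ [])
        ... | inj₂ le′ = linear (gap k c ∷ gap k c′ ∷ sumIx (λ k → gap k c′) ∷ r ∷ gap j c′ ∷ []) (1 ⊗ v₀ ⊞ (v₃ ⊟ con 1ℤ) ⊑ v₁ ∷ 1 ⊗ con 0ℤ ⊑ v₀ ∷ 1 ⊗ v₁ ⊞ v₄ ⊑ v₂ ∷ 1 ⊗ con (+ 5) ⊑ v₃ ∷ 1 ⊗ con (+ 4) ⊑ v₄ ∷ [])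
              (con (+ 8) ⊑ v₂) (le ∷ 0≤gap k c∈ ∷ le′ ∷ 5≤r ∷ g′ ∷ [])

        tilted-low : ∀ d j → s j ≡ opp d → (∀ x → sumIx (λ k → sg (s k) x) ≡ + 2 * sg d x) →
                     ∀ {p} → p ∈ A → φ σ j (s j) p ≡ H (b j) - r → 1ℤ + sg d (ht p) ≤ sg d t → + 7 ≤ Λ
        tilted-low d j sj eq p∈ ep p<t = go (pair (facet d) σ) (pair-gap d)
          where
          go : ((k , c , c′ , _) : ∃ λ k → ∃₂ λ c c′ → c ∈ A × c′ ∈ A × sg d (ht c) ≡ M (facet d) × sg d (ht c′) ≡ M (facet d) × r - 1ℤ ≤ f σ k c - f σ k c′) →
               gap k c + (r - 1ℤ) ≤ gap k c′ → + 7 ≤ Λ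
          go (k , c , c′ , c∈ , c′∈ , e , e′ , _) le = linear (Λ ∷ sumIx (λ k → gap k c′) ∷ M (facet d) ∷ sg d t ∷ []) (1 ⊗ v₁ ⊞ + 2 ⊠ (v₂ ⊟ v₃) ⊑ v₀ ∷ 2 ⊗ con 1ℤ ⊑ v₂ ⊟ v₃ ∷ 1 ⊗ con (+ 8) ⊑ v₁ ∷ [])
            (con (+ 7) ⊑ v₀)
            (ℤₚ.≤-reflexive (sym (Λ-facet (+ 2) d eq {c′} e′)) ∷ t<M (facet d) ∷
             sum≥8 k j c∈ c′∈ le (gap-low d j sj p∈ ep p<t c∈ e) (gap-low d j sj p∈ ep p<t c′∈ e′) ∷ [])

        tilted-high : ∀ d → (∀ x → sumIx (λ k → sg (s k) x) ≡ + 2 * sg d x) → ∀ {p} → sg d t ≤ sg d (ht p) → sumIx (λ k → gap k p) ≤ Λ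
        tilted-high d eq {p} t≤p =
          linear (sumIx (λ k → gap k p) ∷ Λ ∷ sg d (ht p) ∷ sg d t ∷ sumIx (λ k → sg (s k) (ht p)) ∷ sumIx (λ k → sg (s k) t) ∷ [])
            (1 ⊗ v₀ ⊞ (v₄ ⊟ v₅) ⊑ v₁ ∷ 2 ⊗ v₃ ⊑ v₂ ∷ 1 ⊗ + 2 ⊠ v₂ ⊑ v₄ ∷ 1 ⊗ v₅ ⊑ + 2 ⊠ v₃ ∷ []) (v₀ ⊑ v₁)
            (ℤₚ.≤-reflexive (sym (Λ-at p)) ∷ t≤p ∷ ℤₚ.≤-reflexive (sym (eq (ht p))) ∷ ℤₚ.≤-reflexive (eq t) ∷ [])

        -- Let `p` be the point where the functional `j`, of slope opposite to `d`, is `r` below its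
        -- maximum. If `p` is not below `t` in direction `d`, its gaps add up to at most `Λ` and the
        -- parity argument applies; otherwise the gaps on the facet are large enough for `from7`.
        tilted-5 : r ≡ + 5 → ∀ d j → s j ≡ opp d → (∀ x → sumIx (λ k → sg (s k) x) ≡ + 2 * sg d x) → IsTwo j →
                   -[1+ 0 ] ≤ sumIx (λ k → D σ k (s k))
        tilted-5 r≡5 d j sj eq two-j@(_ , p , p∈ , ep) with sg d t ℤₚ.≤? sg d (ht p)
        ... | yes t≤p = odd-goal r≡5 j two-j (tilted-high d eq {p} t≤p)
        ... | no t≰p  = from7 (tilted-low d j sj eq p∈ ep (ℤₚ.i<j⇒suc[i]≤j (ℤₚ.≰⇒> t≰p)))

      split-r : r ≡ + 5 ⊎ r ≡ + 6 ⊎ + 7 ≤ r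
      split-r with + 7 ℤₚ.≤? r
      ... | yes p = inj₂ (inj₂ p)
      ... | no ¬p with + 6 ℤₚ.≤? r
      ...   | yes q = inj₂ (inj₁ (ℤₚ.≤-antisym (linear (r ∷ []) (1 ⊗ con 1ℤ ⊞ v₀ ⊑ con (+ 7) ∷ []) (v₀ ⊑ con (+ 6)) (ℤₚ.i<j⇒suc[i]≤j (ℤₚ.≰⇒> ¬p) ∷ [])) q))
      ...   | no ¬q = inj₁ (ℤₚ.≤-antisym (linear (r ∷ []) (1 ⊗ con 1ℤ ⊞ v₀ ⊑ con (+ 6) ∷ []) (v₀ ⊑ con (+ 5)) (ℤₚ.i<j⇒suc[i]≤j (ℤₚ.≰⇒> ¬q) ∷ [])) 5≤r)

      beta-pattern : ∀ σ s → Pattern s → Fail σ s ⊎ -[1+ 0 ] ≤ sumIx (λ k → D σ k (s k))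
      beta-pattern σ s (constant d eq) = inj₂ (go (Λ-lower σ s (+ 4) d eq))
            where
            open Quad σ s
            open QuadGaps A r π t B σ s
            go : (∃ λ g → r - 1ℤ ≤ g × Λ ≡ g + + 4 * (M (facet d) - sg d t)) → -[1+ 0 ] ≤ sumIx (λ k → D σ k (s k))
            -- Four slopes towards the facet add 4 to the gaps there, so `Λ` ≥ (r - 1) + 4 ≥ 8.
            go (g , le , e) = from7 (linear (Λ ∷ g ∷ M (facet d) ∷ sg d t ∷ r ∷ [])
                (1 ⊗ v₁ ⊞ + 4 ⊠ (v₂ ⊟ v₃) ⊑ v₀ ∷ 4 ⊗ con 1ℤ ⊑ v₂ ⊟ v₃ ∷ 1 ⊗ v₄ ⊟ con 1ℤ ⊑ v₁ ∷ 1 ⊗ con (+ 5) ⊑ v₄ ∷ []) (con (+ 7) ⊑ v₀)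
                (ℤₚ.≤-reflexive (sym e) ∷ t<M (facet d) ∷ le ∷ 5≤r ∷ []))
      beta-pattern σ s (tilted d j sj eq) = inj₂ (go split-r)
            where
            open Quad σ s
            open QuadGaps A r π t B σ s
            Λ≥ : r + 1ℤ ≤ Λ
            Λ≥ = Λ-go (Λ-lower σ s (+ 2) d eq)
              where
              Λ-go : (∃ λ g → r - 1ℤ ≤ g × Λ ≡ g + + 2 * (M (facet d) - sg d t)) → r + 1ℤ ≤ Λ
              Λ-go (g , le , e) = linear (Λ ∷ g ∷ M (facet d) ∷ sg d t ∷ r ∷ [])
                  (1 ⊗ v₁ ⊞ + 2 ⊠ (v₂ ⊟ v₃) ⊑ v₀ ∷ 2 ⊗ con 1ℤ ⊑ v₂ ⊟ v₃ ∷ 1 ⊗ v₄ ⊟ con 1ℤ ⊑ v₁ ∷ []) (v₄ ⊞ con 1ℤ ⊑ v₀)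
                  (ℤₚ.≤-reflexive (sym e) ∷ t<M (facet d) ∷ le ∷ [])
            go : r ≡ + 5 ⊎ r ≡ + 6 ⊎ + 7 ≤ r → -[1+ 0 ] ≤ sumIx (λ k → D σ k (s k))
            go (inj₂ (inj₂ 7≤r)) = from7 (linear (Λ ∷ r ∷ []) (1 ⊗ v₁ ⊞ con 1ℤ ⊑ v₀ ∷ 1 ⊗ con (+ 7) ⊑ v₁ ∷ []) (con (+ 7) ⊑ v₀) (Λ≥ ∷ 7≤r ∷ []))
            go (inj₂ (inj₁ r≡6)) = from7 (subst (λ v → v + 1ℤ ≤ Λ) r≡6 Λ≥)
            go (inj₁ r≡5) = [ (λ twos → tilted-5 σ s r≡5 d j sj eq (twos j)) , id ]′ (from6 (subst (λ v → v + 1ℤ ≤ Λ) r≡5 Λ≥))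
      beta-pattern σ s (balanced eq same flip) = go someTwo
            where
            open Quad σ s
            open QuadGaps A r π t B σ s
            Λ≡ : ∀ a → Λ ≡ sumIx (λ k → gap k a)
            Λ≡ a = trans (Λ-at a) (trans (cong (λ v → sumIx (λ k → gap k a) + v) (cong₂ _-_ (eq (ht a)) (eq t))) (ℤₚ.+-identityʳ _))
            go : (∃ IsTwo) ⊎ (∀ k → H (b k) ≤ C (b k) + 1ℤ) → Fail σ s ⊎ -[1+ 0 ] ≤ sumIx (λ k → D σ k (s k))
            go (inj₂ l) = inj₂ (from3 (go₀ (facet-sum σ s ⊕)) l)
              where
              go₀ : (∃ λ c → c ∈ A × sg ⊕ (ht c) ≡ M (facet ⊕) × r - 1ℤ ≤ sumIx (λ k → gap k c)) → + 3 ≤ Λ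
              go₀ (c , c∈ , e , le) = 
                (linear (Λ ∷ sumIx (λ k → gap k c) ∷ r ∷ []) (1 ⊗ v₁ ⊑ v₀ ∷ 1 ⊗ v₂ ⊟ con 1ℤ ⊑ v₁ ∷ 1 ⊗ con (+ 5) ⊑ v₂ ∷ []) (con (+ 3) ⊑ v₀)
                  (ℤₚ.≤-reflexive (sym (Λ≡ c)) ∷ le ∷ 5≤r ∷ []))
            go (inj₁ (k , two-k@(_ , p , p∈ , _))) = go′ split-r
              where
              r≤Λ : r ≤ Λ
              r≤Λ = subst₂ _≤_ (gap-two two-k) (sym (Λ≡ p)) (one≤sum k p∈)
              go″ : r ≡ + 6 → (∀ k → IsTwo k) → Dec (+ 7 ≤ Λ) → Fail σ s ⊎ -[1+ 0 ] ≤ sumIx (λ k → D σ k (s k))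
              go″ r≡6 twos (yes 7≤Λ) = inj₂ (from7 7≤Λ)
              go″ r≡6 twos (no 7≰Λ)  = inj₁ record { r≡6 = r≡6 ; bal = eq ; same = same ; flip = flip ; twos = twos
                        ; Λ≤6 = linear (Λ ∷ []) (1 ⊗ con 1ℤ ⊞ v₀ ⊑ con (+ 7) ∷ []) (v₀ ⊑ con (+ 6)) (ℤₚ.i<j⇒suc[i]≤j (ℤₚ.≰⇒> 7≰Λ) ∷ []) }
              go′ : r ≡ + 5 ⊎ r ≡ + 6 ⊎ + 7 ≤ r → Fail σ s ⊎ -[1+ 0 ] ≤ sumIx (λ k → D σ k (s k))
              go′ (inj₂ (inj₂ 7≤r)) = inj₂ (from7 (ℤₚ.≤-trans 7≤r r≤Λ))
              go′ (inj₁ r≡5) = inj₂ (odd-goal r≡5 k two-k (ℤₚ.≤-reflexive (sym (Λ≡ p))))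
              go′ (inj₂ (inj₁ r≡6)) = [ (λ twos → go″ r≡6 twos (+ 7 ℤₚ.≤? Λ)) , inj₂ ]′ (from6 (subst (_≤ Λ) r≡6 r≤Λ))

      beta : ∀ σ s → Fail σ s ⊎ -[1+ 0 ] ≤ sumIx (λ k → D σ k (s k))
      beta σ s = beta-pattern σ s (classify s)

  -- From a solution of the bounds to a centre

  Centre : ∀ {m} → List (Vec ℤ m) → ℕ → Set
  Centre A r = ∃ λ w → (∀ {a} → a ∈ A → suc (manhattan w a) ℕ.≤ r) × (∀ p → ∃ λ a → a ∈ A × manhattan w p ℕ.≤ suc (manhattan a p))

  same-or-opp : ∀ s s′ → s′ ≡ s ⊎ s′ ≡ opp s
  same-or-opp ⊕ ⊕ = inj₁ refl
  same-or-opp ⊕ ⊖ = inj₂ refl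
  same-or-opp ⊖ ⊕ = inj₂ refl
  same-or-opp ⊖ ⊖ = inj₁ refl

  sg-opp : ∀ s i → sg (opp s) i ≡ - sg s i
  sg-opp ⊕ i = refl
  sg-opp ⊖ i = sym (ℤₚ.neg-involutive i)

  module Conclude (A : List P) (r : ℕ) (π t : ℤ) (B : ∀ σ k s → Slice.Bound A (+ r) π t (φ σ k s)) where
    open Slice A (+ r) π t
    open Bound

    -- The functional that norms the distance from `w` to the point in question decides: `C≤all`
    -- keeps the distance to `A` below `r`, and `C≤top` compares `w`, up to 1, with the point of `A`
    -- where that functional is largest.
    centre : (∃ λ w → ∀ σ k s → φ σ k s w ≤ C (B σ k s)) → Centre A r
    centre (w , below) = w , near , hull
      where
      near : ∀ {a} → a ∈ A → suc (manhattan w a) ℕ.≤ r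
      near {a} a∈ = go (φ-norming w a)
        where
        go : (∃ λ σ → ∃₂ λ k s → dist w a ≡ φ σ k s w - φ σ k s a) → suc (manhattan w a) ℕ.≤ r
        go (σ , k , s , e) = ℤₚ.drop‿+≤+ (linear (dist w a ∷ φ σ k s w ∷ φ σ k s a ∷ C (B σ k s) ∷ + r ∷ [])
          (1 ⊗ v₀ ⊑ v₁ ⊟ v₂ ∷ 1 ⊗ v₁ ⊑ v₃ ∷ 1 ⊗ v₃ ⊑ v₂ ⊞ (v₄ ⊟ con 1ℤ) ∷ []) (con 1ℤ ⊞ v₀ ⊑ v₄)
          (ℤₚ.≤-reflexive e ∷ below σ k s ∷ C≤all (B σ k s) a∈ ∷ []))
      hull : ∀ p → ∃ λ a → a ∈ A × manhattan w p ℕ.≤ suc (manhattan a p)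
      hull p = go (φ-norming w p)
        where
        go : (∃ λ σ → ∃₂ λ k s → dist w p ≡ φ σ k s w - φ σ k s p) → ∃ λ a → a ∈ A × manhattan w p ℕ.≤ suc (manhattan a p)
        go (σ , k , s , e) = top b , top∈ b , ℤₚ.drop‿+≤+
          (linear (dist w p ∷ φ σ k s w ∷ φ σ k s p ∷ C b ∷ H b ∷ φ σ k s (top b) ∷ dist (top b) p ∷ [])
            (1 ⊗ v₀ ⊑ v₁ ⊟ v₂ ∷ 1 ⊗ v₁ ⊑ v₃ ∷ 1 ⊗ v₃ ⊑ v₄ ⊞ con 1ℤ ∷ 1 ⊗ v₄ ⊑ v₅ ∷ 1 ⊗ v₅ ⊟ v₂ ⊑ v₆ ∷ []) (v₀ ⊑ con 1ℤ ⊞ v₆)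
            (ℤₚ.≤-reflexive e ∷ below σ k s ∷ C≤top b ∷ ℤₚ.≤-reflexive (sym (g-top b)) ∷ φ-lipschitz σ k s (top b) p ∷ []))
          where b = B σ k s

  -- Sums of two bounds

  module PairBounds (A : List P) (r π t : ℤ) (B : ∀ σ k s → Slice.Bound A r π t (φ σ k s)) {a₀ : P} (a₀∈ : a₀ ∈ A) where
    open Slice A r π t
    open Bound
    open Solve B

    ≤C+2 : ∀ {g} (b : Bound g) → H b ≤ C b + + 2
    ≤C+2 b = go (kind b)
      where
      go : Kind _ (H b) (C b) → H b ≤ C b + + 2
      go (two e _ _ _) = ℤₚ.≤-reflexive e
      go (one e _ _ _) = ℤₚ.≤-trans (ℤₚ.≤-reflexive e) (ℤₚ.+-monoʳ-≤ (C b) (+≤+ (s≤s z≤n)))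
      go (zero le)     = ℤₚ.≤-trans le (ℤₚ.i≤i+j (C b) (+ 2))

    tight-or-low : ∀ {g} (b : Bound g) → (∃ λ p → p ∈ A × g p ≤ H b - (r - 1ℤ)) ⊎ H b ≤ C b
    tight-or-low {g} b = go (kind b)
      where
      go : Kind g (H b) (C b) → (∃ λ p → p ∈ A × g p ≤ H b - (r - 1ℤ)) ⊎ H b ≤ C b
      go (two e p p∈ ep) = inj₁ (p , p∈ , linear (g p ∷ H b ∷ r ∷ []) (1 ⊗ v₀ ⊑ v₁ ⊟ v₂ ∷ []) (v₀ ⊑ v₁ ⊟ (v₂ ⊟ con 1ℤ)) (ℤₚ.≤-reflexive ep ∷ []))
      go (one e p p∈ ep) = inj₁ (p , p∈ , ep)
      go (zero le)       = inj₂ le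

    IsTwo : ∀ {g} → Bound g → Set
    IsTwo {g} b = H b ≡ C b + + 2 × ∃ λ p → p ∈ A × g p ≡ H b - r

    two-or-≤C+1 : ∀ {g} (b : Bound g) → IsTwo b ⊎ H b ≤ C b + 1ℤ
    two-or-≤C+1 b = go (kind b)
      where
      go : Kind _ (H b) (C b) → IsTwo b ⊎ H b ≤ C b + 1ℤ
      go (two e p p∈ ep) = inj₁ (e , p , p∈ , ep)
      go (one e _ _ _)   = inj₂ (ℤₚ.≤-reflexive e)
      go (zero le)       = inj₂ (ℤₚ.≤-trans le (ℤₚ.i≤i+j (C b) 1ℤ))

    -- The two maxima add up to the range of `g` on `A`. A loss of 2 on either side makes this at
    -- least `r` ≥ 3 against a total loss of at most 4; a loss of 1 makes it at least r - 1 against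
    -- at most 2.
    opposite : ∀ {g g′} (b : Bound g) (b′ : Bound g′) → (∀ {a} → a ∈ A → g a + g′ a ≡ 0ℤ) → + 3 ≤ r → -[1+ 0 ] ≤ C b + C b′
    opposite {g} {g′} b b′ sum0 3≤r = go (two-or-≤C+1 b) (two-or-≤C+1 b′)
      where
      far : r ≤ H b + H b′ → -[1+ 0 ] ≤ C b + C b′
      far le = linear (H b ∷ H b′ ∷ C b ∷ C b′ ∷ r ∷ []) (1 ⊗ v₄ ⊑ v₀ ⊞ v₁ ∷ 1 ⊗ con (+ 3) ⊑ v₄ ∷ 1 ⊗ v₀ ⊑ v₂ ⊞ con (+ 2) ∷ 1 ⊗ v₁ ⊑ v₃ ⊞ con (+ 2) ∷ []) (con -[1+ 0 ] ⊑ v₂ ⊞ v₃)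
        (le ∷ 3≤r ∷ ≤C+2 b ∷ ≤C+2 b′ ∷ [])
      go : IsTwo b ⊎ H b ≤ C b + 1ℤ → IsTwo b′ ⊎ H b′ ≤ C b′ + 1ℤ → -[1+ 0 ] ≤ C b + C b′
      go (inj₁ (_ , p , p∈ , e)) _ = far (linear (g p ∷ g′ p ∷ H b ∷ H b′ ∷ r ∷ []) (1 ⊗ v₀ ⊑ v₂ ⊟ v₄ ∷ 1 ⊗ v₁ ⊑ v₃ ∷ 1 ⊗ con 0ℤ ⊑ v₀ ⊞ v₁ ∷ []) (v₄ ⊑ v₂ ⊞ v₃)
        (ℤₚ.≤-reflexive e ∷ max b′ p∈ ∷ ℤₚ.≤-reflexive (sym (sum0 p∈)) ∷ []))
      go (inj₂ _) (inj₁ (_ , p , p∈ , e)) = far (linear (g p ∷ g′ p ∷ H b ∷ H b′ ∷ r ∷ []) (1 ⊗ v₁ ⊑ v₃ ⊟ v₄ ∷ 1 ⊗ v₀ ⊑ v₂ ∷ 1 ⊗ con 0ℤ ⊑ v₀ ⊞ v₁ ∷ []) (v₄ ⊑ v₂ ⊞ v₃)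
        (ℤₚ.≤-reflexive e ∷ max b p∈ ∷ ℤₚ.≤-reflexive (sym (sum0 p∈)) ∷ []))
      go (inj₂ l) (inj₂ l′) = go′ (tight-or-low b) (tight-or-low b′)
        where
        near : r - 1ℤ ≤ H b + H b′ → -[1+ 0 ] ≤ C b + C b′
        near le = linear (H b ∷ H b′ ∷ C b ∷ C b′ ∷ r ∷ []) (1 ⊗ v₄ ⊟ con 1ℤ ⊑ v₀ ⊞ v₁ ∷ 1 ⊗ con (+ 3) ⊑ v₄ ∷ 1 ⊗ v₀ ⊑ v₂ ⊞ con 1ℤ ∷ 1 ⊗ v₁ ⊑ v₃ ⊞ con 1ℤ ∷ []) (con -[1+ 0 ] ⊑ v₂ ⊞ v₃)
          (le ∷ 3≤r ∷ l ∷ l′ ∷ [])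
        go′ : (∃ λ p → p ∈ A × g p ≤ H b - (r - 1ℤ)) ⊎ H b ≤ C b → (∃ λ p → p ∈ A × g′ p ≤ H b′ - (r - 1ℤ)) ⊎ H b′ ≤ C b′ → -[1+ 0 ] ≤ C b + C b′
        go′ (inj₁ (p , p∈ , le)) _ = near (linear (g p ∷ g′ p ∷ H b ∷ H b′ ∷ r ∷ []) (1 ⊗ v₀ ⊑ v₂ ⊟ (v₄ ⊟ con 1ℤ) ∷ 1 ⊗ v₁ ⊑ v₃ ∷ 1 ⊗ con 0ℤ ⊑ v₀ ⊞ v₁ ∷ []) (v₄ ⊟ con 1ℤ ⊑ v₂ ⊞ v₃)
          (le ∷ max b′ p∈ ∷ ℤₚ.≤-reflexive (sym (sum0 p∈)) ∷ []))
        go′ (inj₂ _) (inj₁ (p , p∈ , le)) = near (linear (g p ∷ g′ p ∷ H b ∷ H b′ ∷ r ∷ []) (1 ⊗ v₁ ⊑ v₃ ⊟ (v₄ ⊟ con 1ℤ) ∷ 1 ⊗ v₀ ⊑ v₂ ∷ 1 ⊗ con 0ℤ ⊑ v₀ ⊞ v₁ ∷ []) (v₄ ⊟ con 1ℤ ⊑ v₂ ⊞ v₃)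
          (le ∷ max b p∈ ∷ ℤₚ.≤-reflexive (sym (sum0 p∈)) ∷ []))
        go′ (inj₂ le) (inj₂ le′) = linear (g a₀ ∷ g′ a₀ ∷ H b ∷ H b′ ∷ C b ∷ C b′ ∷ []) (1 ⊗ v₀ ⊑ v₂ ∷ 1 ⊗ v₁ ⊑ v₃ ∷ 1 ⊗ v₂ ⊑ v₄ ∷ 1 ⊗ v₃ ⊑ v₅ ∷ 1 ⊗ con 0ℤ ⊑ v₀ ⊞ v₁ ∷ []) (con -[1+ 0 ] ⊑ v₄ ⊞ v₅)
          (max b a₀∈ ∷ max b′ a₀∈ ∷ le ∷ le′ ∷ ℤₚ.≤-reflexive (sym (sum0 a₀∈)) ∷ [])

    module _ (5≤r : + 5 ≤ r) (facet : ∀ d → FacetBounds.Facet A r π t B d) where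
      open FacetBounds A r π t B
      open Facet

      -- For equal slopes the two functionals add up to twice the height, and a facet point only
      -- shows that the maxima exceed 2t by 2, one too few for two losses of 2. The missing unit
      -- comes from a facet two steps beyond `t`, from a `p` with gap `r` that is at most one step
      -- below `t`, or from a facet point that misses the maximum.
      data Cond (d : Sgn) : Set where
        deep  : + 2 ≤ M (facet d) - sg d t → Cond d
        flat  : (∀ {a} → a ∈ A → -[1+ 0 ] ≤ sg d (ht a) - sg d t) → Cond d
        loose : (∀ σ k → H (B σ k d) ≡ C (B σ k d) + + 2 → ∃ λ c → c ∈ A × sg d (ht c) ≡ M (facet d) × 1ℤ ≤ H (B σ k d) - φ σ k d c) → Cond d

      module Parallel (σ : Sgn) (k : Ix) (d : Sgn) where
        b b′ : Bound _
        b  = B σ k d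
        b′ = B (opp σ) k d
        g g′ : P → ℤ
        g  = φ σ k d
        g′ = φ (opp σ) k d
        sum2 : ∀ a → g a + g′ a ≡ sg d (ht a) + sg d (ht a)
        sum2 a = trans (cong (λ v → g a + (v + sg d (ht a))) (f-opp σ k a)) (lem (f σ k a) (sg d (ht a)))
          where
          lem : ∀ u h → (u + h) + (- u + h) ≡ h + h
          lem = solve-∀
        τ : ℤ
        τ = sg d t
        done : + 3 ≤ H b + H b′ - (τ + τ) → -[1+ 0 ] ≤ D σ k d + D (opp σ) k d
        done le = linear (H b ∷ H b′ ∷ C b ∷ C b′ ∷ τ ∷ []) (1 ⊗ con (+ 3) ⊑ v₀ ⊞ v₁ ⊟ (v₄ ⊞ v₄) ∷ 1 ⊗ v₀ ⊑ v₂ ⊞ con (+ 2) ∷ 1 ⊗ v₁ ⊑ v₃ ⊞ con (+ 2) ∷ []) (con -[1+ 0 ] ⊑ (v₂ ⊟ v₄) ⊞ (v₃ ⊟ v₄))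
          (le ∷ ≤C+2 b ∷ ≤C+2 b′ ∷ [])
        at-facet : ∀ {c} → c ∈ A → sg d (ht c) ≡ M (facet d) → + 2 + (H b - g c) ≤ H b + H b′ - (τ + τ)
        at-facet {c} c∈ e = linear (H b ∷ H b′ ∷ g c ∷ g′ c ∷ sg d (ht c) ∷ M (facet d) ∷ τ ∷ [])
          (1 ⊗ v₄ ⊞ v₄ ⊑ v₂ ⊞ v₃ ∷ 1 ⊗ v₃ ⊑ v₁ ∷ 2 ⊗ v₅ ⊑ v₄ ∷ 2 ⊗ con 1ℤ ⊑ v₅ ⊟ v₆ ∷ []) (con (+ 2) ⊞ (v₀ ⊟ v₂) ⊑ v₀ ⊞ v₁ ⊟ (v₆ ⊞ v₆))
          (ℤₚ.≤-reflexive (sym (sum2 c)) ∷ max b′ c∈ ∷ ℤₚ.≤-reflexive (sym e) ∷ t<M (facet d) ∷ [])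
        base : ∃ λ c → c ∈ A × sg d (ht c) ≡ M (facet d)
        base = go (pair (facet d) ⊕)
          where
          go : (∃ λ k → ∃₂ λ c c′ → c ∈ A × c′ ∈ A × sg d (ht c) ≡ M (facet d) × sg d (ht c′) ≡ M (facet d) × r - 1ℤ ≤ f ⊕ k c - f ⊕ k c′) → ∃ λ c → c ∈ A × sg d (ht c) ≡ M (facet d)
          go (_ , c , _ , c∈ , _ , e , _) = c , c∈ , e
        parallel : Cond d → -[1+ 0 ] ≤ D σ k d + D (opp σ) k d
        parallel (deep 2≤) = done (go base)
          where
          go : (∃ λ c → c ∈ A × sg d (ht c) ≡ M (facet d)) → + 3 ≤ H b + H b′ - (τ + τ)
          go (c , c∈ , e) = linear (H b ∷ H b′ ∷ g c ∷ g′ c ∷ sg d (ht c) ∷ M (facet d) ∷ τ ∷ [])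
            (1 ⊗ v₄ ⊞ v₄ ⊑ v₂ ⊞ v₃ ∷ 1 ⊗ v₃ ⊑ v₁ ∷ 1 ⊗ v₂ ⊑ v₀ ∷ 2 ⊗ v₅ ⊑ v₄ ∷ 2 ⊗ con (+ 2) ⊑ v₅ ⊟ v₆ ∷ []) (con (+ 3) ⊑ v₀ ⊞ v₁ ⊟ (v₆ ⊞ v₆))
            (ℤₚ.≤-reflexive (sym (sum2 c)) ∷ max b′ c∈ ∷ max b c∈ ∷ ℤₚ.≤-reflexive (sym e) ∷ 2≤ ∷ [])
        parallel cond = go (kind b) cond
          where
          weak : H b ≤ C b + 1ℤ → (∃ λ c → c ∈ A × sg d (ht c) ≡ M (facet d)) → -[1+ 0 ] ≤ D σ k d + D (opp σ) k d
          weak le (c , c∈ , e) = linear (H b ∷ H b′ ∷ C b ∷ C b′ ∷ τ ∷ g c ∷ []) (1 ⊗ con (+ 2) ⊞ (v₀ ⊟ v₅) ⊑ v₀ ⊞ v₁ ⊟ (v₄ ⊞ v₄) ∷ 1 ⊗ v₀ ⊑ v₂ ⊞ con 1ℤ ∷ 1 ⊗ v₁ ⊑ v₃ ⊞ con (+ 2) ∷ 1 ⊗ v₅ ⊑ v₀ ∷ []) (con -[1+ 0 ] ⊑ (v₂ ⊟ v₄) ⊞ (v₃ ⊟ v₄))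
            (at-facet c∈ e ∷ le ∷ ≤C+2 b′ ∷ max b c∈ ∷ [])
          go : Kind g (H b) (C b) → Cond d → -[1+ 0 ] ≤ D σ k d + D (opp σ) k d
          go (one e _ _ _) _ = weak (ℤₚ.≤-reflexive e) base
          go (zero le)     _ = weak (ℤₚ.≤-trans le (ℤₚ.i≤i+j (C b) 1ℤ)) base
          go (two e p p∈ ep) (deep 2≤) = parallel (deep 2≤)
          go (two e p p∈ ep) (flat near) = done (linear (H b ∷ H b′ ∷ g p ∷ g′ p ∷ sg d (ht p) ∷ τ ∷ r ∷ [])
            (1 ⊗ v₄ ⊞ v₄ ⊑ v₂ ⊞ v₃ ∷ 1 ⊗ v₃ ⊑ v₁ ∷ 1 ⊗ v₂ ⊑ v₀ ⊟ v₆ ∷ 2 ⊗ con -[1+ 0 ] ⊑ v₄ ⊟ v₅ ∷ 1 ⊗ con (+ 5) ⊑ v₆ ∷ []) (con (+ 3) ⊑ v₀ ⊞ v₁ ⊟ (v₅ ⊞ v₅))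
            (ℤₚ.≤-reflexive (sym (sum2 p)) ∷ max b′ p∈ ∷ ℤₚ.≤-reflexive ep ∷ near p∈ ∷ 5≤r ∷ []))
          go (two e p p∈ ep) (loose l) = done (go′ (l σ k e))
            where
            go′ : (∃ λ c → c ∈ A × sg d (ht c) ≡ M (facet d) × 1ℤ ≤ H b - g c) → + 3 ≤ H b + H b′ - (τ + τ)
            go′ (c , c∈ , ec , gap≥1) = linear (H b ∷ H b′ ∷ g c ∷ τ ∷ []) (1 ⊗ con (+ 2) ⊞ (v₀ ⊟ v₂) ⊑ v₀ ⊞ v₁ ⊟ (v₃ ⊞ v₃) ∷ 1 ⊗ con 1ℤ ⊑ v₀ ⊟ v₂ ∷ []) (con (+ 3) ⊑ v₀ ⊞ v₁ ⊟ (v₃ ⊞ v₃))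
              (at-facet c∈ ec ∷ gap≥1 ∷ [])

      alpha : (∀ d → Cond d) → ∀ σ k s s′ → -[1+ 0 ] ≤ D σ k s + D (opp σ) k s′
      alpha cond σ k s s′ = go (same-or-opp s s′)
        where
        go : s′ ≡ s ⊎ s′ ≡ opp s → -[1+ 0 ] ≤ D σ k s + D (opp σ) k s′
        go (inj₁ refl) = Parallel.parallel σ k s (cond s)
        go (inj₂ refl) = linear (C (B σ k s) ∷ C (B (opp σ) k (opp s)) ∷ sg s t ∷ sg (opp s) t ∷ []) (1 ⊗ con -[1+ 0 ] ⊑ v₀ ⊞ v₁ ∷ 1 ⊗ v₃ ⊑ ⊝ v₂ ∷ []) (con -[1+ 0 ] ⊑ (v₀ ⊟ v₂) ⊞ (v₁ ⊟ v₃))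
          (opposite (B σ k s) (B (opp σ) k (opp s)) (λ {a} _ → trans (cong₂ (λ u v → φ σ k s a + (u + v)) (f-opp σ k a) (sg-opp s (ht a))) (lem (f σ k a) (sg s (ht a)))) (ℤₚ.≤-trans (+≤+ (s≤s (s≤s (s≤s z≤n)))) 5≤r) ∷ ℤₚ.≤-reflexive (sg-opp s t) ∷ [])
          where
          lem : ∀ u h → (u + h) + (- u + - h) ≡ 0ℤ
          lem = solve-∀

  -- F j is twice the coordinate on which the sign vectors of f ⊕ k₀ and f ⊕ j agree.
  F : Ix → P → ℤ
  F j a = f ⊕ k₀ a + f ⊕ j a

  -- In terms of the coordinate of `j`: points of the parity other than `π` differ by at most 1,
  -- while two points of parity `π` differ by at least 3. Hence `Narrow` for `π` contradicts `Wide`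
  -- for `π` + 1.
  Narrow Wide : List P → ℤ → Ix → Set
  Narrow A π j = ∀ {a a′} → a ∈ A → a′ ∈ A → parity a ≡₂ π + 1ℤ → parity a′ ≡₂ π + 1ℤ → F j a - F j a′ ≤ + 2
  Wide A π j   = ∃₂ λ p p′ → p ∈ A × p′ ∈ A × parity p ≡₂ π × parity p′ ≡₂ π × + 6 ≤ F j p - F j p′

  -- What a failure says about the points of either parity

  module FailureShape (A : List P) (r π t : ℤ) (B : ∀ σ k s → Slice.Bound A r π t (φ σ k s))
               (diam : ∀ {a b} → a ∈ A → b ∈ A → dist a b ≤ r) (5≤r : + 5 ≤ r) (facet : ∀ d → FacetBounds.Facet A r π t B d) where
    open Slice A r π t
    open Bound
    open Solve B
    open FacetBounds A r π t B
    open Beta diam 5≤r facet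

    -- A loss of 2 means that the maximum has parity `π`, so a point of the other parity does not
    -- attain it.
    odd-gap : ∀ {g} (b : Bound g) → H b ≡ C b + + 2 → ∀ {a} → a ∈ A → g a ≡₂ π + 1ℤ → 1ℤ ≤ H b - g a
    odd-gap {g} b e {a} a∈ (q , eq) = linear (H b ∷ g a ∷ π ∷ half b ∷ q ∷ [])
      (1 ⊗ v₂ ⊞ + 2 ⊠ v₃ ⊞ con (+ 2) ⊑ v₀ ∷ 1 ⊗ v₁ ⊑ v₂ ⊞ con 1ℤ ⊞ + 2 ⊠ v₄ ∷ 2 ⊗ con 0ℤ ⊑ v₃ ⊟ v₄ ∷ []) (con 1ℤ ⊑ v₀ ⊟ v₁)
      (ℤₚ.≤-reflexive (sym e) ∷ ℤₚ.≤-reflexive eq ∷ sum≤ (half b - q) (linear (H b ∷ g a ∷ π ∷ half b ∷ q ∷ [])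
        (1 ⊗ v₀ ⊑ v₂ ⊞ + 2 ⊠ v₃ ⊞ con (+ 2) ∷ 1 ⊗ v₂ ⊞ con 1ℤ ⊞ + 2 ⊠ v₄ ⊑ v₁ ∷ 1 ⊗ v₁ ⊑ v₀ ∷ []) (con -[1+ 0 ] ⊑ + 2 ⊠ (v₃ ⊟ v₄))
        (ℤₚ.≤-reflexive e ∷ ℤₚ.≤-reflexive (sym eq) ∷ max b a∈ ∷ [])) ∷ [])

    parity-shift : ∀ σ k s a → ∀ {i} → parity a ≡₂ i → φ σ k s a ≡₂ i
    parity-shift σ k s a {i} (q , e) = go (φ-parity σ k s a)
      where
      go : φ σ k s a ≡₂ parity a → φ σ k s a ≡₂ i
      go (q′ , e′) = q + q′ , trans e′ (trans (cong (λ v → v + + 2 * q′) e) (lem i q q′))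
        where
        lem : ∀ i q q′ → i + + 2 * q + + 2 * q′ ≡ i + + 2 * (q + q′)
        lem = solve-∀

    module _ {σ s} (fail : Fail σ s) where
      open Fail fail
      open Quad σ s

      Λ-sum : ∀ a → Λ ≡ sumIx (λ k → gap k a)
      Λ-sum a = trans (Λ-at a) (trans (cong (λ v → sumIx (λ k → gap k a) + v) (cong₂ _-_ (bal (ht a)) (bal t))) (ℤₚ.+-identityʳ _))

      data Partition (j l m : Ix) : Set where
        partition : (∀ a → sumIx (λ k → gap k a) ≡ gap k₀ a + gap j a + gap l a + gap m a) → Partition j l m

      -- The slopes of `k₀` and `j` are opposite, so the heights cancel.
      gap-sum : ∀ j → s j ≡ opp (s k₀) → ∀ a → gap k₀ a + gap j a ≡ H (b k₀) + H (b j) - (f σ k₀ a + f σ j a)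
      gap-sum j sj a = trans (cong (λ v → gap k₀ a + (H (b j) - (f σ j a + v))) (trans (cong (λ v → sg v (ht a)) sj) (sg-opp (s k₀) (ht a))))
        (lem (H (b k₀)) (H (b j)) (f σ k₀ a) (f σ j a) (sg (s k₀) (ht a)))
        where
        lem : ∀ H H′ u u′ h → (H - (u + h)) + (H′ - (u′ + - h)) ≡ H + H′ - (u + u′)
        lem = solve-∀

      -- At a point of the other parity all four gaps are at least 1 and their sum is at most 6, so
      -- those of `k₀` and `j` together lie between 2 and 4.
      narrow-σ : ∀ {j l m} → Partition j l m → s j ≡ opp (s k₀) → ∀ {a a′} → a ∈ A → a′ ∈ A → parity a ≡₂ π + 1ℤ → parity a′ ≡₂ π + 1ℤ →
                 (f σ k₀ a + f σ j a) - (f σ k₀ a′ + f σ j a′) ≤ + 2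
      narrow-σ {j} {l} {m} (partition part) sj {a} {a′} a∈ a′∈ pa pa′ =
        linear (gap k₀ a ∷ gap j a ∷ gap k₀ a′ ∷ gap j a′ ∷ gap l a′ ∷ gap m a′ ∷ Λ ∷ H (b k₀) + H (b j) ∷ f σ k₀ a + f σ j a ∷ f σ k₀ a′ + f σ j a′ ∷ [])
          (1 ⊗ con 1ℤ ⊑ v₀ ∷ 1 ⊗ con 1ℤ ⊑ v₁ ∷ 1 ⊗ v₀ ⊞ v₁ ⊑ v₇ ⊟ v₈ ∷ 1 ⊗ v₇ ⊟ v₉ ⊑ v₂ ⊞ v₃ ∷ 1 ⊗ con 1ℤ ⊑ v₄ ∷ 1 ⊗ con 1ℤ ⊑ v₅ ∷ 1 ⊗ v₂ ⊞ v₃ ⊞ v₄ ⊞ v₅ ⊑ v₆ ∷ 1 ⊗ v₆ ⊑ con (+ 6) ∷ [])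
          (v₈ ⊟ v₉ ⊑ con (+ 2))
          (odd k₀ a∈ pa ∷ odd j a∈ pa ∷ ℤₚ.≤-reflexive (gap-sum j sj a) ∷ ℤₚ.≤-reflexive (sym (gap-sum j sj a′)) ∷ odd l a′∈ pa′ ∷ odd m a′∈ pa′ ∷
           ℤₚ.≤-reflexive (sym (trans (Λ-sum a′) (part a′))) ∷ Λ≤6 ∷ [])
        where
        odd : ∀ k {a} → a ∈ A → parity a ≡₂ π + 1ℤ → 1ℤ ≤ gap k a
        odd k {a} a∈ pa = odd-gap (b k) (proj₁ (twos k)) a∈ (parity-shift σ k (s k) a {π + 1ℤ} pa)

      two-parity : ∀ k → let (_ , p , _) = twos k in parity p ≡₂ π
      two-parity k = go (twos k)
        where
        go : ((_ , p , _) : IsTwo k) → parity p ≡₂ π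
        go (e , p , _ , ep) = go′ (φ-parity σ k (s k) p)
          where
          go′ : φ σ k (s k) p ≡₂ parity p → parity p ≡₂ π
          go′ (q , eq) = half (b k) - + 2 - q , ℤₚ.≤-antisym
            (linear (H (b k) ∷ φ σ k (s k) p ∷ parity p ∷ π ∷ half (b k) ∷ q ∷ r ∷ [])
              (1 ⊗ v₂ ⊞ + 2 ⊠ v₅ ⊑ v₁ ∷ 1 ⊗ v₁ ⊑ v₀ ⊟ v₆ ∷ 1 ⊗ v₀ ⊑ v₃ ⊞ + 2 ⊠ v₄ ⊞ con (+ 2) ∷ 1 ⊗ con (+ 6) ⊑ v₆ ∷ []) (v₂ ⊑ v₃ ⊞ + 2 ⊠ (v₄ ⊟ con (+ 2) ⊟ v₅))
              (ℤₚ.≤-reflexive (sym eq) ∷ ℤₚ.≤-reflexive ep ∷ ℤₚ.≤-reflexive e ∷ ℤₚ.≤-reflexive (sym r≡6) ∷ []))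
            (linear (H (b k) ∷ φ σ k (s k) p ∷ parity p ∷ π ∷ half (b k) ∷ q ∷ r ∷ [])
              (1 ⊗ v₁ ⊑ v₂ ⊞ + 2 ⊠ v₅ ∷ 1 ⊗ v₀ ⊟ v₆ ⊑ v₁ ∷ 1 ⊗ v₃ ⊞ + 2 ⊠ v₄ ⊞ con (+ 2) ⊑ v₀ ∷ 1 ⊗ v₆ ⊑ con (+ 6) ∷ []) (v₃ ⊞ + 2 ⊠ (v₄ ⊟ con (+ 2) ⊟ v₅) ⊑ v₂)
              (ℤₚ.≤-reflexive eq ∷ ℤₚ.≤-reflexive (sym ep) ∷ ℤₚ.≤-reflexive (sym e) ∷ ℤₚ.≤-reflexive r≡6 ∷ []))

      -- Where the gap of `l` is 6 there is nothing left for `k₀` and `j`; where the gap of `k₀` is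
      -- 6, these two have at least 6.
      wide-σ : ∀ {j l m} → Partition j l m → s j ≡ opp (s k₀) →
               let p = proj₁ (proj₂ (twos l)) ; p′ = proj₁ (proj₂ (twos k₀)) in + 6 ≤ (f σ k₀ p + f σ j p) - (f σ k₀ p′ + f σ j p′)
      wide-σ {j} {l} {m} (partition part) sj = go (twos l) (twos k₀)
        where
        go : ((_ , p , _) : IsTwo l) ((_ , p′ , _) : IsTwo k₀) → + 6 ≤ (f σ k₀ p + f σ j p) - (f σ k₀ p′ + f σ j p′)
        go tl@(_ , p , p∈ , _) t₀@(_ , p′ , p′∈ , _) =
          linear (gap k₀ p ∷ gap j p ∷ gap l p ∷ gap m p ∷ gap k₀ p′ ∷ gap j p′ ∷ Λ ∷ H (b k₀) + H (b j) ∷ f σ k₀ p + f σ j p ∷ f σ k₀ p′ + f σ j p′ ∷ [])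
            (1 ⊗ con (+ 6) ⊑ v₂ ∷ 1 ⊗ con 0ℤ ⊑ v₃ ∷ 1 ⊗ v₀ ⊞ v₁ ⊞ v₂ ⊞ v₃ ⊑ v₆ ∷ 1 ⊗ v₆ ⊑ con (+ 6) ∷ 1 ⊗ v₇ ⊟ v₈ ⊑ v₀ ⊞ v₁ ∷
             1 ⊗ con (+ 6) ⊑ v₄ ∷ 1 ⊗ con 0ℤ ⊑ v₅ ∷ 1 ⊗ v₄ ⊞ v₅ ⊑ v₇ ⊟ v₉ ∷ [])
            (con (+ 6) ⊑ v₈ ⊟ v₉)
            (ℤₚ.≤-reflexive (sym (trans (gap-two tl) r≡6)) ∷ 0≤gap m p∈ ∷ ℤₚ.≤-reflexive (sym (trans (Λ-sum p) (part p))) ∷ Λ≤6 ∷ ℤₚ.≤-reflexive (sym (gap-sum j sj p)) ∷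
             ℤₚ.≤-reflexive (sym (trans (gap-two t₀) r≡6)) ∷ 0≤gap j p′∈ ∷ ℤₚ.≤-reflexive (gap-sum j sj p′) ∷ [])

      split-at : ∀ j → j ≡ k₀ ⊎ ∃₂ λ l m → Partition j l m
      split-at k₀ = inj₁ refl
      split-at k₁ = inj₂ (k₂ , k₃ , partition λ a → refl)
      split-at k₂ = inj₂ (k₁ , k₃ , partition λ a → lem (gap k₀ a) (gap k₁ a) (gap k₂ a) (gap k₃ a))
        where
        lem : ∀ a b c d → a + b + c + d ≡ a + c + b + d
        lem = solve-∀
      split-at k₃ = inj₂ (k₁ , k₂ , partition λ a → lem (gap k₀ a) (gap k₁ a) (gap k₂ a) (gap k₃ a))
        where
        lem : ∀ a b c d → a + b + c + d ≡ a + d + b + c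
        lem = solve-∀

    F-σ : ∀ σ j a a′ → (F j a - F j a′ ≡ (f σ k₀ a + f σ j a) - (f σ k₀ a′ + f σ j a′)) ⊎
                       (F j a - F j a′ ≡ (f σ k₀ a′ + f σ j a′) - (f σ k₀ a + f σ j a))
    F-σ ⊕ j a a′ = inj₁ refl
    F-σ ⊖ j a a′ = inj₂ (trans (lem (f ⊕ k₀ a) (f ⊕ j a) (f ⊕ k₀ a′) (f ⊕ j a′))
      (sym (cong₂ _-_ (cong₂ _+_ (f-opp⊕ k₀ a′) (f-opp⊕ j a′)) (cong₂ _+_ (f-opp⊕ k₀ a) (f-opp⊕ j a)))))
      where
      lem : ∀ x y x′ y′ → (x + y) - (x′ + y′) ≡ (- x′ + - y′) - (- x + - y)
      lem = solve-∀

    narrow : ∀ {σ s} → Fail σ s → ∀ j → s j ≡ opp (s k₀) → j ≡ k₀ ⊎ Narrow A π j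
    narrow {σ} {s} fail j sj = go (split-at fail j)
      where
      go : j ≡ k₀ ⊎ (∃₂ λ l m → Partition fail j l m) → j ≡ k₀ ⊎ Narrow A π j
      go (inj₁ e) = inj₁ e
      go (inj₂ (l , m , part)) = inj₂ λ {a} {a′} a∈ a′∈ pa pa′ →
        [ (λ e → subst (_≤ + 2) (sym e) (narrow-σ fail part sj a∈ a′∈ pa pa′)) , (λ e → subst (_≤ + 2) (sym e) (narrow-σ fail part sj a′∈ a∈ pa′ pa)) ]′ (F-σ σ j a a′)

    wide : ∀ {σ s} → Fail σ s → ∀ j → s j ≡ opp (s k₀) → j ≡ k₀ ⊎ Wide A π j
    wide {σ} {s} fail j sj = go (split-at fail j)
      where
      go : j ≡ k₀ ⊎ (∃₂ λ l m → Partition fail j l m) → j ≡ k₀ ⊎ Wide A π j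
      go (inj₁ e) = inj₁ e
      go (inj₂ (l , m , part)) = inj₂ (result (F-σ σ j p p′))
        where
        p  = proj₁ (proj₂ (Fail.twos fail l))
        p′ = proj₁ (proj₂ (Fail.twos fail k₀))
        p∈  = proj₁ (proj₂ (proj₂ (Fail.twos fail l)))
        p′∈ = proj₁ (proj₂ (proj₂ (Fail.twos fail k₀)))
        result : _ → Wide A π j
        result (inj₁ e) = p , p′ , p∈ , p′∈ , two-parity fail l , two-parity fail k₀ , subst (+ 6 ≤_) (sym e) (wide-σ fail part sj)
        result (inj₂ e) = p′ , p , p′∈ , p∈ , two-parity fail k₀ , two-parity fail l ,
          linear (F j p ∷ F j p′ ∷ f σ k₀ p + f σ j p ∷ f σ k₀ p′ + f σ j p′ ∷ []) (1 ⊗ v₀ ⊟ v₁ ⊑ v₃ ⊟ v₂ ∷ 1 ⊗ con (+ 6) ⊑ v₂ ⊟ v₃ ∷ []) (con (+ 6) ⊑ v₁ ⊟ v₀)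
            (ℤₚ.≤-reflexive e ∷ wide-σ fail part sj ∷ [])

  find : ∀ {X : Set} {Q : X → Set} → (∀ x → Dec (Q x)) → ∀ xs → (∃ λ x → x ∈ xs × Q x) ⊎ (∀ {x} → x ∈ xs → ¬ Q x)
  find Q? []       = inj₂ λ ()
  find Q? (x ∷ xs) with Q? x | find Q? xs
  ... | yes q | _ = inj₁ (x , here refl , q)
  ... | no ¬q | inj₁ (y , y∈ , q) = inj₁ (y , there y∈ , q)
  ... | no ¬q | inj₂ none = inj₂ λ { (here refl) → ¬q ; (there y∈) → none y∈ }

  choose : {X Y : Sgn → Set} → (∀ s → X s ⊎ Y s) → (∃ X) ⊎ (∀ s → Y s)
  choose g with g ⊕ | g ⊖
  ... | inj₁ x | _      = inj₁ (⊕ , x)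
  ... | inj₂ _ | inj₁ x = inj₁ (⊖ , x)
  ... | inj₂ y | inj₂ z = inj₂ λ { ⊕ → y ; ⊖ → z }

  mk : Sgn → Sgn → Sgn → Sgn → Ix → Sgn
  mk a b c d k₀ = a
  mk a b c d k₁ = b
  mk a b c d k₂ = c
  mk a b c d k₃ = d

  pick : ∀ x y → ∃ λ j → ¬ j ≡ k₀ × ¬ j ≡ x × ¬ j ≡ y
  pick k₀ k₀ = k₁ , (λ ()) , (λ ()) , λ ()
  pick k₀ k₁ = k₂ , (λ ()) , (λ ()) , λ ()
  pick k₀ k₂ = k₁ , (λ ()) , (λ ()) , λ ()
  pick k₀ k₃ = k₁ , (λ ()) , (λ ()) , λ ()
  pick k₁ k₀ = k₂ , (λ ()) , (λ ()) , λ ()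
  pick k₁ k₁ = k₂ , (λ ()) , (λ ()) , λ ()
  pick k₁ k₂ = k₃ , (λ ()) , (λ ()) , λ ()
  pick k₁ k₃ = k₂ , (λ ()) , (λ ()) , λ ()
  pick k₂ k₀ = k₁ , (λ ()) , (λ ()) , λ ()
  pick k₂ k₁ = k₃ , (λ ()) , (λ ()) , λ ()
  pick k₂ k₂ = k₁ , (λ ()) , (λ ()) , λ ()
  pick k₂ k₃ = k₁ , (λ ()) , (λ ()) , λ ()
  pick k₃ k₀ = k₁ , (λ ()) , (λ ()) , λ ()
  pick k₃ k₁ = k₂ , (λ ()) , (λ ()) , λ ()
  pick k₃ k₂ = k₁ , (λ ()) , (λ ()) , λ ()
  pick k₃ k₃ = k₁ , (λ ()) , (λ ()) , λ ()

  ≡₂-sym : ∀ {i j} → i ≡₂ j → j ≡₂ i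
  ≡₂-sym {i} {j} (q , e) = - q , trans (lem j q) (cong (λ v → v + + 2 * (- q)) (sym e))
    where
    lem : ∀ j q → j ≡ j + + 2 * q + + 2 * (- q)
    lem = solve-∀

  ≡₂-trans : ∀ {i j k} → i ≡₂ j → j ≡₂ k → i ≡₂ k
  ≡₂-trans {i} {j} {k} (q , e) (q′ , e′) = q′ + q , trans e (trans (cong (λ v → v + + 2 * q) e′) (lem k q′ q))
    where
    lem : ∀ k q′ q → k + + 2 * q′ + + 2 * q ≡ k + + 2 * (q′ + q)
    lem = solve-∀

  -- What a failure for the parity π says about A; it cannot happen for both parities.
  Obstruction : List P → ℤ → Set
  Obstruction A π = ∃ λ same → ∀ j → j ≡ k₀ ⊎ j ≡ same ⊎ (Narrow A π j × Wide A π j)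

  -- Besides `k₀` each obstruction exempts one index, so an index remains that neither exempts.
  -- There the points of parity `π` + 1 would have to be both close together and far apart.
  one-obstruction : ∀ {A π} → Obstruction A π → Obstruction A (π + 1ℤ) → ⊥
  one-obstruction {A} {π} (x , g) (y , h) = go (pick x y)
    where
    go : (∃ λ j → ¬ j ≡ k₀ × ¬ j ≡ x × ¬ j ≡ y) → ⊥
    go (j , ≢0 , ≢x , ≢y) = go′ (g j) (h j)
      where
      clash : Narrow A π j → Wide A (π + 1ℤ) j → ⊥
      clash nar (p , p′ , p∈ , p′∈ , pp , pp′ , le) = case (ℤₚ.≤-trans le (nar p∈ p′∈ pp pp′))
        where
        case : + 6 ≤ + 2 → ⊥
        case (+≤+ (s≤s (s≤s ())))
      go′ : j ≡ k₀ ⊎ j ≡ x ⊎ (Narrow A π j × Wide A π j) → j ≡ k₀ ⊎ j ≡ y ⊎ (Narrow A (π + 1ℤ) j × Wide A (π + 1ℤ) j) → ⊥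
      go′ (inj₁ e) _ = ≢0 e
      go′ (inj₂ (inj₁ e)) _ = ≢x e
      go′ _ (inj₁ e) = ≢0 e
      go′ _ (inj₂ (inj₁ e)) = ≢y e
      go′ (inj₂ (inj₂ (nar , _))) (inj₂ (inj₂ (_ , wid))) = clash nar wid

  -- Choice of the height in dimension 4

  module Four (A : List P) (r : ℕ) {a₀ : P} (a₀∈ : a₀ ∈ A) (diam : ∀ {a b} → a ∈ A → b ∈ A → manhattan a b ℕ.≤ r) (5≤r : 5 ℕ.≤ r) where

    private
      R : ℤ
      R = + r

      diamℤ : ∀ {a b} → a ∈ A → b ∈ A → dist a b ≤ R
      diamℤ a∈ b∈ = +≤+ (diam a∈ b∈)

    extreme : ∀ d → ∃ λ a → a ∈ A × (∀ {b} → b ∈ A → sg d (ht b) ≤ sg d (ht a))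
    extreme d = argmax (λ a → sg d (ht a)) A a₀∈

    ext : Sgn → P
    ext d = proj₁ (extreme d)

    top : Sgn → ℤ
    top d = sg d (ht (ext d))

    Pairs : Sgn → Set
    Pairs d = ∀ σ → ∃ λ k → ∃₂ λ c c′ → c ∈ A × c′ ∈ A × sg d (ht c) ≡ top d × sg d (ht c′) ≡ top d × R - 1ℤ ≤ f σ k c - f σ k c′

    sg-inj : ∀ d {i j} → sg d i ≡ sg d j → i ≡ j
    sg-inj ⊕ e = e
    sg-inj ⊖ e = ℤₚ.neg-injective e

    pairs : ∀ d {e} → e ∈ A → sg d (ht e) ≡ top d → R - 1ℤ ≤ dist (ext d) e → Pairs d
    pairs d {e} e∈ lev far = go (φ-norming (ext d) e)
      where
      a = ext d
      a∈ = proj₁ (proj₂ (extreme d))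
      go : (∃ λ σ → ∃₂ λ k s → dist a e ≡ φ σ k s a - φ σ k s e) → Pairs d
      go (σ , k , s , eq) σ′ = go′ (same-or-opp σ σ′)
        where
        sep : R - 1ℤ ≤ f σ k a - f σ k e
        sep = linear (R ∷ dist a e ∷ f σ k a ∷ f σ k e ∷ sg s (ht a) ∷ sg s (ht e) ∷ [])
          (1 ⊗ v₀ ⊟ con 1ℤ ⊑ v₁ ∷ 1 ⊗ v₁ ⊑ (v₂ ⊞ v₄) ⊟ (v₃ ⊞ v₅) ∷ 1 ⊗ v₄ ⊑ v₅ ∷ []) (v₀ ⊟ con 1ℤ ⊑ v₂ ⊟ v₃)
          (far ∷ ℤₚ.≤-reflexive eq ∷ ℤₚ.≤-reflexive (cong (sg s) (sg-inj d (sym lev))) ∷ [])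
        go′ : σ′ ≡ σ ⊎ σ′ ≡ opp σ → ∃ λ k → ∃₂ λ c c′ → c ∈ A × c′ ∈ A × sg d (ht c) ≡ top d × sg d (ht c′) ≡ top d × R - 1ℤ ≤ f σ′ k c - f σ′ k c′
        go′ (inj₁ refl) = k , a , e , a∈ , e∈ , refl , lev , sep
        go′ (inj₂ refl) = k , e , a , e∈ , a∈ , lev , refl ,
          linear (R ∷ f σ k a ∷ f σ k e ∷ f (opp σ) k a ∷ f (opp σ) k e ∷ []) (1 ⊗ v₀ ⊟ con 1ℤ ⊑ v₁ ⊟ v₂ ∷ 1 ⊗ ⊝ v₂ ⊑ v₄ ∷ 1 ⊗ v₃ ⊑ ⊝ v₁ ∷ []) (v₀ ⊟ con 1ℤ ⊑ v₄ ⊟ v₃)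
            (sep ∷ ℤₚ.≤-reflexive (sym (f-opp σ k e)) ∷ ℤₚ.≤-reflexive (f-opp σ k a) ∷ [])

    shift : Sgn → P → P
    shift d (h ∷ p) = h - sg d 1ℤ ∷ p

    φ-shift : ∀ σ k s d p → φ σ k s (shift d p) ≡ φ σ k s p - sg s (sg d 1ℤ)
    φ-shift σ k s d (h ∷ x ∷ y ∷ z ∷ []) = trans (cong (λ v → f σ k (h ∷ x ∷ y ∷ z ∷ []) + v) (sym (sg-minus s h (sg d 1ℤ)))) (lem (f σ k (h ∷ x ∷ y ∷ z ∷ [])) (sg s h) (sg s (sg d 1ℤ)))
      where
      lem : ∀ u v w → u + (v - w) ≡ u + v - w
      lem = solve-∀

    -- If no other point of the facet is far from an extreme point, move that point inwards.
    inward : ∀ d → (∀ {e} → e ∈ A → ¬ (sg d (ht e) ≡ top d × R - 1ℤ ≤ dist (ext d) e)) → Centre A r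
    inward d none = shift d a , near , λ p → a , a∈ , hull p
      where
      a = ext d
      a∈ = proj₁ (proj₂ (extreme d))
      w = shift d a
      sg-unit : ∀ s d → s ≡ d × sg s (sg d 1ℤ) ≡ 1ℤ ⊎ s ≡ opp d × sg s (sg d 1ℤ) ≡ -[1+ 0 ]
      sg-unit ⊕ ⊕ = inj₁ (refl , refl)
      sg-unit ⊕ ⊖ = inj₂ (refl , refl)
      sg-unit ⊖ ⊕ = inj₂ (refl , refl)
      sg-unit ⊖ ⊖ = inj₁ (refl , refl)
      near : ∀ {e} → e ∈ A → suc (manhattan w e) ℕ.≤ r
      near {e} e∈ = go (φ-norming w e)
        where
        go : (∃ λ σ → ∃₂ λ k s → dist w e ≡ φ σ k s w - φ σ k s e) → suc (manhattan w e) ℕ.≤ r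
        go (σ , k , s , eq) = ℤₚ.drop‿+≤+ (go′ (sg-unit s d))
          where
          go′ : s ≡ d × sg s (sg d 1ℤ) ≡ 1ℤ ⊎ s ≡ opp d × sg s (sg d 1ℤ) ≡ -[1+ 0 ] → 1ℤ + dist w e ≤ R
          go′ (inj₁ (_ , u)) = linear (dist w e ∷ φ σ k s w ∷ φ σ k s e ∷ φ σ k s a ∷ sg s (sg d 1ℤ) ∷ R ∷ [])
            (1 ⊗ v₀ ⊑ v₁ ⊟ v₂ ∷ 1 ⊗ v₁ ⊑ v₃ ⊟ v₄ ∷ 1 ⊗ con 1ℤ ⊑ v₄ ∷ 1 ⊗ v₃ ⊟ v₂ ⊑ v₅ ∷ []) (con 1ℤ ⊞ v₀ ⊑ v₅)
            (ℤₚ.≤-reflexive eq ∷ ℤₚ.≤-reflexive (φ-shift σ k s d a) ∷ ℤₚ.≤-reflexive (sym u) ∷ ℤₚ.≤-trans (φ-lipschitz σ k s a e) (diamℤ a∈ e∈) ∷ [])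
          go′ (inj₂ (refl , u)) = go″ (sg d (ht e) ℤₚ.≟ top d)
            where
            go″ : Dec (sg d (ht e) ≡ top d) → 1ℤ + dist w e ≤ R
            go″ (yes lev) = linear (dist w e ∷ φ σ k s w ∷ φ σ k s e ∷ φ σ k s a ∷ sg s (sg d 1ℤ) ∷ R ∷ dist a e ∷ [])
              (1 ⊗ v₀ ⊑ v₁ ⊟ v₂ ∷ 1 ⊗ v₁ ⊑ v₃ ⊟ v₄ ∷ 1 ⊗ con -[1+ 0 ] ⊑ v₄ ∷ 1 ⊗ v₃ ⊟ v₂ ⊑ v₆ ∷ 1 ⊗ con 1ℤ ⊞ v₆ ⊑ v₅ ⊟ con 1ℤ ∷ []) (con 1ℤ ⊞ v₀ ⊑ v₅)
              (ℤₚ.≤-reflexive eq ∷ ℤₚ.≤-reflexive (φ-shift σ k s d a) ∷ ℤₚ.≤-reflexive (sym u) ∷ φ-lipschitz σ k s a e ∷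
               ℤₚ.i<j⇒suc[i]≤j (ℤₚ.≰⇒> (λ far → none e∈ (lev , far))) ∷ [])
            -- A point off the facet: the slope towards the facet bounds the rest of the difference,
            -- and reversing the slope gains twice the drop in height, at least 2. This pays for the
            -- step and for the strict inequality.
            go″ (no off) = linear (dist w e ∷ φ σ k s w ∷ f σ k e ∷ f σ k a ∷ sg s (sg d 1ℤ) ∷ R ∷ sg s (ht a) ∷ sg s (ht e) ∷ top d ∷ sg d (ht e) ∷ [])
              (1 ⊗ v₀ ⊑ v₁ ⊟ (v₂ ⊞ v₇) ∷ 1 ⊗ v₁ ⊑ (v₃ ⊞ v₆) ⊟ v₄ ∷ 1 ⊗ con -[1+ 0 ] ⊑ v₄ ∷ 1 ⊗ (v₃ ⊞ v₈) ⊟ (v₂ ⊞ v₉) ⊑ v₅ ∷ 1 ⊗ v₆ ⊑ ⊝ v₈ ∷ 1 ⊗ ⊝ v₉ ⊑ v₇ ∷ 2 ⊗ con 1ℤ ⊞ v₉ ⊑ v₈ ∷ []) (con 1ℤ ⊞ v₀ ⊑ v₅)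
              (ℤₚ.≤-reflexive eq ∷ ℤₚ.≤-reflexive (φ-shift σ k s d a) ∷ ℤₚ.≤-reflexive (sym u) ∷ ℤₚ.≤-trans (φ-lipschitz σ k d a e) (diamℤ a∈ e∈) ∷
               ℤₚ.≤-reflexive (sg-opp d (ht a)) ∷ ℤₚ.≤-reflexive (sym (sg-opp d (ht e))) ∷ ℤₚ.i<j⇒suc[i]≤j (ℤₚ.≤∧≢⇒< (proj₂ (proj₂ (extreme d)) e∈) off) ∷ [])
      hull : ∀ p → manhattan w p ℕ.≤ suc (manhattan a p)
      hull p = go (φ-norming w p)
        where
        go : (∃ λ σ → ∃₂ λ k s → dist w p ≡ φ σ k s w - φ σ k s p) → manhattan w p ℕ.≤ suc (manhattan a p)
        go (σ , k , s , eq) = ℤₚ.drop‿+≤+ (linear (dist w p ∷ φ σ k s w ∷ φ σ k s p ∷ φ σ k s a ∷ sg s (sg d 1ℤ) ∷ dist a p ∷ [])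
          (1 ⊗ v₀ ⊑ v₁ ⊟ v₂ ∷ 1 ⊗ v₁ ⊑ v₃ ⊟ v₄ ∷ 1 ⊗ con -[1+ 0 ] ⊑ v₄ ∷ 1 ⊗ v₃ ⊟ v₂ ⊑ v₅ ∷ []) (v₀ ⊑ con 1ℤ ⊞ v₅)
          (ℤₚ.≤-reflexive eq ∷ ℤₚ.≤-reflexive (φ-shift σ k s d a) ∷ low (sg-unit s d) ∷ φ-lipschitz σ k s a p ∷ []))
          where
          low : s ≡ d × sg s (sg d 1ℤ) ≡ 1ℤ ⊎ s ≡ opp d × sg s (sg d 1ℤ) ≡ -[1+ 0 ] → -[1+ 0 ] ≤ sg s (sg d 1ℤ)
          low (inj₁ (_ , u)) = ℤₚ.≤-trans Data.Integer.-≤+ (ℤₚ.≤-reflexive (sym u))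
          low (inj₂ (_ , u)) = ℤₚ.≤-reflexive (sym u)

    facet? : ∀ d → Centre A r ⊎ Pairs d
    facet? d = go (find (λ e → both (sg d (ht e) ℤₚ.≟ top d) (R - 1ℤ ℤₚ.≤? dist (ext d) e)) A)
      where
      both : ∀ {X Y : Set} → Dec X → Dec Y → Dec (X × Y)
      both (yes x) (yes y) = yes (x , y)
      both (no ¬x) _       = no λ (x , _) → ¬x x
      both (yes x) (no ¬y) = no λ (_ , y) → ¬y y
      go : (∃ λ e → e ∈ A × (sg d (ht e) ≡ top d × R - 1ℤ ≤ dist (ext d) e)) ⊎ (∀ {e} → e ∈ A → ¬ (sg d (ht e) ≡ top d × R - 1ℤ ≤ dist (ext d) e)) → Centre A r ⊎ Pairs d
      go (inj₁ (e , e∈ , lev , far)) = inj₂ (pairs d e∈ lev far)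
      go (inj₂ none) = inj₁ (inward d none)

    module At (t : ℤ) (below : ∀ d → 1ℤ ≤ top d - sg d t) (prs : ∀ d → Pairs d) where

      5≤R : + 5 ≤ R
      5≤R = +≤+ 5≤r

      module AtParity (π : ℤ) where
        open Slice A R π t
        open Bound using (H; C; half)

        B : ∀ σ k s → Bound (φ σ k s)
        B σ k s = bound (φ σ k s) a₀∈ λ {a} {b} a∈ b∈ → ℤₚ.≤-trans (φ-lipschitz σ k s a b) (diamℤ a∈ b∈)

        facet : ∀ d → FacetBounds.Facet A R π t B d
        facet d = record { M = top d ; t<M = below d ; pair = prs d }

        open PairBounds A R π t B a₀∈ using (Cond; alpha; deep; flat; loose)
        open FailureShape A R π t B diamℤ 5≤R facet using (odd-gap; parity-shift; narrow; wide)
        open FacetBounds A R π t B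
        open Beta diamℤ 5≤R facet
        open Solve B

        Conds : Set
        Conds = ∀ d → Cond 5≤R facet d

        obstruction : ∀ {σ s} → Fail σ s → Obstruction A π
        obstruction {σ} {s} fail = Fail.same fail , λ j → go j (Fail.flip fail j)
          where
          go : ∀ j → j ≡ k₀ ⊎ j ≡ Fail.same fail ⊎ s j ≡ opp (s k₀) → j ≡ k₀ ⊎ j ≡ Fail.same fail ⊎ (Narrow A π j × Wide A π j)
          go j (inj₁ e) = inj₁ e
          go j (inj₂ (inj₁ e)) = inj₂ (inj₁ e)
          go j (inj₂ (inj₂ sj)) = go′ (narrow fail j sj) (wide fail j sj)
            where
            go′ : j ≡ k₀ ⊎ Narrow A π j → j ≡ k₀ ⊎ Wide A π j → j ≡ k₀ ⊎ j ≡ Fail.same fail ⊎ (Narrow A π j × Wide A π j)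
            go′ (inj₁ e) _ = inj₁ e
            go′ _ (inj₁ e) = inj₁ e
            go′ (inj₂ n) (inj₂ w) = inj₂ (inj₂ (n , w))

        attempt : Conds → Centre A r ⊎ Obstruction A π × R ≡ + 6
        attempt conds = go (choose λ σ → choose λ s₀ → choose λ s₁ → choose λ s₂ → choose λ s₃ → beta σ (mk s₀ s₁ s₂ s₃))
          where
          go : _ → Centre A r ⊎ Obstruction A π × R ≡ + 6
          go (inj₁ (σ , s₀ , s₁ , s₂ , s₃ , fail)) = inj₂ (obstruction fail , Fail.r≡6 fail)
          go (inj₂ ok) = inj₁ (Conclude.centre A r π t B (solve record
            { α = alpha 5≤R facet conds ; β = λ σ s → ok σ (s k₀) (s k₁) (s k₂) (s k₃) }))

        loose-parity : ∀ d {a} → a ∈ A → sg d (ht a) ≡ top d → parity a ≡₂ π + 1ℤ → Cond 5≤R facet d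
        loose-parity d {a} a∈ lev pa = loose λ σ k e → a , a∈ , lev , odd-gap (B σ k d) e a∈ (parity-shift σ k d a {π + 1ℤ} pa)

        H-parity : ∀ σ k d → H (B σ k d) ≡ C (B σ k d) + + 2 → ∀ {c} → c ∈ A → ¬ 1ℤ ≤ H (B σ k d) - φ σ k d c → parity c ≡₂ π
        H-parity σ k d e {c} c∈ ¬gap = ≡₂-trans {k = π} (≡₂-sym (φ-parity σ k d c)) (half (B σ k d) + 1ℤ , trans φ≡H (trans e (lem π (half (B σ k d)))))
          where
          lem : ∀ π h → π + + 2 * h + + 2 ≡ π + + 2 * (h + 1ℤ)
          lem = solve-∀
          φ≡H : φ σ k d c ≡ H (B σ k d)
          φ≡H = ℤₚ.≤-antisym (Bound.max (B σ k d) c∈)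
            (linear (H (B σ k d) ∷ φ σ k d c ∷ []) (1 ⊗ con 1ℤ ⊞ (v₀ ⊟ v₁) ⊑ con 1ℤ ∷ []) (v₀ ⊑ v₁) (ℤₚ.i<j⇒suc[i]≤j (ℤₚ.≰⇒> ¬gap) ∷ []))

      -- The conditions for the second parity may draw on the obstruction found for the first, which
      -- `wide≡3` exploits.
      attempts : ∀ π → AtParity.Conds π → (Obstruction A π → R ≡ + 6 → AtParity.Conds (π + 1ℤ)) → Centre A r
      attempts π conds conds′ = go (AtParity.attempt π conds)
        where
        go : Centre A r ⊎ Obstruction A π × R ≡ + 6 → Centre A r
        go (inj₁ c) = c
        go (inj₂ (o , r≡6)) = go′ (AtParity.attempt (π + 1ℤ) (conds′ o r≡6))
          where
          go′ : Centre A r ⊎ Obstruction A (π + 1ℤ) × R ≡ + 6 → Centre A r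
          go′ (inj₁ c) = c
          go′ (inj₂ (o′ , _)) = ⊥-elim (one-obstruction {π = π} o o′)

    width : ℤ
    width = top ⊕ + top ⊖

    bot : ℤ
    bot = - top ⊖

    bot≤ : ∀ {a} → a ∈ A → bot ≤ ht a
    bot≤ {a} a∈ = linear (top ⊖ ∷ ht a ∷ []) (1 ⊗ ⊝ v₁ ⊑ v₀ ∷ []) (⊝ v₀ ⊑ v₁) (proj₂ (proj₂ (extreme ⊖)) a∈ ∷ [])

    wide≥4 : + 4 ≤ width → (∀ d → Pairs d) → Centre A r
    wide≥4 4≤ prs = attempts 0ℤ (λ d → deep (low d)) (λ _ _ d → deep (low d))
      where
      -- Width 4 leaves room for two steps to either facet.
      t = bot + + 2
      low : ∀ d → + 2 ≤ top d - sg d t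
      low ⊕ = linear (top ⊕ ∷ top ⊖ ∷ []) (1 ⊗ con (+ 4) ⊑ v₀ ⊞ v₁ ∷ []) (con (+ 2) ⊑ v₀ ⊟ (⊝ v₁ ⊞ con (+ 2))) (4≤ ∷ [])
      low ⊖ = linear (top ⊖ ∷ []) [] (con (+ 2) ⊑ v₀ ⊟ (⊝ (⊝ v₀ ⊞ con (+ 2)))) []
      open At t (λ d → ℤₚ.≤-trans (+≤+ (s≤s z≤n)) (low d)) prs
      open PairBounds using (deep)

    wide≡2 : width ≡ + 2 → (∀ d → Pairs d) → Centre A r
    wide≡2 w≡2 prs = attempts 0ℤ (λ d → flat (near d)) (λ _ _ d → flat (near d))
      where
      -- The middle height, from which no point of `A` is more than one step away.
      t = bot + 1ℤ
      low : ∀ d → 1ℤ ≤ top d - sg d t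
      low ⊕ = linear (top ⊕ ∷ top ⊖ ∷ []) (1 ⊗ con (+ 2) ⊑ v₀ ⊞ v₁ ∷ []) (con 1ℤ ⊑ v₀ ⊟ (⊝ v₁ ⊞ con 1ℤ)) (ℤₚ.≤-reflexive (sym w≡2) ∷ [])
      low ⊖ = linear (top ⊖ ∷ []) [] (con 1ℤ ⊑ v₀ ⊟ (⊝ (⊝ v₀ ⊞ con 1ℤ))) []
      near : ∀ d {a} → a ∈ A → -[1+ 0 ] ≤ sg d (ht a) - sg d t
      near ⊕ {a} a∈ = linear (top ⊖ ∷ ht a ∷ []) (1 ⊗ ⊝ v₀ ⊑ v₁ ∷ []) (con -[1+ 0 ] ⊑ v₁ ⊟ (⊝ v₀ ⊞ con 1ℤ)) (bot≤ a∈ ∷ [])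
      near ⊖ {a} a∈ = linear (top ⊕ ∷ top ⊖ ∷ ht a ∷ []) (1 ⊗ v₂ ⊑ v₀ ∷ 1 ⊗ v₀ ⊞ v₁ ⊑ con (+ 2) ∷ []) (con -[1+ 0 ] ⊑ ⊝ v₂ ⊟ (⊝ (⊝ v₁ ⊞ con 1ℤ)))
        (proj₂ (proj₂ (extreme ⊕)) a∈ ∷ ℤₚ.≤-reflexive w≡2 ∷ [])
      open At t low prs
      open PairBounds using (flat)

    -- Only one facet can be two steps away from `t`. At the other one the first parity is chosen so
    -- that an extreme point has the wrong parity and misses every maximum with loss 2. For the
    -- second parity the obstruction just found keeps two distant points of that facet from both
    -- having parity `π` + 1.
    wide≡3 : width ≡ + 3 → (∀ j → ¬ j ≡ k₀ → ∀ {a a′} → a ∈ A → a′ ∈ A → F j a - F j a′ ≤ + 6) → (∀ d → Pairs d) → Centre A r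
    wide≡3 w≡3 small prs = attempts π (λ { ⊕ → deep deep⊕ ; ⊖ → AtParity.loose-parity π ⊖ a∈ refl (-[1+ 0 ] , lem (parity a)) })
                                      (λ o r≡6 → λ { ⊕ → deep deep⊕ ; ⊖ → loose (again o r≡6) })
      where
      a = ext ⊖
      a∈ = proj₁ (proj₂ (extreme ⊖))
      π = parity a + 1ℤ
      t = bot + 1ℤ
      lem : ∀ p → p ≡ p + 1ℤ + 1ℤ + + 2 * -[1+ 0 ]
      lem = solve-∀
      deep⊕ : + 2 ≤ top ⊕ - sg ⊕ t
      deep⊕ = linear (top ⊕ ∷ top ⊖ ∷ []) (1 ⊗ con (+ 3) ⊑ v₀ ⊞ v₁ ∷ []) (con (+ 2) ⊑ v₀ ⊟ (⊝ v₁ ⊞ con 1ℤ)) (ℤₚ.≤-reflexive (sym w≡3) ∷ [])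
      low : ∀ d → 1ℤ ≤ top d - sg d t
      low ⊕ = ℤₚ.≤-trans (+≤+ (s≤s z≤n)) deep⊕
      low ⊖ = linear (top ⊖ ∷ []) [] (con 1ℤ ⊑ v₀ ⊟ (⊝ (⊝ v₀ ⊞ con 1ℤ))) []
      open At t low prs
      open PairBounds using (deep; loose)
      open AtParity (π + 1ℤ) using (B; H-parity)
      open Slice.Bound using (H; C)
      -- Two points of the facet of the other parity are at an even distance at least 5, but
      -- the obstruction confines them to a 1 × 1 × 3 box.
      far-apart : Obstruction A π → R ≡ + 6 → ∀ {k c c′} → c ∈ A → c′ ∈ A → sg ⊖ (ht c) ≡ top ⊖ → sg ⊖ (ht c′) ≡ top ⊖ →
                  R - 1ℤ ≤ f ⊕ k c - f ⊕ k c′ → parity c ≡₂ π + 1ℤ → parity c′ ≡₂ π + 1ℤ → ⊥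
      far-apart (same , o) r≡6 {k} {c} {c′} c∈ c′∈ lev lev′ sep pc pc′ = contra even
        where
        Within : Ix → ℤ → Set
        Within j β = F j c - F j c′ ≤ β × F j c′ - F j c ≤ β
        close : ∀ k β₁ β₂ β₃ → Within k₁ β₁ → Within k₂ β₂ → Within k₃ β₃ → β₁ + β₂ + β₃ ≤ + 10 → + 2 * (f ⊕ k c - f ⊕ k c′) ≤ + 10
        close k₀ β₁ β₂ β₃ b₁ b₂ b₃ le = linear (f ⊕ k₀ c ∷ f ⊕ k₁ c ∷ f ⊕ k₂ c ∷ f ⊕ k₃ c ∷ f ⊕ k₀ c′ ∷ f ⊕ k₁ c′ ∷ f ⊕ k₂ c′ ∷ f ⊕ k₃ c′ ∷ β₁ ∷ β₂ ∷ β₃ ∷ [])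
          (1 ⊗ (v₀ ⊞ v₁) ⊟ (v₄ ⊞ v₅) ⊑ v₈ ∷ 1 ⊗ (v₀ ⊞ v₂) ⊟ (v₄ ⊞ v₆) ⊑ v₉ ∷ 1 ⊗ (v₀ ⊞ v₃) ⊟ (v₄ ⊞ v₇) ⊑ v₁₀ ∷ 1 ⊗ con 0ℤ ⊑ v₀ ⊞ v₁ ⊞ v₂ ⊞ v₃ ∷ 1 ⊗ v₄ ⊞ v₅ ⊞ v₆ ⊞ v₇ ⊑ con 0ℤ ∷ 1 ⊗ v₈ ⊞ v₉ ⊞ v₁₀ ⊑ con (+ 10) ∷ []) (+ 2 ⊠ (v₀ ⊟ v₄) ⊑ con (+ 10))
          (proj₁ b₁ ∷ proj₁ b₂ ∷ proj₁ b₃ ∷ ℤₚ.≤-reflexive (sym (f-sum ⊕ c)) ∷ ℤₚ.≤-reflexive (f-sum ⊕ c′) ∷ le ∷ [])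
        close k₁ β₁ β₂ β₃ b₁ b₂ b₃ le = linear (f ⊕ k₀ c ∷ f ⊕ k₁ c ∷ f ⊕ k₂ c ∷ f ⊕ k₃ c ∷ f ⊕ k₀ c′ ∷ f ⊕ k₁ c′ ∷ f ⊕ k₂ c′ ∷ f ⊕ k₃ c′ ∷ β₁ ∷ β₂ ∷ β₃ ∷ [])
          (1 ⊗ (v₀ ⊞ v₁) ⊟ (v₄ ⊞ v₅) ⊑ v₈ ∷ 1 ⊗ (v₄ ⊞ v₆) ⊟ (v₀ ⊞ v₂) ⊑ v₉ ∷ 1 ⊗ (v₄ ⊞ v₇) ⊟ (v₀ ⊞ v₃) ⊑ v₁₀ ∷ 1 ⊗ v₀ ⊞ v₁ ⊞ v₂ ⊞ v₃ ⊑ con 0ℤ ∷ 1 ⊗ con 0ℤ ⊑ v₄ ⊞ v₅ ⊞ v₆ ⊞ v₇ ∷ 1 ⊗ v₈ ⊞ v₉ ⊞ v₁₀ ⊑ con (+ 10) ∷ []) (+ 2 ⊠ (v₁ ⊟ v₅) ⊑ con (+ 10))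
          (proj₁ b₁ ∷ proj₂ b₂ ∷ proj₂ b₃ ∷ ℤₚ.≤-reflexive (f-sum ⊕ c) ∷ ℤₚ.≤-reflexive (sym (f-sum ⊕ c′)) ∷ le ∷ [])
        close k₂ β₁ β₂ β₃ b₁ b₂ b₃ le = linear (f ⊕ k₀ c ∷ f ⊕ k₁ c ∷ f ⊕ k₂ c ∷ f ⊕ k₃ c ∷ f ⊕ k₀ c′ ∷ f ⊕ k₁ c′ ∷ f ⊕ k₂ c′ ∷ f ⊕ k₃ c′ ∷ β₁ ∷ β₂ ∷ β₃ ∷ [])
          (1 ⊗ (v₄ ⊞ v₅) ⊟ (v₀ ⊞ v₁) ⊑ v₈ ∷ 1 ⊗ (v₀ ⊞ v₂) ⊟ (v₄ ⊞ v₆) ⊑ v₉ ∷ 1 ⊗ (v₄ ⊞ v₇) ⊟ (v₀ ⊞ v₃) ⊑ v₁₀ ∷ 1 ⊗ v₀ ⊞ v₁ ⊞ v₂ ⊞ v₃ ⊑ con 0ℤ ∷ 1 ⊗ con 0ℤ ⊑ v₄ ⊞ v₅ ⊞ v₆ ⊞ v₇ ∷ 1 ⊗ v₈ ⊞ v₉ ⊞ v₁₀ ⊑ con (+ 10) ∷ []) (+ 2 ⊠ (v₂ ⊟ v₆) ⊑ con (+ 10))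
          (proj₂ b₁ ∷ proj₁ b₂ ∷ proj₂ b₃ ∷ ℤₚ.≤-reflexive (f-sum ⊕ c) ∷ ℤₚ.≤-reflexive (sym (f-sum ⊕ c′)) ∷ le ∷ [])
        close k₃ β₁ β₂ β₃ b₁ b₂ b₃ le = linear (f ⊕ k₀ c ∷ f ⊕ k₁ c ∷ f ⊕ k₂ c ∷ f ⊕ k₃ c ∷ f ⊕ k₀ c′ ∷ f ⊕ k₁ c′ ∷ f ⊕ k₂ c′ ∷ f ⊕ k₃ c′ ∷ β₁ ∷ β₂ ∷ β₃ ∷ [])
          (1 ⊗ (v₄ ⊞ v₅) ⊟ (v₀ ⊞ v₁) ⊑ v₈ ∷ 1 ⊗ (v₄ ⊞ v₆) ⊟ (v₀ ⊞ v₂) ⊑ v₉ ∷ 1 ⊗ (v₀ ⊞ v₃) ⊟ (v₄ ⊞ v₇) ⊑ v₁₀ ∷ 1 ⊗ v₀ ⊞ v₁ ⊞ v₂ ⊞ v₃ ⊑ con 0ℤ ∷ 1 ⊗ con 0ℤ ⊑ v₄ ⊞ v₅ ⊞ v₆ ⊞ v₇ ∷ 1 ⊗ v₈ ⊞ v₉ ⊞ v₁₀ ⊑ con (+ 10) ∷ []) (+ 2 ⊠ (v₃ ⊟ v₇) ⊑ con (+ 10))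
          (proj₂ b₁ ∷ proj₂ b₂ ∷ proj₁ b₃ ∷ ℤₚ.≤-reflexive (f-sum ⊕ c) ∷ ℤₚ.≤-reflexive (sym (f-sum ⊕ c′)) ∷ le ∷ [])
        wide : ∀ j → ¬ j ≡ k₀ → Within j (+ 6)
        wide j ≢0 = small j ≢0 c∈ c′∈ , small j ≢0 c′∈ c∈
        thin : ∀ j → ¬ j ≡ k₀ → ¬ j ≡ same → Within j (+ 2)
        thin j ≢0 ≢s = go (o j)
          where
          go : j ≡ k₀ ⊎ j ≡ same ⊎ (Narrow A π j × Wide A π j) → Within j (+ 2)
          go (inj₁ e) = ⊥-elim (≢0 e)
          go (inj₂ (inj₁ e)) = ⊥-elim (≢s e)
          go (inj₂ (inj₂ (nar , _))) = nar c∈ c′∈ pc pc′ , nar c′∈ c∈ pc′ pc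
        -- Twice the difference is a signed sum of the differences of the three `F`. Only the one of
        -- `same` may reach 6, the others at most 2.
        bounded : ∀ x → x ≡ same → + 2 * (f ⊕ k c - f ⊕ k c′) ≤ + 10
        bounded k₀ refl = close k (+ 2) (+ 2) (+ 2) (thin k₁ (λ ()) (λ ())) (thin k₂ (λ ()) (λ ())) (thin k₃ (λ ()) (λ ())) (+≤+ (ℕₚ.≤ᵇ⇒≤ 6 10 _))
        bounded k₁ refl = close k (+ 6) (+ 2) (+ 2) (wide k₁ λ ()) (thin k₂ (λ ()) (λ ())) (thin k₃ (λ ()) (λ ())) ℤₚ.≤-refl
        bounded k₂ refl = close k (+ 2) (+ 6) (+ 2) (thin k₁ (λ ()) (λ ())) (wide k₂ λ ()) (thin k₃ (λ ()) (λ ())) ℤₚ.≤-refl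
        bounded k₃ refl = close k (+ 2) (+ 2) (+ 6) (thin k₁ (λ ()) (λ ())) (thin k₂ (λ ()) (λ ())) (wide k₃ λ ()) ℤₚ.≤-refl
        even : f ⊕ k c - f ⊕ k c′ ≡₂ 0ℤ
        even = go (≡₂-trans {k = π + 1ℤ} (φ-parity ⊕ k ⊕ c) pc) (≡₂-trans {k = π + 1ℤ} (φ-parity ⊕ k ⊕ c′) pc′)
          where
          go : φ ⊕ k ⊕ c ≡₂ π + 1ℤ → φ ⊕ k ⊕ c′ ≡₂ π + 1ℤ → f ⊕ k c - f ⊕ k c′ ≡₂ 0ℤ
          go (q , e) (q′ , e′) = q - q′ , ℤₚ.≤-antisym
            (linear (f ⊕ k c ∷ f ⊕ k c′ ∷ ht c ∷ ht c′ ∷ π ∷ q ∷ q′ ∷ [])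
              (1 ⊗ v₀ ⊞ v₂ ⊑ v₄ ⊞ con 1ℤ ⊞ + 2 ⊠ v₅ ∷ 1 ⊗ v₄ ⊞ con 1ℤ ⊞ + 2 ⊠ v₆ ⊑ v₁ ⊞ v₃ ∷ 1 ⊗ v₃ ⊑ v₂ ∷ []) (v₀ ⊟ v₁ ⊑ con 0ℤ ⊞ + 2 ⊠ (v₅ ⊟ v₆))
              (ℤₚ.≤-reflexive e ∷ ℤₚ.≤-reflexive (sym e′) ∷ ℤₚ.≤-reflexive (sg-inj ⊖ (trans lev′ (sym lev))) ∷ []))
            (linear (f ⊕ k c ∷ f ⊕ k c′ ∷ ht c ∷ ht c′ ∷ π ∷ q ∷ q′ ∷ [])
              (1 ⊗ v₄ ⊞ con 1ℤ ⊞ + 2 ⊠ v₅ ⊑ v₀ ⊞ v₂ ∷ 1 ⊗ v₁ ⊞ v₃ ⊑ v₄ ⊞ con 1ℤ ⊞ + 2 ⊠ v₆ ∷ 1 ⊗ v₂ ⊑ v₃ ∷ []) (con 0ℤ ⊞ + 2 ⊠ (v₅ ⊟ v₆) ⊑ v₀ ⊟ v₁)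
              (ℤₚ.≤-reflexive (sym e) ∷ ℤₚ.≤-reflexive e′ ∷ ℤₚ.≤-reflexive (sg-inj ⊖ (trans lev (sym lev′))) ∷ []))
        contra : f ⊕ k c - f ⊕ k c′ ≡₂ 0ℤ → ⊥
        contra (q , e) = absurd (linear (δ ∷ q ∷ []) (2 ⊗ + 2 ⊠ v₁ ⊑ v₀ ∷ 4 ⊗ con 0ℤ ⊑ v₁ ⊟ con (+ 3) ∷ 1 ⊗ + 2 ⊠ v₀ ⊑ con (+ 10) ∷ []) (con (+ 12) ⊑ con (+ 10))
            (ℤₚ.≤-reflexive (sym (trans e (ℤₚ.+-identityˡ (+ 2 * q)))) ∷
             sum≤ (q - + 3) (linear (δ ∷ q ∷ R ∷ []) (1 ⊗ v₂ ⊟ con 1ℤ ⊑ v₀ ∷ 1 ⊗ con (+ 6) ⊑ v₂ ∷ 1 ⊗ v₀ ⊑ con 0ℤ ⊞ + 2 ⊠ v₁ ∷ []) (con -[1+ 0 ] ⊑ + 2 ⊠ (v₁ ⊟ con (+ 3)))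
               (sep ∷ ℤₚ.≤-reflexive (sym r≡6) ∷ ℤₚ.≤-reflexive e ∷ [])) ∷
             bounded same refl ∷ []))
          where
          δ = f ⊕ k c - f ⊕ k c′
          absurd : + 12 ≤ + 10 → ⊥
          absurd (+≤+ le) = ℕₚ.<⇒≱ (ℕₚ.≤ᵇ⇒≤ 11 12 _) le
      again : Obstruction A π → R ≡ + 6 → ∀ σ k → H (B σ k ⊖) ≡ C (B σ k ⊖) + + 2 → ∃ λ c → c ∈ A × sg ⊖ (ht c) ≡ top ⊖ × 1ℤ ≤ H (B σ k ⊖) - φ σ k ⊖ c
      again o r≡6 σ k e = go (prs ⊖ ⊕)
        where
        go : _ → ∃ λ c → c ∈ A × sg ⊖ (ht c) ≡ top ⊖ × 1ℤ ≤ H (B σ k ⊖) - φ σ k ⊖ c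
        go (k′ , c , c′ , c∈ , c′∈ , lev , lev′ , sep) = go′ (1ℤ ℤₚ.≤? H (B σ k ⊖) - φ σ k ⊖ c) (1ℤ ℤₚ.≤? H (B σ k ⊖) - φ σ k ⊖ c′)
          where
          go′ : Dec (1ℤ ≤ H (B σ k ⊖) - φ σ k ⊖ c) → Dec (1ℤ ≤ H (B σ k ⊖) - φ σ k ⊖ c′) → ∃ λ c → c ∈ A × sg ⊖ (ht c) ≡ top ⊖ × 1ℤ ≤ H (B σ k ⊖) - φ σ k ⊖ c
          go′ (yes p) _ = c , c∈ , lev , p
          go′ _ (yes p) = c′ , c′∈ , lev′ , p
          -- If both points attained the maximum, they would share its parity, contrary to
          -- `far-apart`.
          go′ (no ¬p) (no ¬p′) = ⊥-elim (far-apart o r≡6 {k′} c∈ c′∈ lev lev′ sep (H-parity σ k ⊖ e c∈ ¬p) (H-parity σ k ⊖ e c′∈ ¬p′))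

  -- Symmetries and embeddings; the result in dimension 4

  Small : ∀ {m} → List (Vec ℤ m) → ℕ → Set
  Small A r = ∀ {a b} → a ∈ A → b ∈ A → manhattan a b ℕ.≤ r

  isometry-centre : ∀ {m} (σ : Vec ℤ m → Vec ℤ m) → (∀ x → σ (σ x) ≡ x) → (∀ x y → manhattan (σ x) (σ y) ≡ manhattan x y) →
                    ∀ A {r} → Centre (map σ A) r → Centre A r
  isometry-centre σ inv iso A {r} (w , near , hull) = σ w , near′ , hull′
    where
    swap : ∀ x y → manhattan (σ x) y ≡ manhattan x (σ y)
    swap x y = trans (sym (iso (σ x) y)) (cong (λ v → manhattan v (σ y)) (inv x))
    near′ : ∀ {a} → a ∈ A → suc (manhattan (σ w) a) ℕ.≤ r
    near′ {a} a∈ = subst (λ d → suc d ℕ.≤ r) (sym (swap w a)) (near (∈-map⁺ σ a∈))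
    hull′ : ∀ p → ∃ λ a → a ∈ A × manhattan (σ w) p ℕ.≤ suc (manhattan a p)
    hull′ p with hull (σ p)
    ... | b , b∈ , le with ∈-map⁻ σ b∈
    ... | a , a∈ , refl = a , a∈ , subst₂ (λ u v → u ℕ.≤ suc v) (sym (swap w p)) (iso a p) le

  small-map : ∀ {m} (σ : Vec ℤ m → Vec ℤ m) → (∀ x y → manhattan (σ x) (σ y) ≡ manhattan x y) → ∀ A {r} → Small A r → Small (map σ A) r
  small-map σ iso A small a∈ b∈ with ∈-map⁻ σ a∈ | ∈-map⁻ σ b∈
  ... | a , a∈′ , refl | b , b∈′ , refl = subst (ℕ._≤ _) (sym (iso a b)) (small a∈′ b∈′)

  -- Forgetting the first coordinate of a centre only shortens its distances to points where that
  -- coordinate is 0.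
  embed-centre : ∀ {m} (A : List (Vec ℤ m)) {r} → Centre (map (0ℤ ∷_) A) r → Centre A r
  embed-centre A {r} (h ∷ w , near , hull) = w , near′ , hull′
    where
    near′ : ∀ {a} → a ∈ A → suc (manhattan w a) ℕ.≤ r
    near′ {a} a∈ = ℕₚ.≤-trans (s≤s (ℕₚ.m≤n+m (manhattan w a) ∣ h - 0ℤ ∣)) (near (∈-map⁺ (0ℤ ∷_) a∈))
    hull′ : ∀ p → ∃ λ a → a ∈ A × manhattan w p ℕ.≤ suc (manhattan a p)
    hull′ p with hull (0ℤ ∷ p)
    ... | b , b∈ , le with ∈-map⁻ (0ℤ ∷_) b∈
    ... | a , a∈ , refl = a , a∈ , ℕₚ.≤-trans (ℕₚ.m≤n+m (manhattan w p) ∣ h - 0ℤ ∣) le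

  small-embed : ∀ {m} (A : List (Vec ℤ m)) {r} → Small A r → Small (map (0ℤ ∷_) A) r
  small-embed A small a∈ b∈ with ∈-map⁻ (0ℤ ∷_) a∈ | ∈-map⁻ (0ℤ ∷_) b∈
  ... | a , a∈′ , refl | b , b∈′ , refl = small a∈′ b∈′

  -- These isometries let any coordinate play the role of the height.
  exchange : Ix → P → P
  exchange k₀ p = p
  exchange k₁ (h ∷ x ∷ y ∷ z ∷ []) = x ∷ h ∷ y ∷ z ∷ []
  exchange k₂ (h ∷ x ∷ y ∷ z ∷ []) = y ∷ x ∷ h ∷ z ∷ []
  exchange k₃ (h ∷ x ∷ y ∷ z ∷ []) = z ∷ x ∷ y ∷ h ∷ []

  exchange-inv : ∀ i p → exchange i (exchange i p) ≡ p
  exchange-inv k₀ p = refl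
  exchange-inv k₁ (h ∷ x ∷ y ∷ z ∷ []) = refl
  exchange-inv k₂ (h ∷ x ∷ y ∷ z ∷ []) = refl
  exchange-inv k₃ (h ∷ x ∷ y ∷ z ∷ []) = refl

  exchange-iso : ∀ i p q → manhattan (exchange i p) (exchange i q) ≡ manhattan p q
  exchange-iso k₀ p q = refl
  exchange-iso k₁ (h ∷ x ∷ y ∷ z ∷ []) (h′ ∷ x′ ∷ y′ ∷ z′ ∷ []) = lem (∣ h - h′ ∣) (∣ x - x′ ∣) (∣ y - y′ ∣) (∣ z - z′ ∣)
    where
    lem : ∀ a b c d → b ℕ.+ (a ℕ.+ (c ℕ.+ (d ℕ.+ 0))) ≡ a ℕ.+ (b ℕ.+ (c ℕ.+ (d ℕ.+ 0)))
    lem = ℕsolve-∀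
  exchange-iso k₂ (h ∷ x ∷ y ∷ z ∷ []) (h′ ∷ x′ ∷ y′ ∷ z′ ∷ []) = lem (∣ h - h′ ∣) (∣ x - x′ ∣) (∣ y - y′ ∣) (∣ z - z′ ∣)
    where
    lem : ∀ a b c d → c ℕ.+ (b ℕ.+ (a ℕ.+ (d ℕ.+ 0))) ≡ a ℕ.+ (b ℕ.+ (c ℕ.+ (d ℕ.+ 0)))
    lem = ℕsolve-∀
  exchange-iso k₃ (h ∷ x ∷ y ∷ z ∷ []) (h′ ∷ x′ ∷ y′ ∷ z′ ∷ []) = lem (∣ h - h′ ∣) (∣ x - x′ ∣) (∣ y - y′ ∣) (∣ z - z′ ∣)
    where
    lem : ∀ a b c d → d ℕ.+ (b ℕ.+ (c ℕ.+ (a ℕ.+ 0))) ≡ a ℕ.+ (b ℕ.+ (c ℕ.+ (d ℕ.+ 0)))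
    lem = ℕsolve-∀

  coord : Ix → P → ℤ
  coord i p = ht (exchange i p)

  -- A coordinate of width at least 4 serves as height; if there is none, one of width 3 or 2. If
  -- all widths are at most 1, `A` has diameter at most 4 < `r` and `a₀` itself is a centre.
  centre-4 : ∀ A {r} {a₀ : P} → a₀ ∈ A → Small A r → 5 ℕ.≤ r → Centre A r
  centre-4 A {r} {a₀} a₀∈ small 5≤r = go (≥? (+ 4))
    where
    module X (i : Ix) = Four (map (exchange i) A) r (∈-map⁺ (exchange i) a₀∈) (small-map (exchange i) (exchange-iso i) A small) 5≤r

    spread : ∀ i {a b} → a ∈ A → b ∈ A → coord i a - coord i b ≤ X.width i
    spread i {a} {b} a∈ b∈ = linear (coord i a ∷ coord i b ∷ X.top i ⊕ ∷ X.top i ⊖ ∷ []) (1 ⊗ v₀ ⊑ v₂ ∷ 1 ⊗ ⊝ v₁ ⊑ v₃ ∷ []) (v₀ ⊟ v₁ ⊑ v₂ ⊞ v₃)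
      (proj₂ (proj₂ (X.extreme i ⊕)) (∈-map⁺ (exchange i) a∈) ∷ proj₂ (proj₂ (X.extreme i ⊖)) (∈-map⁺ (exchange i) b∈) ∷ [])

    ≥? : ∀ n → (∃ λ i → n ≤ X.width i) ⊎ (∀ i → ¬ n ≤ X.width i)
    ≥? n with n ℤₚ.≤? X.width k₀ | n ℤₚ.≤? X.width k₁ | n ℤₚ.≤? X.width k₂ | n ℤₚ.≤? X.width k₃
    ... | yes p | _ | _ | _ = inj₁ (k₀ , p)
    ... | _ | yes p | _ | _ = inj₁ (k₁ , p)
    ... | _ | _ | yes p | _ = inj₁ (k₂ , p)
    ... | _ | _ | _ | yes p = inj₁ (k₃ , p)
    ... | no p | no q | no s | no t = inj₂ λ { k₀ → p ; k₁ → q ; k₂ → s ; k₃ → t }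

    facets : ∀ i → ((∀ d → X.Pairs i d) → Centre (map (exchange i) A) r) → Centre A r
    facets i k = isometry-centre (exchange i) (exchange-inv i) (exchange-iso i) A (go (X.facet? i ⊕) (X.facet? i ⊖))
      where
      go : Centre (map (exchange i) A) r ⊎ X.Pairs i ⊕ → Centre (map (exchange i) A) r ⊎ X.Pairs i ⊖ → Centre (map (exchange i) A) r
      go (inj₁ c) _ = c
      go _ (inj₁ c) = c
      go (inj₂ p) (inj₂ q) = k λ { ⊕ → p ; ⊖ → q }

    flat : (∀ i → ¬ + 2 ≤ X.width i) → Centre A r
    flat ¬2 = a₀ , (λ {a} a∈ → ℕₚ.≤-trans (s≤s (small₁ a₀ a a₀∈ a∈)) 5≤r) , λ p → a₀ , a₀∈ , ℕₚ.n≤1+n _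
      where
      abs≤1 : ∀ i → i ≤ 1ℤ → - i ≤ 1ℤ → ∣ i ∣ ℕ.≤ 1
      abs≤1 (+ n)    (+≤+ le) _        = le
      abs≤1 -[1+ n ] _        (+≤+ le) = le
      narrow : ∀ i {a b} → a ∈ A → b ∈ A → coord i a - coord i b ≤ 1ℤ
      narrow i {a} {b} a∈ b∈ = linear (coord i a ∷ coord i b ∷ X.width i ∷ []) (1 ⊗ v₀ ⊟ v₁ ⊑ v₂ ∷ 1 ⊗ con 1ℤ ⊞ v₂ ⊑ con (+ 2) ∷ []) (v₀ ⊟ v₁ ⊑ con 1ℤ)
        (spread i a∈ b∈ ∷ ℤₚ.i<j⇒suc[i]≤j (ℤₚ.≰⇒> (¬2 i)) ∷ [])
      close : ∀ i {a b} → a ∈ A → b ∈ A → ∣ coord i a - coord i b ∣ ℕ.≤ 1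
      close i {a} {b} a∈ b∈ = abs≤1 _ (narrow i a∈ b∈) (subst (_≤ 1ℤ) (lem (coord i b) (coord i a)) (narrow i b∈ a∈))
        where
        lem : ∀ u v → u - v ≡ - (v - u)
        lem = solve-∀
      small₁ : ∀ a b → a ∈ A → b ∈ A → manhattan a b ℕ.≤ 4
      small₁ a@(h ∷ x ∷ y ∷ z ∷ []) b@(h′ ∷ x′ ∷ y′ ∷ z′ ∷ []) a∈ b∈ =
        ℕₚ.+-mono-≤ (close k₀ a∈ b∈) (ℕₚ.+-mono-≤ (close k₁ a∈ b∈) (ℕₚ.+-mono-≤ (close k₂ a∈ b∈) (ℕₚ.+-mono-≤ (close k₃ a∈ b∈) z≤n)))

    boxed : (∀ i → ¬ + 4 ≤ X.width i) → ∀ i j → ¬ j ≡ k₀ → ∀ {a a′} → a ∈ map (exchange i) A → a′ ∈ map (exchange i) A → F j a - F j a′ ≤ + 6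
    boxed ¬4 i j ≢0 a∈ a′∈ with ∈-map⁻ (exchange i) a∈ | ∈-map⁻ (exchange i) a′∈
    ... | b , b∈ , refl | b′ , b′∈ , refl = subst (_≤ + 6) (sym (F-coord j ≢0 (exchange i b) (exchange i b′)))
          (linear (coord j (exchange i b) ∷ coord j (exchange i b′) ∷ []) (2 ⊗ v₀ ⊟ v₁ ⊑ con (+ 3) ∷ []) ((v₀ ⊟ v₁) ⊞ (v₀ ⊟ v₁) ⊑ con (+ 6)) (le i j b b′ b∈ b′∈ ∷ []))
      where
      F-coord : ∀ j → ¬ j ≡ k₀ → ∀ a a′ → F j a - F j a′ ≡ (coord j a - coord j a′) + (coord j a - coord j a′)
      F-coord k₀ ≢0 = ⊥-elim (≢0 refl)
      F-coord k₁ _ (h ∷ x ∷ y ∷ z ∷ []) (h′ ∷ x′ ∷ y′ ∷ z′ ∷ []) = lem x y z x′ y′ z′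
        where
        lem : ∀ x y z x′ y′ z′ → (x + y + z + (x + - y + - z)) - (x′ + y′ + z′ + (x′ + - y′ + - z′)) ≡ (x - x′) + (x - x′)
        lem = solve-∀
      F-coord k₂ _ (h ∷ x ∷ y ∷ z ∷ []) (h′ ∷ x′ ∷ y′ ∷ z′ ∷ []) = lem x y z x′ y′ z′
        where
        lem : ∀ x y z x′ y′ z′ → (x + y + z + (- x + y + - z)) - (x′ + y′ + z′ + (- x′ + y′ + - z′)) ≡ (y - y′) + (y - y′)
        lem = solve-∀
      F-coord k₃ _ (h ∷ x ∷ y ∷ z ∷ []) (h′ ∷ x′ ∷ y′ ∷ z′ ∷ []) = lem x y z x′ y′ z′
        where
        lem : ∀ x y z x′ y′ z′ → (x + y + z + (- x + - y + z)) - (x′ + y′ + z′ + (- x′ + - y′ + z′)) ≡ (z - z′) + (z - z′)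
        lem = solve-∀
      three : ∀ i {a b} → a ∈ A → b ∈ A → coord i a - coord i b ≤ + 3
      three i {a} {b} a∈ b∈ = linear (coord i a ∷ coord i b ∷ X.width i ∷ []) (1 ⊗ v₀ ⊟ v₁ ⊑ v₂ ∷ 1 ⊗ con 1ℤ ⊞ v₂ ⊑ con (+ 4) ∷ []) (v₀ ⊟ v₁ ⊑ con (+ 3))
        (spread i a∈ b∈ ∷ ℤₚ.i<j⇒suc[i]≤j (ℤₚ.≰⇒> (¬4 i)) ∷ [])
      permuted : ∀ i j → ∃ λ l → ∀ p → coord j (exchange i p) ≡ coord l p
      permuted k₀ j  = j , λ p → refl
      permuted k₁ k₀ = k₁ , λ { (h ∷ x ∷ y ∷ z ∷ []) → refl }
      permuted k₁ k₁ = k₀ , λ { (h ∷ x ∷ y ∷ z ∷ []) → refl }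
      permuted k₁ k₂ = k₂ , λ { (h ∷ x ∷ y ∷ z ∷ []) → refl }
      permuted k₁ k₃ = k₃ , λ { (h ∷ x ∷ y ∷ z ∷ []) → refl }
      permuted k₂ k₀ = k₂ , λ { (h ∷ x ∷ y ∷ z ∷ []) → refl }
      permuted k₂ k₁ = k₁ , λ { (h ∷ x ∷ y ∷ z ∷ []) → refl }
      permuted k₂ k₂ = k₀ , λ { (h ∷ x ∷ y ∷ z ∷ []) → refl }
      permuted k₂ k₃ = k₃ , λ { (h ∷ x ∷ y ∷ z ∷ []) → refl }
      permuted k₃ k₀ = k₃ , λ { (h ∷ x ∷ y ∷ z ∷ []) → refl }
      permuted k₃ k₁ = k₁ , λ { (h ∷ x ∷ y ∷ z ∷ []) → refl }
      permuted k₃ k₂ = k₂ , λ { (h ∷ x ∷ y ∷ z ∷ []) → refl }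
      permuted k₃ k₃ = k₀ , λ { (h ∷ x ∷ y ∷ z ∷ []) → refl }
      le : ∀ i j b b′ → b ∈ A → b′ ∈ A → coord j (exchange i b) - coord j (exchange i b′) ≤ + 3
      le i j b b′ b∈ b′∈ = let (l , e) = permuted i j in subst₂ (λ u v → u - v ≤ + 3) (sym (e b)) (sym (e b′)) (three l b∈ b′∈)

    go : (∃ λ i → + 4 ≤ X.width i) ⊎ (∀ i → ¬ + 4 ≤ X.width i) → Centre A r
    go (inj₁ (i , 4≤)) = facets i (X.wide≥4 i 4≤)
    go (inj₂ ¬4) = go′ (≥? (+ 2))
      where
      go′ : (∃ λ i → + 2 ≤ X.width i) ⊎ (∀ i → ¬ + 2 ≤ X.width i) → Centre A r
      go′ (inj₂ ¬2) = flat ¬2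
      go′ (inj₁ (i , 2≤)) = go″ (+ 3 ℤₚ.≤? X.width i)
        where
        go″ : Dec (+ 3 ≤ X.width i) → Centre A r
        go″ (yes 3≤) = facets i (X.wide≡3 i (ℤₚ.≤-antisym (linear (X.width i ∷ []) (1 ⊗ con 1ℤ ⊞ v₀ ⊑ con (+ 4) ∷ []) (v₀ ⊑ con (+ 3)) (ℤₚ.i<j⇒suc[i]≤j (ℤₚ.≰⇒> (¬4 i)) ∷ [])) 3≤) (boxed ¬4 i))
        go″ (no ¬3) = facets i (X.wide≡2 i (ℤₚ.≤-antisym (linear (X.width i ∷ []) (1 ⊗ con 1ℤ ⊞ v₀ ⊑ con (+ 3) ∷ []) (v₀ ⊑ con (+ 2)) (ℤₚ.i<j⇒suc[i]≤j (ℤₚ.≰⇒> ¬3) ∷ [])) 2≤))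

  -- Centres in dimensions at most 3 for small radii

  sg-0 : ∀ s → sg s 0ℤ ≡ 0ℤ
  sg-0 ⊕ = refl
  sg-0 ⊖ = refl

  -- Points of height 0: the functionals with both slopes agree on A.
  module Flat (A : List P) (r : ℕ) {a₀ : P} (a₀∈ : a₀ ∈ A) (small : Small A r) (3≤r : 3 ℕ.≤ r) (ht≡0 : ∀ {a} → a ∈ A → ht a ≡ 0ℤ) (π : ℤ) where
    R : ℤ
    R = + r
    open Slice A R π 0ℤ
    open Bound

    B : ∀ σ k s → Bound (φ σ k s)
    B σ k s = bound (φ σ k s) a₀∈ λ {a} {b} a∈ b∈ → ℤₚ.≤-trans (φ-lipschitz σ k s a b) (+≤+ (small a∈ b∈))

    open Solve B
    open PairBounds A R π 0ℤ B a₀∈ using (opposite)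

    φ-flat : ∀ σ k s {a} → a ∈ A → φ σ k s a ≡ f σ k a
    φ-flat σ k s {a} a∈ = trans (cong (λ v → f σ k a + v) (trans (cong (sg s) (ht≡0 a∈)) (sg-0 s))) (ℤₚ.+-identityʳ (f σ k a))

    D-flat : ∀ σ k s → D σ k s ≡ C (B σ k s)
    D-flat σ k s = trans (cong (λ v → C (B σ k s) - v) (sg-0 s)) (ℤₚ.+-identityʳ (C (B σ k s)))

    opposite-flat : ∀ σ k s σ′ k′ s′ → (∀ {a} → a ∈ A → f σ k a + f σ′ k′ a ≡ 0ℤ) → -[1+ 0 ] ≤ D σ k s + D σ′ k′ s′
    opposite-flat σ k s σ′ k′ s′ eq = subst₂ (λ u v → -[1+ 0 ] ≤ u + v) (sym (D-flat σ k s)) (sym (D-flat σ′ k′ s′))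
      (opposite (B σ k s) (B σ′ k′ s′) (λ a∈ → trans (cong₂ _+_ (φ-flat σ k s a∈) (φ-flat σ′ k′ s′ a∈)) (eq a∈)) (+≤+ 3≤r))

    alpha : ∀ σ k s s′ → -[1+ 0 ] ≤ D σ k s + D (opp σ) k s′
    alpha σ k s s′ = opposite-flat σ k s (opp σ) k s′ λ {a} _ → trans (cong (λ v → f σ k a + v) (f-opp σ k a)) (ℤₚ.+-inverseʳ (f σ k a))

    conclude : (∀ σ s → -[1+ 0 ] ≤ sumIx (λ k → D σ k (s k))) → Centre A r
    conclude beta = Conclude.centre A r π 0ℤ B (solve record { α = alpha ; β = beta })

  -- On a plane the four functionals of a class form two opposite pairs, so `β` reduces to pair
  -- bounds. Two bounds of -1 would give only -2; but parity 0 makes the sums even, which improves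
  -- each bound to 0.
  centre-2-3 : ∀ A {a₀ : Vec ℤ 2} → a₀ ∈ A → Small A 3 → Centre A 3
  centre-2-3 A a₀∈ small = embed-centre A (embed-centre (map (0ℤ ∷_) A) (conclude beta))
    where
    A₂ = map (0ℤ ∷_) (map (0ℤ ∷_) A)
    planar : ∀ {a} → a ∈ A₂ → ∃₂ λ y z → a ≡ 0ℤ ∷ 0ℤ ∷ y ∷ z ∷ []
    planar a∈ with ∈-map⁻ (0ℤ ∷_) a∈
    ... | _ , b∈ , refl with ∈-map⁻ (0ℤ ∷_) b∈
    ... | y ∷ z ∷ [] , _ , refl = y , z , refl
    open Flat A₂ 3 (∈-map⁺ (0ℤ ∷_) (∈-map⁺ (0ℤ ∷_) a₀∈)) (small-embed (map (0ℤ ∷_) A) (small-embed A small)) ℕₚ.≤-refl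
      (λ a∈ → cong ht (proj₂ (proj₂ (planar a∈)))) 0ℤ
    open Slice A₂ (+ 3) 0ℤ 0ℤ
    open Solve B
    open Slice.Bound using (C; half)
    opp01 : ∀ σ {a} → a ∈ A₂ → f σ k₀ a + f σ k₁ a ≡ 0ℤ
    opp01 σ a∈ with planar a∈
    opp01 ⊕ a∈ | y , z , refl = lem y z
      where
      lem : ∀ y z → (0ℤ + y + z) + (0ℤ + - y + - z) ≡ 0ℤ
      lem = solve-∀
    opp01 ⊖ a∈ | y , z , refl = lem y z
      where
      lem : ∀ y z → (0ℤ + - y + - z) + (0ℤ + y + z) ≡ 0ℤ
      lem = solve-∀
    opp23 : ∀ σ {a} → a ∈ A₂ → f σ k₂ a + f σ k₃ a ≡ 0ℤ
    opp23 σ a∈ with planar a∈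
    opp23 ⊕ a∈ | y , z , refl = lem y z
      where
      lem : ∀ y z → (0ℤ + y + - z) + (0ℤ + - y + z) ≡ 0ℤ
      lem = solve-∀
    opp23 ⊖ a∈ | y , z , refl = lem y z
      where
      lem : ∀ y z → (0ℤ + - y + z) + (0ℤ + y + - z) ≡ 0ℤ
      lem = solve-∀
    even : ∀ σ k s k′ s′ → (∀ {a} → a ∈ A₂ → f σ k a + f σ k′ a ≡ 0ℤ) → 0ℤ ≤ D σ k s + D σ k′ s′
    even σ k s k′ s′ eq = linear (D σ k s ∷ D σ k′ s′ ∷ half (B σ k s) ∷ half (B σ k′ s′) ∷ [])
      (1 ⊗ con 0ℤ ⊞ + 2 ⊠ v₂ ⊑ v₀ ∷ 1 ⊗ con 0ℤ ⊞ + 2 ⊠ v₃ ⊑ v₁ ∷ 2 ⊗ con 0ℤ ⊑ v₂ ⊞ v₃ ∷ []) (con 0ℤ ⊑ v₀ ⊞ v₁)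
      (ℤₚ.≤-reflexive (sym (D-flat σ k s)) ∷ ℤₚ.≤-reflexive (sym (D-flat σ k′ s′)) ∷
       sum≤ (half (B σ k s) + half (B σ k′ s′)) (linear (D σ k s ∷ D σ k′ s′ ∷ half (B σ k s) ∷ half (B σ k′ s′) ∷ [])
         (1 ⊗ con -[1+ 0 ] ⊑ v₀ ⊞ v₁ ∷ 1 ⊗ v₀ ⊑ con 0ℤ ⊞ + 2 ⊠ v₂ ∷ 1 ⊗ v₁ ⊑ con 0ℤ ⊞ + 2 ⊠ v₃ ∷ []) (con -[1+ 0 ] ⊑ + 2 ⊠ (v₂ ⊞ v₃))
         (opposite-flat σ k s σ k′ s′ eq ∷ ℤₚ.≤-reflexive (D-flat σ k s) ∷ ℤₚ.≤-reflexive (D-flat σ k′ s′) ∷ [])) ∷ [])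
    beta : ∀ σ s → -[1+ 0 ] ≤ sumIx (λ k → D σ k (s k))
    beta σ s = linear (D σ k₀ (s k₀) ∷ D σ k₁ (s k₁) ∷ D σ k₂ (s k₂) ∷ D σ k₃ (s k₃) ∷ [])
      (1 ⊗ con 0ℤ ⊑ v₀ ⊞ v₁ ∷ 1 ⊗ con 0ℤ ⊑ v₂ ⊞ v₃ ∷ []) (con -[1+ 0 ] ⊑ v₀ ⊞ v₁ ⊞ v₂ ⊞ v₃)
      (even σ k₀ (s k₀) k₁ (s k₁) (opp01 σ) ∷ even σ k₂ (s k₂) k₃ (s k₃) (opp23 σ) ∷ [])

  -- The largest point is a centre unless some point lies 2 below it, and then the point between
  -- them is.
  centre-1-2 : ∀ A {a₀ : Vec ℤ 1} → a₀ ∈ A → Small A 2 → Centre A 2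
  centre-1-2 A a₀∈ small with argmax head A a₀∈
  ... | (x ∷ []) , a∈ , mx with find {Q = λ b → + 2 ≤ x - head b} (λ b → + 2 ℤₚ.≤? x - head b) A
  ...   | inj₂ none = (x ∷ []) , (λ { {y ∷ []} b∈ → s≤s (bound1 y b∈) }) , λ p → (x ∷ []) , a∈ , ℕₚ.n≤1+n _
        where
        bound1 : ∀ y → (y ∷ []) ∈ A → ∣ x - y ∣ ℕ.+ 0 ℕ.≤ 1
        bound1 y b∈ = subst (ℕ._≤ 1) (sym (ℕₚ.+-identityʳ _)) (ℤₚ.drop‿+≤+ (subst (_≤ 1ℤ) (sym (ℤₚ.0≤i⇒+∣i∣≡i (ℤₚ.i≤j⇒0≤j-i (mx b∈))))
          (linear (x ∷ y ∷ []) (1 ⊗ con 1ℤ ⊞ (v₀ ⊟ v₁) ⊑ con (+ 2) ∷ []) (v₀ ⊟ v₁ ⊑ con 1ℤ) (ℤₚ.i<j⇒suc[i]≤j (ℤₚ.≰⇒> (none b∈)) ∷ []))))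
  ...   | inj₁ (_ , _ , _) = (x - 1ℤ ∷ []) , (λ { {y ∷ []} b∈ → s≤s (bound1 y b∈) }) , λ { (p ∷ []) → (x ∷ []) , a∈ , tri p }
        where
        abs≤1 : ∀ i → i ≤ 1ℤ → - i ≤ 1ℤ → ∣ i ∣ ℕ.≤ 1
        abs≤1 (+ n)    (+≤+ le) _        = le
        abs≤1 -[1+ n ] _        (+≤+ le) = le
        bound1 : ∀ y → (y ∷ []) ∈ A → ∣ x - 1ℤ - y ∣ ℕ.+ 0 ℕ.≤ 1
        bound1 y b∈ = subst (ℕ._≤ 1) (sym (ℕₚ.+-identityʳ _)) (abs≤1 (x - 1ℤ - y)
          (linear (x ∷ y ∷ []) (1 ⊗ v₀ ⊟ v₁ ⊑ con (+ 2) ∷ []) (v₀ ⊟ con 1ℤ ⊟ v₁ ⊑ con 1ℤ) (ℤₚ.≤-trans (abs≥ (x - y)) (+≤+ (subst (ℕ._≤ 2) (ℕₚ.+-identityʳ _) (small a∈ b∈))) ∷ []))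
          (linear (x ∷ y ∷ []) (1 ⊗ v₁ ⊑ v₀ ∷ []) (⊝ (v₀ ⊟ con 1ℤ ⊟ v₁) ⊑ con 1ℤ) (mx b∈ ∷ [])))
        tri : ∀ p → ∣ x - 1ℤ - p ∣ ℕ.+ 0 ℕ.≤ suc (∣ x - p ∣ ℕ.+ 0)
        tri p = subst₂ (λ u v → u ℕ.≤ suc v) (sym (ℕₚ.+-identityʳ _)) (sym (ℕₚ.+-identityʳ _))
          (ℕₚ.≤-trans (subst (λ v → ∣ v ∣ ℕ.≤ ∣ -[1+ 0 ] ∣ ℕ.+ ∣ x - p ∣) (lem x p) (ℤₚ.∣i+j∣≤∣i∣+∣j∣ -[1+ 0 ] (x - p))) ℕₚ.≤-refl)
          where
          lem : ∀ x p → -[1+ 0 ] + (x - p) ≡ x - 1ℤ - p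
          lem = solve-∀

  Partition₄ : Ix → Ix → Ix → Ix → Set
  Partition₄ i j l m = ∀ (g : Ix → ℤ) → sumIx g ≡ g i + g j + g l + g m

  p₀₁ : Partition₄ k₀ k₁ k₂ k₃
  p₀₁ g = lem (g k₀) (g k₁) (g k₂) (g k₃)
    where
    lem : ∀ a b c d → a + b + c + d ≡ a + b + c + d
    lem = solve-∀

  p₂₃ : Partition₄ k₂ k₃ k₀ k₁
  p₂₃ g = lem (g k₀) (g k₁) (g k₂) (g k₃)
    where
    lem : ∀ a b c d → a + b + c + d ≡ c + d + a + b
    lem = solve-∀

  p₀₂ : Partition₄ k₀ k₂ k₁ k₃
  p₀₂ g = lem (g k₀) (g k₁) (g k₂) (g k₃)
    where
    lem : ∀ a b c d → a + b + c + d ≡ a + c + b + d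
    lem = solve-∀

  p₀₃ : Partition₄ k₀ k₃ k₁ k₂
  p₀₃ g = lem (g k₀) (g k₁) (g k₂) (g k₃)
    where
    lem : ∀ a b c d → a + b + c + d ≡ a + d + b + c
    lem = solve-∀

  p₁₂ : Partition₄ k₁ k₂ k₀ k₃
  p₁₂ g = lem (g k₀) (g k₁) (g k₂) (g k₃)
    where
    lem : ∀ a b c d → a + b + c + d ≡ b + c + a + d
    lem = solve-∀

  p₁₃ : Partition₄ k₁ k₃ k₀ k₂
  p₁₃ g = lem (g k₀) (g k₁) (g k₂) (g k₃)
    where
    lem : ∀ a b c d → a + b + c + d ≡ b + d + a + c
    lem = solve-∀

  centre-3-4 : ∀ A {a₀ : Vec ℤ 3} → a₀ ∈ A → Small A 4 → Centre A 4
  centre-3-4 A {a₀} a₀∈ small = embed-centre A choice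
    where
    A₁ = map (0ℤ ∷_) A
    a₁∈ = ∈-map⁺ (0ℤ ∷_) a₀∈
    flat : ∀ {a} → a ∈ A₁ → ht a ≡ 0ℤ
    flat a∈ with ∈-map⁻ (0ℤ ∷_) a∈
    ... | _ , _ , refl = refl
    small₁ : Small A₁ 4
    small₁ = small-embed A small
    f-diam : ∀ σ k {a b} → a ∈ A₁ → b ∈ A₁ → f σ k a - f σ k b ≤ + 4
    f-diam σ k {a} {b} a∈ b∈ = linear (f σ k a ∷ f σ k b ∷ ht a ∷ ht b ∷ dist a b ∷ [])
      (1 ⊗ (v₀ ⊞ v₂) ⊟ (v₁ ⊞ v₃) ⊑ v₄ ∷ 1 ⊗ v₃ ⊑ v₂ ∷ 1 ⊗ v₄ ⊑ con (+ 4) ∷ []) (v₀ ⊟ v₁ ⊑ con (+ 4))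
      (φ-lipschitz σ k ⊕ a b ∷ ℤₚ.≤-reflexive (trans (flat b∈) (sym (flat a∈))) ∷ +≤+ (small₁ a∈ b∈) ∷ [])

    Tight : Ix → ℤ → Set
    Tight k i = ∃₂ λ a b → a ∈ A₁ × b ∈ A₁ × f ⊕ k a - f ⊕ k b ≡ + 4 × f ⊕ k a ≡₂ i

    -- A pair at the full range 4 attains the maximum of `f ⊕ k` on `A₁`, which has only one parity.
    exclusive : ∀ k → Tight k 0ℤ → ¬ Tight k 1ℤ
    exclusive k (a , b , a∈ , b∈ , e , q , eq) (a′ , b′ , a′∈ , b′∈ , e′ , q′ , eq′) = absurd (parity-clash q q′ (trans (sym eq) (trans same eq′)))
      where
      same : f ⊕ k a ≡ f ⊕ k a′
      same = ℤₚ.≤-antisym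
        (linear (f ⊕ k a ∷ f ⊕ k a′ ∷ f ⊕ k b′ ∷ []) (1 ⊗ v₀ ⊟ v₂ ⊑ con (+ 4) ∷ 1 ⊗ con (+ 4) ⊑ v₁ ⊟ v₂ ∷ []) (v₀ ⊑ v₁) (f-diam ⊕ k a∈ b′∈ ∷ ℤₚ.≤-reflexive (sym e′) ∷ []))
        (linear (f ⊕ k a ∷ f ⊕ k a′ ∷ f ⊕ k b ∷ []) (1 ⊗ v₁ ⊟ v₂ ⊑ con (+ 4) ∷ 1 ⊗ con (+ 4) ⊑ v₀ ⊟ v₂ ∷ []) (v₁ ⊑ v₀) (f-diam ⊕ k a′∈ b∈ ∷ ℤₚ.≤-reflexive (sym e) ∷ []))
      parity-clash : ∀ q q′ → 0ℤ + + 2 * q ≡ 1ℤ + + 2 * q′ → 1ℤ ≤ 0ℤ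
      parity-clash q q′ e = linear (q ∷ q′ ∷ []) (1 ⊗ con 0ℤ ⊞ + 2 ⊠ v₀ ⊑ con 1ℤ ⊞ + 2 ⊠ v₁ ∷ 2 ⊗ con 0ℤ ⊑ v₀ ⊟ v₁ ⊟ con 1ℤ ∷ []) (con 1ℤ ⊑ con 0ℤ)
        (ℤₚ.≤-reflexive e ∷ sum≤ (q - q′ - 1ℤ) (linear (q ∷ q′ ∷ []) (1 ⊗ con 1ℤ ⊞ + 2 ⊠ v₁ ⊑ con 0ℤ ⊞ + 2 ⊠ v₀ ∷ []) (con -[1+ 0 ] ⊑ + 2 ⊠ (v₀ ⊟ v₁ ⊟ con 1ℤ)) (ℤₚ.≤-reflexive (sym e) ∷ [])) ∷ [])
      absurd : 1ℤ ≤ 0ℤ → ⊥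
      absurd (+≤+ ())

    module Par (π : ℤ) where
      open Flat A₁ 4 a₁∈ small₁ (ℕₚ.n≤1+n 3) flat π public
      open Slice A₁ (+ 4) π 0ℤ
      open Bound
      open Solve B
      open PairBounds A₁ (+ 4) π 0ℤ B a₁∈ using (IsTwo; two-or-≤C+1; tight-or-low; ≤C+2)

      two⇒tight : ∀ σ k s → IsTwo (B σ k s) → Tight k π
      two⇒tight ⊕ k s (e , p , p∈ , ep) = top b , p , top∈ b , p∈ ,
          ℤₚ.≤-antisym (f-diam ⊕ k (top∈ b) p∈)
            (linear (f ⊕ k (top b) ∷ f ⊕ k p ∷ H b ∷ []) (1 ⊗ v₂ ⊑ v₀ ∷ 1 ⊗ v₁ ⊑ v₂ ⊟ con (+ 4) ∷ []) (con (+ 4) ⊑ v₀ ⊟ v₁)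
              (ℤₚ.≤-reflexive (trans (sym (g-top b)) (φ-flat ⊕ k s (top∈ b))) ∷ ℤₚ.≤-reflexive (trans (sym (φ-flat ⊕ k s p∈)) ep) ∷ [])) ,
          half b + 1ℤ , trans (sym (φ-flat ⊕ k s (top∈ b))) (trans (g-top b) (trans e (lem π (half b))))
        where
        b = B ⊕ k s
        lem : ∀ π h → π + + 2 * h + + 2 ≡ π + + 2 * (h + 1ℤ)
        lem = solve-∀
      -- The maximum of the opposite functional is the minimum here. Since the range 4 is even, both
      -- ends have the same parity.
      two⇒tight ⊖ k s (e , p , p∈ , ep) = p , top b , p∈ , top∈ b ,
          ℤₚ.≤-antisym (f-diam ⊕ k p∈ (top∈ b))
            (linear (f ⊖ k (top b) ∷ f ⊖ k p ∷ H b ∷ f ⊕ k (top b) ∷ f ⊕ k p ∷ []) (1 ⊗ v₂ ⊑ v₀ ∷ 1 ⊗ v₁ ⊑ v₂ ⊟ con (+ 4) ∷ 1 ⊗ v₀ ⊑ ⊝ v₃ ∷ 1 ⊗ ⊝ v₄ ⊑ v₁ ∷ []) (con (+ 4) ⊑ v₄ ⊟ v₃)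
              (ℤₚ.≤-reflexive (trans (sym (g-top b)) (φ-flat ⊖ k s (top∈ b))) ∷ ℤₚ.≤-reflexive (trans (sym (φ-flat ⊖ k s p∈)) ep) ∷
               ℤₚ.≤-reflexive (f-opp⊕ k (top b)) ∷ ℤₚ.≤-reflexive (sym (f-opp⊕ k p)) ∷ [])) ,
          1ℤ - half b - π , trans (sym (ℤₚ.neg-involutive (f ⊕ k p))) (trans (cong -_ (trans (sym (f-opp⊕ k p)) (trans (sym (φ-flat ⊖ k s p∈)) (trans ep (cong (λ v → v - + 4) e))))) (lem π (half b)))
        where
        b = B ⊖ k s
        lem : ∀ π h → - (π + + 2 * h + + 2 - + 4) ≡ π + + 2 * (1ℤ - h - π)
        lem = solve-∀

      tight? : ∀ k → Tight k π ⊎ ¬ Tight k π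
      tight? k = go (two-or-≤C+1 b)
        where
        b = B ⊕ k ⊕
        go : IsTwo b ⊎ H b ≤ C b + 1ℤ → Tight k π ⊎ ¬ Tight k π
        go (inj₁ t) = inj₁ (two⇒tight ⊕ k ⊕ t)
        go (inj₂ l) = inj₂ λ (a , c , a∈ , c∈ , e , q , eq) → absurd
          (linear (q ∷ half b ∷ π ∷ H b ∷ f ⊕ k a ∷ []) (1 ⊗ v₄ ⊑ v₃ ∷ 1 ⊗ v₃ ⊑ v₂ ⊞ + 2 ⊠ v₁ ⊞ con 1ℤ ∷ 1 ⊗ v₂ ⊞ + 2 ⊠ v₀ ⊑ v₄ ∷ 2 ⊗ con 0ℤ ⊑ v₀ ⊟ v₁ ⊟ con 1ℤ ∷ []) (con 1ℤ ⊑ con 0ℤ)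
            (subst (_≤ H b) (φ-flat ⊕ k ⊕ a∈) (max b a∈) ∷ l ∷ ℤₚ.≤-reflexive (sym eq) ∷
             sum≤ (q - half b - 1ℤ) (linear (q ∷ half b ∷ π ∷ f ⊕ k a ∷ f ⊕ k c ∷ []) (1 ⊗ v₂ ⊞ + 2 ⊠ v₁ ⊑ v₄ ⊞ (con (+ 4) ⊟ con 1ℤ) ∷ 1 ⊗ v₃ ⊑ v₂ ⊞ + 2 ⊠ v₀ ∷ 1 ⊗ con (+ 4) ⊑ v₃ ⊟ v₄ ∷ []) (con -[1+ 0 ] ⊑ + 2 ⊠ (v₀ ⊟ v₁ ⊟ con 1ℤ))
               (subst (λ v → C b ≤ v + (+ 4 - 1ℤ)) (φ-flat ⊕ k ⊕ c∈) (C≤all b c∈) ∷ ℤₚ.≤-reflexive eq ∷ ℤₚ.≤-reflexive (sym e) ∷ [])) ∷ []))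
          where
          absurd : 1ℤ ≤ 0ℤ → ⊥
          absurd (+≤+ ())

      module _ {i j l m} (part : Partition₄ i j l m) (¬i : ¬ Tight i π) (¬j : ¬ Tight j π) (σ : Sgn) (s : Ix → Sgn) where
        open Quad σ s hiding (IsTwo)

        gap-total : ∀ {p} → p ∈ A₁ → H (b i) + H (b j) + H (b l) + H (b m) ≡ gap i p + gap j p + gap l p + gap m p
        gap-total {p} p∈ = trans (lem (H (b i)) (H (b j)) (H (b l)) (H (b m)) (g i) (g j) (g l) (g m))
          (trans (cong (λ v → gap i p + gap j p + gap l p + gap m p + v) (trans (sym (part g)) total)) (ℤₚ.+-identityʳ _))
          where
          g : Ix → ℤ
          g k = φ σ k (s k) p
          total : sumIx g ≡ 0ℤ
          total = trans (cong₂ _+_ (cong₂ _+_ (cong₂ _+_ (φ-flat σ k₀ (s k₀) p∈) (φ-flat σ k₁ (s k₁) p∈)) (φ-flat σ k₂ (s k₂) p∈)) (φ-flat σ k₃ (s k₃) p∈)) (f-sum σ p)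
          lem : ∀ a b c d x y z w → a + b + c + d ≡ (a - x) + (b - y) + (c - z) + (d - w) + (x + y + z + w)
          lem = solve-∀

        finish : -[1+ 0 ] ≤ C (b i) + C (b j) + C (b l) + C (b m) → -[1+ 0 ] ≤ sumIx (λ k → D σ k (s k))
        finish le = subst (-[1+ 0 ] ≤_) (sym (trans (part (λ k → D σ k (s k)))
          (cong₂ _+_ (cong₂ _+_ (cong₂ _+_ (D-flat σ i (s i)) (D-flat σ j (s j))) (D-flat σ l (s l))) (D-flat σ m (s m))))) le

        -- The point `p` has parity `π`, because the maximum of the functional `n` has it and 4 is
        -- even. If the bound of `k` loses 1, its maximum has the other parity and `p` misses it.
        untight : ∀ k → ¬ Tight k π → ∀ n {p} → H (b n) ≡ C (b n) + + 2 → p ∈ A₁ → φ σ n (s n) p ≡ H (b n) - + 4 → H (b k) ≤ C (b k) + gap k p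
        untight k ¬k n {p} en p∈ ep = go (kind (b k))
          where
          go : Kind (φ σ k (s k)) (H (b k)) (C (b k)) → H (b k) ≤ C (b k) + gap k p
          go (two e q q∈ eq) = ⊥-elim (¬k (two⇒tight σ k (s k) (e , q , q∈ , eq)))
          go (zero le) = linear (H (b k) ∷ C (b k) ∷ gap k p ∷ []) (1 ⊗ v₀ ⊑ v₁ ∷ 1 ⊗ con 0ℤ ⊑ v₂ ∷ []) (v₀ ⊑ v₁ ⊞ v₂) (le ∷ 0≤gap k p∈ ∷ [])
          go (one e _ _ _) = go′ (φ-parity σ k (s k) p) (φ-parity σ n (s n) p)
            where
            go′ : φ σ k (s k) p ≡₂ parity p → φ σ n (s n) p ≡₂ parity p → H (b k) ≤ C (b k) + gap k p
            go′ (q , eq) (q′ , eq′) = linear (H (b k) ∷ φ σ k (s k) p ∷ H (b n) ∷ φ σ n (s n) p ∷ π ∷ half (b k) ∷ half (b n) ∷ q ∷ q′ ∷ parity p ∷ [])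
              (1 ⊗ v₁ ⊑ v₉ ⊞ + 2 ⊠ v₇ ∷ 1 ⊗ v₉ ⊞ + 2 ⊠ v₈ ⊑ v₃ ∷ 1 ⊗ v₃ ⊑ v₂ ⊟ con (+ 4) ∷ 1 ⊗ v₂ ⊑ v₄ ⊞ + 2 ⊠ v₆ ⊞ con (+ 2) ∷ 2 ⊗ con 0ℤ ⊑ v₅ ⊟ v₆ ⊞ con 1ℤ ⊟ v₇ ⊞ v₈ ∷ [])
              (v₀ ⊑ v₄ ⊞ + 2 ⊠ v₅ ⊞ (v₀ ⊟ v₁))
              (ℤₚ.≤-reflexive eq ∷ ℤₚ.≤-reflexive (sym eq′) ∷ ℤₚ.≤-reflexive ep ∷ ℤₚ.≤-reflexive en ∷
               sum≤ (half (b k) - half (b n) + 1ℤ - q + q′) (linear (H (b k) ∷ φ σ k (s k) p ∷ H (b n) ∷ φ σ n (s n) p ∷ π ∷ half (b k) ∷ half (b n) ∷ q ∷ q′ ∷ parity p ∷ [])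
                 (1 ⊗ v₁ ⊑ v₀ ∷ 1 ⊗ v₀ ⊑ v₄ ⊞ + 2 ⊠ v₅ ⊞ con 1ℤ ∷ 1 ⊗ v₉ ⊞ + 2 ⊠ v₇ ⊑ v₁ ∷ 1 ⊗ v₃ ⊑ v₉ ⊞ + 2 ⊠ v₈ ∷ 1 ⊗ v₂ ⊟ con (+ 4) ⊑ v₃ ∷ 1 ⊗ v₄ ⊞ + 2 ⊠ v₆ ⊞ con (+ 2) ⊑ v₂ ∷ [])
                 (con -[1+ 0 ] ⊑ + 2 ⊠ (v₅ ⊟ v₆ ⊞ con 1ℤ ⊟ v₇ ⊞ v₈))
                 (max (b k) p∈ ∷ ℤₚ.≤-reflexive e ∷ ℤₚ.≤-reflexive (sym eq) ∷ ℤₚ.≤-reflexive eq′ ∷ ℤₚ.≤-reflexive (sym ep) ∷ ℤₚ.≤-reflexive (sym en) ∷ [])) ∷ [])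

        -- If `l` or `m` loses 2, its gap of 4 at the witnessing point covers both their losses, and
        -- those of `i` and `j` are covered by their own gaps there. If no loss exceeds 1, one gap
        -- of 3 suffices for all four, and without any such gap there is no loss.
        beta : -[1+ 0 ] ≤ sumIx (λ k → D σ k (s k))
        beta = finish (go (two-or-≤C+1 (b l)) (two-or-≤C+1 (b m)))
          where
          with-two : ∀ n {p} → n ≡ l ⊎ n ≡ m → H (b n) ≡ C (b n) + + 2 → p ∈ A₁ → φ σ n (s n) p ≡ H (b n) - + 4 → -[1+ 0 ] ≤ C (b i) + C (b j) + C (b l) + C (b m)
          with-two n {p} which e p∈ ep = linear (H (b i) ∷ H (b j) ∷ H (b l) ∷ H (b m) ∷ C (b i) ∷ C (b j) ∷ C (b l) ∷ C (b m) ∷ gap i p ∷ gap j p ∷ gap l p + gap m p ∷ [])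
            (1 ⊗ v₈ ⊞ v₉ ⊞ v₁₀ ⊑ v₀ ⊞ v₁ ⊞ v₂ ⊞ v₃ ∷ 1 ⊗ v₀ ⊑ v₄ ⊞ v₈ ∷ 1 ⊗ v₁ ⊑ v₅ ⊞ v₉ ∷ 1 ⊗ v₂ ⊑ v₆ ⊞ con (+ 2) ∷ 1 ⊗ v₃ ⊑ v₇ ⊞ con (+ 2) ∷ 1 ⊗ con (+ 4) ⊑ v₁₀ ∷ [])
            (con -[1+ 0 ] ⊑ v₄ ⊞ v₅ ⊞ v₆ ⊞ v₇)
            (ℤₚ.≤-reflexive (sym (trans (gap-total p∈) (ℤₚ.+-assoc (gap i p + gap j p) (gap l p) (gap m p)))) ∷ untight i ¬i n e p∈ ep ∷ untight j ¬j n e p∈ ep ∷ ≤C+2 (b l) ∷ ≤C+2 (b m) ∷ four which ∷ [])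
            where
            gap-n : gap n p ≡ + 4
            gap-n = trans (cong (λ v → H (b n) - v) ep) (lem (H (b n)))
              where
              lem : ∀ H → H - (H - + 4) ≡ + 4
              lem = solve-∀
            four : n ≡ l ⊎ n ≡ m → + 4 ≤ gap l p + gap m p
            four (inj₁ refl) = linear (gap l p ∷ gap m p ∷ []) (1 ⊗ con (+ 4) ⊑ v₀ ∷ 1 ⊗ con 0ℤ ⊑ v₁ ∷ []) (con (+ 4) ⊑ v₀ ⊞ v₁) (ℤₚ.≤-reflexive (sym gap-n) ∷ 0≤gap m p∈ ∷ [])
            four (inj₂ refl) = linear (gap l p ∷ gap m p ∷ []) (1 ⊗ con (+ 4) ⊑ v₁ ∷ 1 ⊗ con 0ℤ ⊑ v₀ ∷ []) (con (+ 4) ⊑ v₀ ⊞ v₁) (ℤₚ.≤-reflexive (sym gap-n) ∷ 0≤gap l p∈ ∷ [])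
          loose : ∀ k → ¬ Tight k π → H (b k) ≤ C (b k) + 1ℤ
          loose k ¬k = [ (λ t → ⊥-elim (¬k (two⇒tight σ k (s k) t))) , id ]′ (two-or-≤C+1 (b k))
          go : IsTwo (b l) ⊎ H (b l) ≤ C (b l) + 1ℤ → IsTwo (b m) ⊎ H (b m) ≤ C (b m) + 1ℤ → -[1+ 0 ] ≤ C (b i) + C (b j) + C (b l) + C (b m)
          go (inj₁ (e , p , p∈ , ep)) _ = with-two l (inj₁ refl) e p∈ ep
          go (inj₂ _) (inj₁ (e , p , p∈ , ep)) = with-two m (inj₂ refl) e p∈ ep
          go (inj₂ ll) (inj₂ lm) = go′ (tight-or-low (b i)) (tight-or-low (b j)) (tight-or-low (b l)) (tight-or-low (b m))
            where
            sum3 : + 3 ≤ H (b i) + H (b j) + H (b l) + H (b m) → -[1+ 0 ] ≤ C (b i) + C (b j) + C (b l) + C (b m)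
            sum3 le = linear (H (b i) ∷ H (b j) ∷ H (b l) ∷ H (b m) ∷ C (b i) ∷ C (b j) ∷ C (b l) ∷ C (b m) ∷ [])
              (1 ⊗ con (+ 3) ⊑ v₀ ⊞ v₁ ⊞ v₂ ⊞ v₃ ∷ 1 ⊗ v₀ ⊑ v₄ ⊞ con 1ℤ ∷ 1 ⊗ v₁ ⊑ v₅ ⊞ con 1ℤ ∷ 1 ⊗ v₂ ⊑ v₆ ⊞ con 1ℤ ∷ 1 ⊗ v₃ ⊑ v₇ ⊞ con 1ℤ ∷ []) (con -[1+ 0 ] ⊑ v₄ ⊞ v₅ ⊞ v₆ ⊞ v₇)
              (le ∷ loose i ¬i ∷ loose j ¬j ∷ ll ∷ lm ∷ [])
            some : ∀ {p} → p ∈ A₁ → + 3 ≤ gap i p + gap j p + gap l p + gap m p → -[1+ 0 ] ≤ C (b i) + C (b j) + C (b l) + C (b m)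
            some p∈ le = sum3 (subst (+ 3 ≤_) (sym (gap-total p∈)) le)
            low : ∀ k {p} → φ σ k (s k) p ≤ H (b k) - (+ 4 - 1ℤ) → + 3 ≤ gap k p
            low k {p} le = linear (H (b k) ∷ φ σ k (s k) p ∷ []) (1 ⊗ v₁ ⊑ v₀ ⊟ (con (+ 4) ⊟ con 1ℤ) ∷ []) (con (+ 3) ⊑ v₀ ⊟ v₁) (le ∷ [])
            Low : Ix → Set
            Low k = (∃ λ p → p ∈ A₁ × φ σ k (s k) p ≤ H (b k) - (+ 4 - 1ℤ)) ⊎ H (b k) ≤ C (b k)
            go′ : Low i → Low j → Low l → Low m → -[1+ 0 ] ≤ C (b i) + C (b j) + C (b l) + C (b m)
            go′ (inj₁ (p , p∈ , le)) _ _ _ = some p∈ (linear (gap i p ∷ gap j p ∷ gap l p ∷ gap m p ∷ []) (1 ⊗ con (+ 3) ⊑ v₀ ∷ 1 ⊗ con 0ℤ ⊑ v₁ ∷ 1 ⊗ con 0ℤ ⊑ v₂ ∷ 1 ⊗ con 0ℤ ⊑ v₃ ∷ []) (con (+ 3) ⊑ v₀ ⊞ v₁ ⊞ v₂ ⊞ v₃) (low i {p} le ∷ 0≤gap j p∈ ∷ 0≤gap l p∈ ∷ 0≤gap m p∈ ∷ []))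
            go′ _ (inj₁ (p , p∈ , le)) _ _ = some p∈ (linear (gap i p ∷ gap j p ∷ gap l p ∷ gap m p ∷ []) (1 ⊗ con 0ℤ ⊑ v₀ ∷ 1 ⊗ con (+ 3) ⊑ v₁ ∷ 1 ⊗ con 0ℤ ⊑ v₂ ∷ 1 ⊗ con 0ℤ ⊑ v₃ ∷ []) (con (+ 3) ⊑ v₀ ⊞ v₁ ⊞ v₂ ⊞ v₃) (0≤gap i p∈ ∷ low j {p} le ∷ 0≤gap l p∈ ∷ 0≤gap m p∈ ∷ []))
            go′ _ _ (inj₁ (p , p∈ , le)) _ = some p∈ (linear (gap i p ∷ gap j p ∷ gap l p ∷ gap m p ∷ []) (1 ⊗ con 0ℤ ⊑ v₀ ∷ 1 ⊗ con 0ℤ ⊑ v₁ ∷ 1 ⊗ con (+ 3) ⊑ v₂ ∷ 1 ⊗ con 0ℤ ⊑ v₃ ∷ []) (con (+ 3) ⊑ v₀ ⊞ v₁ ⊞ v₂ ⊞ v₃) (0≤gap i p∈ ∷ 0≤gap j p∈ ∷ low l {p} le ∷ 0≤gap m p∈ ∷ []))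
            go′ _ _ _ (inj₁ (p , p∈ , le)) = some p∈ (linear (gap i p ∷ gap j p ∷ gap l p ∷ gap m p ∷ []) (1 ⊗ con 0ℤ ⊑ v₀ ∷ 1 ⊗ con 0ℤ ⊑ v₁ ∷ 1 ⊗ con 0ℤ ⊑ v₂ ∷ 1 ⊗ con (+ 3) ⊑ v₃ ∷ []) (con (+ 3) ⊑ v₀ ⊞ v₁ ⊞ v₂ ⊞ v₃) (0≤gap i p∈ ∷ 0≤gap j p∈ ∷ 0≤gap l p∈ ∷ low m {p} le ∷ []))
            go′ (inj₂ hi) (inj₂ hj) (inj₂ hl) (inj₂ hm) = linear (H (b i) ∷ H (b j) ∷ H (b l) ∷ H (b m) ∷ C (b i) ∷ C (b j) ∷ C (b l) ∷ C (b m) ∷ gap i a ∷ gap j a ∷ gap l a ∷ gap m a ∷ [])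
              (1 ⊗ v₈ ⊞ v₉ ⊞ v₁₀ ⊞ v₁₁ ⊑ v₀ ⊞ v₁ ⊞ v₂ ⊞ v₃ ∷ 1 ⊗ v₀ ⊑ v₄ ∷ 1 ⊗ v₁ ⊑ v₅ ∷ 1 ⊗ v₂ ⊑ v₆ ∷ 1 ⊗ v₃ ⊑ v₇ ∷ 1 ⊗ con 0ℤ ⊑ v₈ ∷ 1 ⊗ con 0ℤ ⊑ v₉ ∷ 1 ⊗ con 0ℤ ⊑ v₁₀ ∷ 1 ⊗ con 0ℤ ⊑ v₁₁ ∷ [])
              (con -[1+ 0 ] ⊑ v₄ ⊞ v₅ ⊞ v₆ ⊞ v₇)
              (ℤₚ.≤-reflexive (sym (gap-total a₁∈)) ∷ hi ∷ hj ∷ hl ∷ hm ∷ 0≤gap i a₁∈ ∷ 0≤gap j a₁∈ ∷ 0≤gap l a₁∈ ∷ 0≤gap m a₁∈ ∷ [])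
              where a = 0ℤ ∷ a₀

    -- Each functional is tight for at most one parity, so for one of the parities
    -- two of the four are not tight.
    choice : Centre A₁ 4
    choice = go (Par.tight? 0ℤ k₀) (Par.tight? 0ℤ k₁) (Par.tight? 0ℤ k₂) (Par.tight? 0ℤ k₃)
      where
      use : ∀ π {i j l m} → Partition₄ i j l m → ¬ Tight i π → ¬ Tight j π → Centre A₁ 4
      use π part ¬i ¬j = Par.conclude π (Par.beta π part ¬i ¬j)
      Dec₂ : Ix → Set
      Dec₂ k = Tight k 0ℤ ⊎ ¬ Tight k 0ℤ
      go : Dec₂ k₀ → Dec₂ k₁ → Dec₂ k₂ → Dec₂ k₃ → Centre A₁ 4
      go (inj₂ t₀) (inj₂ t₁) _ _ = use 0ℤ p₀₁ t₀ t₁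
      go (inj₁ t₀) (inj₁ t₁) _ _ = use 1ℤ p₀₁ (exclusive k₀ t₀) (exclusive k₁ t₁)
      go _ _ (inj₂ t₂) (inj₂ t₃) = use 0ℤ p₂₃ t₂ t₃
      go _ _ (inj₁ t₂) (inj₁ t₃) = use 1ℤ p₂₃ (exclusive k₂ t₂) (exclusive k₃ t₃)
      go (inj₂ t₀) (inj₁ _) (inj₂ t₂) (inj₁ _) = use 0ℤ p₀₂ t₀ t₂
      go (inj₂ t₀) (inj₁ _) (inj₁ _) (inj₂ t₃) = use 0ℤ p₀₃ t₀ t₃
      go (inj₁ _) (inj₂ t₁) (inj₂ t₂) (inj₁ _) = use 0ℤ p₁₂ t₁ t₂
      go (inj₁ _) (inj₂ t₁) (inj₁ _) (inj₂ t₃) = use 0ℤ p₁₃ t₁ t₃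

  -- Centres in all dimensions up to 4

  Centred : ℕ → ℕ → Set
  Centred m r = ∀ (A : List (Vec ℤ m)) {a₀} → a₀ ∈ A → Small A r → Centre A r

  descend : ∀ {m M r} → m ≤′ M → Centred M r → Centred m r
  descend ≤′-refl        centred = centred
  descend (≤′-step m≤M) centred = descend m≤M λ A a₀∈ small →
    embed-centre A (centred (map (0ℤ ∷_) A) (∈-map⁺ (0ℤ ∷_) a₀∈) (small-embed A small))

  -- For each `r` up to 5 there is one extremal dimension, r - 1; for larger `r` it remains 4. Lower
  -- dimensions embed.
  centre : ∀ {m r} → m ℕ.≤ 4 → m ℕ.< r → 2 ℕ.≤ r → Centred m r
  centre {r = 2} _ (s≤s m≤1) _ = descend (ℕₚ.≤⇒≤′ m≤1) centre-1-2
  centre {r = 3} _ (s≤s m≤2) _ = descend (ℕₚ.≤⇒≤′ m≤2) centre-2-3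
  centre {r = 4} _ (s≤s m≤3) _ = descend (ℕₚ.≤⇒≤′ m≤3) centre-3-4
  centre {r = suc (suc (suc (suc (suc r))))} m≤4 _ _ =
    descend (ℕₚ.≤⇒≤′ m≤4) λ A a₀∈ small → centre-4 A a₀∈ small (s≤s (s≤s (s≤s (s≤s (s≤s z≤n)))))
  centre {r = 0} _ _ ()
  centre {r = 1} _ _ (s≤s ())

-- One push, on rational approximations of the coordinates

module Pushing where
  open LinearArithmetic
  open ℚ-Linear using () renaming (linear to linearℚ)
  open import Data.Integer using (+_)
  open import Data.Rational
  open import Data.Rational.Properties
  open import Data.Rational.Solver using (module +-*-Solver)
  open import Data.List using (List; []; _∷_; foldr; _++_)
  open import Data.List.Membership.Propositional using (_∈_; _∉_)
  open import Data.List.Relation.Unary.Any using (here; there)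
  open import Data.List.Relation.Unary.All using ([]; _∷_)
  import Data.List.Membership.DecPropositional as DecMembership
  open import Data.Product using (∃; _×_; _,_)
  open import Data.Sum using (_⊎_; inj₁; inj₂; [_,_]′)
  open import Data.List.Membership.Propositional.Properties using (∈-++⁻)
  open import Data.Empty using (⊥-elim)
  open import Relation.Nullary using (Dec; yes; no)
  open import Relation.Binary.Definitions using (DecidableEquality)
  open import Relation.Binary.PropositionalEquality

  2ℚ 4ℚ : ℚ
  2ℚ = + 2 / 1
  4ℚ = + 4 / 1

  *-monoˡ : ∀ {r p q} → 0ℚ ≤ r → p ≤ q → r * p ≤ r * q
  *-monoˡ {r} 0≤r = *-monoˡ-≤-nonNeg r {{nonNegative 0≤r}}

  *-monoʳ : ∀ {r p q} → 0ℚ ≤ r → p ≤ q → p * r ≤ q * r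
  *-monoʳ {r} 0≤r = *-monoʳ-≤-nonNeg r {{nonNegative 0≤r}}

  0≤* : ∀ {p q} → 0ℚ ≤ p → 0ℚ ≤ q → 0ℚ ≤ p * q
  0≤* {p} {q} 0≤p 0≤q = subst (_≤ p * q) (*-zeroʳ p) (*-monoˡ 0≤p 0≤q)

  0<* : ∀ {p q} → 0ℚ < p → 0ℚ < q → 0ℚ < p * q
  0<* {p} {q} 0<p 0<q = subst (_< p * q) (*-zeroʳ p) (*-monoʳ-<-pos p {{positive 0<p}} 0<q)

  infixr 4 _⇆_

  -- |a - b| ≤ ε as two linear inequalities, fit for certificates; by symmetry each estimate is
  -- proved for one of them and used twice.
  record Close (ε a b : ℚ) : Set where
    constructor _⇆_
    field
      upper : a ≤ b + ε
      lower : b ≤ a + ε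

  open Close public

  close-sym : ∀ {ε a b} → Close ε a b → Close ε b a
  close-sym (p ⇆ q) = q ⇆ p

  close-refl : ∀ {ε} → 0ℚ ≤ ε → ∀ a → Close ε a a
  close-refl {ε} 0≤ε a = le ⇆ le
    where
    le : a ≤ a + ε
    le = linearℚ (a ∷ ε ∷ []) (1 ⊗ con 0ℚ ⊑ v₁ ∷ []) (v₀ ⊑ v₀ ⊞ v₁) (0≤ε ∷ [])

  close-mono : ∀ {ε η a b} → ε ≤ η → Close ε a b → Close η a b
  close-mono {a = a} {b = b} ε≤η (p ⇆ q) = ≤-trans p (+-monoʳ-≤ b ε≤η) ⇆ ≤-trans q (+-monoʳ-≤ a ε≤η)

  private
    +-half : ∀ ε η a b c d → a ≤ b + ε → c ≤ d + η → a + c ≤ b + d + (ε + η)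
    +-half ε η a b c d p q = linearℚ (a ∷ b ∷ c ∷ d ∷ ε ∷ η ∷ []) (1 ⊗ v₀ ⊑ v₁ ⊞ v₄ ∷ 1 ⊗ v₂ ⊑ v₃ ⊞ v₅ ∷ []) (v₀ ⊞ v₂ ⊑ v₁ ⊞ v₃ ⊞ (v₄ ⊞ v₅)) (p ∷ q ∷ [])

    ⊔-half : ∀ ε a b c d → a ≤ b + ε → c ≤ d + ε → a ⊔ c ≤ b ⊔ d + ε
    ⊔-half ε a b c d p q = ⊔-lub (≤-trans p (+-monoˡ-≤ ε (p≤p⊔q b d))) (≤-trans q (+-monoˡ-≤ ε (p≤q⊔p b d)))

    ⊓-half : ∀ ε a b c d → a ≤ b + ε → c ≤ d + ε → a ⊓ c ≤ b ⊓ d + ε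
    ⊓-half ε a b c d p q with ⊓-sel b d
    ... | inj₁ e = ≤-trans (p⊓q≤p a c) (subst (λ v → a ≤ v + ε) (sym e) p)
    ... | inj₂ e = ≤-trans (p⊓q≤q a c) (subst (λ v → c ≤ v + ε) (sym e) q)

    scale-half : ∀ ε a b c → 0ℚ ≤ c → a ≤ b + ε → c * a ≤ c * b + c * ε
    scale-half ε a b c 0≤c p = subst (c * a ≤_) (*-distribˡ-+ c b ε) (*-monoˡ 0≤c p)

    *-half : ∀ ε η α β a a′ b b′ → 0ℚ ≤ ε → 0ℚ ≤ η → 0ℚ ≤ a → a ≤ α → 0ℚ ≤ b′ → b′ ≤ β → a ≤ a′ + ε → b ≤ b′ + η → a * b ≤ a′ * b′ + (α * η + ε * β)
    *-half ε η α β a a′ b b′ 0≤ε 0≤η 0≤a a≤ 0≤b′ b′≤ p q = linearℚ (a * b ∷ a * b′ ∷ a * η ∷ a′ * b′ ∷ ε * b′ ∷ α * η ∷ ε * β ∷ [])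
      (1 ⊗ v₀ ⊑ v₁ ⊞ v₂ ∷ 1 ⊗ v₁ ⊑ v₃ ⊞ v₄ ∷ 1 ⊗ v₂ ⊑ v₅ ∷ 1 ⊗ v₄ ⊑ v₆ ∷ []) (v₀ ⊑ v₃ ⊞ (v₅ ⊞ v₆))
      (subst (a * b ≤_) (*-distribˡ-+ a b′ η) (*-monoˡ 0≤a q) ∷ subst (a * b′ ≤_) (*-distribʳ-+ b′ a′ ε) (*-monoʳ 0≤b′ p) ∷
       *-monoʳ 0≤η a≤ ∷ *-monoˡ 0≤ε b′≤ ∷ [])

  close-+ : ∀ {ε η a b c d} → Close ε a b → Close η c d → Close (ε + η) (a + c) (b + d)
  close-+ {ε} {η} {a} {b} {c} {d} (p ⇆ p′) (q ⇆ q′) = +-half ε η a b c d p q ⇆ +-half ε η b a d c p′ q′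

  close-trans : ∀ {ε η a b c} → Close ε a b → Close η b c → Close (ε + η) a c
  close-trans {ε} {η} {a} {b} {c} (p ⇆ p′) (q ⇆ q′) =
    linearℚ (a ∷ b ∷ c ∷ ε ∷ η ∷ []) (1 ⊗ v₀ ⊑ v₁ ⊞ v₃ ∷ 1 ⊗ v₁ ⊑ v₂ ⊞ v₄ ∷ []) (v₀ ⊑ v₂ ⊞ (v₃ ⊞ v₄)) (p ∷ q ∷ []) ⇆
    linearℚ (a ∷ b ∷ c ∷ ε ∷ η ∷ []) (1 ⊗ v₁ ⊑ v₀ ⊞ v₃ ∷ 1 ⊗ v₂ ⊑ v₁ ⊞ v₄ ∷ []) (v₂ ⊑ v₀ ⊞ (v₃ ⊞ v₄)) (p′ ∷ q′ ∷ [])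

  close-neg : ∀ {ε a b} → Close ε a b → Close ε (- a) (- b)
  close-neg {ε} {a} {b} (p ⇆ q) = half a b q ⇆ half b a p
    where
    half : ∀ a b → b ≤ a + ε → - a ≤ - b + ε
    half a b q = linearℚ (a ∷ b ∷ ε ∷ []) (1 ⊗ v₁ ⊑ v₀ ⊞ v₂ ∷ []) (⊝ v₀ ⊑ ⊝ v₁ ⊞ v₂) (q ∷ [])

  close-⊔ : ∀ {ε a b c d} → Close ε a b → Close ε c d → Close ε (a ⊔ c) (b ⊔ d)
  close-⊔ {ε} {a} {b} {c} {d} (p ⇆ p′) (q ⇆ q′) = ⊔-half ε a b c d p q ⇆ ⊔-half ε b a d c p′ q′

  close-⊓ : ∀ {ε a b c d} → Close ε a b → Close ε c d → Close ε (a ⊓ c) (b ⊓ d)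
  close-⊓ {ε} {a} {b} {c} {d} (p ⇆ p′) (q ⇆ q′) = ⊓-half ε a b c d p q ⇆ ⊓-half ε b a d c p′ q′

  close-scale : ∀ {ε a b} c → 0ℚ ≤ c → Close ε a b → Close (c * ε) (c * a) (c * b)
  close-scale {ε} {a} {b} c 0≤c (p ⇆ q) = scale-half ε a b c 0≤c p ⇆ scale-half ε b a c 0≤c q

  close-* : ∀ {ε η a a′ b b′} α β → 0ℚ ≤ ε → 0ℚ ≤ η → 0ℚ ≤ a → a ≤ α → 0ℚ ≤ a′ → a′ ≤ α → 0ℚ ≤ b → b ≤ β → 0ℚ ≤ b′ → b′ ≤ β →
            Close ε a a′ → Close η b b′ → Close (α * η + ε * β) (a * b) (a′ * b′)
  close-* {ε} {η} {a} {a′} {b} {b′} α β 0≤ε 0≤η 0≤a a≤ 0≤a′ a′≤ 0≤b b≤ 0≤b′ b′≤ (p ⇆ p′) (q ⇆ q′) =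
    *-half ε η α β a a′ b b′ 0≤ε 0≤η 0≤a a≤ 0≤b′ b′≤ p q ⇆ *-half ε η α β a′ a b′ b 0≤ε 0≤η 0≤a′ a′≤ 0≤b b≤ p′ q′

  clamp : ℚ → ℚ
  clamp p = 0ℚ ⊔ (p ⊓ 1ℚ)

  0≤clamp : ∀ p → 0ℚ ≤ clamp p
  0≤clamp p = p≤p⊔q 0ℚ (p ⊓ 1ℚ)

  clamp≤1 : ∀ p → clamp p ≤ 1ℚ
  clamp≤1 p = ⊔-lub (nonNegative⁻¹ 1ℚ) (p⊓q≤q p 1ℚ)

  clamp-close : ∀ {ε a b} → 0ℚ ≤ ε → Close ε a b → Close ε (clamp a) (clamp b)
  clamp-close 0≤ε c = close-⊔ (close-refl 0≤ε 0ℚ) (close-⊓ c (close-refl 0≤ε 1ℚ))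

  clamp≤ : ∀ {p q} → 0ℚ ≤ q → p ≤ q → clamp p ≤ q
  clamp≤ {p} 0≤q p≤q = ⊔-lub 0≤q (≤-trans (p⊓q≤p p 1ℚ) p≤q)

  -- 1 / (1 - h), for h ≤ ½.
  den : ℚ → ℚ
  den h = (1ℚ - h) ⊔ ½

  ½≤den : ∀ h → ½ ≤ den h
  ½≤den h = p≤q⊔p (1ℚ - h) ½

  den-pos : ∀ h → Positive (den h)
  den-pos h = positive (<-≤-trans (positive⁻¹ ½) (½≤den h))

  ι : ℚ → ℚ
  ι h = (1/ den h) {{pos⇒nonZero (den h) {{den-pos h}}}}

  ι-den : ∀ h → ι h * den h ≡ 1ℚ
  ι-den h = *-inverseˡ (den h) {{pos⇒nonZero (den h) {{den-pos h}}}}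

  0≤ι : ∀ h → 0ℚ ≤ ι h
  0≤ι h = <⇒≤ (positive⁻¹ (ι h) {{1/pos⇒pos (den h) {{den-pos h}}}})

  ι≤2 : ∀ h → ι h ≤ 2ℚ
  ι≤2 h = linearℚ (ι h * ½ ∷ ι h * den h ∷ ι h ∷ []) (2 ⊗ v₀ ⊑ v₁ ∷ 2 ⊗ v₁ ⊑ con 1ℚ ∷ 2 ⊗ ½ ⊠ v₂ ⊑ v₀ ∷ []) (v₂ ⊑ con 2ℚ)
    (*-monoˡ (0≤ι h) (½≤den h) ∷ ≤-reflexive (ι-den h) ∷ ≤-reflexive (*-comm ½ (ι h)) ∷ [])

  -- The difference of the inverses is their product times the difference of the denominators, and
  -- each inverse is at most 2.
  ι-close : ∀ {ε h h′} → 0ℚ ≤ ε → Close ε h h′ → Close (4ℚ * ε) (ι h) (ι h′)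
  ι-close {ε} {h} {h′} 0≤ε c = half h h′ (lower den-close) ⇆ half h′ h (upper den-close)
    where
    den-close : Close ε (den h) (den h′)
    den-close = close-⊔ (close-mono (≤-reflexive (+-identityˡ ε)) (close-+ (close-refl ≤-refl 1ℚ) (close-neg c))) (close-refl 0≤ε ½)
    half : ∀ h h′ → den h′ ≤ den h + ε → ι h ≤ ι h′ + 4ℚ * ε
    half h h′ le = linearℚ (ι h ∷ ι h′ ∷ ι h * ι h′ * den h′ ∷ ι h * ι h′ * den h ∷ ι h * ι h′ * ε ∷ ε ∷ [])
      (1 ⊗ v₀ ⊑ v₂ ∷ 1 ⊗ v₂ ⊑ v₃ ⊞ v₄ ∷ 1 ⊗ v₃ ⊑ v₁ ∷ 1 ⊗ v₄ ⊑ 4ℚ ⊠ v₅ ∷ []) (v₀ ⊑ v₁ ⊞ 4ℚ ⊠ v₅)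
      (≤-reflexive (sym (trans (*-assoc (ι h) (ι h′) (den h′)) (trans (cong (ι h *_) (ι-den h′)) (*-identityʳ (ι h))))) ∷
       subst (ι h * ι h′ * den h′ ≤_) (*-distribˡ-+ (ι h * ι h′) (den h) ε) (*-monoˡ (0≤* (0≤ι h) (0≤ι h′)) le) ∷
       ≤-reflexive (trans (cong (_* den h) (*-comm (ι h) (ι h′))) (trans (*-assoc (ι h′) (ι h) (den h)) (trans (cong (ι h′ *_) (ι-den h)) (*-identityʳ (ι h′))))) ∷
       *-monoʳ 0≤ε (≤-trans (*-monoˡ (0≤ι h) (ι≤2 h′)) (*-monoʳ (nonNegative⁻¹ 2ℚ) (ι≤2 h))) ∷ [])

  den-id : ∀ {h} → h ≤ ½ → den h ≡ 1ℚ - h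
  den-id {h} h≤½ = p≥q⇒p⊔q≡p (linearℚ (h ∷ []) (1 ⊗ v₀ ⊑ con ½ ∷ []) (con ½ ⊑ con 1ℚ ⊟ v₀) (h≤½ ∷ []))

  module Push {V : Set} (_≟_ : DecidableEquality V) (A : List V) (w : V) where
    open DecMembership _≟_ using (_∈?_)

    sumOver : List V → (V → ℚ) → ℚ
    sumOver L f = foldr (λ v q → f v + q) 0ℚ L

    κ : ℚ
    κ = sumOver A (λ _ → 1ℚ)

    0≤κ : 0ℚ ≤ κ
    0≤κ = 0≤count A
      where
      0≤count : ∀ L → 0ℚ ≤ sumOver L (λ _ → 1ℚ)
      0≤count []      = ≤-refl
      0≤count (_ ∷ L) = +-mono-≤ {0ℚ} {1ℚ} {0ℚ} (nonNegative⁻¹ 1ℚ) (0≤count L)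

    indicator : ∀ {X : Set} → Dec X → ℚ
    indicator (yes _) = 1ℚ
    indicator (no _)  = 0ℚ

    1A 1w : V → ℚ
    1A v = indicator (v ∈? A)
    1w v = indicator (v ≟ w)

    minOver : List V → (V → ℚ) → ℚ
    minOver L X = foldr (λ a m → clamp (X a) ⊓ m) 1ℚ L

    -- How far the collapse of A towards w has to go (s = 1 means all the way).
    μ : (V → ℚ) → ℚ → ℚ
    μ X s = minOver A X ⊓ clamp s

    -- A push takes the mass `κ` * `μ` from `A`. Up to ½ of it, the amount `h`, is given to no
    -- vertex but made good by the factor `ι`, and only the excess goes to `w`. Thus `w` receives
    -- nothing while `κ` * `μ` ≤ ½, and 1 - `h` ≥ ½ keeps the division under control.
    h : (V → ℚ) → ℚ → ℚ
    h X s = κ * μ X s ⊓ ½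

    base : (V → ℚ) → ℚ → V → ℚ
    base X s v = clamp (X v) - μ X s * 1A v + (κ * μ X s - h X s) * 1w v

    push : (V → ℚ) → ℚ → V → ℚ
    push X s v = ι (h X s) * base X s v

    0≤indicator : ∀ {X : Set} (d : Dec X) → 0ℚ ≤ indicator d
    0≤indicator (yes _) = nonNegative⁻¹ 1ℚ
    0≤indicator (no _)  = ≤-refl

    indicator≤1 : ∀ {X : Set} (d : Dec X) → indicator d ≤ 1ℚ
    indicator≤1 (yes _) = ≤-refl
    indicator≤1 (no _)  = nonNegative⁻¹ 1ℚ

    0≤minOver : ∀ L X → 0ℚ ≤ minOver L X
    0≤minOver []      X = nonNegative⁻¹ 1ℚ
    0≤minOver (a ∷ L) X = ⊓-glb (0≤clamp (X a)) (0≤minOver L X)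

    minOver≤1 : ∀ L X → minOver L X ≤ 1ℚ
    minOver≤1 []      X = ≤-refl
    minOver≤1 (a ∷ L) X = ≤-trans (p⊓q≤q (clamp (X a)) (minOver L X)) (minOver≤1 L X)

    minOver≤ : ∀ {L X a} → a ∈ L → minOver L X ≤ clamp (X a)
    minOver≤ {a ∷ L} {X} (here refl) = p⊓q≤p (clamp (X a)) (minOver L X)
    minOver≤ {a ∷ L} {X} (there a∈)  = ≤-trans (p⊓q≤q (clamp (X a)) (minOver L X)) (minOver≤ {L} {X} a∈)

    minOver-attained : ∀ L X → (∃ λ a → a ∈ L × minOver L X ≡ clamp (X a)) ⊎ minOver L X ≡ 1ℚ
    minOver-attained []      X = inj₂ refl
    minOver-attained (a ∷ L) X with ⊓-sel (clamp (X a)) (minOver L X) | minOver-attained L X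
    ... | inj₁ e | _                = inj₁ (a , here refl , e)
    ... | inj₂ e | inj₁ (b , b∈ , e′) = inj₁ (b , there b∈ , trans e e′)
    ... | inj₂ e | inj₂ e′          = inj₂ (trans e e′)

    0≤μ : ∀ X s → 0ℚ ≤ μ X s
    0≤μ X s = ⊓-glb (0≤minOver A X) (0≤clamp s)

    μ≤1 : ∀ X s → μ X s ≤ 1ℚ
    μ≤1 X s = ≤-trans (p⊓q≤q (minOver A X) (clamp s)) (clamp≤1 s)

    μ≤at : ∀ X s {a} → a ∈ A → μ X s ≤ clamp (X a)
    μ≤at X s a∈ = ≤-trans (p⊓q≤p (minOver A X) (clamp s)) (minOver≤ {A} {X} a∈)

    μ≤s : ∀ X s → μ X s ≤ clamp s
    μ≤s X s = p⊓q≤q (minOver A X) (clamp s)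

    0≤h : ∀ X s → 0ℚ ≤ h X s
    0≤h X s = ⊓-glb (0≤* 0≤κ (0≤μ X s)) (nonNegative⁻¹ ½)

    h≤½ : ∀ X s → h X s ≤ ½
    h≤½ X s = p⊓q≤q (κ * μ X s) ½

    h≤κμ : ∀ X s → h X s ≤ κ * μ X s
    h≤κμ X s = p⊓q≤p (κ * μ X s) ½

    μ1A≤ : ∀ X s v → μ X s * 1A v ≤ clamp (X v)
    μ1A≤ X s v with v ∈? A
    ... | yes v∈ = ≤-trans (≤-reflexive (*-identityʳ (μ X s))) (μ≤at X s v∈)
    ... | no _   = ≤-trans (≤-reflexive (*-zeroʳ (μ X s))) (0≤clamp (X v))

    0≤excess : ∀ X s → 0ℚ ≤ κ * μ X s - h X s
    0≤excess X s = linearℚ (κ * μ X s ∷ h X s ∷ []) (1 ⊗ v₁ ⊑ v₀ ∷ []) (con 0ℚ ⊑ v₀ ⊟ v₁) (h≤κμ X s ∷ [])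

    0≤base : ∀ X s v → 0ℚ ≤ base X s v
    0≤base X s v = linearℚ (clamp (X v) ∷ μ X s * 1A v ∷ (κ * μ X s - h X s) * 1w v ∷ []) (1 ⊗ v₁ ⊑ v₀ ∷ 1 ⊗ con 0ℚ ⊑ v₂ ∷ []) (con 0ℚ ⊑ v₀ ⊟ v₁ ⊞ v₂)
      (μ1A≤ X s v ∷ 0≤* (0≤excess X s) (0≤indicator (v ≟ w)) ∷ [])

    0≤push : ∀ X s v → 0ℚ ≤ push X s v
    0≤push X s v = 0≤* (0≤ι (h X s)) (0≤base X s v)

    base≤ : ∀ X s v → base X s v ≤ clamp (X v) + (κ * μ X s - h X s) * 1w v
    base≤ X s v = linearℚ (clamp (X v) ∷ μ X s * 1A v ∷ (κ * μ X s - h X s) * 1w v ∷ []) (1 ⊗ con 0ℚ ⊑ v₁ ∷ []) (v₀ ⊟ v₁ ⊞ v₂ ⊑ v₀ ⊞ v₂)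
      (0≤* (0≤μ X s) (0≤indicator (v ∈? A)) ∷ [])

    push≤ : ∀ X s v → push X s v ≤ 2ℚ * (clamp (X v) + (κ * μ X s - h X s) * 1w v)
    push≤ X s v = ≤-trans (*-monoˡ (0≤ι (h X s)) (base≤ X s v)) (*-monoʳ (≤-trans (0≤base X s v) (base≤ X s v)) (ι≤2 (h X s)))

    base≤1+κ : ∀ X s v → base X s v ≤ 1ℚ + κ
    base≤1+κ X s v = linearℚ (base X s v ∷ clamp (X v) ∷ (κ * μ X s - h X s) * 1w v ∷ κ * μ X s ∷ h X s ∷ κ ∷ [])
      (1 ⊗ v₀ ⊑ v₁ ⊞ v₂ ∷ 1 ⊗ v₁ ⊑ con 1ℚ ∷ 1 ⊗ v₂ ⊑ v₃ ⊟ v₄ ∷ 1 ⊗ con 0ℚ ⊑ v₄ ∷ 1 ⊗ v₃ ⊑ v₅ ∷ []) (v₀ ⊑ con 1ℚ ⊞ v₅)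
      (base≤ X s v ∷ clamp≤1 (X v) ∷ ≤-trans (*-monoˡ (0≤excess X s) (indicator≤1 (v ≟ w))) (≤-reflexive (*-identityʳ (κ * μ X s - h X s))) ∷ 0≤h X s ∷
       ≤-trans (*-monoˡ 0≤κ (μ≤1 X s)) (≤-reflexive (*-identityʳ κ)) ∷ [])

    minOver-close : ∀ {ε} → 0ℚ ≤ ε → ∀ L {X Y} → (∀ {a} → a ∈ L → Close ε (X a) (Y a)) → Close ε (minOver L X) (minOver L Y)
    minOver-close 0≤ε []      c = close-refl 0≤ε 1ℚ
    minOver-close 0≤ε (a ∷ L) c = close-⊓ (clamp-close 0≤ε (c (here refl))) (minOver-close 0≤ε L (λ a∈ → c (there a∈)))

    μ-close : ∀ {ε} → 0ℚ ≤ ε → ∀ {X Y s t} → (∀ {a} → a ∈ A → Close ε (X a) (Y a)) → Close ε s t → Close ε (μ X s) (μ Y t)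
    μ-close 0≤ε c d = close-⊓ (minOver-close 0≤ε A c) (clamp-close 0≤ε d)

    h-close : ∀ {ε} → 0ℚ ≤ ε → ∀ {X Y s t} → Close ε (μ X s) (μ Y t) → Close (κ * ε) (h X s) (h Y t)
    h-close 0≤ε c = close-⊓ (close-scale κ 0≤κ c) (close-refl (0≤* 0≤κ 0≤ε) ½)

    scale-indicator : ∀ {ε a b} {X : Set} (d : Dec X) → 0ℚ ≤ ε → Close ε a b → Close ε (a * indicator d) (b * indicator d)
    scale-indicator {ε} {a} {b} (yes _) 0≤ε c = subst₂ (Close ε) (sym (*-identityʳ a)) (sym (*-identityʳ b)) c
    scale-indicator {ε} {a} {b} (no _)  0≤ε c = subst₂ (Close ε) (sym (*-zeroʳ a)) (sym (*-zeroʳ b)) (close-refl 0≤ε 0ℚ)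

    -- From the product rule: the factor `ι` is at most 2 and varies by 4`κ` per unit, and the
    -- factor `base` is at most 1 + `κ` and varies by 2 + 2`κ`.
    Lip : ℚ
    Lip = 2ℚ * (1ℚ + 1ℚ + (κ + κ)) + 4ℚ * κ * (1ℚ + κ)

    -- Stated with `μ` separate from the coordinates, so that a push with small `μ` can also be
    -- compared with the push of the same point at time 0.
    push-close′ : ∀ {ε} → 0ℚ ≤ ε → ∀ {X Y s t} v → Close ε (clamp (X v)) (clamp (Y v)) → Close ε (μ X s) (μ Y t) →
                  Close (Lip * ε) (push X s v) (push Y t v)
    push-close′ {ε} 0≤ε {X} {Y} {s} {t} v c μc = close-mono (≤-reflexive (total ε κ))
      (close-* 2ℚ (1ℚ + κ) (0≤* {4ℚ} (nonNegative⁻¹ 4ℚ) (0≤* 0≤κ 0≤ε)) 0≤η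
        (0≤ι (h X s)) (ι≤2 (h X s)) (0≤ι (h Y t)) (ι≤2 (h Y t)) (0≤base X s v) (base≤1+κ X s v) (0≤base Y t v) (base≤1+κ Y t v)
        (ι-close (0≤* 0≤κ 0≤ε) hc)
        (close-+ (close-+ c (close-neg (scale-indicator (v ∈? A) 0≤ε μc)))
                 (scale-indicator (v ≟ w) 0≤κε (close-+ (close-scale κ 0≤κ μc) (close-neg hc)))))
      where
      hc : Close (κ * ε) (h X s) (h Y t)
      hc = h-close 0≤ε {X} {Y} {s} {t} μc
      0≤κε : 0ℚ ≤ κ * ε + κ * ε
      0≤κε = +-mono-≤ {0ℚ} {κ * ε} {0ℚ} (0≤* 0≤κ 0≤ε) (0≤* 0≤κ 0≤ε)
      0≤η : 0ℚ ≤ ε + ε + (κ * ε + κ * ε)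
      0≤η = +-mono-≤ {0ℚ} {ε + ε} {0ℚ} (+-mono-≤ {0ℚ} {ε} {0ℚ} 0≤ε 0≤ε) 0≤κε
      total : ∀ e k → 2ℚ * (e + e + (k * e + k * e)) + 4ℚ * (k * e) * (1ℚ + k) ≡ (2ℚ * (1ℚ + 1ℚ + (k + k)) + 4ℚ * k * (1ℚ + k)) * e
      total = solve 2 (λ e k → con′ 2ℚ :* (e :+ e :+ (k :* e :+ k :* e)) :+ con′ 4ℚ :* (k :* e) :* (con′ 1ℚ :+ k) :=
                               (con′ 2ℚ :* (con′ 1ℚ :+ con′ 1ℚ :+ (k :+ k)) :+ con′ 4ℚ :* k :* (con′ 1ℚ :+ k)) :* e) refl
        where open +-*-Solver renaming (con to con′)

    push-close : ∀ {ε} → 0ℚ ≤ ε → ∀ {X Y s t} v → (∀ {a} → a ∈ v ∷ A → Close ε (X a) (Y a)) → Close ε s t →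
                 Close (Lip * ε) (push X s v) (push Y t v)
    push-close 0≤ε {X} {Y} {s} {t} v c d = push-close′ 0≤ε {X} {Y} {s} {t} v (clamp-close 0≤ε (c (here refl))) (μ-close 0≤ε (λ a∈ → c (there a∈)) d)

    0≤Lip : 0ℚ ≤ Lip
    0≤Lip = +-mono-≤ {0ℚ} {2ℚ * (1ℚ + 1ℚ + (κ + κ))} {0ℚ}
      (0≤* {2ℚ} (nonNegative⁻¹ 2ℚ) (+-mono-≤ {0ℚ} {1ℚ + 1ℚ} {0ℚ} (nonNegative⁻¹ (1ℚ + 1ℚ)) (+-mono-≤ {0ℚ} {κ} {0ℚ} 0≤κ 0≤κ)))
      (0≤* (0≤* {4ℚ} (nonNegative⁻¹ 4ℚ) 0≤κ) (+-mono-≤ {0ℚ} {1ℚ} {0ℚ} (nonNegative⁻¹ 1ℚ) 0≤κ))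

    1w-∉ : ∀ {v} → v ≢ w → 1w v ≡ 0ℚ
    1w-∉ {v} v≢w with v ≟ w
    ... | yes e = ⊥-elim (v≢w e)
    ... | no _  = refl

    1A-∈ : ∀ {v} → v ∈ A → 1A v ≡ 1ℚ
    1A-∈ {v} v∈ with v ∈? A
    ... | yes _ = refl
    ... | no v∉ = ⊥-elim (v∉ v∈)

    1A-∉ : ∀ {v} → v ∉ A → 1A v ≡ 0ℚ
    1A-∉ {v} v∉ with v ∈? A
    ... | yes v∈ = ⊥-elim (v∉ v∈)
    ... | no _   = refl

    push≤-off : ∀ X s {v} → v ≢ w ⊎ κ * μ X s ≤ ½ → push X s v ≤ 2ℚ * clamp (X v)
    push≤-off X s {v} o = subst (λ z → push X s v ≤ 2ℚ * z) (trans (cong (λ z → clamp (X v) + z) (vanish o)) (+-identityʳ (clamp (X v)))) (push≤ X s v)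
      where
      vanish : v ≢ w ⊎ κ * μ X s ≤ ½ → (κ * μ X s - h X s) * 1w v ≡ 0ℚ
      vanish (inj₁ v≢w) = trans (cong ((κ * μ X s - h X s) *_) (1w-∉ v≢w)) (*-zeroʳ (κ * μ X s - h X s))
      vanish (inj₂ le)  = trans (cong (λ z → (κ * μ X s - z) * 1w v) (p≤q⇒p⊓q≡p le)) (trans (cong (_* 1w v) (+-inverseʳ (κ * μ X s))) (*-zeroˡ (1w v)))

    push-still : ∀ X v → push X 0ℚ v ≡ clamp (X v)
    push-still X v = trans (cong₂ (λ m k → ι (k ⊓ ½) * (clamp (X v) - m * 1A v + (k - k ⊓ ½) * 1w v)) μ≡0 (trans (cong (κ *_) μ≡0) (*-zeroʳ κ)))
      (arith (clamp (X v)) (1A v) (1w v))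
      where
      μ≡0 : μ X 0ℚ ≡ 0ℚ
      μ≡0 = p≥q⇒p⊓q≡q (0≤minOver A X)
      arith : ∀ c a b → 1ℚ * (c - 0ℚ * a + 0ℚ * b) ≡ c
      arith = solve 3 (λ c a b → con′ 1ℚ :* (c :- con′ 0ℚ :* a :+ con′ 0ℚ :* b) := c) refl
        where open +-*-Solver renaming (con to con′)

    -- At full time `μ` is the minimum over `A`, and a coordinate attaining it drops to 0. If the
    -- minimum is the 1 that `minOver` starts from, every clamped coordinate on `A` is 1 and any of
    -- them serves.
    push-vanishes : ∀ {a₀} → a₀ ∈ A → w ∉ A → ∀ X s → 1ℚ ≤ s → ∃ λ a → a ∈ A × push X s a ≡ 0ℚ
    push-vanishes {a₀} a₀∈ w∉ X s 1≤s = fin (minOver-attained A X)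
      where
      clamps : clamp s ≡ 1ℚ
      clamps = ≤-antisym (clamp≤1 s) (≤-trans (⊓-glb 1≤s ≤-refl) (p≤q⊔p 0ℚ (s ⊓ 1ℚ)))
      μ≡ : μ X s ≡ minOver A X
      μ≡ = trans (cong (minOver A X ⊓_) clamps) (p≤q⇒p⊓q≡p (minOver≤1 A X))
      arith : ∀ i c k → i * (c - c * 1ℚ + k * 0ℚ) ≡ 0ℚ
      arith = solve 3 (λ i c k → i :* (c :- c :* con′ 1ℚ :+ k :* con′ 0ℚ) := con′ 0ℚ) refl
        where open +-*-Solver renaming (con to con′)
      zero-at : ∀ {a} → a ∈ A → μ X s ≡ clamp (X a) → push X s a ≡ 0ℚ
      zero-at {a} a∈ e = trans (cong (ι (h X s) *_) (trans (cong (λ m → clamp (X a) - m * 1A a + (κ * μ X s - h X s) * 1w a) e)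
          (cong₂ (λ p q → clamp (X a) - clamp (X a) * p + (κ * μ X s - h X s) * q) (1A-∈ a∈) (1w-∉ λ { refl → w∉ a∈ }))))
        (arith (ι (h X s)) (clamp (X a)) (κ * μ X s - h X s))
      fin : (∃ λ a → a ∈ A × minOver A X ≡ clamp (X a)) ⊎ minOver A X ≡ 1ℚ → ∃ λ a → a ∈ A × push X s a ≡ 0ℚ
      fin (inj₁ (a , a∈ , e)) = a , a∈ , zero-at a∈ (trans μ≡ e)
      fin (inj₂ e) = a₀ , a₀∈ , zero-at a₀∈ (≤-antisym (μ≤at X s a₀∈) (≤-trans (clamp≤1 (X a₀)) (≤-reflexive (sym (trans μ≡ e)))))

    sumOver-cong : ∀ L {f g} → (∀ {v} → v ∈ L → f v ≡ g v) → sumOver L f ≡ sumOver L g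
    sumOver-cong []      e = refl
    sumOver-cong (v ∷ L) e = cong₂ _+_ (e (here refl)) (sumOver-cong L (λ v∈ → e (there v∈)))

    sumOver-base : ∀ L X s → sumOver L (push X s) ≡ ι (h X s) * (sumOver L (λ v → clamp (X v)) - μ X s * sumOver L 1A + (κ * μ X s - h X s) * sumOver L 1w)
    sumOver-base []      X s = sym (arith (ι (h X s)) (μ X s) (κ * μ X s - h X s))
      where
      arith : ∀ i m k → i * (0ℚ - m * 0ℚ + k * 0ℚ) ≡ 0ℚ
      arith = solve 3 (λ i m k → i :* (con′ 0ℚ :- m :* con′ 0ℚ :+ k :* con′ 0ℚ) := con′ 0ℚ) refl
        where open +-*-Solver renaming (con to con′)
    sumOver-base (v ∷ L) X s = trans (cong (λ z → push X s v + z) (sumOver-base L X s))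
      (arith (ι (h X s)) (μ X s) (κ * μ X s - h X s) (clamp (X v)) (1A v) (1w v) (sumOver L (λ v → clamp (X v))) (sumOver L 1A) (sumOver L 1w))
      where
      arith : ∀ i m k c a b c′ a′ b′ → i * (c - m * a + k * b) + i * (c′ - m * a′ + k * b′) ≡ i * ((c + c′) - m * (a + a′) + k * (b + b′))
      arith = solve 9 (λ i m k c a b c′ a′ b′ → i :* (c :- m :* a :+ k :* b) :+ i :* (c′ :- m :* a′ :+ k :* b′) := i :* ((c :+ c′) :- m :* (a :+ a′) :+ k :* (b :+ b′))) refl
        where open +-*-Solver

    -- Taking `κ` * `μ` away and returning all but `h` of it turns a total 1 into 1 - `h`, which `ι`
    -- restores. Stated for inexact totals, because approximations add up to 1 only approximately.
    sum-push : ∀ Ω X s → sumOver Ω 1A ≡ κ → sumOver Ω 1w ≡ 1ℚ → sumOver Ω (push X s) - 1ℚ ≡ ι (h X s) * (sumOver Ω (λ v → clamp (X v)) - 1ℚ)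
    sum-push Ω X s eA ew = trans (cong₂ (λ p q → p - q) (sumOver-base Ω X s) (sym (trans (cong (ι (h X s) *_) (sym (den-id (h≤½ X s)))) (ι-den (h X s)))))
      (trans (cong₂ (λ p q → ι (h X s) * (sumOver Ω (λ v → clamp (X v)) - μ X s * p + (κ * μ X s - h X s) * q) - ι (h X s) * (1ℚ - h X s)) eA ew)
        (arith (ι (h X s)) (μ X s) κ (h X s) (sumOver Ω (λ v → clamp (X v)))))
      where
      arith : ∀ i m k g c → i * (c - m * k + (k * m - g) * 1ℚ) - i * (1ℚ - g) ≡ i * (c - 1ℚ)
      arith = solve 5 (λ i m k g c → i :* (c :- m :* k :+ (k :* m :- g) :* con′ 1ℚ) :- i :* (con′ 1ℚ :- g) := i :* (c :- con′ 1ℚ)) refl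
        where open +-*-Solver renaming (con to con′)

    sumOver-++ : ∀ L M f → sumOver (L ++ M) f ≡ sumOver L f + sumOver M f
    sumOver-++ []      M f = sym (+-identityˡ (sumOver M f))
    sumOver-++ (v ∷ L) M f = trans (cong (λ z → f v + z) (sumOver-++ L M f)) (sym (+-assoc (f v) (sumOver L f) (sumOver M f)))

    sumOver-0 : ∀ L → sumOver L (λ _ → 0ℚ) ≡ 0ℚ
    sumOver-0 []      = refl
    sumOver-0 (v ∷ L) = trans (+-identityˡ (sumOver L (λ _ → 0ℚ))) (sumOver-0 L)

    domain : List V → List V
    domain M = w ∷ A ++ M

    module _ {M} (w∉A : w ∉ A) (w∉M : w ∉ M) (disjoint : ∀ {a} → a ∈ A → a ∉ M) where
      sum-1A : sumOver (domain M) 1A ≡ κ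
      sum-1A = trans (cong₂ _+_ (1A-∉ w∉A) (trans (sumOver-++ A M 1A)
          (cong₂ _+_ (sumOver-cong A 1A-∈) (trans (sumOver-cong M (λ v∈ → 1A-∉ (λ a∈ → disjoint a∈ v∈))) (sumOver-0 M)))))
        (trans (+-identityˡ (κ + 0ℚ)) (+-identityʳ κ))

      sum-1w : sumOver (domain M) 1w ≡ 1ℚ
      sum-1w = cong₂ _+_ (indicator-yes) (trans (sumOver-cong (A ++ M) (λ v∈ → 1w-∉ λ { refl → [ w∉A , w∉M ]′ (∈-++⁻ A v∈) })) (sumOver-0 (A ++ M)))
        where
        indicator-yes : 1w w ≡ 1ℚ
        indicator-yes with w ≟ w
        ... | yes _ = refl
        ... | no ne = ⊥-elim (ne refl)

-- Estimates and finite sums for Cauchy reals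

module Reals where
  open LinearArithmetic
  open Pushing
  open ℚ-Linear using () renaming (linear to linearℚ)
  open import Defs using (ℝ; seq; cauchy; _≈_; 0ℝ; sumℝ; ∣_-_∣<_) renaming (_<_ to _<ᴿ_; _≤_ to _≤ᴿ_; _+_ to _+ᴿ_)
  open import Data.Nat using (ℕ)
  import Data.Nat as ℕ
  import Data.Nat.Properties as ℕₚ
  open import Data.Integer using (+_)
  open import Data.Rational
  open import Data.Rational.Properties
  open import Data.Rational.Solver using (module +-*-Solver)
  open import Data.List using (List; []; _∷_; map; filter)
  open import Data.List.Membership.Propositional using (_∈_; _∉_)
  open import Data.List.Membership.Propositional.Properties using (∈-filter⁺; ∈-filter⁻)
  open import Data.List.Membership.Propositional.Properties.WithK using (unique∧set⇒bag)
  open import Data.List.Relation.Binary.BagAndSetEquality using (∼bag⇒↭)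
  open import Data.List.Relation.Binary.Permutation.Propositional using (_↭_; refl; prep; swap; trans)
  open import Data.List.Relation.Unary.Any using (here; there)
  open import Data.List.Relation.Unary.All using ([]; _∷_)
  open import Data.List.Relation.Unary.Unique.Propositional using (Unique)
  open import Data.List.Relation.Unary.Unique.Propositional.Properties using (filter⁺)
  import Data.List.Membership.DecPropositional as DecMembership
  open import Data.Product using (∃; _×_; _,_; proj₁; proj₂)
  open import Data.Sum using (_⊎_; inj₁; inj₂; [_,_]′)
  open import Data.Empty using (⊥-elim)
  open import Function.Bundles using (mk⇔)
  open import Relation.Nullary using (¬_; Dec; yes; no)
  open import Relation.Unary using (Decidable)
  open import Relation.Binary.Definitions using (DecidableEquality)
  open import Relation.Binary.PropositionalEquality as ≡ using (_≡_; _≢_; sym; cong; cong₂; subst; subst₂)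

  ½* : ∀ {ε} → 0ℚ < ε → 0ℚ < ½ * ε
  ½* = 0<* (positive⁻¹ ½)

  ⅛ : ℚ
  ⅛ = + 1 / 8

  ⅛* : ∀ {ε} → 0ℚ < ε → 0ℚ < ⅛ * ε
  ⅛* = 0<* (positive⁻¹ ⅛)

  half-sum : ∀ ε → ½ * ε + ½ * ε ≡ ε
  half-sum = solve 1 (λ e → con½ :* e :+ con½ :* e := e) ≡.refl
    where
    open +-*-Solver renaming (con to con′)
    con½ : ∀ {n} → Polynomial n
    con½ = con′ ½

  ½ε<ε : ∀ {ε} → 0ℚ < ε → ½ * ε < ε
  ½ε<ε {ε} 0<ε = subst₂ _<_ (+-identityˡ (½ * ε)) (half-sum ε) (+-monoˡ-< (½ * ε) (½* 0<ε))

  shrink : ∀ L {ε} → 0ℚ ≤ L → 0ℚ < ε → ∃ λ η → 0ℚ < η × L * η ≤ ε × η ≤ ε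
  -- The witness is ε / (1 + L), which makes sense for L = 0 too.
  shrink L {ε} 0≤L 0<ε = ε * i , 0<ε*i , le , le′
    where
    c : ℚ
    c = 1ℚ + L
    0<c : 0ℚ < c
    0<c = <-≤-trans (positive⁻¹ 1ℚ) (≤-trans (≤-reflexive (sym (+-identityʳ 1ℚ))) (+-monoʳ-≤ 1ℚ 0≤L))
    i : ℚ
    i = (1/ c) {{pos⇒nonZero c {{positive 0<c}}}}
    0<i : 0ℚ < i
    0<i = positive⁻¹ i {{1/pos⇒pos c {{positive 0<c}}}}
    0<ε*i : 0ℚ < ε * i
    0<ε*i = 0<* 0<ε 0<i
    whole : ε * i + L * (ε * i) ≡ ε
    whole = ≡.trans (arith ε i L) (≡.trans (cong (ε *_) (*-inverseˡ c {{pos⇒nonZero c {{positive 0<c}}}})) (*-identityʳ ε))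
      where
      arith : ∀ e i l → e * i + l * (e * i) ≡ e * (i * (1ℚ + l))
      arith = solve 3 (λ e i l → e :* i :+ l :* (e :* i) := e :* (i :* (con′ 1ℚ :+ l))) ≡.refl
        where open +-*-Solver renaming (con to con′)
    le : L * (ε * i) ≤ ε
    le = linearℚ (ε * i ∷ L * (ε * i) ∷ ε ∷ []) (1 ⊗ con 0ℚ ⊑ v₀ ∷ 1 ⊗ v₀ ⊞ v₁ ⊑ v₂ ∷ []) (v₁ ⊑ v₂) (<⇒≤ 0<ε*i ∷ ≤-reflexive whole ∷ [])
    le′ : ε * i ≤ ε
    le′ = linearℚ (ε * i ∷ L * (ε * i) ∷ ε ∷ []) (1 ⊗ con 0ℚ ⊑ v₁ ∷ 1 ⊗ v₀ ⊞ v₁ ⊑ v₂ ∷ []) (v₀ ⊑ v₂) (0≤* 0≤L (<⇒≤ 0<ε*i) ∷ ≤-reflexive whole ∷ [])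

  Eventually : (ℕ → Set) → Set
  Eventually P = ∃ λ N → ∀ n → N ℕ.≤ n → P n

  module _ {P Q : ℕ → Set} where
    ev-map : (∀ n → P n → Q n) → Eventually P → Eventually Q
    ev-map f (N , p) = N , λ n N≤n → f n (p n N≤n)

    ev-∧ : Eventually P → Eventually Q → Eventually (λ n → P n × Q n)
    ev-∧ (M , p) (N , q) = M ℕ.⊔ N , λ n le → p n (ℕₚ.≤-trans (ℕₚ.m≤m⊔n M N) le) , q n (ℕₚ.≤-trans (ℕₚ.m≤n⊔m M N) le)

  ev-map₂ : {P Q R : ℕ → Set} → (∀ n → P n → Q n → R n) → Eventually P → Eventually Q → Eventually R
  ev-map₂ f p q = ev-map (λ n (p , q) → f n p q) (ev-∧ p q)

  ev-always : {P : ℕ → Set} → (∀ n → P n) → Eventually P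
  ev-always p = 0 , λ n _ → p n

  ev-sat : {P : Set} → Eventually (λ _ → P) → P
  ev-sat (N , p) = p N ℕₚ.≤-refl

  ev-all : ∀ {V : Set} {P : V → ℕ → Set} L → (∀ {a} → a ∈ L → Eventually (P a)) → Eventually (λ n → ∀ a → a ∈ L → P a n)
  ev-all             []      p = 0 , λ _ _ _ ()
  ev-all {P = P} (a ∷ L) p = ev-map₂ (λ { n q qs _ (here ≡.refl) → q ; n q qs a (there a∈) → qs a a∈ }) (p (here ≡.refl)) (ev-all {P = P} L (λ a∈ → p (there a∈)))

  Closeᴿ : ℚ → ℝ → ℝ → Set
  Closeᴿ ε x y = Eventually (λ n → Close ε (seq x n) (seq y n))

  abs⇒close : ∀ {ε a b} → ∣ a - b ∣ < ε → Close ε a b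
  abs⇒close {ε} {a} {b} lt =
    linearℚ (a ∷ b ∷ ε ∷ ∣ a - b ∣ ∷ []) (1 ⊗ v₀ ⊟ v₁ ⊑ v₃ ∷ 1 ⊗ v₃ ⊑ v₂ ∷ []) (v₀ ⊑ v₁ ⊞ v₂) (p≤∣p∣ (a - b) ∷ <⇒≤ lt ∷ []) ⇆
    linearℚ (a ∷ b ∷ ε ∷ ∣ a - b ∣ ∷ []) (1 ⊗ ⊝ (v₀ ⊟ v₁) ⊑ v₃ ∷ 1 ⊗ v₃ ⊑ v₂ ∷ []) (v₁ ⊑ v₀ ⊞ v₂)
      (≤-trans (p≤∣p∣ (- (a - b))) (≤-reflexive (∣-p∣≡∣p∣ (a - b))) ∷ <⇒≤ lt ∷ [])
    where
    p≤∣p∣ : ∀ p → p ≤ ∣ p ∣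
    p≤∣p∣ p = [ (λ 0≤p → ≤-reflexive (sym (0≤p⇒∣p∣≡p 0≤p))) , (λ p≤0 → ≤-trans p≤0 (0≤∣p∣ p)) ]′ (≤-total 0ℚ p)

  close⇒abs : ∀ {ε a b} → Close ε a b → ∣ a - b ∣ ≤ ε
  close⇒abs {ε} {a} {b} (p ⇆ q) = [ (λ e → ≤-trans (≤-reflexive e) (linearℚ (a ∷ b ∷ ε ∷ []) (1 ⊗ v₀ ⊑ v₁ ⊞ v₂ ∷ []) (v₀ ⊟ v₁ ⊑ v₂) (p ∷ []))) ,
    (λ e → ≤-trans (≤-reflexive e) (linearℚ (a ∷ b ∷ ε ∷ []) (1 ⊗ v₁ ⊑ v₀ ⊞ v₂ ∷ []) (⊝ (v₀ ⊟ v₁) ⊑ v₂) (q ∷ []))) ]′ (∣p∣≡p∨∣p∣≡-p (a - b))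

  close⇒abs< : ∀ {ε a b} → 0ℚ < ε → Close (½ * ε) a b → ∣ a - b ∣ < ε
  close⇒abs< 0<ε c = ≤-<-trans (close⇒abs c) (½ε<ε 0<ε)

  ≈⇒close : ∀ {x y} → x ≈ y → ∀ {ε} → 0ℚ < ε → Closeᴿ ε x y
  ≈⇒close e {ε} 0<ε = ev-map (λ _ → abs⇒close) (e ε 0<ε)

  close⇒≈ : ∀ {x y} → (∀ {ε} → 0ℚ < ε → Closeᴿ ε x y) → x ≈ y
  close⇒≈ c ε 0<ε = ev-map (λ _ → close⇒abs< 0<ε) (c (½* 0<ε))

  steady : ∀ x {ε} → 0ℚ < ε → ∃ λ N → ∀ m n → N ℕ.≤ m → N ℕ.≤ n → Close ε (seq x m) (seq x n)
  steady x {ε} 0<ε = proj₁ (cauchy x ε 0<ε) , λ m n le le′ → abs⇒close (proj₂ (cauchy x ε 0<ε) m n le le′)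

  mkℝ : (f : ℕ → ℚ) → (∀ {ε} → 0ℚ < ε → ∃ λ N → ∀ m n → N ℕ.≤ m → N ℕ.≤ n → Close ε (f m) (f n)) → ℝ
  mkℝ f c .seq = f
  mkℝ f c .cauchy ε 0<ε = proj₁ (c (½* 0<ε)) , λ m n le le′ → close⇒abs< 0<ε (proj₂ (c (½* 0<ε)) m n le le′)

  ≡⇒≈ : ∀ {x y} → (∀ n → seq x n ≡ seq y n) → x ≈ y
  ≡⇒≈ {x} {y} e = close⇒≈ {x} {y} λ 0<ε → ev-always λ n → subst (Close _ (seq x n)) (e n) (close-refl (<⇒≤ 0<ε) (seq x n))

  ≈-refl : ∀ {x} → x ≈ x
  ≈-refl {x} = ≡⇒≈ {x} {x} λ _ → ≡.refl

  ≈-sym : ∀ {x y} → x ≈ y → y ≈ x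
  ≈-sym {x} {y} e = close⇒≈ {y} {x} λ 0<ε → ev-map (λ _ → close-sym) (≈⇒close {x} {y} e 0<ε)

  ≈-trans : ∀ {x y z} → x ≈ y → y ≈ z → x ≈ z
  ≈-trans {x} {y} {z} p q = close⇒≈ {x} {z} λ {ε} 0<ε → ev-map₂ (λ n c d → subst (λ η → Close η (seq x n) (seq z n)) (half-sum ε) (close-trans c d))
    (≈⇒close {x} {y} p (½* 0<ε)) (≈⇒close {y} {z} q (½* 0<ε))

  +-congᴿ : ∀ {x x′ y y′} → x ≈ x′ → y ≈ y′ → (x +ᴿ y) ≈ (x′ +ᴿ y′)
  +-congᴿ {x} {x′} {y} {y′} p q = close⇒≈ {x +ᴿ y} {x′ +ᴿ y′} λ {ε} 0<ε →
    ev-map₂ (λ n c d → subst (λ η → Close η (seq x n + seq y n) (seq x′ n + seq y′ n)) (half-sum ε) (close-+ c d))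
    (≈⇒close {x} {x′} p (½* 0<ε)) (≈⇒close {y} {y′} q (½* 0<ε))

  -- One comparison of sufficiently late approximations decides: if it is violated by three eighths
  -- of ε, then x exceeds y by an eighth from there on, which the hypothesis forbids.
  ≤⇒close : ∀ {x y} → x ≤ᴿ y → ∀ {ε} → 0ℚ < ε → Eventually (λ n → seq x n ≤ seq y n + ε)
  ≤⇒close {x} {y} x≤y {ε} 0<ε = decide (seq x N ≤? seq y N + (η + η + η))
    where
    η : ℚ
    η = ⅛ * ε
    0<η : 0ℚ < η
    0<η = ⅛* 0<ε
    N : ℕ
    N = proj₁ (steady x 0<η) ℕ.⊔ proj₁ (steady y 0<η)
    cx : ∀ n → N ℕ.≤ n → Close η (seq x N) (seq x n)
    cx n le = proj₂ (steady x 0<η) N n (ℕₚ.m≤m⊔n _ _) (ℕₚ.≤-trans (ℕₚ.m≤m⊔n _ _) le)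
    cy : ∀ n → N ℕ.≤ n → Close η (seq y N) (seq y n)
    cy n le = proj₂ (steady y 0<η) N n (ℕₚ.m≤n⊔m (proj₁ (steady x 0<η)) _) (ℕₚ.≤-trans (ℕₚ.m≤n⊔m (proj₁ (steady x 0<η)) _) le)
    decide : Dec (seq x N ≤ seq y N + (η + η + η)) → Eventually (λ n → seq x n ≤ seq y n + ε)
    decide (yes p) = N , λ n le → linearℚ (seq x N ∷ seq y N ∷ seq x n ∷ seq y n ∷ ε ∷ [])
      (1 ⊗ v₀ ⊑ v₁ ⊞ (⅛ ⊠ v₄ ⊞ ⅛ ⊠ v₄ ⊞ ⅛ ⊠ v₄) ∷ 1 ⊗ v₂ ⊑ v₀ ⊞ ⅛ ⊠ v₄ ∷ 1 ⊗ v₁ ⊑ v₃ ⊞ ⅛ ⊠ v₄ ∷ 3 ⊗ con 0ℚ ⊑ ⅛ ⊠ v₄ ∷ []) (v₂ ⊑ v₃ ⊞ v₄)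
      (p ∷ lower (cx n le) ∷ upper (cy n le) ∷ <⇒≤ 0<η ∷ [])
    decide (no p) = ⊥-elim (x≤y (η , 0<η , N , λ n le → linearℚ (seq x N ∷ seq y N ∷ seq x n ∷ seq y n ∷ η ∷ [])
      (1 ⊗ v₁ ⊞ (v₄ ⊞ v₄ ⊞ v₄) ⊑ v₀ ∷ 1 ⊗ v₀ ⊑ v₂ ⊞ v₄ ∷ 1 ⊗ v₃ ⊑ v₁ ⊞ v₄ ∷ []) (v₃ ⊞ v₄ ⊑ v₂) (<⇒≤ (≰⇒> p) ∷ upper (cx n le) ∷ lower (cy n le) ∷ [])))

  close⇒≤ : ∀ {x y} → (∀ {ε} → 0ℚ < ε → Eventually (λ n → seq x n ≤ seq y n + ε)) → x ≤ᴿ y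
  close⇒≤ {x} {y} c (ε , 0<ε , lt) = <-irrefl ≡.refl (<-≤-trans (½* 0<ε) (ev-sat (ev-map₂ (λ n p q → linearℚ (seq x n ∷ seq y n ∷ ε ∷ [])
    (1 ⊗ v₁ ⊞ v₂ ⊑ v₀ ∷ 1 ⊗ v₀ ⊑ v₁ ⊞ ½ ⊠ v₂ ∷ []) (½ ⊠ v₂ ⊑ con 0ℚ) (p ∷ q ∷ [])) lt (c (½* 0<ε)))))

  ≤-resp : ∀ {x y x′ y′} → x ≈ x′ → y ≈ y′ → x ≤ᴿ y → x′ ≤ᴿ y′
  ≤-resp {x} {y} {x′} {y′} p q le = close⇒≤ {x′} {y′} λ {ε} 0<ε → ev-map₂ (λ n c (d , e) → linearℚ (seq x n ∷ seq y n ∷ seq x′ n ∷ seq y′ n ∷ ε ∷ [])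
    (1 ⊗ v₀ ⊑ v₁ ⊞ ⅛ ⊠ v₄ ∷ 1 ⊗ v₂ ⊑ v₀ ⊞ ⅛ ⊠ v₄ ∷ 1 ⊗ v₁ ⊑ v₃ ⊞ ⅛ ⊠ v₄ ∷ 5 ⊗ con 0ℚ ⊑ ⅛ ⊠ v₄ ∷ []) (v₂ ⊑ v₃ ⊞ v₄)
      (c ∷ lower d ∷ upper e ∷ <⇒≤ (⅛* 0<ε) ∷ []))
    (≤⇒close {x} {y} le (⅛* 0<ε)) (ev-∧ (≈⇒close {x} {x′} p (⅛* 0<ε)) (≈⇒close {y} {y′} q (⅛* 0<ε)))

  ≮0⇒≈0 : ∀ {x} → 0ℝ ≤ᴿ x → ¬ (0ℝ <ᴿ x) → x ≈ 0ℝ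
  ≮0⇒≈0 {x} 0≤x x≤0 = close⇒≈ {x} {0ℝ} λ 0<ε → ev-map₂ (λ n p q → p ⇆ q) (≤⇒close {x} {0ℝ} x≤0 0<ε) (≤⇒close {0ℝ} {x} 0≤x 0<ε)

  ≈0⇒≮0 : ∀ {x} → x ≈ 0ℝ → ¬ (0ℝ <ᴿ x)
  ≈0⇒≮0 {x} e = close⇒≤ {x} {0ℝ} λ 0<ε → ev-map (λ _ → upper) (≈⇒close {x} {0ℝ} e 0<ε)

  -- The substitute for comparing `z` with `a`: two overlapping alternatives, decided by a single
  -- approximation.
  split : ∀ z a {η} → 0ℚ < η → Eventually (λ n → seq z n ≤ a + (η + η)) ⊎ Eventually (λ n → a ≤ seq z n)
  split z a {η} 0<η = decide (seq z N ≤? a + η)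
    where
    N : ℕ
    N = proj₁ (steady z 0<η)
    decide : Dec (seq z N ≤ a + η) → Eventually (λ n → seq z n ≤ a + (η + η)) ⊎ Eventually (λ n → a ≤ seq z n)
    decide (yes p) = inj₁ (N , λ n le → linearℚ (seq z N ∷ seq z n ∷ a ∷ η ∷ []) (1 ⊗ v₀ ⊑ v₂ ⊞ v₃ ∷ 1 ⊗ v₁ ⊑ v₀ ⊞ v₃ ∷ []) (v₁ ⊑ v₂ ⊞ (v₃ ⊞ v₃))
      (p ∷ lower (proj₂ (steady z 0<η) N n ℕₚ.≤-refl le) ∷ []))
    decide (no p) = inj₂ (N , λ n le → linearℚ (seq z N ∷ seq z n ∷ a ∷ η ∷ []) (1 ⊗ v₂ ⊞ v₃ ⊑ v₀ ∷ 1 ⊗ v₀ ⊑ v₁ ⊞ v₃ ∷ []) (v₂ ⊑ v₁)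
      (<⇒≤ (≰⇒> p) ∷ upper (proj₂ (steady z 0<η) N n ℕₚ.≤-refl le) ∷ []))

  near⇒close : ∀ {ε} x y → ∣ x - y ∣< ε → Closeᴿ ε x y
  near⇒close {ε} x y ((η , 0<η , p) , (θ , 0<θ , q)) = ev-map₂ (λ n c d → drop (seq x n) (seq y n) η 0<η c ⇆ drop (seq y n) (seq x n) θ 0<θ d) p q
    where
    drop : ∀ a b η → 0ℚ < η → a + η ≤ b + ε → a ≤ b + ε
    drop a b η 0<η le = linearℚ (a ∷ b ∷ η ∷ ε ∷ []) (1 ⊗ v₀ ⊞ v₂ ⊑ v₁ ⊞ v₃ ∷ 1 ⊗ con 0ℚ ⊑ v₂ ∷ []) (v₀ ⊑ v₁ ⊞ v₃) (le ∷ <⇒≤ 0<η ∷ [])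

  close⇒near : ∀ {ε} x y → 0ℚ < ε → Closeᴿ (½ * ε) x y → ∣ x - y ∣< ε
  close⇒near {ε} x y 0<ε c = (½ * ε , ½* 0<ε , ev-map (λ n c → raise (seq x n) (seq y n) (upper c)) c) , (½ * ε , ½* 0<ε , ev-map (λ n c → raise (seq y n) (seq x n) (lower c)) c)
    where
    raise : ∀ a b → a ≤ b + ½ * ε → a + ½ * ε ≤ b + ε
    raise a b le = linearℚ (a ∷ b ∷ ε ∷ []) (1 ⊗ v₀ ⊑ v₁ ⊞ ½ ⊠ v₂ ∷ []) (v₀ ⊞ ½ ⊠ v₂ ⊑ v₁ ⊞ v₂) (le ∷ [])

  module _ {V : Set} (_≟_ : DecidableEquality V) (f : V → ℝ) where
    open DecMembership _≟_ using (_∈?_)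

    total-of : List V → ℝ
    total-of L = sumℝ (map f L)

    sum-↭ : ∀ {L M} → L ↭ M → total-of L ≈ total-of M
    sum-↭ {L} {M} refl = ≈-refl {total-of L}
    sum-↭ (prep {L} {M} v p) = +-congᴿ {f v} {f v} {total-of L} {total-of M} (≈-refl {f v}) (sum-↭ p)
    sum-↭ (swap {L} {M} u v p) = ≈-trans {f u +ᴿ (f v +ᴿ total-of L)} {f v +ᴿ (f u +ᴿ total-of L)} {f v +ᴿ (f u +ᴿ total-of M)}
      (≡⇒≈ {f u +ᴿ (f v +ᴿ total-of L)} {f v +ᴿ (f u +ᴿ total-of L)} λ n → exchange (seq (f u) n) (seq (f v) n) (seq (total-of L) n))
      (+-congᴿ {f v} {f v} {f u +ᴿ total-of L} {f u +ᴿ total-of M} (≈-refl {f v}) (+-congᴿ {f u} {f u} {total-of L} {total-of M} (≈-refl {f u}) (sum-↭ p)))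
      where
      exchange : ∀ a b c → a + (b + c) ≡ b + (a + c)
      exchange = solve 3 (λ a b c → a :+ (b :+ c) := b :+ (a :+ c)) ≡.refl
        where open +-*-Solver
    sum-↭ (trans {L} {M} {N} p q) = ≈-trans {total-of L} {total-of M} {total-of N} (sum-↭ p) (sum-↭ q)

    sum-filter : ∀ {P : V → Set} (P? : Decidable P) L → (∀ {v} → v ∈ L → ¬ P v → f v ≈ 0ℝ) → total-of (filter P? L) ≈ total-of L
    sum-filter P? []      z = ≈-refl {0ℝ}
    sum-filter P? (v ∷ L) z with P? v
    ... | yes _ = +-congᴿ {f v} {f v} {total-of (filter P? L)} {total-of L} (≈-refl {f v}) (sum-filter P? L (λ v∈ → z (there v∈)))
    ... | no ¬P = ≈-trans {total-of (filter P? L)} {0ℝ +ᴿ total-of (filter P? L)} {f v +ᴿ total-of L}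
      (≡⇒≈ {total-of (filter P? L)} {0ℝ +ᴿ total-of (filter P? L)} (λ n → sym (+-identityˡ (seq (total-of (filter P? L)) n))))
      (+-congᴿ {0ℝ} {f v} {total-of (filter P? L)} {total-of L} (≈-sym {f v} {0ℝ} (z (here ≡.refl) ¬P)) (sum-filter P? L (λ v∈ → z (there v∈))))

    -- Both sums reduce to the common entries. Without repetitions, the two lists of common entries
    -- are permutations of each other.
    sum-support : ∀ {L M} → Unique L → Unique M → (∀ v → v ∉ L → f v ≈ 0ℝ) → (∀ v → v ∉ M → f v ≈ 0ℝ) → total-of L ≈ total-of M
    sum-support {L} {M} uL uM zL zM = ≈-trans {total-of L} {total-of (filter (_∈? M) L)} {total-of M}
      (≈-sym {total-of (filter (_∈? M) L)} {total-of L} (sum-filter (_∈? M) L (λ _ → zM _)))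
      (≈-trans {total-of (filter (_∈? M) L)} {total-of (filter (_∈? L) M)} {total-of M}
        (sum-↭ (∼bag⇒↭ (unique∧set⇒bag (filter⁺ (_∈? M) uL) (filter⁺ (_∈? L) uM)
          (mk⇔ (λ v∈ → let (a , b) = ∈-filter⁻ (_∈? M) v∈ in ∈-filter⁺ (_∈? L) b a) (λ v∈ → let (a , b) = ∈-filter⁻ (_∈? L) v∈ in ∈-filter⁺ (_∈? M) b a)))))
        (sum-filter (_∈? L) M (λ _ → zL _)))

    ≤-total-of : (∀ v → 0ℝ ≤ᴿ f v) → ∀ {L v} → v ∈ L → f v ≤ᴿ total-of L
    ≤-total-of 0≤f {u ∷ L} (here ≡.refl) = close⇒≤ {f u} {f u +ᴿ total-of L} λ {ε} 0<ε → ev-map (λ n p →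
        linearℚ (seq (f u) n ∷ seq (total-of L) n ∷ ε ∷ []) (1 ⊗ con 0ℚ ⊑ v₁ ⊞ v₂ ∷ []) (v₀ ⊑ v₀ ⊞ v₁ ⊞ v₂) (p ∷ [])) (≤⇒close {0ℝ} {total-of L} (0≤sum L) 0<ε)
      where
      0≤sum : ∀ L → 0ℝ ≤ᴿ total-of L
      0≤sum []      = close⇒≤ {0ℝ} {0ℝ} λ 0<ε → ev-always λ _ → <⇒≤ (<-≤-trans 0<ε (≤-reflexive (sym (+-identityˡ _))))
      0≤sum (v ∷ L) = close⇒≤ {0ℝ} {f v +ᴿ total-of L} λ {ε} 0<ε → ev-map₂ (λ n p q →
        linearℚ (seq (f v) n ∷ seq (total-of L) n ∷ ε ∷ []) (1 ⊗ con 0ℚ ⊑ v₀ ⊞ ½ ⊠ v₂ ∷ 1 ⊗ con 0ℚ ⊑ v₁ ⊞ ½ ⊠ v₂ ∷ []) (con 0ℚ ⊑ v₀ ⊞ v₁ ⊞ v₂) (p ∷ q ∷ []))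
        (≤⇒close {0ℝ} {f v} (0≤f v) (½* 0<ε)) (≤⇒close {0ℝ} {total-of L} (0≤sum L) (½* 0<ε))
    ≤-total-of 0≤f {u ∷ L} {v} (there v∈) = close⇒≤ {f v} {f u +ᴿ total-of L} λ {ε} 0<ε → ev-map₂ (λ n p q →
        linearℚ (seq (f v) n ∷ seq (f u) n ∷ seq (total-of L) n ∷ ε ∷ []) (1 ⊗ con 0ℚ ⊑ v₁ ⊞ ½ ⊠ v₃ ∷ 1 ⊗ v₀ ⊑ v₂ ⊞ ½ ⊠ v₃ ∷ []) (v₀ ⊑ v₁ ⊞ v₂ ⊞ v₃) (p ∷ q ∷ []))
        (≤⇒close {0ℝ} {f u} (0≤f u) (½* 0<ε)) (≤⇒close {f v} {total-of L} (≤-total-of 0≤f v∈) (½* 0<ε))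

-- One push on real coordinates, and its time interval

module Steps where
  open LinearArithmetic
  open Pushing
  open Reals
  open ℚ-Linear using () renaming (linear to linearℚ)
  open import Defs using (ℝ; seq; _≈_; 0ℝ; 1ℝ) renaming (_<_ to _<ᴿ_; _≤_ to _≤ᴿ_; _+_ to _+ᴿ_)
  open import Data.Nat using (ℕ; zero; suc)
  import Data.Nat as ℕ
  import Data.Nat.Properties as ℕₚ
  open import Data.Integer using (+_)
  open import Data.Rational
  open import Data.Rational.Properties
  open import Data.List using (List; []; _∷_)
  open import Data.List.Membership.Propositional using (_∈_; _∉_)
  open import Data.List.Relation.Unary.All using ([]; _∷_)
  open import Data.Product using (∃; _×_; _,_; proj₁; proj₂)
  open import Data.Sum using (_⊎_; inj₁; inj₂; [_,_]′)
  open import Data.Empty using (⊥-elim)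
  open import Relation.Nullary using (¬_)
  open import Relation.Binary.Definitions using (DecidableEquality)
  open import Relation.Binary.PropositionalEquality using (_≡_; _≢_; refl; trans; sym; cong; subst)

  clamp-pos : ∀ {p q} → 0ℚ < q → q ≤ clamp p → q ≤ p
  clamp-pos {p} {q} 0<q q≤ = [ (λ e → ⊥-elim (<-irrefl refl (<-≤-trans 0<q (≤-trans q≤ (≤-reflexive e))))) ,
    (λ e → ≤-trans q≤ (≤-trans (≤-reflexive e) (p⊓q≤p p 1ℚ))) ]′ (⊔-sel 0ℚ (p ⊓ 1ℚ))

  clamp-0 : ∀ {ε p} → 0ℚ ≤ ε → Close ε p 0ℚ → clamp p ≤ ε
  clamp-0 {ε} 0≤ε (p≤ ⇆ _) = clamp≤ 0≤ε (≤-trans p≤ (≤-reflexive (+-identityˡ ε)))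

  clamp-close-id : ∀ {ε} p → 0ℚ ≤ ε → 0ℚ ≤ p + ε → p ≤ 1ℚ + ε → Close ε (clamp p) p
  clamp-close-id {ε} p 0≤ε 0≤p+ε p≤ = ⊔-lub 0≤p+ε (≤-trans (p⊓q≤p p 1ℚ) (upper (close-refl 0≤ε p))) ⇆
    [ (λ 1≤p → ≤-trans p≤ (+-monoˡ-≤ ε (≤-trans (⊓-glb 1≤p ≤-refl) (p≤q⊔p 0ℚ (p ⊓ 1ℚ))))) ,
      (λ p≤1 → ≤-trans (≤-trans (⊓-glb ≤-refl p≤1) (p≤q⊔p 0ℚ (p ⊓ 1ℚ))) (upper (close-refl 0≤ε (clamp p)))) ]′ (≤-total 1ℚ p)

  record InUnit (x : ℝ) : Set where
    constructor _⋯_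
    field
      above : 0ℝ ≤ᴿ x
      below : x ≤ᴿ 1ℝ

  clamp-unit : ∀ {x} → InUnit x → ∀ {ε} → 0ℚ < ε → Eventually (λ n → Close ε (clamp (seq x n)) (seq x n))
  clamp-unit {x} (a ⋯ b) 0<ε = ev-map₂ (λ n p q → clamp-close-id (seq x n) (<⇒≤ 0<ε) p q) (≤⇒close {0ℝ} {x} a 0<ε) (≤⇒close {x} {1ℝ} b 0<ε)

  module StepAt {V : Set} (_≟_ : DecidableEquality V) (A : List V) (w : V) where
    open Push _≟_ A w public

    at : (V → ℝ) → ℕ → V → ℚ
    at x n v = seq (x v) n

    private
      steady-all : ∀ (x : V → ℝ) L {ε} → 0ℚ < ε → ∃ λ N → ∀ m n → N ℕ.≤ m → N ℕ.≤ n → ∀ a → a ∈ L → Close ε (at x m a) (at x n a)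
      steady-all x L {ε} 0<ε = proj₁ ev , λ m n le le′ a a∈ → proj₂ ev (proj₁ ev) ℕₚ.≤-refl a a∈ m n le le′
        where
        P : V → ℕ → Set
        P a N = ∀ m n → N ℕ.≤ m → N ℕ.≤ n → Close ε (at x m a) (at x n a)
        ev : Eventually (λ N → ∀ a → a ∈ L → P a N)
        ev = ev-all {P = P} L λ {a} _ → proj₁ (steady (x a) 0<ε) , λ N le m n l l′ → proj₂ (steady (x a) 0<ε) m n (ℕₚ.≤-trans le l) (ℕₚ.≤-trans le l′)

      steady-both : ∀ (x : V → ℝ) s L {ε} → 0ℚ < ε → ∃ λ N → ∀ m n → N ℕ.≤ m → N ℕ.≤ n → (∀ {a} → a ∈ L → Close ε (at x m a) (at x n a)) × Close ε (seq s m) (seq s n)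
      steady-both x s L 0<ε = M ℕ.⊔ N , λ m n l l′ →
        (λ a∈ → proj₂ (steady-all x L 0<ε) m n (ℕₚ.≤-trans (ℕₚ.m≤m⊔n M N) l) (ℕₚ.≤-trans (ℕₚ.m≤m⊔n M N) l′) _ a∈) ,
        proj₂ (steady s 0<ε) m n (ℕₚ.≤-trans (ℕₚ.m≤n⊔m M N) l) (ℕₚ.≤-trans (ℕₚ.m≤n⊔m M N) l′)
        where
        M = proj₁ (steady-all x L 0<ε)
        N = proj₁ (steady s 0<ε)

    step : (V → ℝ) → ℝ → V → ℝ
    step x s v = mkℝ (λ n → push (at x n) (seq s n) v) λ 0<ε → bound (shrink Lip 0≤Lip 0<ε)
      where
      bound : ∀ {ε} → (∃ λ η → 0ℚ < η × Lip * η ≤ ε × η ≤ ε) → ∃ λ N → ∀ m n → N ℕ.≤ m → N ℕ.≤ n → Close ε (push (at x m) (seq s m) v) (push (at x n) (seq s n) v)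
      bound (η , 0<η , le , _) = proj₁ (steady-both x s (v ∷ A) 0<η) , λ m n l l′ →
        let (c , d) = proj₂ (steady-both x s (v ∷ A) 0<η) m n l l′
        in close-mono le (push-close (<⇒≤ 0<η) {at x m} {at x n} {seq s m} {seq s n} v c d)

    smallest : (V → ℝ) → ℝ → ℝ
    smallest x s = mkℝ (λ n → μ (at x n) (seq s n)) λ 0<ε → proj₁ (steady-both x s A 0<ε) , λ m n l l′ →
      let (c , d) = proj₂ (steady-both x s A 0<ε) m n l l′ in μ-close (<⇒≤ 0<ε) c d

    smallest-close : ∀ {ε} → 0ℚ ≤ ε → ∀ {x y s t} → (∀ v → Closeᴿ ε (x v) (y v)) → Closeᴿ ε s t → Closeᴿ ε (smallest x s) (smallest y t)
    smallest-close {ε} 0≤ε {x} {y} c d = ev-map₂ (λ n c d → μ-close 0≤ε (c _) d) (ev-all {P = λ a n → Close ε (at x n a) (at y n a)} A (λ {a} _ → c a)) d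

    step-close : ∀ {ε} → 0ℚ ≤ ε → ∀ {x y s t} → (∀ v → Closeᴿ ε (x v) (y v)) → Closeᴿ ε s t → ∀ v → Closeᴿ (Lip * ε) (step x s v) (step y t v)
    step-close {ε} 0≤ε {x} {y} {s} {t} c d v = ev-map₂ (λ n c d → push-close 0≤ε {at x n} {at y n} {seq s n} {seq t n} v (c _) d)
      (ev-all {P = λ a n → Close ε (at x n a) (at y n a)} (v ∷ A) (λ {a} _ → c a)) d

    0≤step : ∀ x s v → 0ℝ ≤ᴿ step x s v
    0≤step x s v = close⇒≤ {0ℝ} {step x s v} λ 0<ε → ev-always λ n → ≤-trans (0≤push (at x n) (seq s n) v) (upper (close-refl (<⇒≤ 0<ε) (push (at x n) (seq s n) v)))

    -- A coordinate that is 0 can become positive only at `w`, and there only through the excess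
    -- over ½.
    step-vanishes : ∀ {x s v} → x v ≈ 0ℝ → v ≢ w ⊎ Eventually (λ n → κ * seq (smallest x s) n ≤ ½) → step x s v ≈ 0ℝ
    step-vanishes {x} {s} {v} x≈0 o = close⇒≈ {step x s v} {0ℝ} λ {ε} 0<ε → ev-map₂ (λ n p c →
        linearℚ (push (at x n) (seq s n) v ∷ clamp (at x n v) ∷ ε ∷ []) (1 ⊗ v₀ ⊑ 2ℚ ⊠ v₁ ∷ 2 ⊗ v₁ ⊑ ½ ⊠ v₂ ∷ []) (v₀ ⊑ con 0ℚ ⊞ v₂)
          (push≤-off (at x n) (seq s n) p ∷ clamp-0 (<⇒≤ (½* 0<ε)) c ∷ []) ⇆
        linearℚ (push (at x n) (seq s n) v ∷ ε ∷ []) (1 ⊗ con 0ℚ ⊑ v₀ ∷ 1 ⊗ con 0ℚ ⊑ v₁ ∷ []) (con 0ℚ ⊑ v₀ ⊞ v₁) (0≤push (at x n) (seq s n) v ∷ <⇒≤ 0<ε ∷ []))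
      (off o) (≈⇒close {x v} {0ℝ} x≈0 (½* 0<ε))
      where
      off : v ≢ w ⊎ Eventually (λ n → κ * seq (smallest x s) n ≤ ½) → Eventually (λ n → v ≢ w ⊎ κ * μ (at x n) (seq s n) ≤ ½)
      off (inj₁ ne) = ev-always λ _ → inj₁ ne
      off (inj₂ e)  = ev-map (λ _ → inj₂) e

    step-pos⁻ : ∀ {x s v} → v ≢ w → 0ℝ <ᴿ step x s v → 0ℝ <ᴿ x v
    step-pos⁻ {x} {s} {v} v≢w (ε , 0<ε , p) = ½ * ε , ½* 0<ε , ev-map (λ n le → ≤-trans (≤-reflexive (+-identityˡ (½ * ε))) (clamp-pos (½* 0<ε)
      (halve {push (at x n) (seq s n) v} {clamp (at x n v)} (push≤-off (at x n) (seq s n) (inj₁ v≢w)) le))) p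
      where
      halve : ∀ {a b} → a ≤ 2ℚ * b → 0ℚ + ε ≤ a → ½ * ε ≤ b
      halve {a} {b} p q = ≤-trans (*-monoˡ (nonNegative⁻¹ ½) (≤-trans (≤-reflexive (sym (+-identityˡ ε))) (≤-trans q p)))
        (≤-reflexive (trans (sym (*-assoc ½ 2ℚ b)) (*-identityˡ b)))

    Stationary : (V → ℝ) → ℝ → Set
    Stationary x s = ∀ {ε} → 0ℚ < ε → Eventually (λ n → μ (at x n) (seq s n) ≤ ε)

    stationary-time : ∀ {x s} → s ≈ 0ℝ → Stationary x s
    stationary-time {x} {s} e 0<ε = ev-map (λ n c → ≤-trans (μ≤s (at x n) (seq s n)) (clamp-0 (<⇒≤ 0<ε) c)) (≈⇒close {s} {0ℝ} e 0<ε)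

    stationary-point : ∀ {x s a} → a ∈ A → x a ≈ 0ℝ → Stationary x s
    stationary-point {x} {s} {a} a∈ e 0<ε = ev-map (λ n c → ≤-trans (μ≤at (at x n) (seq s n) a∈) (clamp-0 (<⇒≤ 0<ε) c)) (≈⇒close {x a} {0ℝ} e 0<ε)

    step-still : ∀ {x s} → (∀ v → InUnit (x v)) → Stationary x s → ∀ v → step x s v ≈ x v
    step-still {x} {s} unit small v = close⇒≈ {step x s v} {x v} λ {ε} 0<ε → bound 0<ε (shrink Lip 0≤Lip (½* 0<ε))
      where
      bound : ∀ {ε} → 0ℚ < ε → (∃ λ η → 0ℚ < η × Lip * η ≤ ½ * ε × η ≤ ½ * ε) → Closeᴿ ε (step x s v) (x v)
      bound {ε} 0<ε (η , 0<η , le , _) = ev-map₂ (λ n m c → subst (λ z → Close z (push (at x n) (seq s n) v) (at x n v)) (half-sum ε)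
          (close-trans (close-mono le (subst (Close (Lip * η) (push (at x n) (seq s n) v)) (push-still (at x n) v)
            (push-close′ (<⇒≤ 0<η) {at x n} {at x n} {seq s n} {0ℚ} v (close-refl (<⇒≤ 0<η) (clamp (at x n v))) (small-μ n m)))) c))
        (small 0<η) (clamp-unit {x v} (unit v) (½* 0<ε))
        where
        small-μ : ∀ n → μ (at x n) (seq s n) ≤ η → Close η (μ (at x n) (seq s n)) (μ (at x n) 0ℚ)
        small-μ n m = linearℚ (μ (at x n) (seq s n) ∷ μ (at x n) 0ℚ ∷ η ∷ []) (1 ⊗ v₀ ⊑ v₂ ∷ 1 ⊗ con 0ℚ ⊑ v₁ ∷ []) (v₀ ⊑ v₁ ⊞ v₂) (m ∷ 0≤μ (at x n) 0ℚ ∷ []) ⇆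
          linearℚ (μ (at x n) (seq s n) ∷ μ (at x n) 0ℚ ∷ η ∷ []) (1 ⊗ v₁ ⊑ con 0ℚ ∷ 1 ⊗ con 0ℚ ⊑ v₀ ∷ 1 ⊗ con 0ℚ ⊑ v₂ ∷ []) (v₁ ⊑ v₀ ⊞ v₂)
            (μ≤s (at x n) 0ℚ ∷ 0≤μ (at x n) (seq s n) ∷ <⇒≤ 0<η ∷ [])

    -- Which coordinate vanishes may change with the approximation, so none can be named. But if all
    -- were positive, they would be so at a common late index, where one of them is exactly 0.
    step-kills : ∀ {x s a₀} → a₀ ∈ A → w ∉ A → Eventually (λ n → 1ℚ ≤ seq s n) → ¬ (∀ {a} → a ∈ A → 0ℝ <ᴿ step x s a)
    step-kills {x} {s} a₀∈ w∉ late pos = ev-sat (ev-map₂ (λ n l ps → let (a , a∈ , e) = push-vanishes a₀∈ w∉ (at x n) (seq s n) l in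
        <-irrefl (sym e) (ps a a∈)) late (ev-all {P = λ a n → 0ℚ < push (at x n) (seq s n) a} A
          (λ a∈ → let (ε , 0<ε , p) = pos a∈ in ev-map (λ n le → <-≤-trans (<-≤-trans 0<ε (≤-reflexive (sym (+-identityˡ ε)))) le) p)))

    seq-total : ∀ (f : V → ℝ) L n → seq (total-of _≟_ f L) n ≡ sumOver L (λ v → seq (f v) n)
    seq-total f []      n = refl
    seq-total f (v ∷ L) n = cong (λ z → seq (f v) n + z) (seq-total f L n)

    sum-cong : ∀ {f g : V → ℝ} L → (∀ v → f v ≈ g v) → total-of _≟_ f L ≈ total-of _≟_ g L
    sum-cong         []      e = ≈-refl {0ℝ}
    sum-cong {f} {g} (v ∷ L) e = +-congᴿ {f v} {g v} {total-of _≟_ f L} {total-of _≟_ g L} (e v) (sum-cong L e)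

    step-total : ∀ {x s M} → w ∉ A → w ∉ M → (∀ {a} → a ∈ A → a ∉ M) → (∀ v → InUnit (x v)) →
                 total-of _≟_ x (domain M) ≈ 1ℝ → total-of _≟_ (step x s) (domain M) ≈ 1ℝ
    step-total {x} {s} {M} w∉A w∉M disjoint unit total = close⇒≈ {total-of _≟_ (step x s) Ω} {1ℝ} λ {ε} 0<ε →
        ev-map (λ n c → subst (λ z → Close ε z 1ℚ) (sym (seq-total (step x s) Ω n)) (bound n 0<ε (subst (λ z → Close (½ * ε) z 1ℚ)
          (trans (seq-total (step x 0ℝ) Ω n) (sumOver-cong Ω (λ {v} _ → push-still (at x n) v))) c)))
          (≈⇒close {total-of _≟_ (step x 0ℝ) Ω} {1ℝ} clamped (½* 0<ε))
      where
      Ω = domain M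
      clamped : total-of _≟_ (step x 0ℝ) Ω ≈ 1ℝ
      clamped = ≈-trans {total-of _≟_ (step x 0ℝ) Ω} {total-of _≟_ x Ω} {1ℝ}
        (sum-cong {step x 0ℝ} {x} Ω (step-still {x} {0ℝ} unit (stationary-time {x} {0ℝ} (≈-refl {0ℝ})))) total
      bound : ∀ n {ε} → 0ℚ < ε → Close (½ * ε) (sumOver Ω (λ v → clamp (at x n v))) 1ℚ → Close ε (sumOver Ω (push (at x n) (seq s n))) 1ℚ
      bound n {ε} 0<ε (p ⇆ q) =
        linearℚ (T ∷ i * (S - 1ℚ) ∷ i * (½ * ε) ∷ ε ∷ []) (1 ⊗ v₀ ⊟ con 1ℚ ⊑ v₁ ∷ 1 ⊗ v₁ ⊑ v₂ ∷ 1 ⊗ v₂ ⊑ 2ℚ ⊠ ½ ⊠ v₃ ∷ []) (v₀ ⊑ con 1ℚ ⊞ v₃)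
          (≤-reflexive eq ∷ *-monoˡ (0≤ι (h (at x n) (seq s n))) (linearℚ (S ∷ ε ∷ []) (1 ⊗ v₀ ⊑ con 1ℚ ⊞ ½ ⊠ v₁ ∷ []) (v₀ ⊟ con 1ℚ ⊑ ½ ⊠ v₁) (p ∷ [])) ∷ i½ε ∷ []) ⇆
        linearℚ (T ∷ i * (S - 1ℚ) ∷ i * (1ℚ - S) ∷ i * (½ * ε) ∷ ε ∷ []) (1 ⊗ v₁ ⊑ v₀ ⊟ con 1ℚ ∷ 1 ⊗ ⊝ v₂ ⊑ v₁ ∷ 1 ⊗ v₂ ⊑ v₃ ∷ 1 ⊗ v₃ ⊑ 2ℚ ⊠ ½ ⊠ v₄ ∷ []) (con 1ℚ ⊑ v₀ ⊞ v₄)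
          (≤-reflexive (sym eq) ∷ ≤-reflexive flip ∷ *-monoˡ (0≤ι (h (at x n) (seq s n))) (linearℚ (S ∷ ε ∷ []) (1 ⊗ con 1ℚ ⊑ v₀ ⊞ ½ ⊠ v₁ ∷ []) (con 1ℚ ⊟ v₀ ⊑ ½ ⊠ v₁) (q ∷ [])) ∷ i½ε ∷ [])
        where
        i = ι (h (at x n) (seq s n))
        S = sumOver Ω (λ v → clamp (at x n v))
        T = sumOver Ω (push (at x n) (seq s n))
        eq : T - 1ℚ ≡ i * (S - 1ℚ)
        eq = sum-push Ω (at x n) (seq s n) (sum-1A w∉A w∉M disjoint) (sum-1w w∉A w∉M disjoint)
        i½ε : i * (½ * ε) ≤ 2ℚ * (½ * ε)
        i½ε = *-monoʳ (<⇒≤ (½* 0<ε)) (ι≤2 (h (at x n) (seq s n)))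
        flip : - (i * (1ℚ - S)) ≡ i * (S - 1ℚ)
        flip = trans (neg-distribʳ-* i (1ℚ - S)) (cong (i *_) (trans (neg-distrib-+ 1ℚ (- S)) (trans (cong (λ z → - 1ℚ + z) (neg-involutive′ S)) (+-comm (- 1ℚ) S))))
          where
          neg-involutive′ : ∀ p → - (- p) ≡ p
          neg-involutive′ p = ≤-antisym (linearℚ (p ∷ []) [] (⊝ (⊝ v₀) ⊑ v₀) []) (linearℚ (p ∷ []) [] (v₀ ⊑ ⊝ (⊝ v₀)) [])

  -- The i-th collapse takes place while 3 ≤ 2ⁱ⁺² t ≤ 4, so later indices are finished before earlier ones begin.
  rate : ℕ → ℚ
  rate zero    = 4ℚ
  rate (suc i) = rate i + rate i

  3ℚ : ℚ
  3ℚ = + 3 / 1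

  4≤rate : ∀ i → 4ℚ ≤ rate i
  4≤rate zero    = ≤-refl
  4≤rate (suc i) = linearℚ (rate i ∷ []) (2 ⊗ con 4ℚ ⊑ v₀ ∷ []) (con 4ℚ ⊑ v₀ ⊞ v₀) (4≤rate i ∷ [])

  0≤rate : ∀ i → 0ℚ ≤ rate i
  0≤rate i = ≤-trans (nonNegative⁻¹ 4ℚ) (4≤rate i)

  ramp : ℕ → ℚ → ℚ
  ramp i q = clamp (rate i * q - 3ℚ)

  ramp-close : ∀ i {ε} → 0ℚ ≤ ε → ∀ {p q} → Close ε p q → Close (rate i * ε) (ramp i p) (ramp i q)
  ramp-close i {ε} 0≤ε c = clamp-close (0≤* (0≤rate i) 0≤ε) (close-mono (≤-reflexive (+-identityʳ (rate i * ε)))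
    (close-+ (close-scale (rate i) (0≤rate i) c) (close-refl ≤-refl (- 3ℚ))))

  rampᴿ : ℕ → ℝ → ℝ
  rampᴿ i t = mkℝ (λ n → ramp i (seq t n)) λ 0<ε → bound (shrink (rate i) (0≤rate i) 0<ε)
    where
    bound : ∀ {ε} → (∃ λ η → 0ℚ < η × rate i * η ≤ ε × η ≤ ε) → ∃ λ N → ∀ m n → N ℕ.≤ m → N ℕ.≤ n → Close ε (ramp i (seq t m)) (ramp i (seq t n))
    bound (η , 0<η , le , _) = proj₁ (steady t 0<η) , λ m n l l′ → close-mono le (ramp-close i (<⇒≤ 0<η) (proj₂ (steady t 0<η) m n l l′))

  ramp-closeᴿ : ∀ i {ε} → 0ℚ ≤ ε → ∀ {s t} → Closeᴿ ε s t → Closeᴿ (rate i * ε) (rampᴿ i s) (rampᴿ i t)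
  ramp-closeᴿ i 0≤ε = ev-map (λ n → ramp-close i 0≤ε)

  ramp-0 : ∀ i → rampᴿ i 0ℝ ≈ 0ℝ
  ramp-0 i = ≡⇒≈ {rampᴿ i 0ℝ} {0ℝ} λ n → cong (λ z → clamp (z - 3ℚ)) (*-zeroʳ (rate i))

  1≤clamp : ∀ {p} → 1ℚ ≤ p → 1ℚ ≤ clamp p
  1≤clamp {p} 1≤p = ≤-trans (⊓-glb 1≤p ≤-refl) (p≤q⊔p 0ℚ (p ⊓ 1ℚ))

  ramp-1 : ∀ i n → 1ℚ ≤ seq (rampᴿ i 1ℝ) n
  ramp-1 i n = 1≤clamp (linearℚ (rate i * 1ℚ ∷ rate i ∷ []) (1 ⊗ v₁ ⊑ v₀ ∷ 1 ⊗ con 4ℚ ⊑ v₁ ∷ []) (con 1ℚ ⊑ v₀ ⊟ con 3ℚ) (≤-reflexive (sym (*-identityʳ (rate i))) ∷ 4≤rate i ∷ []))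

  -- The `i`-th ramp is positive only when `rate i` * t ≥ 3, and each later rate is at least twice
  -- as large, so its ramp has passed 4.
  ramp-later : ∀ {i j t} → i ℕ.< j → 0ℝ <ᴿ rampᴿ i t → Eventually (λ n → 1ℚ ≤ seq (rampᴿ j t) n)
  ramp-later {i} {j} {t} i<j (ε , 0<ε , p) = ev-map (λ n le → 1≤clamp
      (later (seq t n) i<j (≤-trans (linearℚ (rate i * seq t n ∷ []) (1 ⊗ con 0ℚ ⊑ v₀ ⊟ con 3ℚ ∷ []) (con 3ℚ ⊑ v₀)
        (≤-trans (<⇒≤ 0<ε) (clamp-pos 0<ε (≤-trans (≤-reflexive (sym (+-identityˡ ε))) le)) ∷ [])) ≤-refl))) p
    where
    double : ∀ i q → 3ℚ ≤ rate i * q → 4ℚ ≤ rate (suc i) * q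
    double i q le = linearℚ (rate i * q ∷ rate (suc i) * q ∷ []) (2 ⊗ con 3ℚ ⊑ v₀ ∷ 1 ⊗ v₀ ⊞ v₀ ⊑ v₁ ∷ []) (con 4ℚ ⊑ v₁) (le ∷ ≤-reflexive (sym (*-distribʳ-+ q (rate i) (rate i))) ∷ [])
    later′ : ∀ q {i j} → i ℕ.<′ j → 3ℚ ≤ rate i * q → 4ℚ ≤ rate j * q
    later′ q {i} ℕ.≤′-refl     le = double i q le
    later′ q {i} (ℕ.≤′-step {j} l) le = double j q (≤-trans (linearℚ [] [] (con 3ℚ ⊑ con 4ℚ) []) (later′ q l le))
    later : ∀ q {i j} → i ℕ.< j → 3ℚ ≤ rate i * q → 1ℚ ≤ rate j * q - 3ℚ
    later q {i} {j} l le = linearℚ (rate j * q ∷ []) (1 ⊗ con 4ℚ ⊑ v₀ ∷ []) (con 1ℚ ⊑ v₀ ⊟ con 3ℚ) (later′ q (ℕₚ.<⇒<′ l) le ∷ [])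

-- The deformation obtained from a sequence of collapses

module Collapses where
  open LinearArithmetic
  open Pushing
  open Reals
  open Steps
  open ℚ-Linear using () renaming (linear to linearℚ)
  open import Defs using (ℝ; seq; _≈_; 0ℝ; 1ℝ; I; val; 0I; 1I; SimplicialComplex; module Realisation; Contractible; VR; ∣_-_∣<_) renaming (_<_ to _<ᴿ_; _≤_ to _≤ᴿ_; _+_ to _+ᴿ_)
  open import Data.Nat using (ℕ; zero; suc)
  import Data.Nat as ℕ
  import Data.Nat.Properties as ℕₚ
  open import Data.Rational hiding (_≟_; truncate)
  open import Data.Rational.Properties hiding (_≟_)
  open import Data.List using (List; []; _∷_; [_]; _++_; filter; deduplicate)
  open import Data.List.Membership.Propositional using (_∈_; _∉_; find)
  open import Data.List.Membership.Propositional.Properties using (∈-filter⁺; ∈-filter⁻; ∈-++⁺ˡ; ∈-++⁺ʳ; ∈-++⁻; ∈-deduplicate⁺; ∈-deduplicate⁻)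
  open import Data.List.Relation.Binary.Subset.Propositional using (_⊆_)
  open import Data.List.Relation.Unary.Any using (here; there)
  open import Data.List.Relation.Unary.All using (All; []; _∷_; all?)
  import Data.List.Relation.Unary.All as All
  open import Data.List.Relation.Unary.All.Properties using (¬All⇒Any¬; ¬Any⇒All¬)
  open import Data.List.Relation.Unary.AllPairs using ([]; _∷_)
  open import Data.List.Relation.Unary.Unique.Propositional using (Unique)
  open import Data.List.Relation.Unary.Unique.Propositional.Properties using (filter⁺; ++⁺)
  import Data.List.Relation.Unary.Unique.DecPropositional.Properties as DecUnique
  import Data.List.Membership.DecPropositional as DecMembership
  open import Data.Product using (Σ; ∃; _×_; _,_; proj₁; proj₂)
  open import Data.Sum using (_⊎_; inj₁; inj₂; [_,_]′)
  open import Data.Empty using (⊥-elim)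
  open import Function.Metric.Nat using (IsMetric)
  open import Relation.Nullary using (¬_; Dec; yes; no; ¬?; _×-dec_)
  open import Relation.Binary.Definitions using (DecidableEquality)
  open import Relation.Binary.PropositionalEquality using (_≡_; _≢_; refl; trans; sym; cong; subst)

  -- Every simplex containing A i and no later A j spans a simplex with w i once the vertices outside its star are dropped.
  record Collapse {V : Set} (d : V → V → ℕ) (r : ℕ) : Set where
    field
      A         : ℕ → List V
      w         : ℕ → V
      unique    : ∀ i → Unique (A i)
      inhabited : ∀ i → ∃ (_∈ A i)
      cone      : ∀ i → (∀ {a b} → a ∈ A i → b ∈ A i → d a b ℕ.≤ r) → ∀ u → (∀ {a} → a ∈ A i → d u a ℕ.≤ r) → (∃ λ j → i ℕ.< j × A j ⊆ u ∷ A i) ⊎ d (w i) u ℕ.≤ r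
      fresh     : ∀ {i j} → i ℕ.≤ j → w i ∉ A j
      escape    : ∀ σ → ∃ λ N → ∀ j → N ℕ.≤ j → ∃ λ a → a ∈ A j × a ∉ σ
      base      : V
      isolate   : ∀ u → u ≢ base → ∃ λ j → A j ⊆ [ u ]

  module Deformation {V : Set} (_≟_ : DecidableEquality V) {d : V → V → ℕ} (isMetric : IsMetric _≡_ d) (r : ℕ) (collapse : Collapse d r) where
    open Collapse collapse renaming (unique to A-unique)
    open DecMembership _≟_ using (_∈?_)
    private K = VR isMetric r
    open SimplicialComplex K using (IsSimplex)
    open Realisation K

    module S i = StepAt _≟_ (A i) (w i)

    Pos : ℕ → (V → ℝ) → Set
    Pos j x = ∀ {a} → a ∈ A j → 0ℝ <ᴿ x a

    -- Kept apart from `Point`, so that a simplex need not be chosen for every intermediate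
    -- coordinate function.
    record In (τ : List V) (x : V → ℝ) : Set where
      constructor in-simplex
      field
        nonneg   : ∀ v → 0ℝ ≤ᴿ x v
        supported : ∀ v → v ∉ τ → x v ≈ 0ℝ
        sums     : total-of _≟_ x τ ≈ 1ℝ
    open In

    in-unit : ∀ {τ x} → In τ x → ∀ v → InUnit (x v)
    in-unit {τ} {x} p v = nonneg p v ⋯ below (v ∈? τ)
      where
      below : Dec (v ∈ τ) → x v ≤ᴿ 1ℝ
      below (yes v∈) = ≤-resp {x v} {total-of _≟_ x τ} {x v} {1ℝ} (≈-refl {x v}) (sums p) (≤-total-of _≟_ x (nonneg p) v∈)
      below (no v∉)  = ≤-resp {0ℝ} {1ℝ} {x v} {1ℝ} (≈-sym {x v} {0ℝ} (supported p v v∉)) (≈-refl {1ℝ}) (I.≤1 0I)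

    in-change : ∀ {τ τ′ x} → Unique τ → Unique τ′ → In τ x → (∀ v → v ∉ τ′ → x v ≈ 0ℝ) → In τ′ x
    in-change {τ} {τ′} {x} u u′ p z = in-simplex (nonneg p) z
      (≈-trans {total-of _≟_ x τ′} {total-of _≟_ x τ} {1ℝ} (sum-support _≟_ x u′ u z (supported p)) (sums p))

    -- The mass is counted over `w i`, `A i` and the remaining entries of `τ`, where `step-total`
    -- applies. As sums over repetition-free lists containing the support agree, `τ′` may then
    -- replace that list.
    in-step : ∀ {i τ τ′ x s} → Unique τ → Unique τ′ → In τ x → (∀ v → v ∉ τ′ → S.step i x s v ≈ 0ℝ) → In τ′ (S.step i x s)
    in-step {i} {τ} {τ′} {x} {s} u u′ p z = in-change uΩ u′ (in-simplex (S.0≤step i x s)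
        (λ v v∉ → S.step-vanishes i {x} {s} {v} (supported p v (outside v∉)) (inj₁ λ { refl → v∉ (here refl) }))
        (S.step-total i {x} {s} {M} (fresh ℕₚ.≤-refl) w∉M disjoint (in-unit p) (sums (in-change u uΩ p λ v v∉ → supported p v (outside v∉))))) z
      where
      P? : ∀ v → Dec (v ∉ A i × v ≢ w i)
      P? v = ¬? (v ∈? A i) ×-dec ¬? (v ≟ w i)
      M = filter P? τ
      w∉M : w i ∉ M
      w∉M w∈ = proj₂ (proj₂ (∈-filter⁻ P? {xs = τ} w∈)) refl
      disjoint : ∀ {a} → a ∈ A i → a ∉ M
      disjoint a∈ a∈M = proj₁ (proj₂ (∈-filter⁻ P? {xs = τ} a∈M)) a∈
      uΩ : Unique (S.domain i M)
      uΩ = ¬Any⇒All¬ (A i ++ M) (λ w∈ → [ fresh {i} ℕₚ.≤-refl , w∉M ]′ (∈-++⁻ (A i) w∈)) ∷ ++⁺ (A-unique i) (filter⁺ P? u) (λ (a∈ , a∈M) → disjoint a∈ a∈M)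
      outside : ∀ {v} → v ∉ S.domain i M → v ∉ τ
      outside {v} v∉ v∈ = v∉ (there (∈-++⁺ʳ (A i) (∈-filter⁺ P? v∈ ((λ a∈ → v∉ (there (∈-++⁺ˡ a∈))) , λ { refl → v∉ (here refl) }))))

    -- By `cone` a vertex u of a simplex around `A i` is in the star of `w i`, or u and `A i`
    -- together cover a later `A j`. Under this condition, while all of `A i` is positive, u has
    -- coordinate 0 in the second case.
    Active : ℕ → (V → ℝ) → ℝ → Set
    Active i x s = 0ℝ <ᴿ s → ∀ j → i ℕ.< j → ¬ Pos j x

    -- One simplex for all images of points near `x` in `τ`. Openness is tested on one closed
    -- simplex at a time, so continuity needs the same simplex for the whole neighbourhood.
    CarrierNear : (List V) → (V → ℝ) → ℝ → ((V → ℝ) → ℝ → Set) → ((V → ℝ) → ℝ → V → ℝ) → Set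
    CarrierNear τ x s P f = ∃ λ τ′ → Unique τ′ × IsSimplex τ′ × ∃ λ δ → 0ℚ < δ ×
      (∀ y t → In τ y → P y t → (∀ v → Closeᴿ δ (x v) (y v)) → Closeᴿ δ s t → In τ′ (f y t))

    -- If `τ` lacks a vertex of `A i`, nothing moves. Otherwise either the minimum stays positive
    -- nearby, and the image lives on `w i` and its star, or the removed mass stays at most ½ nearby
    -- and `τ` remains a carrier.
    carrier-step : ∀ i {τ} → Unique τ → IsSimplex τ → ∀ x s → CarrierNear τ x s (Active i) (S.step i)
    carrier-step i {τ} uτ (τ≢[] , diam) x s = missing (all? (_∈? τ) (A i))
      where
      κ = S.κ i
      -- With `κ` * `η` ≤ 1/16 the five `η` that occur in `small` stay below ½.
      η-spec = shrink κ {⅛ * ½} (S.0≤κ i) (positive⁻¹ (⅛ * ½))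
      η = proj₁ η-spec
      0<η : 0ℚ < η
      0<η = proj₁ (proj₂ η-spec)
      κη≤ : κ * η ≤ ⅛ * ½
      κη≤ = proj₁ (proj₂ (proj₂ η-spec))

      star : ∀ u → Dec (d (w i) u ℕ.≤ r × u ≢ w i)
      star u = (d (w i) u ℕ.≤? r) ×-dec ¬? (u ≟ w i)
      τ′ = w i ∷ filter star τ
      uτ′ : Unique τ′
      uτ′ = ¬Any⇒All¬ (filter star τ) (λ w∈ → proj₂ (proj₂ (∈-filter⁻ star {xs = τ} w∈)) refl) ∷ filter⁺ star uτ
      near-w : ∀ {u} → u ∈ τ′ → d (w i) u ℕ.≤ r
      near-w (here refl) = subst (ℕ._≤ r) (sym (IsMetric.≈⇒0 isMetric refl)) ℕ.z≤n
      near-w (there u∈)  = proj₁ (proj₂ (∈-filter⁻ star {xs = τ} u∈))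
      diam′ : ∀ {u v} → u ∈ τ′ → v ∈ τ′ → d u v ℕ.≤ r
      diam′ (here refl) v∈          = near-w v∈
      diam′ {u} (there u∈) (here refl) = subst (ℕ._≤ r) (IsMetric.sym isMetric (w i) u) (near-w (there u∈))
      diam′ (there u∈)  (there v∈)  = diam (proj₁ (∈-filter⁻ star {xs = τ} u∈)) (proj₁ (∈-filter⁻ star {xs = τ} v∈))

      large : (∀ {a} → a ∈ A i → a ∈ τ) → Eventually (λ n → η + η ≤ seq (S.smallest i x s) n) → CarrierNear τ x s (Active i) (S.step i)
      large A⊆τ big = τ′ , uτ′ , ((λ ()) , diam′) , η , 0<η , λ y t p active cx cs →
        in-step {i} {τ} {τ′} {y} {t} uτ uτ′ p (vanish y t p active (big-near y t cx cs))
        where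
        big-near : ∀ y t → (∀ v → Closeᴿ η (x v) (y v)) → Closeᴿ η s t → Eventually (λ n → η ≤ seq (S.smallest i y t) n)
        big-near y t cx cs = ev-map₂ (λ n p c → linearℚ (seq (S.smallest i x s) n ∷ seq (S.smallest i y t) n ∷ η ∷ [])
          (1 ⊗ v₂ ⊞ v₂ ⊑ v₀ ∷ 1 ⊗ v₀ ⊑ v₁ ⊞ v₂ ∷ []) (v₂ ⊑ v₁) (p ∷ upper c ∷ [])) big (S.smallest-close i (<⇒≤ 0<η) {x} {y} {s} {t} cx cs)
        module _ y t (p : In τ y) (active : Active i y t) (bigy : Eventually (λ n → η ≤ seq (S.smallest i y t) n)) where
          positive-by : ∀ z → (∀ n → seq (S.smallest i y t) n ≤ clamp (seq z n)) → 0ℝ <ᴿ z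
          positive-by z le = η , 0<η , ev-map (λ n q → ≤-trans (≤-reflexive (+-identityˡ η)) (clamp-pos 0<η (≤-trans q (le n)))) bigy
          posA : Pos i y
          posA {a} a∈ = positive-by (y a) λ n → S.μ≤at i (S.at i y n) (seq t n) a∈
          not-in-star : ∀ v → (∃ λ j → i ℕ.< j × A j ⊆ v ∷ A i) → y v ≈ 0ℝ
          not-in-star v (j , i<j , sub) = ≮0⇒≈0 {y v} (nonneg p v) λ 0<yv →
            active (positive-by t λ n → S.μ≤s i (S.at i y n) (seq t n)) j i<j λ a∈ → pick 0<yv (sub a∈)
            where
            pick : 0ℝ <ᴿ y v → ∀ {a} → a ∈ v ∷ A i → 0ℝ <ᴿ y a
            pick 0<yv (here refl) = 0<yv
            pick 0<yv (there a∈)  = posA a∈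
          vanish : ∀ v → v ∉ τ′ → S.step i y t v ≈ 0ℝ
          vanish v v∉ = S.step-vanishes i {y} {t} {v} (zero-at (v ∈? τ)) (inj₁ v≢w)
            where
            v≢w : v ≢ w i
            v≢w refl = v∉ (here refl)
            zero-at : Dec (v ∈ τ) → y v ≈ 0ℝ
            zero-at (no v∉τ) = supported p v v∉τ
            zero-at (yes v∈) = [ not-in-star v , (λ le → ⊥-elim (v∉ (there (∈-filter⁺ star v∈ (le , v≢w))))) ]′ (cone i (λ a∈ b∈ → diam (A⊆τ a∈) (A⊆τ b∈)) v λ a∈ → diam v∈ (A⊆τ a∈))

      small : Eventually (λ n → seq (S.smallest i x s) n ≤ η + η + (η + η)) → CarrierNear τ x s (Active i) (S.step i)
      small le = τ , uτ , (τ≢[] , diam) , η , 0<η , λ y t p _ cx cs → in-step {i} {τ} {τ} {y} {t} uτ uτ p λ v v∉ →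
        S.step-vanishes i {y} {t} {v} (supported p v v∉) (inj₂ (ev-map₂ (λ n q c → bound (seq (S.smallest i x s) n) (seq (S.smallest i y t) n) q (lower c))
          le (S.smallest-close i (<⇒≤ 0<η) {x} {y} {s} {t} cx cs)))
        where
        bound : ∀ a b → a ≤ η + η + (η + η) → b ≤ a + η → κ * b ≤ ½
        bound a b p q = ≤-trans (*-monoˡ (S.0≤κ i) (≤-trans q (+-monoˡ-≤ η p))) (linearℚ (κ * (η + η + (η + η) + η) ∷ κ * η ∷ [])
          (1 ⊗ v₀ ⊑ v₁ ⊞ v₁ ⊞ (v₁ ⊞ v₁) ⊞ v₁ ∷ 5 ⊗ v₁ ⊑ con (⅛ * ½) ∷ []) (v₀ ⊑ con ½) (≤-reflexive (distrib κ η) ∷ κη≤ ∷ []))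
          where
          distrib : ∀ k e → k * (e + e + (e + e) + e) ≡ k * e + k * e + (k * e + k * e) + k * e
          distrib k e = trans (*-distribˡ-+ k (e + e + (e + e)) e) (cong (λ z → z + k * e) (trans (*-distribˡ-+ k (e + e) (e + e)) (cong (λ z → z + z) (*-distribˡ-+ k e e))))

      missing : Dec (All (_∈ τ) (A i)) → CarrierNear τ x s (Active i) (S.step i)
      missing (yes A⊆τ) = [ small , large (All.lookup A⊆τ) ]′ (split (S.smallest i x s) (η + η) 0<η)
      missing (no ¬A⊆τ) = let (a , a∈ , a∉) = find (¬All⇒Any¬ (_∈? τ) (A i) ¬A⊆τ) in
        τ , uτ , (τ≢[] , diam) , 1ℚ , positive⁻¹ 1ℚ , λ y t p _ _ _ → in-step {i} {τ} {τ} {y} {t} uτ uτ p λ v v∉ →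
        ≈-trans {S.step i y t v} {y v} {0ℝ} (S.step-still i {y} {t} (in-unit p) (S.stationary-point i {y} {t} a∈ (supported p a a∉)) v) (supported p v v∉)

    -- The highest index acts first, in agreement with the ramps, which finish it first.
    comp : ℕ → (V → ℝ) → ℝ → V → ℝ
    comp zero    x t = x
    comp (suc N) x t = comp N (S.step N x (rampᴿ N t)) t

    record Modulus (ε : ℚ) (P : ℚ → Set) : Set where
      constructor modulus
      field
        δ    : ℚ
        0<δ  : 0ℚ < δ
        δ≤ε  : δ ≤ ε
        spec : P δ

    StepModulus CompModulus : ℕ → ℚ → ℚ → Set
    StepModulus i ε δ = ∀ x y s t → (∀ v → Closeᴿ δ (x v) (y v)) → Closeᴿ δ s t → ∀ v → Closeᴿ ε (S.step i x (rampᴿ i s) v) (S.step i y (rampᴿ i t) v)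
    CompModulus N ε δ = ∀ x y s t → (∀ v → Closeᴿ δ (x v) (y v)) → Closeᴿ δ s t → ∀ v → Closeᴿ ε (comp N x s v) (comp N y t v)

    close-monoᴿ : ∀ {ε δ} → ε ≤ δ → ∀ {x y} → Closeᴿ ε x y → Closeᴿ δ x y
    close-monoᴿ le = ev-map (λ _ → close-mono le)

    step-modulus : ∀ i {ε} → 0ℚ < ε → Modulus ε (StepModulus i ε)
    step-modulus i {ε} 0<ε = outer (shrink (S.Lip i) (S.0≤Lip i) 0<ε)
      where
      outer : (∃ λ η → 0ℚ < η × S.Lip i * η ≤ ε × η ≤ ε) → Modulus ε (StepModulus i ε)
      outer (η , 0<η , Lη≤ε , η≤ε) = inner (shrink (rate i) (0≤rate i) 0<η)
        where
        inner : (∃ λ δ → 0ℚ < δ × rate i * δ ≤ η × δ ≤ η) → Modulus ε (StepModulus i ε)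
        inner (δ , 0<δ , rδ≤η , δ≤η) = modulus δ 0<δ (≤-trans δ≤η η≤ε) λ x y s t c d v →
          close-monoᴿ Lη≤ε {S.step i x (rampᴿ i s) v} {S.step i y (rampᴿ i t) v}
            (S.step-close i (<⇒≤ 0<η) {x} {y} {rampᴿ i s} {rampᴿ i t} (λ v → close-monoᴿ δ≤η {x v} {y v} (c v))
              (close-monoᴿ rδ≤η {rampᴿ i s} {rampᴿ i t} (ramp-closeᴿ i (<⇒≤ 0<δ) {s} {t} d)) v)

    comp-modulus : ∀ N {ε} → 0ℚ < ε → Modulus ε (CompModulus N ε)
    comp-modulus zero    {ε} 0<ε = modulus ε 0<ε ≤-refl λ x y s t c d → c
    comp-modulus (suc N) {ε} 0<ε = outer (comp-modulus N 0<ε)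
      where
      outer : Modulus ε (CompModulus N ε) → Modulus ε (CompModulus (suc N) ε)
      outer (modulus η 0<η η≤ε f) = inner (step-modulus N 0<η)
        where
        inner : Modulus η (StepModulus N η) → Modulus ε (CompModulus (suc N) ε)
        inner (modulus δ 0<δ δ≤η g) = modulus δ 0<δ (≤-trans δ≤η η≤ε) λ x y s t c d →
          f (S.step N x (rampᴿ N s)) (S.step N y (rampᴿ N t)) s t (g x y s t c d) (close-monoᴿ δ≤η {s} {t} d)

    comp-cong : ∀ N {x y s t} → (∀ v → x v ≈ y v) → s ≈ t → ∀ v → comp N x s v ≈ comp N y t v
    comp-cong N {x} {y} {s} {t} p q v = close⇒≈ {comp N x s v} {comp N y t v} λ 0<ε → go (comp-modulus N 0<ε)
      where
      go : ∀ {ε} → Modulus ε (CompModulus N ε) → Closeᴿ ε (comp N x s v) (comp N y t v)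
      go (modulus δ 0<δ _ f) = f x y s t (λ v → ≈⇒close {x v} {y v} (p v) 0<δ) (≈⇒close {s} {t} q 0<δ) v

    -- The invariant between pushes: once one of the remaining pushes has begun, those of index at
    -- least `N` have had their full effect.
    Ready : ℕ → (V → ℝ) → ℝ → Set
    Ready N x t = ∀ i → i ℕ.< N → 0ℝ <ᴿ rampᴿ i t → ∀ j → N ℕ.≤ j → ¬ Pos j x

    ready⇒active : ∀ {N x t} → Ready (suc N) x t → Active N x (rampᴿ N t)
    ready⇒active {N} ready = ready N ℕₚ.≤-refl

    -- A completed push leaves `A N` with a vanishing coordinate. It revives no later set, because
    -- only `w N` can become positive and `fresh` keeps it out of them.
    step-not-pos : ∀ {N x s} → Eventually (λ n → 1ℚ ≤ seq s n) → (∀ j → N ℕ.< j → ¬ Pos j x) → ∀ j → N ℕ.≤ j → ¬ Pos j (S.step N x s)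
    step-not-pos {N} {x} {s} late before j N≤j pos = [ (λ N<j → before j N<j λ a∈ → S.step-pos⁻ N {x} {s} (λ { refl → fresh (ℕₚ.<⇒≤ N<j) a∈ }) (pos a∈)) ,
      (λ { refl → S.step-kills N {x} {s} (proj₂ (inhabited N)) (fresh ℕₚ.≤-refl) late pos }) ]′ (ℕₚ.m≤n⇒m<n∨m≡n N≤j)

    ready-step : ∀ {N x t} → Ready (suc N) x t → Ready N (S.step N x (rampᴿ N t)) t
    ready-step {N} {x} {t} ready i i<N 0<s = step-not-pos {N} {x} {rampᴿ N t} (ramp-later {i} {N} {t} i<N 0<s) (ready i (ℕₚ.m<n⇒m<1+n i<N) 0<s)

    ⊓-pos : ∀ {p q} → 0ℚ < p → 0ℚ < q → 0ℚ < p ⊓ q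
    ⊓-pos {p} {q} 0<p 0<q = [ (λ e → subst (0ℚ <_) (sym e) 0<p) , (λ e → subst (0ℚ <_) (sym e) 0<q) ]′ (⊓-sel p q)

    close-reflᴿ : ∀ {δ} → 0ℚ < δ → ∀ x → Closeᴿ δ x x
    close-reflᴿ 0<δ x = ev-always λ n → close-refl (<⇒≤ 0<δ) (seq x n)

    carrier-comp : ∀ N {τ} → Unique τ → IsSimplex τ → ∀ x t → In τ x → Ready N x t → CarrierNear τ x t (Ready N) (comp N)
    carrier-comp zero    {τ} u simp x t _ _ = τ , u , simp , 1ℚ , positive⁻¹ 1ℚ , λ y s p _ _ _ → p
    carrier-comp (suc N) {τ} u simp x t p ready = first (carrier-step N u simp x (rampᴿ N t))
      where
      E : (V → ℝ) → ℝ → V → ℝ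
      E y s = S.step N y (rampᴿ N s)
      first : CarrierNear τ x (rampᴿ N t) (Active N) (S.step N) → CarrierNear τ x t (Ready (suc N)) (comp (suc N))
      first (τ₁ , u₁ , simp₁ , δ₁ , 0<δ₁ , f) = second (carrier-comp N u₁ simp₁ (E x t) t
          (f x (rampᴿ N t) p (ready⇒active {N} {x} {t} ready) (λ v → close-reflᴿ 0<δ₁ (x v)) (close-reflᴿ 0<δ₁ (rampᴿ N t))) (ready-step {N} {x} {t} ready))
        where
        second : CarrierNear τ₁ (E x t) t (Ready N) (comp N) → CarrierNear τ x t (Ready (suc N)) (comp (suc N))
        second (τ₂ , u₂ , simp₂ , δ₂ , 0<δ₂ , g) = third (step-modulus N 0<δ₂) (shrink (rate N) (0≤rate N) 0<δ₁)
          where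
          third : Modulus δ₂ (StepModulus N δ₂) → (∃ λ θ → 0ℚ < θ × rate N * θ ≤ δ₁ × θ ≤ δ₁) → CarrierNear τ x t (Ready (suc N)) (comp (suc N))
          third (modulus η 0<η η≤δ₂ h) (θ , 0<θ , rθ≤δ₁ , θ≤δ₁) = τ₂ , u₂ , simp₂ , η ⊓ θ , ⊓-pos 0<η 0<θ , λ y s q ready′ c c′ →
            g (E y s) s
              (f y (rampᴿ N s) q (ready⇒active {N} {y} {s} ready′) (λ v → close-monoᴿ (≤-trans (p⊓q≤q η θ) θ≤δ₁) {x v} {y v} (c v))
                (close-monoᴿ rθ≤δ₁ {rampᴿ N t} {rampᴿ N s} (ramp-closeᴿ N (<⇒≤ 0<θ) {t} {s} (close-monoᴿ (p⊓q≤q η θ) {t} {s} c′))))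
              (ready-step {N} {y} {s} ready′)
              (h x y t s (λ v → close-monoᴿ (p⊓q≤p η θ) {x v} {y v} (c v)) (close-monoᴿ (p⊓q≤p η θ) {t} {s} c′))
              (close-monoᴿ (≤-trans (p⊓q≤p η θ) η≤δ₂) {t} {s} c′)

    Escapes : ℕ → List V → Set
    Escapes N τ = ∀ j → N ℕ.≤ j → ∃ λ a → a ∈ A j × a ∉ τ

    escapes⇒ready : ∀ {N τ x t} → Escapes N τ → In τ x → Ready N x t
    escapes⇒ready {x = x} out p _ _ _ j N≤j pos = let (a , a∈ , a∉) = out j N≤j in ≈0⇒≮0 {x a} (supported p a a∉) (pos a∈)

    -- The additional pushes act first, while the point is still in `τ`, and each of their sets has
    -- a vertex outside `τ`.
    comp-extend : ∀ {N τ x} t → Escapes N τ → In τ x → ∀ k v → comp (k ℕ.+ N) x t v ≈ comp N x t v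
    comp-extend {N} {x = x} t out p zero    v = ≈-refl {comp N x t v}
    comp-extend {N} {x = x} t out p (suc k) v = ≈-trans {comp (suc k ℕ.+ N) x t v} {comp (k ℕ.+ N) x t v} {comp N x t v}
      (comp-cong (k ℕ.+ N) {S.step (k ℕ.+ N) x (rampᴿ (k ℕ.+ N) t)} {x} {t} {t} still (≈-refl {t}) v) (comp-extend t out p k v)
      where
      still : ∀ v → S.step (k ℕ.+ N) x (rampᴿ (k ℕ.+ N) t) v ≈ x v
      still = let (a , a∈ , a∉) = out (k ℕ.+ N) (ℕₚ.m≤n+m N k) in
        S.step-still (k ℕ.+ N) {x} {rampᴿ (k ℕ.+ N) t} (in-unit p) (S.stationary-point (k ℕ.+ N) {x} {rampᴿ (k ℕ.+ N) t} a∈ (supported p a a∉))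

    -- The number of pushes is read off from a carrier, which `_≋_` forgets. Different choices are
    -- compared at the common number `M` + `N`.
    comp-agree : ∀ {N M τ σ x y s t} → Escapes N τ → In τ x → Escapes M σ → In σ y → (∀ v → x v ≈ y v) → s ≈ t → ∀ v → comp N x s v ≈ comp M y t v
    comp-agree {N} {M} {x = x} {y} {s} {t} out p out′ q e e′ v =
      ≈-trans {comp N x s v} {comp (M ℕ.+ N) x s v} {comp M y t v} (≈-sym {comp (M ℕ.+ N) x s v} {comp N x s v} (comp-extend s out p M v))
        (≈-trans {comp (M ℕ.+ N) x s v} {comp (M ℕ.+ N) y t v} {comp M y t v} (comp-cong (M ℕ.+ N) {x} {y} {s} {t} e e′ v)
          (subst (λ k → comp k y t v ≈ comp M y t v) (ℕₚ.+-comm N M) (comp-extend t out′ q N v)))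

    in-carrier : ∀ x → In (carrier x) (coord x)
    in-carrier x = in-simplex (coord≥0 x) (support x) (total x)

    stage : Point → ℕ
    stage x = proj₁ (escape (carrier x))

    escapes : ∀ x → Escapes (stage x) (carrier x)
    escapes x = proj₂ (escape (carrier x))

    deform-coord : Point → ℝ → V → ℝ
    deform-coord x t = comp (stage x) (coord x) t

    deform-in : ∀ x t → ∃ λ τ → Unique τ × IsSimplex τ × In τ (deform-coord x t)
    deform-in x t = go (carrier-comp (stage x) (unique x) (isSimplex x) (coord x) t (in-carrier x) ready)
      where
      ready : Ready (stage x) (coord x) t
      ready = escapes⇒ready {stage x} {carrier x} {coord x} {t} (escapes x) (in-carrier x)
      go : CarrierNear (carrier x) (coord x) t (Ready (stage x)) (comp (stage x)) → ∃ λ τ → Unique τ × IsSimplex τ × In τ (deform-coord x t)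
      go (τ , u , simp , δ , 0<δ , f) = τ , u , simp , f (coord x) t (in-carrier x) ready (λ v → close-reflᴿ 0<δ (coord x v)) (close-reflᴿ 0<δ t)

    deform : Point → I → Point
    deform x t = record
      { coord     = deform-coord x (val t)
      ; carrier   = proj₁ (deform-in x (val t))
      ; unique    = proj₁ (proj₂ (deform-in x (val t)))
      ; isSimplex = proj₁ (proj₂ (proj₂ (deform-in x (val t))))
      ; coord≥0   = nonneg (proj₂ (proj₂ (proj₂ (deform-in x (val t)))))
      ; support   = supported (proj₂ (proj₂ (proj₂ (deform-in x (val t)))))
      ; total     = sums (proj₂ (proj₂ (proj₂ (deform-in x (val t)))))
      }

    apex-coord : ∀ v → Dec (v ≡ base) → ℝ
    apex-coord v (yes _) = 1ℝ
    apex-coord v (no _)  = 0ℝ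

    apex : Point
    apex = record
      { coord     = λ v → apex-coord v (v ≟ base)
      ; carrier   = [ base ]
      ; unique    = [] ∷ []
      ; isSimplex = SimplicialComplex.vertex K base
      ; coord≥0   = λ v → coord≥ v (v ≟ base)
      ; support   = λ v v∉ → off v (v ≟ base) v∉
      ; total     = at-base (base ≟ base)
      }
      where
      coord≥ : ∀ v e → 0ℝ ≤ᴿ apex-coord v e
      coord≥ v (yes _) = I.0≤ 1I
      coord≥ v (no _)  = I.0≤ 0I
      off : ∀ v e → v ∉ [ base ] → apex-coord v e ≈ 0ℝ
      off v (yes e) v∉ = ⊥-elim (v∉ (here e))
      off v (no _)  v∉ = ≈-refl {0ℝ}
      at-base : ∀ e → (apex-coord base e +ᴿ 0ℝ) ≈ 1ℝ
      at-base (yes _) = ≡⇒≈ {1ℝ +ᴿ 0ℝ} {1ℝ} λ _ → refl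
      at-base (no ne) = ⊥-elim (ne refl)

    comp-0 : ∀ N {x} → (∀ v → InUnit (x v)) → ∀ v → comp N x 0ℝ v ≈ x v
    comp-0 zero    {x} unit v = ≈-refl {x v}
    comp-0 (suc N) {x} unit v = ≈-trans {comp (suc N) x 0ℝ v} {comp N x 0ℝ v} {x v}
      (comp-cong N {S.step N x (rampᴿ N 0ℝ)} {x} {0ℝ} {0ℝ} (S.step-still N {x} {rampᴿ N 0ℝ} unit (S.stationary-time N {x} {rampᴿ N 0ℝ} (ramp-0 N))) (≈-refl {0ℝ}) v)
      (comp-0 N unit v)

    comp-1 : ∀ N {x} → (∀ j → N ℕ.≤ j → ¬ Pos j x) → ∀ j → ¬ Pos j (comp N x 1ℝ)
    comp-1 zero    none j = none j ℕ.z≤n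
    comp-1 (suc N) {x} none = comp-1 N (step-not-pos {N} {x} {rampᴿ N 1ℝ} (ev-always (ramp-1 N)) none)

    -- At time 1 every push is complete and no `A j` is positive throughout. Each vertex other than
    -- `base` has some `A j` inside its singleton, so its coordinate is 0 and all mass is at `base`.
    deform-1 : ∀ x v → deform-coord x 1ℝ v ≈ coord apex v
    deform-1 x v = at v (v ≟ base)
      where
      z = deform-coord x 1ℝ
      none : ∀ j → ¬ Pos j z
      none = comp-1 (stage x) λ j le pos → let (a , a∈ , a∉) = escapes x j le in ≈0⇒≮0 {coord x a} (support x a a∉) (pos a∈)
      P = deform-in x 1ℝ
      p : In (proj₁ P) z
      p = proj₂ (proj₂ (proj₂ P))
      off : ∀ v → v ≢ base → z v ≈ 0ℝ
      off v v≢ = let (j , sub) = isolate v v≢ in ≮0⇒≈0 {z v} (nonneg p v) λ 0<z → none j λ a∈ → pick 0<z (sub a∈)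
        where
        pick : 0ℝ <ᴿ z v → ∀ {a} → a ∈ [ v ] → 0ℝ <ᴿ z a
        pick q (here refl) = q
      at : ∀ v (e : Dec (v ≡ base)) → z v ≈ apex-coord v e
      at v (no v≢)    = off v v≢
      at v (yes refl) = ≈-trans {z v} {z v +ᴿ 0ℝ} {1ℝ} (≡⇒≈ {z v} {z v +ᴿ 0ℝ} λ n → sym (+-identityʳ (seq (z v) n)))
        (sums (in-change (proj₁ (proj₂ P)) ([] ∷ []) p λ u u∉ → off u λ { refl → u∉ (here refl) }))

    module _ (U : Point → Set) (U-open : Open U) (σ : List V) (simp : IsSimplex σ) (x : Point) (x∈σ : x ∈∣ σ ∣) (t : I) (Ux : U (deform x t)) where
      private
        -- Totals are taken over lists without repetitions, whereas σ is an arbitrary list.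
        σ′ = deduplicate _≟_ σ
        N = proj₁ (escape σ)

        uσ′ : Unique σ′
        uσ′ = DecUnique.deduplicate-! _≟_ σ

        simp′ : IsSimplex σ′
        simp′ = nonempty , λ u∈ v∈ → proj₂ simp (∈-deduplicate⁻ _≟_ σ u∈) (∈-deduplicate⁻ _≟_ σ v∈)
          where
          some : ∀ {L : List V} → L ≢ [] → ∃ (_∈ L)
          some {[]}    ne = ⊥-elim (ne refl)
          some {v ∷ _} _  = v , here refl
          nonempty : σ′ ≢ []
          nonempty e = absurd (subst (proj₁ (some (proj₁ simp)) ∈_) e (∈-deduplicate⁺ _≟_ (proj₂ (some (proj₁ simp)))))
            where
            absurd : ∀ {v : V} → v ∉ []
            absurd ()

        out : Escapes N σ′
        out j le = let (a , a∈ , a∉) = proj₂ (escape σ) j le in a , a∈ , λ a∈σ′ → a∉ (∈-deduplicate⁻ _≟_ σ a∈σ′)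

        within : ∀ y → y ∈∣ σ ∣ → In σ′ (coord y)
        within y y∈ = in-change (unique y) uσ′ (in-carrier y) λ v v∉ → y∈ v λ v∈ → v∉ (∈-deduplicate⁺ _≟_ v∈)

        ready : ∀ y s → y ∈∣ σ ∣ → Ready N (coord y) s
        ready y s y∈ = escapes⇒ready {N} {σ′} {coord y} {s} out (within y y∈)

        agree : ∀ y s → y ∈∣ σ ∣ → ∀ v → deform-coord y s v ≈ comp N (coord y) s v
        agree y s y∈ = comp-agree {stage y} {N} {x = coord y} {coord y} {s} {s} (escapes y) (in-carrier y) out (within y y∈) (λ v → ≈-refl {coord y v}) (≈-refl {s})

      Continuous : Set
      Continuous = Σ ℚ λ ε → 0ℚ < ε × (∀ y → y ∈∣ σ ∣ → Near ε x y → ∀ s → ∣ val t - val s ∣< ε → U (deform y s))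

      deform-continuous : Continuous
      deform-continuous = first (carrier-comp N uσ′ simp′ (coord x) (val t) (within x x∈σ) (ready x (val t) x∈σ))
        where
        first : CarrierNear σ′ (coord x) (val t) (Ready N) (comp N) → Continuous
        first (τ , _ , simpτ , δ₁ , 0<δ₁ , f) = second (U-open τ simpτ (deform x t) (inside x (val t) x∈σ (λ v → close-reflᴿ 0<δ₁ (coord x v)) (close-reflᴿ 0<δ₁ (val t))) Ux)
          where
          inside : ∀ y s → y ∈∣ σ ∣ → (∀ v → Closeᴿ δ₁ (coord x v) (coord y v)) → Closeᴿ δ₁ (val t) s → ∀ v → v ∉ τ → deform-coord y s v ≈ 0ℝ
          inside y s y∈ c c′ v v∉ = ≈-trans {deform-coord y s v} {comp N (coord y) s v} {0ℝ} (agree y s y∈ v)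
            (supported (f (coord y) s (within y y∈) (ready y s y∈) c c′) v v∉)
          second : (Σ ℚ λ ε → 0ℚ < ε × (∀ z → z ∈∣ τ ∣ → Near ε (deform x t) z → U z)) → Continuous
          second (ε , 0<ε , g) = third (comp-modulus N (⅛* 0<ε))
            where
            -- Three errors of an eighth: from `deform` to `comp N` at both points, and the modulus
            -- between them. The bound ½ is what `close⇒near` asks for.
            ⅜≤½ : ⅛ * ε + (⅛ * ε + ⅛ * ε) ≤ ½ * ε
            ⅜≤½ = linearℚ (ε ∷ []) (1 ⊗ con 0ℚ ⊑ ⅛ ⊠ v₀ ∷ []) (⅛ ⊠ v₀ ⊞ (⅛ ⊠ v₀ ⊞ ⅛ ⊠ v₀) ⊑ ½ ⊠ v₀) (<⇒≤ (⅛* 0<ε) ∷ [])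
            sandwich : ∀ {a b c d} → a ≈ b → Closeᴿ (⅛ * ε) b c → d ≈ c → ∣ a - d ∣< ε
            sandwich {a} {b} {c} {d} p q e = close⇒near a d 0<ε (ev-map₂ (λ n c (c′ , c″) → close-mono ⅜≤½ (close-trans c (close-trans c′ (close-sym c″))))
              (≈⇒close {a} {b} p (⅛* 0<ε)) (ev-∧ q (≈⇒close {d} {c} e (⅛* 0<ε))))
            third : Modulus (⅛ * ε) (CompModulus N (⅛ * ε)) → Continuous
            third (modulus δ₂ 0<δ₂ _ h) = δ₁ ⊓ δ₂ , ⊓-pos 0<δ₁ 0<δ₂ , λ y y∈ near s near′ → fourth y y∈ s
                (λ v → near⇒close (coord x v) (coord y v) (near v)) (near⇒close (val t) (val s) near′)
              where
              fourth : ∀ y → y ∈∣ σ ∣ → ∀ s → (∀ v → Closeᴿ (δ₁ ⊓ δ₂) (coord x v) (coord y v)) → Closeᴿ (δ₁ ⊓ δ₂) (val t) (val s) → U (deform y s)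
              fourth y y∈ s cx ct = g (deform y s)
                (inside y (val s) y∈ (λ v → close-monoᴿ (p⊓q≤p δ₁ δ₂) {coord x v} {coord y v} (cx v)) (close-monoᴿ (p⊓q≤p δ₁ δ₂) {val t} {val s} ct))
                λ v → sandwich {deform-coord x (val t) v} {comp N (coord x) (val t) v} {comp N (coord y) (val s) v} {deform-coord y (val s) v} (agree x (val t) x∈σ v)
                  (h (coord x) (coord y) (val t) (val s) (λ v → close-monoᴿ (p⊓q≤q δ₁ δ₂) {coord x v} {coord y v} (cx v)) (close-monoᴿ (p⊓q≤q δ₁ δ₂) {val t} {val s} ct) v)
                  (agree y (val s) y∈ v)

    contractible : Contractible K
    contractible = apex , record
      { H          = deform
      ; H-cong     = λ {x} {y} {s} {t} x≋y s≈t → comp-agree {stage x} {stage y} {x = coord x} {coord y} {val s} {val t} (escapes x) (in-carrier x) (escapes y) (in-carrier y) x≋y s≈t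
      ; continuous = deform-continuous
      ; at-0       = λ x → comp-0 (stage x) (in-unit (in-carrier x))
      ; at-1       = deform-1
      }

-- Ordering the nonempty subsets of all layers

module Layerings where
  open Collapses
  open import Data.Nat
  open import Data.Nat.Properties
  open import Data.List using (List; []; _∷_; [_]; _++_; map)
  open import Data.List.Membership.Propositional using (_∈_; _∉_)
  open import Data.List.Membership.Propositional.Properties using (∈-++⁺ˡ; ∈-++⁺ʳ; ∈-map⁺)
  open import Data.List.Relation.Binary.Subset.Propositional using (_⊆_)
  open import Data.List.Relation.Unary.Any using (here; there)
  open import Data.List.Relation.Unary.All using (All; []; _∷_)
  import Data.List.Relation.Unary.All as All
  import Data.List.Relation.Unary.All.Properties as All
  open import Data.List.Relation.Unary.AllPairs using ([]; _∷_)
  open import Data.List.Relation.Unary.Unique.Propositional using (Unique)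
  import Data.List.Membership.DecPropositional as DecMembership
  open import Data.Product using (∃; _×_; _,_; proj₁; proj₂)
  open import Data.Sum using (_⊎_; inj₁; inj₂)
  open import Data.Unit using (⊤; tt)
  open import Data.Empty using (⊥-elim)
  open import Relation.Nullary using (Dec; yes; no)
  open import Relation.Binary.Definitions using (DecidableEquality; Tri; tri<; tri≈; tri>)
  open import Relation.Binary.PropositionalEquality using (_≡_; _≢_; refl; trans; sym; cong)

  -- The nonempty sublists, every one before those that contain it.
  sublists⁺ : ∀ {V : Set} → List V → List (List V)
  sublists⁺ []      = []
  sublists⁺ (v ∷ L) = sublists⁺ L ++ [ v ] ∷ map (v ∷_) (sublists⁺ L)

  module Sublists {V : Set} where
    [_]∈sublists⁺ : ∀ {L : List V} {u} → u ∈ L → [ u ] ∈ sublists⁺ L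
    [_]∈sublists⁺ {v ∷ L} (here refl) = ∈-++⁺ʳ (sublists⁺ L) (here refl)
    [_]∈sublists⁺ {v ∷ L} (there u∈)  = ∈-++⁺ˡ [ u∈ ]∈sublists⁺

    record SublistOf (L A : List V) : Set where
      field
        unique    : Unique A
        inhabited : ∃ (_∈ A)
        subset    : A ⊆ L

    sublists-are : ∀ {L} → Unique L → All (SublistOf L) (sublists⁺ L)
    sublists-are []                     = []
    sublists-are {v ∷ L} (v∉L ∷ uL) = All.++⁺ (All.map weaken rec) (single ∷ All.map⁺ (All.map extend rec))
      where
      rec = sublists-are uL
      weaken : ∀ {A} → SublistOf L A → SublistOf (v ∷ L) A
      weaken s = record { unique = unique ; inhabited = inhabited ; subset = λ a∈ → there (subset a∈) }
        where open SublistOf s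
      single : SublistOf (v ∷ L) [ v ]
      single = record { unique = [] ∷ [] ; inhabited = v , here refl ; subset = λ { (here refl) → here refl } }
      extend : ∀ {A} → SublistOf L A → SublistOf (v ∷ L) (v ∷ A)
      extend s = record { unique = All.tabulate (λ a∈ → All.lookup v∉L (subset a∈)) ∷ unique ; inhabited = v , here refl
                        ; subset = λ { (here refl) → here refl ; (there a∈) → there (subset a∈) } }
        where open SublistOf s

    -- Enlarging a set by a vertex leads further down the list. Inclusion takes the place of
    -- equality, since the larger set may be listed in another order.
    Ahead : List V → List (List V) → Set
    Ahead L []      = ⊤
    Ahead L (A ∷ E) = (∀ {u} → u ∈ L → u ∉ A → ∃ λ B → B ∈ E × B ⊆ u ∷ A) × Ahead L E

    sublists-ahead : ∀ L → Ahead L (sublists⁺ L)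
    sublists-ahead []      = tt
    sublists-ahead (v ∷ L) = first (sublists⁺ L) (λ A∈ → A∈) (sublists-ahead L)
      where
      more : List (List V)
      more = [ v ] ∷ map (v ∷_) (sublists⁺ L)
      extended : ∀ E → Ahead L E → Ahead (v ∷ L) (map (v ∷_) E)
      extended []      _          = tt
      extended (A ∷ E) (now , later) = step , extended E later
        where
        step : ∀ {u} → u ∈ v ∷ L → u ∉ v ∷ A → ∃ λ B → B ∈ map (v ∷_) E × B ⊆ u ∷ v ∷ A
        step (here refl) u∉ = ⊥-elim (u∉ (here refl))
        step (there u∈)  u∉ = let (B , B∈ , B⊆) = now u∈ (λ u∈A → u∉ (there u∈A)) in
          v ∷ B , ∈-map⁺ (v ∷_) B∈ , λ { (here refl) → there (here refl) ; (there b∈) → swap (B⊆ b∈) }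
          where
          swap : ∀ {u b} → b ∈ u ∷ A → b ∈ u ∷ v ∷ A
          swap (here refl) = here refl
          swap (there b∈)  = there (there b∈)
      ahead-more : Ahead (v ∷ L) more
      ahead-more = step , extended (sublists⁺ L) (sublists-ahead L)
        where
        step : ∀ {u} → u ∈ v ∷ L → u ∉ [ v ] → ∃ λ B → B ∈ map (v ∷_) (sublists⁺ L) × B ⊆ u ∷ [ v ]
        step (here refl) u∉ = ⊥-elim (u∉ (here refl))
        step {u} (there u∈) u∉ = v ∷ [ u ] , ∈-map⁺ (v ∷_) [ u∈ ]∈sublists⁺ , λ { (here refl) → there (here refl) ; (there (here refl)) → here refl }
      first : ∀ E → (∀ {A} → A ∈ E → A ∈ sublists⁺ L) → Ahead L E → Ahead (v ∷ L) (E ++ more)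
      first []      _   _             = ahead-more
      first (A ∷ E) E⊆ (now , later) = step , first E (λ A∈ → E⊆ (there A∈)) later
        where
        step : ∀ {u} → u ∈ v ∷ L → u ∉ A → ∃ λ B → B ∈ E ++ more × B ⊆ u ∷ A
        -- The sets without `v` come first, and adding `v` leads into the second half.
        step (here refl) u∉ = v ∷ A , ∈-++⁺ʳ E (there (∈-map⁺ (v ∷_) (E⊆ (here refl)))) , λ b∈ → b∈
        step (there u∈)  u∉ = let (B , B∈ , B⊆) = now u∈ u∉ in B , ∈-++⁺ˡ B∈ , B⊆

  open Sublists

  -- Layer `suc k` stands for the facet added to the k-th box. The field `apex-cone` concerns only
  -- the smaller box and `A` itself, because the other vertices of the layer are covered by larger
  -- sets, which are pushed earlier.
  record Layering {V : Set} (d : V → V → ℕ) (r : ℕ) : Set where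
    field
      base       : V
      layer      : V → ℕ
      layer-0    : ∀ {u} → layer u ≡ 0 → u ≡ base
      vertices   : ℕ → List V
      unique     : ∀ k → Unique (vertices k)
      sound      : ∀ {k u} → u ∈ vertices k → layer u ≡ suc k
      complete   : ∀ {k u} → layer u ≡ suc k → u ∈ vertices k
      inhabited  : ∀ k → ∃ (_∈ vertices k)
      apex       : ℕ → List V → V
      apex-layer : ∀ k A → layer (apex k A) ≤ k
      apex-cone  : ∀ k {A a₀} → a₀ ∈ A → (∀ {a} → a ∈ A → layer a ≡ suc k) → (∀ {a b} → a ∈ A → b ∈ A → d a b ≤ r) →
                   ∀ u → (∀ {a} → a ∈ A → d u a ≤ r) → layer u ≤ k ⊎ u ∈ A → d (apex k A) u ≤ r

  module Blocks {V : Set} (_≟_ : DecidableEquality V) {d : V → V → ℕ} {r : ℕ} (layering : Layering d r) where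
    open Layering layering renaming (unique to vertices-unique; inhabited to vertices-inhabited)
    open DecMembership _≟_ using (_∈?_)

    -- A position in the concatenation of the lists of all layers. Walking from state to state
    -- avoids computing a layer and a position from an index.
    record State : Set where
      constructor state
      field
        level : ℕ
        now   : List V
        rest  : List (List V)
        valid : All (SublistOf (vertices level)) (now ∷ rest)
        ahead : Ahead (vertices level) (now ∷ rest)
    open State

    block : ∀ k E → (∃ (_∈ E)) → All (SublistOf (vertices k)) E → Ahead (vertices k) E → State
    block k (A ∷ E) _        v a = state k A E v a
    block k []      (_ , ()) _ _

    start : ℕ → State
    start k = block k (sublists⁺ (vertices k)) (_ , [ proj₂ (vertices-inhabited k) ]∈sublists⁺) (sublists-are (vertices-unique k)) (sublists-ahead (vertices k))

    start-level : ∀ k → level (start k) ≡ k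
    start-level k = go (sublists⁺ (vertices k))
      where
      go : ∀ E {i v a} → level (block k E i v a) ≡ k
      go []      {_ , ()}
      go (_ ∷ _) = refl

    start-∈ : ∀ k {A} → A ∈ sublists⁺ (vertices k) → A ∈ now (start k) ∷ rest (start k)
    start-∈ k = go (sublists⁺ (vertices k))
      where
      go : ∀ E {i v a A} → A ∈ E → A ∈ now (block k E i v a) ∷ rest (block k E i v a)
      go []      {_ , ()}
      go (_ ∷ _) A∈ = A∈

    next : State → State
    next (state k A []      _        _)       = start (suc k)
    next (state k A (B ∷ E) (_ ∷ v) (_ , a)) = state k B E v a

    walk : ℕ → State
    walk zero    = start 0
    walk (suc i) = next (walk i)

    next-level : ∀ s → level s ≤ level (next s)
    next-level (state k A []      _        _)       = ≤-trans (n≤1+n k) (≤-reflexive (sym (start-level (suc k))))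
    next-level (state k A (B ∷ E) (_ ∷ v) (_ , a)) = ≤-refl

    level-mono : ∀ {i j} → i ≤ j → level (walk i) ≤ level (walk j)
    level-mono i≤j = go (≤⇒≤′ i≤j)
      where
      go : ∀ {i j} → i ≤′ j → level (walk i) ≤ level (walk j)
      go ≤′-refl     = ≤-refl
      go (≤′-step {j} p) = ≤-trans (go p) (next-level (walk j))

    later : ∀ i s → walk i ≡ s → ∀ {B} → B ∈ rest s → ∃ λ j → i < j × now (walk j) ≡ B
    later i (state k A (B ∷ E) (_ ∷ v) (_ , a)) e (here refl) = suc i , ≤-refl , cong (λ s → now (next s)) e
    later i (state k A (B ∷ E) (_ ∷ v) (_ , a)) e (there C∈)  =
      let (j , i<j , e′) = later (suc i) (state k B E v a) (cong next e) C∈ in j , <-trans (n<1+n i) i<j , e′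

    finish : ∀ i {k A} E {v a} → walk i ≡ state k A E v a → ∃ λ j → walk j ≡ start (suc k)
    finish i []      e = suc i , cong next e
    finish i (B ∷ E) {_ ∷ v} {_ , a} e = finish (suc i) E (cong next e)

    starts : ∀ k → ∃ λ i → walk i ≡ start k
    starts zero    = 0 , refl
    starts (suc k) = let (i , e) = starts k ; (j , e′) = finish i (rest (start k)) e in j , trans e′ (cong (λ l → start (suc l)) (start-level k))

    visits : ∀ {k A} → A ∈ sublists⁺ (vertices k) → ∃ λ j → now (walk j) ≡ A × level (walk (proj₁ (starts k))) ≡ k × proj₁ (starts k) ≤ j
    visits {k} {A} A∈ = go (start-∈ k A∈)
      where
      i = proj₁ (starts k)
      e = proj₂ (starts k)
      le : level (walk i) ≡ k
      le = trans (cong level e) (start-level k)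
      go : A ∈ now (start k) ∷ rest (start k) → ∃ λ j → now (walk j) ≡ A × level (walk i) ≡ k × i ≤ j
      go (here refl) = i , cong now e , le , ≤-refl
      go (there A∈)  = let (j , i<j , e′) = later i (start k) e A∈ in j , e′ , le , <⇒≤ i<j

    visits-single : ∀ {k u} → layer u ≡ suc k → ∃ λ j → now (walk j) ≡ [ u ] × proj₁ (starts k) ≤ j
    visits-single p = let (j , e , _ , le) = visits [ complete p ]∈sublists⁺ in j , e , le

    started : ∀ {i k} → level (walk i) < k → i < proj₁ (starts k)
    started {i} {k} lt = ≰⇒> λ le → <-irrefl refl (<-≤-trans lt (≤-trans (≤-reflexive (sym (trans (cong level (proj₂ (starts k))) (start-level k)))) (level-mono le)))

    now-valid : ∀ i → SublistOf (vertices (level (walk i))) (now (walk i))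
    now-valid i = All.head (valid (walk i))

    now-layer : ∀ i {a} → a ∈ now (walk i) → layer a ≡ suc (level (walk i))
    now-layer i a∈ = sound (SublistOf.subset (now-valid i) a∈)

    bounded : ∀ σ → ∃ λ k → ∀ {u} → u ∈ σ → layer u ≤ k
    bounded []      = 0 , λ ()
    bounded (v ∷ σ) = layer v ⊔ proj₁ (bounded σ) ,
      λ { (here refl) → m≤m⊔n (layer v) _ ; (there u∈) → ≤-trans (proj₂ (bounded σ) u∈) (m≤n⊔m (layer v) _) }

    collapse : Collapse d r
    collapse = record
      { A         = λ i → now (walk i)
      ; w         = λ i → apex (level (walk i)) (now (walk i))
      ; unique    = λ i → SublistOf.unique (now-valid i)
      ; inhabited = λ i → SublistOf.inhabited (now-valid i)
      ; cone      = cone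
      -- The apex lies at most at the level of `i`, while every vertex of a set from `i` on lies
      -- strictly above it.
      ; fresh     = λ {i} {j} i≤j w∈ → <-irrefl refl (≤-trans (≤-reflexive (sym (now-layer j w∈))) (≤-trans (apex-layer (level (walk i)) (now (walk i))) (level-mono i≤j)))
      ; escape    = λ σ → let (k , le) = bounded σ in proj₁ (starts k) , λ j s≤j →
          let (a , a∈) = SublistOf.inhabited (now-valid j) in
          a , a∈ , λ a∈σ → <-irrefl refl (≤-trans (≤-reflexive (sym (now-layer j a∈))) (≤-trans (le a∈σ)
            (≤-trans (≤-reflexive (sym (trans (cong level (proj₂ (starts k))) (start-level k)))) (level-mono s≤j))))
      ; base      = base
      ; isolate   = isolate
      }
      where
      equal⇒⊆ : ∀ {A B : List V} → A ≡ B → A ⊆ B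
      equal⇒⊆ refl a∈ = a∈

      isolate : ∀ u → u ≢ base → ∃ λ j → now (walk j) ⊆ [ u ]
      isolate u u≢ = go (layer u) refl
        where
        go : ∀ k → layer u ≡ k → ∃ λ j → now (walk j) ⊆ [ u ]
        go zero    e = ⊥-elim (u≢ (layer-0 e))
        go (suc k) e = let (j , e′ , _) = visits-single e in j , equal⇒⊆ e′

      cone : ∀ i → (∀ {a b} → a ∈ now (walk i) → b ∈ now (walk i) → d a b ≤ r) → ∀ u → (∀ {a} → a ∈ now (walk i) → d u a ≤ r) →
             (∃ λ j → i < j × now (walk j) ⊆ u ∷ now (walk i)) ⊎ d (apex (level (walk i)) (now (walk i))) u ≤ r
      -- For u further out, its singleton comes later; for u in the same layer but outside `A`, some
      -- set within `u ∷ A` does; all others are left to the apex.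
      cone i small u near = split (<-cmp (layer u) (suc k))
        where
        k = level (walk i)
        A = now (walk i)
        near-apex : layer u ≤ k ⊎ u ∈ A → d (apex k A) u ≤ r
        near-apex = apex-cone k (proj₂ (SublistOf.inhabited (now-valid i))) (now-layer i) small u near
        beyond : ∀ l → layer u ≡ suc l → k < l → ∃ λ j → i < j × now (walk j) ⊆ u ∷ A
        beyond l e k<l = let (j , e′ , s≤j) = visits-single e in
          j , <-≤-trans (started {i} k<l) s≤j , λ a∈ → only (equal⇒⊆ e′ a∈)
          where
          only : ∀ {a} → a ∈ [ u ] → a ∈ u ∷ A
          only (here refl) = here refl
        outer : ∀ l → layer u ≡ l → suc k < l → ∃ λ j → i < j × now (walk j) ⊆ u ∷ A
        outer (suc l) e (s≤s lt) = beyond l e lt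
        same : layer u ≡ suc k → Dec (u ∈ A) → (∃ λ j → i < j × now (walk j) ⊆ u ∷ A) ⊎ d (apex k A) u ≤ r
        same e (yes u∈) = inj₂ (near-apex (inj₂ u∈))
        same e (no u∉)  = let (B , B∈ , B⊆) = proj₁ (ahead (walk i)) (complete e) u∉
                              (j , i<j , e′) = later i (walk i) refl B∈
                          in inj₁ (j , i<j , λ a∈ → B⊆ (equal⇒⊆ e′ a∈))
        split : Tri (layer u < suc k) (layer u ≡ suc k) (suc k < layer u) → (∃ λ j → i < j × now (walk j) ⊆ u ∷ A) ⊎ d (apex k A) u ≤ r
        split (tri< lt _ _) = inj₂ (near-apex (inj₁ (s≤s⁻¹ lt)))
        split (tri≈ _ e _)  = same e (u ∈? A)
        split (tri> _ _ gt) = inj₁ (outer (layer u) refl gt)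

-- Boxes growing by facets, and the cone vertices

module Boxing where
  open import Defs using (manhattan; manhattan-isMetric)
  open Centres using (Centre; Small; Centred)
  open Layerings
  open import Data.Nat
  open import Data.Nat.Properties
  open import Data.Nat.DivMod using (_mod_; [m+kn]%n≡m%n; m<n⇒m%n≡m; m≡m%n+[m/n]*n) renaming (_/_ to _div_; m%n<n to %-<)
  open import Data.Integer using (ℤ; +_; -[1+_]; 0ℤ; +[1+_])
  import Data.Integer as ℤ
  import Data.Integer.Properties as ℤₚ
  import Data.Integer.Tactic.RingSolver as ℤ-Solver
  open import Data.Fin using (Fin; zero; suc; toℕ)
  import Data.Fin.Properties as Fin
  open import Data.List using (List; []; _∷_; [_]; map; filter; deduplicate; upTo; cartesianProductWith) renaming (_++_ to _++ᴸ_)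
  open import Data.List.Membership.Propositional using (_∈_)
  open import Data.List.Membership.Propositional.Properties using (∈-filter⁺; ∈-filter⁻; ∈-++⁺ˡ; ∈-++⁺ʳ; ∈-map⁺; ∈-map⁻; ∈-upTo⁺; ∈-deduplicate⁺; ∈-deduplicate⁻; ∈-cartesianProductWith⁺)
  open import Data.List.Relation.Unary.Any using (here)
  open import Data.List.Relation.Unary.All using (All; all?)
  import Data.List.Relation.Unary.All as All
  import Data.List.Relation.Unary.Unique.DecPropositional.Properties as DecUnique
  open import Data.Vec using (Vec; []; _∷_; lookup; tabulate; insertAt; removeAt)
  open import Data.Vec.Properties using (≡-dec; lookup∘tabulate; tabulate∘lookup; tabulate-cong; insertAt-lookup; removeAt-insertAt)
  open import Data.Product using (∃; ∃₂; _×_; _,_; proj₁; proj₂)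
  open import Data.Sum using (_⊎_; inj₁; inj₂; [_,_]′)
  open import Data.Empty using (⊥; ⊥-elim)
  open import Function.Metric.Nat using (IsMetric)
  open import Relation.Nullary using (Dec; yes; no)
  open import Relation.Binary.Definitions using (DecidableEquality)
  open import Relation.Binary.PropositionalEquality using (_≡_; _≢_; refl; trans; sym; cong; cong₂; subst)

  maxF : ∀ {n} → (Fin n → ℕ) → ℕ
  maxF {zero}  f = 0
  maxF {suc n} f = f zero ⊔ maxF (λ j → f (suc j))

  ≤maxF : ∀ {n} (f : Fin n → ℕ) j → f j ≤ maxF f
  ≤maxF f zero    = m≤m⊔n (f zero) _
  ≤maxF f (suc j) = ≤-trans (≤maxF (λ j → f (suc j)) j) (m≤n⊔m (f zero) _)

  maxF-lub : ∀ {n} (f : Fin n → ℕ) {k} → (∀ j → f j ≤ k) → maxF f ≤ k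
  maxF-lub {zero}  f le = z≤n
  maxF-lub {suc n} f le = ⊔-lub (le zero) (maxF-lub (λ j → f (suc j)) (λ j → le (suc j)))

  maxF-attained : ∀ {n} (f : Fin n → ℕ) {k} → maxF f ≡ suc k → ∃ λ j → f j ≡ suc k
  maxF-attained {suc n} f {k} e = [ (λ q → zero , trans (sym q) e) , (λ q → let (j , p) = maxF-attained (λ j → f (suc j)) (trans (sym q) e) in suc j , p) ]′
    (⊔-sel (f zero) (maxF (λ j → f (suc j))))

  toward : ℤ → ℤ
  toward (+ zero)       = 0ℤ
  toward +[1+ k ]       = + k
  toward -[1+ zero ]    = 0ℤ
  toward -[1+ suc k ]   = -[1+ k ]

  private
    diff-suc : ∀ i p → (ℤ.1ℤ ℤ.+ i) ℤ.- p ≡ ℤ.1ℤ ℤ.+ (i ℤ.- p)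
    diff-suc = ℤ-Solver.solve-∀

  ∣-∣-suc : ∀ i p → p ℤ.≤ i → ℤ.∣ (ℤ.1ℤ ℤ.+ i) ℤ.- p ∣ ≡ suc ℤ.∣ i ℤ.- p ∣
  ∣-∣-suc i p p≤i = trans (cong ℤ.∣_∣ (diff-suc i p)) (lemma (i ℤ.- p) (ℤₚ.i≤j⇒0≤j-i p≤i))
    where
    lemma : ∀ q → 0ℤ ℤ.≤ q → ℤ.∣ ℤ.1ℤ ℤ.+ q ∣ ≡ suc ℤ.∣ q ∣
    lemma (+ _) _ = refl

  ∣-∣-pred : ∀ i z p → i ≡ ℤ.1ℤ ℤ.+ z → i ℤ.≤ p → ℤ.∣ z ℤ.- p ∣ ≡ suc ℤ.∣ i ℤ.- p ∣
  ∣-∣-pred i z p refl i≤p = trans (ℤₚ.∣i-j∣≡∣j-i∣ z p) (trans (cong ℤ.∣_∣ (shift p z))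
    (trans (lemma (p ℤ.- (ℤ.1ℤ ℤ.+ z)) (ℤₚ.i≤j⇒0≤j-i i≤p)) (cong suc (ℤₚ.∣i-j∣≡∣j-i∣ p (ℤ.1ℤ ℤ.+ z)))))
    where
    shift : ∀ p z → p ℤ.- z ≡ ℤ.1ℤ ℤ.+ (p ℤ.- (ℤ.1ℤ ℤ.+ z))
    shift = ℤ-Solver.solve-∀
    lemma : ∀ q → 0ℤ ℤ.≤ q → ℤ.∣ ℤ.1ℤ ℤ.+ q ∣ ≡ suc ℤ.∣ q ∣
    lemma (+ _) _ = refl

  toward-1 : ∀ z → ℤ.∣ toward z ℤ.- z ∣ ≤ 1
  toward-1 (+ zero)       = z≤n
  toward-1 +[1+ k ]       = ≤-reflexive (trans (ℤₚ.∣i-j∣≡∣j-i∣ (+ k) +[1+ k ]) (trans (∣-∣-suc (+ k) (+ k) ℤₚ.≤-refl) (cong (λ q → suc ℤ.∣ q ∣) (ℤₚ.+-inverseʳ (+ k)))))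
  toward-1 -[1+ zero ]    = ≤-refl
  toward-1 -[1+ suc k ]   = ≤-reflexive (trans (ℤₚ.∣i-j∣≡∣j-i∣ -[1+ k ] -[1+ suc k ])
    (trans (∣-∣-pred -[1+ k ] -[1+ suc k ] -[1+ k ] refl ℤₚ.≤-refl) (cong (λ q → suc ℤ.∣ q ∣) (ℤₚ.+-inverseʳ -[1+ k ]))))

  double-injective : ∀ a b → a + a ≡ b + b → a ≡ b
  double-injective zero    zero    _ = refl
  double-injective (suc a) (suc b) e = cong suc (double-injective a b (suc-injective (trans (sym (+-suc a a)) (trans (suc-injective e) (+-suc b b)))))

  double-odd : ∀ a b → a + a ≢ suc (b + b)
  double-odd (suc a) b       e = double-odd b a (sym (trans (sym (+-suc a a)) (suc-injective e)))

  even-or-odd : ∀ q → (∃ λ k → q ≡ k + k) ⊎ (∃ λ k → q ≡ suc (k + k))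
  even-or-odd zero    = inj₁ (0 , refl)
  even-or-odd (suc q) = [ (λ (k , e) → inj₂ (k , cong suc e)) , (λ (k , e) → inj₁ (suc k , cong suc (trans e (sym (+-suc k k))))) ]′ (even-or-odd q)

  manhattan-mono : ∀ {n} (w w₀ u : Vec ℤ n) → (∀ j → ℤ.∣ lookup w j ℤ.- lookup u j ∣ ≤ ℤ.∣ lookup w₀ j ℤ.- lookup u j ∣) → manhattan w u ≤ manhattan w₀ u
  manhattan-mono []      []       []      le = z≤n
  manhattan-mono (_ ∷ w) (_ ∷ w₀) (_ ∷ u) le = +-mono-≤ (le zero) (manhattan-mono w w₀ u (λ j → le (suc j)))

  manhattan-removeAt : ∀ {m} (x y : Vec ℤ (suc m)) i → manhattan x y ≡ ℤ.∣ lookup x i ℤ.- lookup y i ∣ + manhattan (removeAt x i) (removeAt y i)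
  manhattan-removeAt (a ∷ x)         (b ∷ y)         zero    = refl
  manhattan-removeAt (a ∷ x@(_ ∷ _)) (b ∷ y@(_ ∷ _)) (suc i) = trans (cong (λ k → ℤ.∣ a ℤ.- b ∣ + k) (manhattan-removeAt x y i))
    (trans (sym (+-assoc ℤ.∣ a ℤ.- b ∣ c e)) (trans (cong (_+ e) (+-comm ℤ.∣ a ℤ.- b ∣ c)) (+-assoc c ℤ.∣ a ℤ.- b ∣ e)))
    where
    c = ℤ.∣ lookup x i ℤ.- lookup y i ∣
    e = manhattan (removeAt x i) (removeAt y i)

  module Boxes (m : ℕ) where
    n : ℕ
    n = suc m

    -- The stage at which the value z is admitted in coordinate j: the boxes grow by one facet at a time,
    -- in the order +1, -1, +2, -2, … of values, cycling through the coordinates.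
    code : Fin n → ℤ → ℕ
    code j (+ zero)  = 0
    code j +[1+ k ]  = suc (toℕ j + (k + k) * n)
    code j -[1+ k ]  = suc (toℕ j + suc (k + k) * n)

    code-0 : ∀ j z → code j z ≡ 0 → z ≡ 0ℤ
    code-0 j (+ zero) _ = refl

    split-unique : ∀ (j j′ : Fin n) q q′ → toℕ j + q * n ≡ toℕ j′ + q′ * n → j ≡ j′ × q ≡ q′
    split-unique j j′ q q′ e = Fin.toℕ-injective j≡ , *-cancelʳ-≡ q q′ n (+-cancelˡ-≡ (toℕ j) _ _ (trans e (cong (_+ q′ * n) (sym j≡))))
      where
      rem : ∀ (j : Fin n) q → (toℕ j + q * n) % n ≡ toℕ j
      rem j q = trans ([m+kn]%n≡m%n (toℕ j) q n) (m<n⇒m%n≡m (Fin.toℕ<n j))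
      j≡ : toℕ j ≡ toℕ j′
      j≡ = trans (sym (rem j q)) (trans (cong (_% n) e) (rem j′ q′))

    code-injective : ∀ {j j′ z z′ k} → code j z ≡ suc k → code j′ z′ ≡ suc k → j ≡ j′ × z ≡ z′
    code-injective {j} {j′} {+[1+ a ]} {+[1+ b ]} p q = let (e , f) = split-unique j j′ (a + a) (b + b) (suc-injective (trans p (sym q))) in e , cong +[1+_] (double-injective a b f)
    code-injective {j} {j′} { -[1+ a ]} { -[1+ b ]} p q = let (e , f) = split-unique j j′ (suc (a + a)) (suc (b + b)) (suc-injective (trans p (sym q))) in e , cong -[1+_] (double-injective a b (suc-injective f))
    code-injective {j} {j′} {+[1+ a ]} { -[1+ b ]} p q = ⊥-elim (double-odd a b (proj₂ (split-unique j j′ (a + a) (suc (b + b)) (suc-injective (trans p (sym q))))))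
    code-injective {j} {j′} { -[1+ a ]} {+[1+ b ]} p q = ⊥-elim (double-odd b a (sym (proj₂ (split-unique j j′ (suc (a + a)) (b + b) (suc-injective (trans p (sym q)))))))

    -- Division by `n`: the remainder is the coordinate, and the parity of the quotient is the sign
    -- of the value.
    decode : ∀ k → ∃₂ λ j z → code j z ≡ suc k
    decode k = [ (λ (a , e) → k mod n , +[1+ a ] , cong suc (value e)) , (λ (a , e) → k mod n , -[1+ a ] , cong suc (value e)) ]′ (even-or-odd (k div n))
      where
      value : ∀ {q} → k div n ≡ q → toℕ (k mod n) + q * n ≡ k
      value refl = trans (cong (_+ k div n * n) (Fin.toℕ-fromℕ< (%-< k n))) (sym (m≡m%n+[m/n]*n k n))

    code-step : ∀ (j : Fin n) a b → a ≤ b → suc (toℕ j + a * n) ≤ suc (toℕ j + b * n)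
    code-step j a b le = s≤s (+-monoʳ-≤ (toℕ j) (*-monoˡ-≤ n le))

    -- Values of equal sign and adjacent size are 2n codes apart, of which only one has to be given
    -- up.
    code-toward : ∀ j z {k} → code j z ≤ suc k → code j (toward z) ≤ k
    code-toward j (+ zero)       le = z≤n
    code-toward j +[1+ zero ]    le = z≤n
    code-toward j +[1+ suc a ]   le = ≤-trans (s≤s (+-monoʳ-≤ (toℕ j) (≤-trans (*-monoˡ-≤ n (+-mono-≤ (n≤1+n a) (≤-refl {a}))) (m≤n+m _ m)))) (≤-trans (≤-reflexive (shift a)) (s≤s⁻¹ le))
      where
      shift : ∀ a → suc (toℕ j + (m + (suc a + a) * n)) ≡ toℕ j + (suc a + suc a) * n
      shift a = trans (sym (+-suc (toℕ j) (m + (suc a + a) * n))) (cong (λ b → toℕ j + b * n) (cong suc (sym (+-suc a a))))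
    code-toward j -[1+ zero ]    le = z≤n
    code-toward j -[1+ suc a ]   le = ≤-trans (s≤s (+-monoʳ-≤ (toℕ j) (≤-trans (*-monoˡ-≤ n (s≤s (+-mono-≤ (n≤1+n a) (≤-refl {a})))) (m≤n+m _ m)))) (≤-trans (≤-reflexive (shift a)) (s≤s⁻¹ le))
      where
      shift : ∀ a → suc (toℕ j + (m + suc (suc a + a) * n)) ≡ toℕ j + suc (suc a + suc a) * n
      shift a = trans (sym (+-suc (toℕ j) (m + suc (suc a + a) * n))) (cong (λ b → toℕ j + b * n) (cong (λ b → suc (suc b)) (sym (+-suc a a))))

    toward-closer : ∀ j z p → code j p < code j z → suc ℤ.∣ toward z ℤ.- p ∣ ≡ ℤ.∣ z ℤ.- p ∣
    toward-closer j +[1+ a ]     p lt = sym (∣-∣-suc (+ a) p (below p lt))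
      where
      below : ∀ p → code j p < code j +[1+ a ] → p ℤ.≤ + a
      below (+ zero)   lt = ℤ.+≤+ z≤n
      below +[1+ b ]   lt = ℤ.+≤+ (≰⇒> λ a≤b → <⇒≱ lt (code-step j (a + a) (b + b) (+-mono-≤ a≤b a≤b)))
      below -[1+ b ]   lt = ℤ.-≤+
    toward-closer j -[1+ zero ]  p lt = sym (∣-∣-pred 0ℤ -[1+ 0 ] p refl (above p lt))
      where
      above : ∀ p → code j p < code j -[1+ 0 ] → 0ℤ ℤ.≤ p
      above (+ _)    lt = ℤ.+≤+ z≤n
      above -[1+ b ] lt = ⊥-elim (<⇒≱ lt (code-step j 1 (suc (b + b)) (s≤s z≤n)))
    toward-closer j -[1+ suc a ] p lt = sym (∣-∣-pred -[1+ a ] -[1+ suc a ] p refl (above p lt))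
      where
      above : ∀ p → code j p < code j -[1+ suc a ] → -[1+ a ] ℤ.≤ p
      above (+ _)    lt = ℤ.-≤+
      above -[1+ b ] lt = ℤ.-≤- (s≤s⁻¹ (≰⇒> λ a≤b → <⇒≱ lt (code-step j (suc (suc a + suc a)) (suc (b + b)) (s≤s (+-mono-≤ a≤b a≤b)))))

    retract : ℕ → ℕ → Fin n → ℤ → ℤ
    retract-by : ∀ k f j z → Dec (code j z ≤ k) → ℤ
    retract k zero    j z = 0ℤ
    retract k (suc f) j z = retract-by k f j z (code j z ≤? k)
    retract-by k f j z (yes _) = z
    retract-by k f j z (no _)  = retract k f j (toward z)

    retract-code : ∀ k f j z → code j (retract k f j z) ≤ k
    retract-code k zero    j z = z≤n
    retract-code k (suc f) j z = go (code j z ≤? k)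
      where
      go : ∀ c → code j (retract-by k f j z c) ≤ k
      go (yes le) = le
      go (no _)   = retract-code k f j (toward z)

    ∣toward∣ : ∀ z {f} → ℤ.∣ z ∣ ≤ suc f → ℤ.∣ toward z ∣ ≤ f
    ∣toward∣ (+ zero)     le       = z≤n
    ∣toward∣ +[1+ k ]     (s≤s le) = le
    ∣toward∣ -[1+ zero ]  le       = z≤n
    ∣toward∣ -[1+ suc k ] (s≤s le) = le

    retract-id : ∀ k f j z → ℤ.∣ z ∣ ≤ f → code j z ≤ k → retract k f j z ≡ z
    retract-id k zero    j z b le = sym (ℤₚ.∣i∣≡0⇒i≡0 (n≤0⇒n≡0 b))
    retract-id k (suc f) j z b le = go (code j z ≤? k)
      where
      go : ∀ c → retract-by k f j z c ≡ z
      go (yes _) = refl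
      go (no ¬le) = ⊥-elim (¬le le)

    retract-near : ∀ k f j z → ℤ.∣ z ∣ ≤ f → ∀ p → code j p ≤ k → ℤ.∣ retract k f j z ℤ.- p ∣ ≤ ℤ.∣ z ℤ.- p ∣
    retract-near k zero    j z b p le = ≤-reflexive (cong (λ q → ℤ.∣ q ℤ.- p ∣) (sym (ℤₚ.∣i∣≡0⇒i≡0 {z} (n≤0⇒n≡0 b))))
    retract-near k (suc f) j z b p le = go (code j z ≤? k)
      where
      go : ∀ c → ℤ.∣ retract-by k f j z c ℤ.- p ∣ ≤ ℤ.∣ z ℤ.- p ∣
      go (yes _)  = ≤-refl
      go (no ¬le) = ≤-trans (retract-near k f j (toward z) (∣toward∣ z b) p le)
        (≤-trans (n≤1+n _) (≤-reflexive (toward-closer j z p (≤-<-trans le (≰⇒> ¬le)))))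

    layer : Vec ℤ n → ℕ
    layer x = maxF (λ j → code j (lookup x j))

    origin : Vec ℤ n
    origin = tabulate (λ _ → 0ℤ)

    layer-0 : ∀ {u} → layer u ≡ 0 → u ≡ origin
    layer-0 {u} e = trans (sym (tabulate∘lookup u)) (tabulate-cong λ j → code-0 j (lookup u j) (n≤0⇒n≡0 (subst (code j (lookup u j) ≤_) e (≤maxF (λ j → code j (lookup u j)) j))))

    ints : ℕ → List ℤ
    ints b = map +_ (upTo (suc b)) ++ᴸ map -[1+_] (upTo b)

    ∈-ints : ∀ {b} z → ℤ.∣ z ∣ ≤ b → z ∈ ints b
    ∈-ints (+ a)        le = ∈-++⁺ˡ (∈-map⁺ +_ (∈-upTo⁺ (s≤s le)))
    ∈-ints {b} -[1+ a ] le = ∈-++⁺ʳ (map +_ (upTo (suc b))) (∈-map⁺ -[1+_] (∈-upTo⁺ le))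

    cube : ∀ l → ℕ → List (Vec ℤ l)
    cube zero    b = [ [] ]
    cube (suc l) b = cartesianProductWith _∷_ (ints b) (cube l b)

    ∈-cube : ∀ {l b} (x : Vec ℤ l) → (∀ j → ℤ.∣ lookup x j ∣ ≤ b) → x ∈ cube l b
    ∈-cube []      le = here refl
    ∈-cube (z ∷ x) le = ∈-cartesianProductWith⁺ _∷_ (∈-ints z (le zero)) (∈-cube x (λ j → le (suc j)))

    ∣∣≤code : ∀ j z → ℤ.∣ z ∣ ≤ code j z
    ∣∣≤code j (+ zero)   = z≤n
    ∣∣≤code j +[1+ k ]   = s≤s (≤-trans (m≤m+n k k) (≤-trans (m≤m*n (k + k) n) (m≤n+m _ (toℕ j))))
    ∣∣≤code j -[1+ k ]   = s≤s (≤-trans (≤-trans (m≤m+n k k) (n≤1+n (k + k))) (≤-trans (m≤m*n (suc (k + k)) n) (m≤n+m _ (toℕ j))))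

    _≟ⱽ_ : DecidableEquality (Vec ℤ n)
    _≟ⱽ_ = ≡-dec ℤₚ._≟_

    in-layer? : ∀ k (x : Vec ℤ n) → Dec (layer x ≡ suc k)
    in-layer? k x = layer x ≟ suc k

    vertices : ℕ → List (Vec ℤ n)
    vertices k = deduplicate _≟ⱽ_ (filter (in-layer? k) (cube n (suc k)))

    sound : ∀ {k u} → u ∈ vertices k → layer u ≡ suc k
    sound {k} u∈ = proj₂ (∈-filter⁻ (in-layer? k) {xs = cube n (suc k)} (∈-deduplicate⁻ _≟ⱽ_ (filter (in-layer? k) (cube n (suc k))) u∈))

    complete : ∀ {k u} → layer u ≡ suc k → u ∈ vertices k
    complete {k} {u} e = ∈-deduplicate⁺ _≟ⱽ_ (∈-filter⁺ (in-layer? k) (∈-cube u λ j → ≤-trans (∣∣≤code j (lookup u j))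
      (≤-trans (≤maxF (λ j → code j (lookup u j)) j) (≤-reflexive e))) e)

    spike : Fin n → ℤ → Fin n → ℤ
    spike i z j with i Fin.≟ j
    ... | yes _ = z
    ... | no _  = 0ℤ

    spike-same : ∀ i z → spike i z i ≡ z
    spike-same i z with i Fin.≟ i
    ... | yes _ = refl
    ... | no ne = ⊥-elim (ne refl)

    spike-code : ∀ i z j → code j (spike i z j) ≤ code i z
    spike-code i z j with i Fin.≟ j
    ... | yes refl = ≤-refl
    ... | no _     = z≤n

    inhabited : ∀ k → ∃ (_∈ vertices k)
    inhabited k = let (i , z , e) = decode k in go i z e
      where
      go : ∀ i z → code i z ≡ suc k → ∃ (_∈ vertices k)
      go i z e = x , complete (≤-antisym
          (maxF-lub (λ j → code j (lookup x j)) λ j → ≤-trans (≤-reflexive (cong (code j) (lookup∘tabulate (spike i z) j))) (≤-trans (spike-code i z j) (≤-reflexive e)))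
          (≤-trans (≤-reflexive (trans (sym e) (cong (code i) (sym (trans (lookup∘tabulate (spike i z) i) (spike-same i z)))))) (≤maxF (λ j → code j (lookup x j)) i)))
        where x = tabulate (spike i z)

    retractᵛ : ℕ → Vec ℤ n → Vec ℤ n
    retractᵛ k x = tabulate λ j → retract k ℤ.∣ lookup x j ∣ j (lookup x j)

    retractᵛ-layer : ∀ k x → layer (retractᵛ k x) ≤ k
    retractᵛ-layer k x = maxF-lub (λ j → code j (lookup (retractᵛ k x) j)) λ j →
      ≤-trans (≤-reflexive (cong (code j) (lookup∘tabulate (λ j → retract k ℤ.∣ lookup x j ∣ j (lookup x j)) j))) (retract-code k ℤ.∣ lookup x j ∣ j (lookup x j))

    -- A coordinate of `x` inside the box does not move, and one outside moves towards every value
    -- inside.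
    retractᵛ-near : ∀ k x u → (∀ j → code j (lookup u j) ≤ k ⊎ code j (lookup x j) ≤ k) → manhattan (retractᵛ k x) u ≤ manhattan x u
    retractᵛ-near k x u ok = manhattan-mono (retractᵛ k x) x u λ j →
      ≤-trans (≤-reflexive (cong (λ q → ℤ.∣ q ℤ.- lookup u j ∣) (lookup∘tabulate (λ j → retract k ℤ.∣ lookup x j ∣ j (lookup x j)) j)))
        ([ retract-near k ℤ.∣ lookup x j ∣ j (lookup x j) ≤-refl (lookup u j) ,
           (λ le → ≤-reflexive (cong (λ q → ℤ.∣ q ℤ.- lookup u j ∣) (retract-id k ℤ.∣ lookup x j ∣ j (lookup x j) ≤-refl le))) ]′ (ok j))

    module Apex (r : ℕ) (centred : Centred m r) where
      small? : ∀ (A : List (Vec ℤ m)) → Dec (All (λ a → All (λ b → manhattan a b ≤ r) A) A)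
      small? A = all? (λ a → all? (λ b → manhattan a b ≤? r) A) A

      facet : Fin n → List (Vec ℤ n) → List (Vec ℤ m)
      facet i = map λ a → removeAt a i

      All⇒Small : ∀ {A : List (Vec ℤ m)} → All (λ a → All (λ b → manhattan a b ≤ r) A) A → Small A r
      All⇒Small s a∈ b∈ = All.lookup (All.lookup s a∈) b∈

      raise : ∀ i z {A : List (Vec ℤ m)} → Centre A r → Vec ℤ n
      raise i z (w , _) = insertAt w i (toward z)

      -- The origin is a default for lists that are empty or have too large a diameter; `apex` has
      -- to be defined for them too.
      candidate : ∀ i z (A : List (Vec ℤ m)) → Dec (All (λ a → All (λ b → manhattan a b ≤ r) A) A) → Vec ℤ n
      candidate i z []      _       = origin
      candidate i z (a ∷ A) (no _)  = origin
      candidate i z (a ∷ A) (yes s) = raise i z (centred (a ∷ A) (here refl) (All⇒Small s))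

      -- Stepping inwards brings coordinate i into the box, but a centre may leave the box in the
      -- other coordinates; the retraction repairs this.
      apex : ℕ → List (Vec ℤ n) → Vec ℤ n
      apex k A = let (i , z , _) = decode k in retractᵛ k (candidate i z (facet i A) (small? (facet i A)))

      apex-layer : ∀ k A → layer (apex k A) ≤ k
      apex-layer k A = let (i , z , _) = decode k in retractᵛ-layer k (candidate i z (facet i A) (small? (facet i A)))

      facet-≤ : ∀ i (a b : Vec ℤ n) → manhattan (removeAt a i) (removeAt b i) ≤ manhattan a b
      facet-≤ i a b = ≤-trans (m≤n+m _ ℤ.∣ lookup a i ℤ.- lookup b i ∣) (≤-reflexive (sym (manhattan-removeAt a b i)))

      module _ (k : ℕ) (i : Fin n) (z : ℤ) (cz : code i z ≡ suc k) {A : List (Vec ℤ n)} (layered : ∀ {a} → a ∈ A → layer a ≡ suc k)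
        (u : Vec ℤ n) (near : ∀ {a} → a ∈ A → manhattan u a ≤ r) where

        -- Only the value `z` in coordinate `i` has the code `suc k`, and some coordinate of `a`
        -- attains this code.
        at-i : ∀ {a} → layer a ≡ suc k → lookup a i ≡ z
        at-i {a} e = let (j , c) = maxF-attained (λ j → code j (lookup a j)) e
                         (j≡i , l≡z) = code-injective {j} {i} c cz
                     in trans (cong (lookup a) (sym j≡i)) l≡z

        module _ (w : Vec ℤ m) (close : ∀ {a} → a ∈ facet i A → suc (manhattan w a) ≤ r)
                 (hull : ∀ p → ∃ λ a → a ∈ facet i A × manhattan w p ≤ suc (manhattan a p)) where
          w₀ : Vec ℤ n
          w₀ = insertAt w i (toward z)

          to-u : manhattan w₀ u ≡ ℤ.∣ toward z ℤ.- lookup u i ∣ + manhattan w (removeAt u i)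
          to-u = trans (manhattan-removeAt w₀ u i) (cong₂ (λ q v → ℤ.∣ q ℤ.- lookup u i ∣ + manhattan v (removeAt u i)) (insertAt-lookup w i (toward z)) (removeAt-insertAt w i (toward z)))

          code-w₀ : code i (lookup w₀ i) ≤ k
          code-w₀ = ≤-trans (≤-reflexive (cong (code i) (insertAt-lookup w i (toward z)))) (code-toward i z (≤-reflexive cz))

          -- The inward step costs 1, which the strict bound on distances to `A` pays. The
          -- retraction does no harm: `u` leaves the box only in coordinate `i`, where `w₀` is
          -- inside.
          member : u ∈ A → manhattan (retractᵛ k w₀) u ≤ r
          member u∈ = ≤-trans (retractᵛ-near k w₀ u ok) (≤-trans (≤-reflexive to-u)
              (≤-trans (+-monoˡ-≤ (manhattan w (removeAt u i)) (subst (λ q → ℤ.∣ toward z ℤ.- q ∣ ≤ 1) (sym (at-i {u} (layered u∈))) (toward-1 z)))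
                (close (∈-map⁺ (λ a → removeAt a i) u∈))))
            where
            ok : ∀ j → code j (lookup u j) ≤ k ⊎ code j (lookup w₀ j) ≤ k
            ok j = [ (λ lt → inj₁ (s≤s⁻¹ lt)) , (λ e → inj₂ (subst (λ l → code l (lookup w₀ l) ≤ k) (sym (proj₁ (code-injective {j} {i} e cz))) code-w₀)) ]′
              (m≤n⇒m<n∨m≡n (≤-trans (≤maxF (λ j → code j (lookup u j)) j) (≤-reflexive (layered u∈))))

          -- The inward step brings coordinate `i` closer to `u` by 1, exactly the unit that the
          -- hull condition of a centre gives away.
          inner : layer u ≤ k → manhattan (retractᵛ k w₀) u ≤ r
          inner le = ≤-trans (retractᵛ-near k w₀ u (λ j → inj₁ (≤-trans (≤maxF (λ j → code j (lookup u j)) j) le)))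
              (≤-trans (≤-reflexive to-u) (through (hull (removeAt u i))))
            where
            D = ℤ.∣ toward z ℤ.- lookup u i ∣
            closer : suc D ≡ ℤ.∣ z ℤ.- lookup u i ∣
            closer = toward-closer i z (lookup u i) (≤-<-trans (≤-trans (≤maxF (λ j → code j (lookup u j)) i) le) (≤-reflexive (sym cz)))
            via : ∀ {a} → a ∈ A → manhattan w (removeAt u i) ≤ suc (manhattan (removeAt a i) (removeAt u i)) → D + manhattan w (removeAt u i) ≤ r
            via {a} a∈ h = ≤-trans (+-monoʳ-≤ D h) (≤-trans (≤-reflexive (trans (+-suc D _)
              (trans (cong (λ q → q + manhattan (removeAt a i) (removeAt u i)) (trans closer (cong (λ q → ℤ.∣ q ℤ.- lookup u i ∣) (sym (at-i {a} (layered a∈))))))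
                (sym (manhattan-removeAt a u i)))))
              (≤-trans (≤-reflexive (IsMetric.sym (manhattan-isMetric n) a u)) (near a∈)))
            through : (∃ λ a → a ∈ facet i A × manhattan w (removeAt u i) ≤ suc (manhattan a (removeAt u i))) → D + manhattan w (removeAt u i) ≤ r
            through (a′ , a′∈ , h) = let (a , a∈ , e) = ∈-map⁻ (λ a → removeAt a i) a′∈ in
              via a∈ (subst (λ q → manhattan w (removeAt u i) ≤ suc (manhattan q (removeAt u i))) e h)

      apex-cone : ∀ k {A a₀} → a₀ ∈ A → (∀ {a} → a ∈ A → layer a ≡ suc k) → (∀ {a b} → a ∈ A → b ∈ A → manhattan a b ≤ r) →
                  ∀ u → (∀ {a} → a ∈ A → manhattan u a ≤ r) → layer u ≤ k ⊎ u ∈ A → manhattan (apex k A) u ≤ r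
      apex-cone k {A} {a₀} a₀∈ layered small u near where-u = let (i , z , cz) = decode k in go i z cz (facet i A) refl (small? (facet i A))
        where
        go : ∀ i z → code i z ≡ suc k → ∀ F → F ≡ facet i A → (s : Dec (All (λ a → All (λ b → manhattan a b ≤ r) F) F)) → manhattan (retractᵛ k (candidate i z F s)) u ≤ r
        go i z cz []      e s        = ⊥-elim (absurd (subst (removeAt a₀ i ∈_) (sym e) (∈-map⁺ (λ a → removeAt a i) a₀∈)))
          where
          absurd : ∀ {v : Vec ℤ m} → v ∈ [] → ⊥
          absurd ()
        go i z cz (a ∷ F) e (no ¬s)  = ⊥-elim (¬s (subst (λ F → All (λ a → All (λ b → manhattan a b ≤ r) F) F) (sym e)
          (All.tabulate λ a∈ → All.tabulate λ b∈ → bound a∈ b∈)))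
          where
          bound : ∀ {a b} → a ∈ facet i A → b ∈ facet i A → manhattan a b ≤ r
          bound a∈ b∈ with ∈-map⁻ (λ a → removeAt a i) a∈ | ∈-map⁻ (λ a → removeAt a i) b∈
          ... | a , a∈A , refl | b , b∈A , refl = ≤-trans (facet-≤ i a b) (small a∈A b∈A)
        go i z cz (a ∷ F) e (yes s)  = done (centred (a ∷ F) (here refl) (All⇒Small s))
          where
          done : (c : Centre (a ∷ F) r) → manhattan (retractᵛ k (raise i z c)) u ≤ r
          done (w , close , hull) = [ inner k i z cz layered u near w close′ hull′ , member k i z cz layered u near w close′ hull′ ]′ where-u
            where
            close′ : ∀ {a} → a ∈ facet i A → suc (manhattan w a) ≤ r
            close′ a∈ = close (subst (_ ∈_) (sym e) a∈)
            hull′ : ∀ p → ∃ λ a → a ∈ facet i A × manhattan w p ≤ suc (manhattan a p)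
            hull′ p = let (b , b∈ , le) = hull p in b , subst (b ∈_) e b∈ , le

      layering : Layering manhattan r
      layering = record
        { base       = origin
        ; layer      = layer
        ; layer-0    = layer-0
        ; vertices   = vertices
        ; unique     = λ k → DecUnique.deduplicate-! _≟ⱽ_ (filter (in-layer? k) (cube n (suc k)))
        ; sound      = sound
        ; complete   = complete
        ; inhabited  = inhabited
        ; apex       = apex
        ; apex-layer = apex-layer
        ; apex-cone  = apex-cone
        }

-- Contractibility of the Vietoris-Rips complex

open import Defs
open import Data.Nat using (ℕ) renaming (_≤_ to _≤ℕ_)
open import Data.Nat using (suc; s≤s⁻¹)
open import Data.Nat.Properties using (≤-trans)

theorem3p12 : (n r : ℕ) → 2 ≤ℕ n → n ≤ℕ 5 → n ≤ℕ r → Contractible (VR (manhattan-isMetric n) r)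
-- Centres are needed for facets, of dimension m = n - 1 ≤ 4, and n ≤ r is the condition m < r on
-- them.
theorem3p12 (suc m) r 2≤n n≤5 n≤r = Collapses.Deformation.contractible _≟ⱽ_ (manhattan-isMetric (suc m)) r
  (Layerings.Blocks.collapse _≟ⱽ_ (Apex.layering r (Centres.centre (s≤s⁻¹ n≤5) n≤r (≤-trans 2≤n n≤r))))
  where open Boxing.Boxes m
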